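{- Let $\widetilde{W}/W\in\{\widetilde{C}_n/C_n,\widetilde{B}_n/B_n,\widetilde{B}_n/D_n,\widetilde{D}_n/D_n\}$ and let $a=\mathcal{A}(w)$ be the abacus of an element $w\in\widetilde{W}/W$. The bounded partition $\mathcal{B}(a)=\mathcal{B}(w)$ is found by creating one part for each bead $b>N$ of $a$, in descending order, as follows: - For each bead $b>N+n$, create a part of size equal to the number of gaps between $b$ and $b-N$ plus $1+x_0+x_n$. - For each bead $b$ with $N+1\le b\le N+n$, create a part of size equal to $b-N$ plus $x_0$. If $b=N+n$ in types $\widetilde{B}/D$ and $\widetilde{D}/D$, then star the resulting part.
   Context: Offsets: $x_0=0$ in types $\widetilde{C}/C,\widetilde{B}/D$ and $x_0=-1$ in types $\widetilde{B}/B,\widetilde{D}/D$; $x_n=0$ in types $\widetilde{C}/C,\widetilde{B}/B$ and $x_n=-1$ in types $\widetilde{B}/D,\widetilde{D}/D$. Groups. Let $N=2n+1$. A mirrored $\mathbb{Z}$-permutation is a bijection $w:\mathbb{Z}\to\mathbb{Z}$ with $w(i+N)=w(i)+N$ and $w(-i)=-w(i)$ for all $i\in\mathbb{Z}$; it is determined by $(w(1),\dots,w(n))$. Under composition these form the affine Coxeter group $\widetilde{C}_n$. Define elements by their images $(w(1),\dots,w(n))$: $s_i=(1,\dots,i-1,i+1,i,i+2,\dots,n)$ for $1\le i\le n-1$; $s_0^C=(-1,2,3,\dots,n)$; $s_0^D=(-2,-1,3,\dots,n)$; $s_n^C=(1,\dots,n-1,n+1)$; $s_n^D=(1,\dots,n-2,n+1,n+2)$.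 The four types are: - $\widetilde{C}/C$: $\widetilde{W}$ is all mirrored $\mathbb{Z}$-permutations, generators $s_0=s_0^C,s_1,\dots,s_{n-1},s_n=s_n^C$ ($n\ge2$). - $\widetilde{B}/B$: those with $|\{i\le0:w(i)\ge1\}|$ even, generators $s_0=s_0^D,s_1,\dots,s_{n-1},s_n=s_n^C$ ($n\ge3$). - $\widetilde{B}/D$: those with $|\{i\le n:w(i)\ge n+1\}|$ even, generators $s_0=s_0^C,s_1,\dots,s_{n-1},s_n=s_n^D$ ($n\ge3$). - $\widetilde{D}/D$: those satisfying both parity conditions, generators $s_0=s_0^D,s_1,\dots,s_{n-1},s_n=s_n^D$ ($n\ge4$). $W$ is generated by $s_1,\dots,s_n$, and $\widetilde{W}/W$ denotes the set of minimal length representatives of the cosets $wW$; $\widetilde{W}$ acts on it by left multiplication of cosets. Abaci and cores. An abacus has runners (columns) $1,\dots,2n$; runner $i$ has entries labeled $mN+i$ for each level $m\in\mathbb{Z}$; some entries are beads, the others gaps; reading order is the order of labels; "lowest" means largest label; the abacus is flush if no bead is preceded by a gap on its runner. $\mathcal{A}(w)$ is the flush abacus whose lowest bead in each runner is an element of $\{w(1),\dots,w(2n)\}$. $\mathcal{C}(w)$ is the partition whose southeast boundary is the lattice path obtained by reading the entries of $\mathcal{A}(w)$ in reading order, recording a north-step for each bead and an east-step for each gap (first row at the top). $w\mapsto\mathcal{C}(w)$ is injective on $\widetilde{W}/W$, and $\widetilde{W}$ acts on its image by transport of structure. Residues. Entries of $\mathbb{N}^2$ are $(i,j)$ = (row,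 column); the $k$-th diagonal is $\{j-i=k\}$ and the main diagonal is $k=0$. Write $p\,\|\,q$ for the element of $\{0,\dots,q-1\}$ congruent to $p$ mod $q$. The fixed residue of $(i,j)$ is $(j-i)\|(2n)$ if this is $\le n$, and $2n-((j-i)\|(2n))$ otherwise. An escalator is a connected component of the cells with $(j-i)\|(2n)\in\{n-1,n,n+1\}$; a descalator is a connected component of the cells with $(j-i)\|(2n)\in\{0,1,2n-1\}$; upper means above the main diagonal, lower means below; the descalator containing the main diagonal is the main descalator. Given $\lambda$, let a row meet an upper escalator in cells $c_1,c_2,c_3$ (left to right): if the row of $\lambda$ ends immediately left of $c_1$, then $c_1$ has both residues $n-1,n$, $c_2$ has residue $n$, $c_3$ undefined; if it ends at $c_1$: residues $n-1,n,n$; if it ends at $c_2$: $n,n,n-1$; if it ends at $c_3$: $c_1$ undefined, $c_2$ has residue $n$, $c_3$ has both residues $n-1,n$; otherwise undefined. Upper descalators: the same rule with $n-1$ replaced by $1$ and $n$ by $0$. Lower escalators/descalators: transposed rule, column by column. Main descalator: residue $0$ if $i=j$; if $|i-j|=1$, residue $1$ when $i+j\equiv1$ mod $4$ and $0$ when $i+j\equiv3$ mod $4$. Type $\widetilde{C}/C$ uses fixed residues only; $\widetilde{B}/B$ uses the descalator rules on descalators; $\widetilde{B}/D$ uses the escalator rules on escalators; $\widetilde{D}/D$ uses both; all remaining cells have their fixed residue. Central peeling procedure. The reference diagonal is the main diagonal in types $\widetilde{C}/C,\widetilde{B}/D$ and the first diagonal in types $\widetilde{B}/B,\widetilde{D}/D$.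 Start with $\lambda^{(1)}=\lambda=\mathcal{C}(w)$. At step $i$ (while $\lambda^{(i)}$ is nonempty) let $d^{(i)}$ be the number of boxes of $\lambda^{(i)}$ on the reference diagonal, $B_i$ the box at the end of the $d^{(i)}$-th row of $\lambda^{(i)}$, and $r_i$ its residue; if $B_i$ is both $n$-removable and $(n-1)$-removable (has both residues), set $r_i=n$. Let $\lambda^{(i+1)}$ be the result of $s_{r_i}$ acting on $\lambda^{(i)}$. The upper diagram $U_\lambda$ is the set of boxes $B_i$ encountered, with the following conditions: in types $\widetilde{B}/D,\widetilde{D}/D$, an application of $s_n^D$ removes two boxes from row $d^{(i)}$ and the box not on the $n$-th diagonal is recorded; in types $\widetilde{B}/B,\widetilde{D}/D$, an application of $s_0^D$ removes two boxes from row $d^{(i)}$ and the box not on the main or $2n$-th diagonal is recorded. Each recorded box carries the residue $r_i$. Bounded partition. $\mathcal{B}(w)$ is the partition $\beta$ whose $i$-th part is the number of boxes in row $i$ of $U_\lambda$ (zero parts are disregarded). In type $\widetilde{B}/D$ (respectively $\widetilde{D}/D$), if there is a part of size $n$ (respectively $n-1$) and the last (lowest) part of this size has rightmost box in $U_\lambda$ with residue $n-1$, then that part is adorned with a star. -}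

module Defs where

open import Data.Bool.Base using (Bool; true; false; if_then_else_; _∧_; _∨_; not)
open import Data.Bool.ListAction using (all; any)
open import Data.Fin.Base using (Fin; zero; suc; toℕ)
open import Data.Integer.Base as ℤ using (ℤ; +_; -[1+_]; 0ℤ; -1ℤ; ∣_∣; _/ℕ_; _%ℕ_; +≤+; -≤+; +<+)
open import Data.Integer.Properties as ℤₚ using ()
open import Data.Integer.DivMod using (a≡a%ℕn+[a/ℕn]*n; n%ℕd<d)
open import Data.Integer.Divisibility.Signed using (_∣_; _∣?_; divides)
open import Data.Integer.Tactic.RingSolver using (solve-∀)
open import Data.List.Base using (List; []; _∷_; map; foldr; filter; length; reverse; upTo; deduplicate)
open import Data.List.Extrema.Nat using (max; xs≤max)
open import Data.List.Membership.Propositional using (_∈_; lose)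
open import Data.List.Membership.Propositional.Properties using (∈-map⁺; ∈-upTo⁺)
open import Data.List.Relation.Unary.All as All using (All)
open import Data.List.Relation.Unary.Any as Any using (Any)
open import Data.List.Relation.Unary.Unique.Propositional using (Unique)
open import Data.Maybe.Base using (Maybe; just; nothing)
open import Data.Nat.Base as ℕ using (ℕ; zero; suc; _∸_; _≡ᵇ_; _≤ᵇ_; _<ᵇ_; s≤s; s≤s⁻¹)
open import Data.Nat.Divisibility using () renaming (_∣_ to _∣ₙ_)
import Data.Nat.Properties as ℕₚ
open import Data.Product.Base using (Σ; Σ-syntax; ∃-syntax; _×_; _,_; proj₁; proj₂)
open import Data.Product.Properties using (≡-dec)
open import Data.Unit.Base using (⊤)
open import Data.Vec.Base using (Vec; []; _∷_; lookup; replicate)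
open import Function.Base using (_∘_; id)
open import Function.Bundles using (_⇔_)
open import Function.Definitions using (Bijective)
open import Relation.Binary.PropositionalEquality
open import Relation.Nullary using (¬_; does; yes; no; contradiction; ¬?)
open import Relation.Nullary.Decidable using (_×-dec_)
open import Relation.Unary using (Decidable)

------------------------------------------------------------------------
-- The four types

data Type : Set where
  C/C B/B B/D D/D : Type

-- Each type is determined by the kind of generator (s^C or s^D) used at
-- the left end (s₀) and at the right end (sₙ).

data End : Set where
  C D : End

left right : Type → End
left C/C = C
left B/B = D
left B/D = C
left D/D = D
right C/C = C
right B/B = C
right B/D = D
right D/D = D

isD : End → Bool
isD C = false
isD D = true

offset : End → ℤ
offset C = 0ℤ
offset D = -1ℤ

x₀ xₙ : Type → ℤ
x₀ ty = offset (left ty)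
xₙ ty = offset (right ty)

minRank : Type → ℕ
minRank C/C = 2
minRank B/B = 3
minRank B/D = 3
minRank D/D = 4

------------------------------------------------------------------------
-- Mirrored ℤ-permutations

N : ℕ → ℕ
N n = suc (2 ℕ.* n)

record Mirrored (n : ℕ) : Set where
  field
    fun       : ℤ → ℤ
    bijective : Bijective _≡_ _≡_ fun
    periodic  : ∀ i → fun (i ℤ.+ + N n) ≡ fun i ℤ.+ + N n
    odd       : ∀ i → fun (ℤ.- i) ≡ ℤ.- fun i

open Mirrored public

EvenlyMany : (ℤ → Set) → Set
EvenlyMany P = ∃[ xs ] Unique xs × (∀ i → i ∈ xs ⇔ P i) × 2 ∣ₙ length xs

LeftParity RightParity : ∀ {n} → End → Mirrored n → Set
LeftParity C w = ⊤
LeftParity D w = EvenlyMany (λ i → i ℤ.≤ 0ℤ × + 1 ℤ.≤ fun w i)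
RightParity C w = ⊤
RightParity {n} D w = EvenlyMany (λ i → i ℤ.≤ + n × + suc n ℤ.≤ fun w i)

W̃ : (ty : Type) (n : ℕ) → Mirrored n → Set
W̃ ty n w = LeftParity (left ty) w × RightParity (right ty) w

------------------------------------------------------------------------
-- Generators, length, minimal length coset representatives

-- The mirrored permutation with prescribed images f 1, …, f n: write
-- b = r + m N with 0 ≤ r ≤ 2n and use w(0) = 0, w(r) = N - w(N - r).

extend : (n : ℕ) → (ℕ → ℤ) → ℤ → ℤ
extend n f b = base (b %ℕ N n) ℤ.+ (b /ℕ N n) ℤ.* + N n
  where
  base : ℕ → ℤ
  base r = if r ≡ᵇ 0 then 0ℤ
           else if r ≤ᵇ n then f r
           else + N n ℤ.- f (N n ∸ r)

leftImages : End → ℕ → ℤ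
leftImages C k = if k ≡ᵇ 1 then -1ℤ else + k
leftImages D k = if k ≡ᵇ 1 then -[1+ 1 ] else if k ≡ᵇ 2 then -1ℤ else + k

rightImages : End → ℕ → ℕ → ℤ
rightImages C n k = if k ≡ᵇ n then + suc n else + k
rightImages D n k = if k ≡ᵇ n ∸ 1 then + (n ℕ.+ 1) else if k ≡ᵇ n then + (n ℕ.+ 2) else + k

swapImages : ℕ → ℕ → ℤ
swapImages r k = if k ≡ᵇ r then + suc r else if k ≡ᵇ suc r then + r else + k

module _ (ty : Type) (n : ℕ) where

  gen : ℕ → ℤ → ℤ
  gen r = extend n (if r ≡ᵇ 0 then leftImages (left ty)
                    else if r ≡ᵇ n then rightImages (right ty) n
                    else swapImages r)

  ⟦_⟧ : List (Fin (suc n)) → ℤ → ℤ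
  ⟦ t ⟧ = foldr (λ r g → gen (toℕ r) ∘ g) id t

  -- Words in the generators s₁, …, sₙ of W.
  ⟦_⟧ᵂ : List (Fin n) → ℤ → ℤ
  ⟦ u ⟧ᵂ = ⟦ map suc u ⟧

  -- ℓ(g) ≤ k.
  ℓ[_]≤_ : (ℤ → ℤ) → ℕ → Set
  ℓ[ g ]≤ k = ∃[ t ] length t ℕ.≤ k × ⟦ t ⟧ ≗ g

  -- The last field says ℓ(w) ≤ ℓ(wu) for all u in W.
  record W̃/W : Set where
    field
      perm    : Mirrored n
      inW̃     : W̃ ty n perm
      minimal : ∀ u k → ℓ[ fun perm ∘ ⟦ u ⟧ᵂ ]≤ k → ℓ[ fun perm ]≤ k

open W̃/W public

-- v′ is the minimal length representative of the coset s_r v W.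
Acts : ∀ {ty n} → ℕ → W̃/W ty n → W̃/W ty n → Set
Acts {ty} {n} r v v′ = ∃[ u ] fun (perm v′) ≗ gen ty n r ∘ fun (perm v) ∘ ⟦_⟧ᵂ ty n u

------------------------------------------------------------------------
-- Abaci

Entry : ℕ → ℤ → Set
Entry n b = ¬ (+ N n ∣ b)

entry? : ∀ n → Decidable (Entry n)
entry? n b = ¬? (+ N n ∣? b)

-- An abacus whose entries are all beads far enough down and all gaps far
-- enough up; `bound` limits the window of labels to inspect.

record Abacus (n : ℕ) : Set₁ where
  field
    Bead  : ℤ → Set
    bead? : Decidable Bead
    bound : ℕ
    below : ∀ b → Entry n b → b ℤ.< ℤ.- + bound → Bead b
    above : ∀ b → Bead b → b ℤ.≤ + bound

open Abacus public

range : ℕ → List ℕ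
range k = map suc (upTo k)

private

  shift⁺ : ∀ {n} (w : Mirrored n) (q : ℕ) i →
           fun w (i ℤ.+ + q ℤ.* + N n) ≡ fun w i ℤ.+ + q ℤ.* + N n
  shift⁺ {n} w zero i = begin
    fun w (i ℤ.+ 0ℤ)   ≡⟨ cong (fun w) (ℤₚ.+-identityʳ i) ⟩
    fun w i            ≡⟨ ℤₚ.+-identityʳ (fun w i) ⟨
    fun w i ℤ.+ 0ℤ     ∎
    where open ≡-Reasoning
  shift⁺ {n} w (suc q) i = begin
    fun w (i ℤ.+ + suc q ℤ.* M)         ≡⟨ cong (fun w) (step i (+ q) M) ⟩
    fun w (i ℤ.+ + q ℤ.* M ℤ.+ M)       ≡⟨ periodic w _ ⟩
    fun w (i ℤ.+ + q ℤ.* M) ℤ.+ M       ≡⟨ cong (ℤ._+ M) (shift⁺ w q i) ⟩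
    fun w i ℤ.+ + q ℤ.* M ℤ.+ M         ≡⟨ step (fun w i) (+ q) M ⟨
    fun w i ℤ.+ + suc q ℤ.* M           ∎
    where
    open ≡-Reasoning
    M = + N n
    step : ∀ a b c → a ℤ.+ (+ 1 ℤ.+ b) ℤ.* c ≡ a ℤ.+ b ℤ.* c ℤ.+ c
    step = solve-∀

  shift : ∀ {n} (w : Mirrored n) (q : ℤ) i →
          fun w (i ℤ.+ q ℤ.* + N n) ≡ fun w i ℤ.+ q ℤ.* + N n
  shift w (+ q) i = shift⁺ w q i
  shift {n} w -[1+ q ] i = begin
    fun w j                                       ≡⟨ cancel (fun w j) (+ suc q) M ⟨
    fun w j ℤ.+ + suc q ℤ.* M ℤ.+ -[1+ q ] ℤ.* M  ≡⟨ cong (ℤ._+ -[1+ q ] ℤ.* M) (shift⁺ w (suc q) j) ⟨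
    fun w (j ℤ.+ + suc q ℤ.* M) ℤ.+ -[1+ q ] ℤ.* M ≡⟨ cong (λ x → fun w x ℤ.+ -[1+ q ] ℤ.* M) (cancel′ i (+ suc q) M) ⟩
    fun w i ℤ.+ -[1+ q ] ℤ.* M                    ∎
    where
    open ≡-Reasoning
    M = + N n
    j = i ℤ.+ -[1+ q ] ℤ.* M
    cancel : ∀ a b c → a ℤ.+ b ℤ.* c ℤ.+ (ℤ.- b) ℤ.* c ≡ a
    cancel = solve-∀
    cancel′ : ∀ a b c → a ℤ.+ (ℤ.- b) ℤ.* c ℤ.+ b ℤ.* c ≡ a
    cancel′ = solve-∀

  fun-0 : ∀ {n} (w : Mirrored n) → fun w 0ℤ ≡ 0ℤ
  fun-0 w = neg-fix (fun w 0ℤ) (odd w 0ℤ)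
    where
    neg-fix : ∀ x → x ≡ ℤ.- x → x ≡ 0ℤ
    neg-fix (+ zero) _ = refl

  -∣i∣≤i : ∀ i → ℤ.- + ∣ i ∣ ℤ.≤ i
  -∣i∣≤i (+ zero)  = ℤₚ.≤-refl
  -∣i∣≤i (+ suc _) = -≤+
  -∣i∣≤i -[1+ _ ]  = ℤₚ.≤-refl

  i≤∣i∣ : ∀ i → i ℤ.≤ + ∣ i ∣
  i≤∣i∣ (+ _)    = ℤₚ.≤-refl
  i≤∣i∣ -[1+ _ ] = -≤+

module _ {n : ℕ} (w : Mirrored n) where

  -- Flush, with lowest beads w(1), …, w(2n): b is a bead iff b = w(j) - mN
  -- for some 1 ≤ j ≤ 2n and m ≥ 0.
  AtOrAboveLowest : ℤ → Set
  AtOrAboveLowest b = Any (λ j → b ℤ.≤ fun w (+ j) × + N n ∣ fun w (+ j) ℤ.- b) (range (2 ℕ.* n))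

  private

    maxAbs : ℕ
    maxAbs = max 0 (map (λ j → ∣ fun w (+ j) ∣) (range (2 ℕ.* n)))

    ∣wj∣≤maxAbs : ∀ {j} → j ∈ range (2 ℕ.* n) → ∣ fun w (+ j) ∣ ℕ.≤ maxAbs
    ∣wj∣≤maxAbs j∈ = All.lookup (xs≤max 0 (map (λ j → ∣ fun w (+ j) ∣) (range (2 ℕ.* n))))
                               (∈-map⁺ (λ j → ∣ fun w (+ j) ∣) j∈)

    below-maxAbs : ∀ b → Entry n b → b ℤ.< ℤ.- + maxAbs → AtOrAboveLowest b
    below-maxAbs b entry b< with proj₂ (bijective w) b
    ... | x , wx≡b = go (x %ℕ N n) (n%ℕd<d x (N n))
                        (trans (sym (shift w (x /ℕ N n) (+ (x %ℕ N n))))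
                          (trans (cong (fun w) (sym (a≡a%ℕn+[a/ℕn]*n x (N n)))) (wx≡b refl)))
      where
      go : ∀ r → r ℕ.< N n → fun w (+ r) ℤ.+ (x /ℕ N n) ℤ.* + N n ≡ b → AtOrAboveLowest b
      go zero _ eq = contradiction
        (divides (x /ℕ N n) (trans (sym eq) (trans (cong (ℤ._+ _) (fun-0 w)) (ℤₚ.+-identityˡ _)))) entry
      go (suc r) r< eq = lose r∈ (b≤ , divides (ℤ.- (x /ℕ N n)) (trans (cong (λ y → fun w (+ suc r) ℤ.- y) (sym eq)) (alg (fun w (+ suc r)) (x /ℕ N n) (+ N n))))
        where
        r∈ : suc r ∈ range (2 ℕ.* n)
        r∈ = ∈-map⁺ suc (∈-upTo⁺ (s≤s⁻¹ r<))
        b≤ : b ℤ.≤ fun w (+ suc r)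
        b≤ = ℤₚ.≤-trans (ℤₚ.<⇒≤ b<)
               (ℤₚ.≤-trans (ℤₚ.neg-mono-≤ (+≤+ (∣wj∣≤maxAbs r∈))) (-∣i∣≤i (fun w (+ suc r))))
        alg : ∀ a q c → a ℤ.- (a ℤ.+ q ℤ.* c) ≡ ℤ.- q ℤ.* c
        alg = solve-∀

    above-maxAbs : ∀ b → AtOrAboveLowest b → b ℤ.≤ + maxAbs
    above-maxAbs b p with All.lookupAny (All.tabulate ∣wj∣≤maxAbs) p
    ... | ∣wj∣≤ , b≤ , _ = ℤₚ.≤-trans b≤ (ℤₚ.≤-trans (i≤∣i∣ _) (+≤+ ∣wj∣≤))

  𝒜 : Abacus n
  𝒜 = record
    { Bead  = AtOrAboveLowest
    ; bead? = λ b → Any.any? (λ j → (b ℤₚ.≤? fun w (+ j)) ×-dec (+ N n ∣? (fun w (+ j) ℤ.- b))) (range (2 ℕ.* n))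
    ; bound = maxAbs
    ; below = below-maxAbs
    ; above = above-maxAbs
    }

module _ {n : ℕ} (a : Abacus n) where

  -- The entries with labels in [-bound, bound], in reading order; all lower
  -- entries are beads and all higher entries are gaps.
  entries : List ℤ
  entries = filter (entry? n) (map (λ i → ℤ.- + bound a ℤ.+ + i) (upTo (suc (2 ℕ.* bound a))))

  beads gaps : List ℤ
  beads = filter (bead? a) entries
  gaps  = filter (¬? ∘ bead? a) entries

  beads↓ : List ℤ
  beads↓ = reverse beads

------------------------------------------------------------------------
-- Partitions

Partition : Set
Partition = List ℕ

-- The boundary path runs from the southwest to the northeast: a bead is
-- the end of a row with as many boxes as there are gaps before the bead,
-- and the last bead ends the first row.

partition : ∀ {n} → Abacus n → Partition
partition a = filter (1 ℕₚ.≤?_) (map (λ b → length (filter (ℤₚ._<? b) (gaps a))) (beads↓ a))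

𝒞 : ∀ {n} → Mirrored n → Partition
𝒞 w = partition (𝒜 w)

-- Rows and columns are numbered from 1.

Cell : Set
Cell = ℕ × ℕ

content : Cell → ℤ
content (i , j) = + j ℤ.- + i

rowLength : Partition → ℕ → ℕ
rowLength []       _             = 0
rowLength (p ∷ ps) zero          = 0
rowLength (p ∷ ps) (suc zero)    = p
rowLength (p ∷ ps) (suc (suc i)) = rowLength ps (suc i)

columnLength : Partition → ℕ → ℕ
columnLength ps j = length (filter (j ℕₚ.≤?_) ps)

-- The number of boxes (i , i + k).
diagonalLength : ℕ → Partition → ℕ
diagonalLength k ps = length (filter (λ i → i ℕ.+ k ℕₚ.≤? rowLength ps i) (range (length ps)))

------------------------------------------------------------------------
-- Residues

infix 7 _∥_

_∥_ : ℤ → ℕ → ℕ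
p ∥ zero  = 0
p ∥ suc q = p %ℕ suc q

data Residue : Set where
  undefined : Residue
  one       : ℕ → Residue
  both      : ℕ → ℕ → Residue

-- The residues of the cells c₁, c₂, c₃ of one row (for columns, transposed)
-- when c₁ lies in column `c₁` and the row of the partition has length ℓ.

threeCells : (p q : ℕ) (c₁ ℓ : ℕ) → Vec Residue 3
threeCells p q c₁ ℓ =
  if suc ℓ ≡ᵇ c₁         then both p q ∷ one q ∷ undefined ∷ []
  else if ℓ ≡ᵇ c₁        then one p ∷ one q ∷ one q ∷ []
  else if ℓ ≡ᵇ c₁ ℕ.+ 1  then one q ∷ one q ∷ one p ∷ []
  else if ℓ ≡ᵇ c₁ ℕ.+ 2  then undefined ∷ one q ∷ both p q ∷ []
  else replicate 3 undefined

-- Among the cells with (j - i) ∥ 2n in three consecutive classes, the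
-- connected components are the bands of three consecutive diagonals.  The
-- result is the position of a cell at distance d from the main diagonal,
-- where the classes begin with `start` and distance grows to the right
-- (above the main diagonal) or downwards (below it).

bandPosition : (n start d : ℕ) → Maybe (Fin 3)
bandPosition n start d with (+ d ℤ.- + start) ∥ (2 ℕ.* n)
... | 0 = just zero
... | 1 = just (suc zero)
... | 2 = just (suc (suc zero))
... | _ = nothing

bandResidue : (p q : ℕ) → Partition → Fin 3 → Cell → Residue
bandResidue p q ps pos (i , j) =
  if i <ᵇ j
  then lookup (threeCells p q (j ∸ toℕ pos) (rowLength ps i)) pos
  else lookup (threeCells p q (i ∸ toℕ pos) (columnLength ps j)) pos

fixedResidue : ℕ → Cell → Residue
fixedResidue n c = one (if k ≤ᵇ n then k else 2 ℕ.* n ∸ k)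
  where k = content c ∥ (2 ℕ.* n)

mainResidue : Cell → Residue
mainResidue (i , j) =
  if i ≡ᵇ j then one 0
  else if (i ℕ.+ j) ℕ.% 4 ≡ᵇ 1 then one 1
  else one 0

escalatorResidue descalatorResidue : ℕ → Partition → Cell → Maybe Residue
escalatorResidue n ps c with bandPosition n (n ∸ 1) ∣ content c ∣
... | just pos = just (bandResidue (n ∸ 1) n ps pos c)
... | nothing  = nothing
descalatorResidue n ps c with ∣ content c ∣ ≤ᵇ 1 | bandPosition n (2 ℕ.* n ∸ 1) ∣ content c ∣
... | true  | _        = just (mainResidue c)
... | false | just pos = just (bandResidue 1 0 ps pos c)
... | false | nothing  = nothing

infixr 4 _orElse_

_orElse_ : Maybe Residue → Residue → Residue
just r  orElse _ = r
nothing orElse r = r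

onlyFor : End → Maybe Residue → Maybe Residue
onlyFor C _ = nothing
onlyFor D r = r

residue : Type → ℕ → Partition → Cell → Residue
residue ty n ps c =
  onlyFor (right ty) (escalatorResidue n ps c)
    orElse onlyFor (left ty) (descalatorResidue n ps c)
    orElse fixedResidue n c

------------------------------------------------------------------------
-- Central peeling

referenceDiagonal : End → ℕ
referenceDiagonal C = 0
referenceDiagonal D = 1

-- The only ambiguity that the procedure resolves is between n - 1 and n.
peelingResidue : ℕ → Residue → Maybe ℕ
peelingResidue n undefined  = nothing
peelingResidue n (one r)    = just r
peelingResidue n (both p q) = if (p ≡ᵇ n ∸ 1) ∧ (q ≡ᵇ n) then just n else nothing

-- Given the last box (d , c) of row d, the box recorded when s_r acts: s_r^D
-- with r ∈ {0, n} removes (d , c ∸ 1) and (d , c), and the one on an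
-- excluded diagonal is passed over.

recordedBox : Type → ℕ → ℕ → Cell → Cell
recordedBox ty n r (d , c) =
  if (isD (right ty) ∧ (r ≡ᵇ n) ∧ (c ≡ᵇ d ℕ.+ n))
     ∨ (isD (left ty) ∧ (r ≡ᵇ 0) ∧ ((c ≡ᵇ d) ∨ (c ≡ᵇ d ℕ.+ 2 ℕ.* n)))
  then (d , c ∸ 1)
  else (d , c)

-- Recorded boxes with their residues, in the order of recording.
UpperDiagram : Set
UpperDiagram = List (Cell × ℕ)

module _ (ty : Type) (n : ℕ) where

  -- Since 𝒞 is injective on W̃/W, the current partition λ is carried along
  -- as the v with λ = 𝒞 v, and s_r acts on λ by acting on v.

  shape : W̃/W ty n → Partition
  shape v = 𝒞 (perm v)

  peelingRow : W̃/W ty n → ℕ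
  peelingRow v = diagonalLength (referenceDiagonal (left ty)) (shape v)

  peelingBox : W̃/W ty n → Cell
  peelingBox v = peelingRow v , rowLength (shape v) (peelingRow v)

  data Peels : W̃/W ty n → UpperDiagram → Set where
    done : ∀ {v} → shape v ≡ [] → Peels v []
    peel : ∀ {v v′ r U} →
           shape v ≢ [] →
           1 ℕ.≤ peelingRow v →
           peelingResidue n (residue ty n (shape v) (peelingBox v)) ≡ just r →
           Acts r v v′ →
           Peels v′ U →
           Peels v ((recordedBox ty n r (peelingBox v) , r) ∷ U)

------------------------------------------------------------------------
-- Bounded partitions

-- A part is its size together with a star flag.  Sizes are integers because
-- the bead formulas below involve negative offsets.

Part : Set
Part = ℤ × Bool

dropZeros : List Part → List Part
dropZeros = filter (λ p → ¬? (proj₁ p ℤₚ.≟ 0ℤ))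

starSize : Type → ℕ → Maybe ℕ
starSize C/C n = nothing
starSize B/B n = nothing
starSize B/D n = just n
starSize D/D n = just (n ∸ 1)

module _ (U : UpperDiagram) where

  boxes : List Cell
  boxes = deduplicate (≡-dec ℕₚ._≟_ ℕₚ._≟_) (map proj₁ U)

  rows : List ℕ
  rows = range (max 0 (map proj₁ boxes))

  boxesInRow : ℕ → ℕ
  boxesInRow i = length (filter (λ c → proj₁ c ℕₚ.≟ i) boxes)

  isLastOfSize : ℕ → ℕ → Bool
  isLastOfSize m i = (boxesInRow i ≡ᵇ m) ∧ all (λ i′ → not ((i <ᵇ i′) ∧ (boxesInRow i′ ≡ᵇ m))) rows

  rightmostHasResidue : ℕ → ℕ → Bool
  rightmostHasResidue r i =
    any (λ ((i′ , j′) , r′) → (i′ ≡ᵇ i) ∧ (r′ ≡ᵇ r) ∧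
           all (λ (i″ , j″) → not ((i″ ≡ᵇ i) ∧ (j′ <ᵇ j″))) boxes)
        U

  starred : Type → ℕ → ℕ → Bool
  starred ty n i with starSize ty n
  ... | nothing = false
  ... | just m  = isLastOfSize m i ∧ rightmostHasResidue (n ∸ 1) i

  rowParts : Type → ℕ → List Part
  rowParts ty n = dropZeros (map (λ i → + boxesInRow i , starred ty n i) rows)

-- ℬ(w) = β.
ℬ[_]≡_ : ∀ {ty n} → W̃/W ty n → List Part → Set
ℬ[_]≡_ {ty} {n} w β = ∃[ U ] Peels ty n w U × β ≡ rowParts U ty n

------------------------------------------------------------------------
-- The parts read off from the abacus

module _ (ty : Type) {n : ℕ} (a : Abacus n) where

  gapsBetween : ℤ → ℤ → ℕ
  gapsBetween lo hi = length (filter (λ g → (lo ℤₚ.<? g) ×-dec (g ℤₚ.<? hi)) (gaps a))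

  beadPart : ℤ → Part
  beadPart b with + (N n ℕ.+ n) ℤₚ.<? b
  ... | yes _ = + gapsBetween (b ℤ.- + N n) b ℤ.+ (+ 1 ℤ.+ x₀ ty ℤ.+ xₙ ty) , false
  ... | no  _ = b ℤ.- + N n ℤ.+ x₀ ty , isD (right ty) ∧ does (b ℤₚ.≟ + (N n ℕ.+ n))

  beadParts : List Part
  beadParts = dropZeros (map beadPart (filter (+ N n ℤₚ.<?_) (beads↓ a)))

{-# OPTIONS --safe #-}

-- A label b not divisible by N is a bead of 𝒜(w) iff w⁻¹(b) < N.  Hence b is a
-- bead iff 2N - b is a gap, and the row that is peeled belongs to the lowest
-- bead b beyond N (beyond N + 1 if the left end is D): its last box lies on the
-- diagonal b - N - 1, or on the 2n-th if b = 2N + 1.  The residue there names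
-- the generator that moves b down.  No bead beyond N lies in a class raised by
-- this generator, so the higher beads keep their order.
--
-- The number of gaps between c - N and c is the number of runners whose lowest
-- bead lies below c - N, and the generator reverses the order of no lowest bead
-- and c - N, except for two beads N + n + 1 and N + n + 2 moved together by sₙᴰ,
-- where both descriptions of the part agree.  So a step keeps the parts of the
-- higher beads; by the symmetry b ↔ 2N - b it lowers the part of b by one, and it
-- adds one box to the row of b.  A star is decided when the lowest bead is the
-- first one whose part has the starred size: its position is N + n or N + n + 1.
--
-- A peeling exists because s_r w is again a minimal representative: w⁻¹ inverts
-- the pair of labels exchanged by s_r, so by the exchange condition every word
-- for w yields a shorter word for s_r w, and ℓ(w) ≤ ℓ(wu) gives the rest.
module Submission where

open import Defs
open import Data.Bool.Base using (Bool; T; _∧_; _∨_; false; if_then_else_; not; true)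
open import Data.Bool.ListAction using (all; any)
import Data.Bool.Properties as Boolₚ
open import Data.Empty using (⊥; ⊥-elim)
open import Data.Fin.Base using (Fin; fromℕ<; suc; toℕ; zero)
import Data.Fin.Properties as Finₚ
open import Data.Integer.Base as ℤ using (+<+; +_; +≤+; -1ℤ; -[1+_]; -≤-; 0ℤ; 1ℤ; _%ℕ_; _/ℕ_; ℤ; ∣_∣)
open import Data.Integer.DivMod using (a≡a%ℕn+[a/ℕn]*n; n%ℕd<d)
open import Data.Integer.Divisibility.Signed using (_∣?_; _∣_; divides)
import Data.Integer.Properties as ℤₚ
open import Data.Integer.Tactic.RingSolver using (solve-∀)
open import Data.List.Base as List using (List; []; [_]; _++_; _∷_; _∷ʳ_; _∷ʳ′_; filter; initLast; length; map; reverse; upTo)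
open import Data.List.Extrema.Nat using (max; max≈v⁺)
open import Data.List.Membership.Propositional using (_∈_; find; lose)
open import Data.List.Membership.Propositional.Properties using (∈-++⁺ʳ; ∈-++⁺ˡ; ∈-++⁻; ∈-deduplicate⁻; ∈-filter⁺; ∈-filter⁻; ∈-map⁺; ∈-map⁻; ∈-upTo⁺; ∈-upTo⁻; ∈-∃++)
import Data.List.Properties as Listₚ
open import Data.List.Relation.Unary.All as All using (All; []; _∷_)
import Data.List.Relation.Unary.All.Properties as Allₚ
open import Data.List.Relation.Unary.AllPairs as AllPairs using (AllPairs; []; _∷_)
import Data.List.Relation.Unary.AllPairs.Properties as AllPairsₚ
open import Data.List.Relation.Unary.Any using (here; there)
import Data.List.Relation.Unary.Any.Properties as Anyₚ
open import Data.List.Relation.Unary.Unique.Propositional using (Unique)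
import Data.List.Relation.Unary.Unique.Propositional.Properties as Uniqueₚ
open import Data.Maybe.Base using (Maybe; just; nothing)
import Data.Maybe.Properties as Maybeₚ
open import Data.Nat.Base as ℕ using (_<ᵇ_; _∸_; _≡ᵇ_; _≤ᵇ_; suc; s≤s; zero; z≤n; ℕ)
import Data.Nat.DivMod as DivMod
open import Data.Nat.Divisibility using () renaming (_∣_ to _∣ₙ_; divides to dividesₙ)
open import Data.Nat.Induction using (<-wellFounded)
open import Data.Nat.ListAction using (sum)
import Data.Nat.ListAction.Properties as Sumₚ
import Data.Nat.Properties as ℕₚ
open import Data.Nat.Tactic.RingSolver using () renaming (solve-∀ to solveℕ)
open import Data.Product.Base using (_,_; _×_; proj₁; proj₂; ∃-syntax; ∃₂)
open import Data.Product.Properties using (≡-dec)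
open import Data.Sum.Base using (_⊎_; inj₁; inj₂)
open import Data.Unit.Base using (tt)
open import Data.Vec.Base as Vec using (Vec; []; _∷_; lookup)
open import Data.Vec.N-ary using (N-ary; _$ⁿ_)
open import Function.Base using (_|>_; _∘_; _⟨_⟩_; flip; id)
open import Function.Bundles using (Equivalence; _⇔_; mk⇔)
open import Induction.WellFounded using (Acc; acc)
open import Relation.Binary.Definitions using (Tri; tri<; tri>; tri≈)
open import Relation.Binary.PropositionalEquality hiding ([_])
open import Relation.Nullary using (Dec; contradiction; does; no; yes; ¬?; ¬_)
open import Relation.Nullary.Decidable using (_×-dec_; map′)
open import Relation.Unary using (Decidable)

-- Two facts make the types with an end D harder than type C/C. A generator with end D also reverses
-- pairs of labels, such as -1 and 1, that no reflection of the group exchanges; `Excluded` names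
-- the sums of such pairs, and the exchange argument is confined to the other pairs. Moreover, on
-- the main descalator the residue of a box alternates with its row, and it names a generator that
-- lowers the bead only because of the parity condition on w: the number of beads beyond N is even,
-- so the parity of the peeled row tells whether N + 1 is a bead. The relation between recorded
-- boxes and beads is proved as an invariant of an arbitrary peeling (`Summary`), which settles the
-- value of ℬ(w) without a separate uniqueness argument; the existence of a peeling then gives the
-- converse. Almost every case ends in a comparison of a few labels with small multiples of N,
-- whence the decision procedure for linear arithmetic.

-- Linear arithmetic over the integers by reflection.

module LinearArithmetic where

  -- Linear arithmetic over ℤ by Fourier–Motzkin elimination.  A form (k , c)
  -- stands for the constraint 0 ≤ k + c · ρ.

  Form : ℕ → Set
  Form n = ℤ × Vec ℤ n

  dot : ∀ {n} → Vec ℤ n → Vec ℤ n → ℤ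
  dot []       []       = 0ℤ
  dot (c ∷ cs) (x ∷ xs) = c ℤ.* x ℤ.+ dot cs xs

  value : ∀ {n} → Form n → Vec ℤ n → ℤ
  value (k , c) ρ = k ℤ.+ dot c ρ

  Holds : ∀ {n} → Vec ℤ n → Form n → Set
  Holds ρ e = 0ℤ ℤ.≤ value e ρ

  infixl 6 _⊞_
  infixl 7 _⊡_

  _⊞_ : ∀ {n} → Form n → Form n → Form n
  (k , c) ⊞ (k′ , c′) = k ℤ.+ k′ , Vec.zipWith ℤ._+_ c c′

  _⊡_ : ∀ {n} → ℤ → Form n → Form n
  a ⊡ (k , c) = a ℤ.* k , Vec.map (a ℤ.*_) c

  dot-+ : ∀ {n} (c c′ ρ : Vec ℤ n) → dot (Vec.zipWith ℤ._+_ c c′) ρ ≡ dot c ρ ℤ.+ dot c′ ρ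
  dot-+ [] [] [] = refl
  dot-+ (c ∷ cs) (d ∷ ds) (x ∷ ρ) rewrite dot-+ cs ds ρ = regroup c d x (dot cs ρ) (dot ds ρ)
    where
    regroup : ∀ c d x p q → (c ℤ.+ d) ℤ.* x ℤ.+ (p ℤ.+ q) ≡ (c ℤ.* x ℤ.+ p) ℤ.+ (d ℤ.* x ℤ.+ q)
    regroup = solve-∀

  dot-* : ∀ {n} a (c ρ : Vec ℤ n) → dot (Vec.map (a ℤ.*_) c) ρ ≡ a ℤ.* dot c ρ
  dot-* a [] [] = sym (ℤₚ.*-zeroʳ a)
  dot-* a (c ∷ cs) (x ∷ ρ) rewrite dot-* a cs ρ = factor a c x (dot cs ρ)
    where
    factor : ∀ a c x p → a ℤ.* c ℤ.* x ℤ.+ a ℤ.* p ≡ a ℤ.* (c ℤ.* x ℤ.+ p)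
    factor = solve-∀

  value-⊞ : ∀ {n} (e e′ : Form n) ρ → value (e ⊞ e′) ρ ≡ value e ρ ℤ.+ value e′ ρ
  value-⊞ (k , c) (k′ , c′) ρ rewrite dot-+ c c′ ρ = regroup k k′ (dot c ρ) (dot c′ ρ)
    where
    regroup : ∀ k k′ p q → (k ℤ.+ k′) ℤ.+ (p ℤ.+ q) ≡ (k ℤ.+ p) ℤ.+ (k′ ℤ.+ q)
    regroup = solve-∀

  value-⊡ : ∀ {n} a (e : Form n) ρ → value (a ⊡ e) ρ ≡ a ℤ.* value e ρ
  value-⊡ a (k , c) ρ rewrite dot-* a c ρ = sym (ℤₚ.*-distribˡ-+ a k (dot c ρ))

  -- The constraints on the first variable: e with coefficient a > 0 (lower
  -- bounds), e with coefficient -b < 0 (upper bounds), and the others.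

  record Split (n : ℕ) : Set where
    constructor split
    field
      lower upper : List (ℕ × Form n)
      rest        : List (Form n)

  splitFirst : ∀ {n} → List (Form (suc n)) → Split n
  splitFirst [] = split [] [] []
  splitFirst ((k , + 0 ∷ c) ∷ es) with splitFirst es
  ... | split l u r = split l u ((k , c) ∷ r)
  splitFirst ((k , + suc a ∷ c) ∷ es) with splitFirst es
  ... | split l u r = split ((suc a , k , c) ∷ l) u r
  splitFirst ((k , -[1+ b ] ∷ c) ∷ es) with splitFirst es
  ... | split l u r = split l ((suc b , k , c) ∷ u) r

  combine : ∀ {n} → ℕ × Form n → ℕ × Form n → Form n
  combine (a , e) (b , e′) = + b ⊡ e ⊞ + a ⊡ e′

  combineAll : ∀ {n} → List (ℕ × Form n) → List (ℕ × Form n) → List (Form n) → List (Form n)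
  combineAll []      us r = r
  combineAll (l ∷ ls) us r = List.map (combine l) us ++ combineAll ls us r

  merge : ∀ {n} → Split n → List (Form n)
  merge (split l u r) = combineAll l u r

  eliminate : ∀ {n} → List (Form (suc n)) → List (Form n)
  eliminate es = merge (splitFirst es)

  -- An equation a x + p = 0 with a > 0, taken out of a list of equations.
  data Pivot (n : ℕ) : Set where
    none : List (Form n) → Pivot n
    some : ℕ → Form n → List (Form (suc n)) → Pivot n

  insertFree : ∀ {n} → Form n → Pivot n → Pivot n
  insertFree e         (none es)     = none (e ∷ es)
  insertFree (k , c) (some a p es) = some a p ((k , 0ℤ ∷ c) ∷ es)

  findPivot : ∀ {n} → List (Form (suc n)) → Pivot n
  findPivot [] = none []
  findPivot ((k , + 0 ∷ c) ∷ es)      = insertFree (k , c) (findPivot es)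
  findPivot ((k , + suc a ∷ c) ∷ es)  = some (suc a) (k , c) es
  findPivot ((k , -[1+ a ] ∷ c) ∷ es) = some (suc a) (-1ℤ ⊡ (k , c)) es

  -- The form a · e - c · (a x + p) no longer contains x, and its value is a times that of e because
  -- a x + p vanishes.
  substitute : ∀ {n} → ℕ → Form n → Form (suc n) → Form n
  substitute a p (k , c ∷ cs) = + a ⊡ (k , cs) ⊞ (ℤ.- c) ⊡ p

  isNegative isNonZero : ℤ → Bool
  isNegative (+ _)    = false
  isNegative -[1+ _ ] = true
  isNonZero (+ 0)     = false
  isNonZero (+ suc _) = true
  isNonZero -[1+ _ ]  = true

  -- `refutes eqs es` derives a contradiction from the equations 0 = e for e in
  -- eqs and the inequalities 0 ≤ e for e in es.
  refutes : ∀ {n} → List (Form n) → List (Form n) → Bool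
  refuteStep : ∀ {n} → Pivot n → List (Form (suc n)) → Bool

  refutes {zero}  []              []              = false
  refutes {zero}  []              ((k , []) ∷ es) = isNegative k ∨ refutes [] es
  refutes {zero}  ((k , []) ∷ eqs) es             = isNonZero k ∨ refutes eqs es
  refutes {suc n} eqs             es              = refuteStep (findPivot eqs) es

  refuteStep (none eqs)     es = refutes eqs (eliminate es)
  refuteStep (some a p eqs) es = refutes (List.map (substitute a p) eqs) (List.map (substitute a p) es)

  module _ {n : ℕ} (x : ℤ) (ρ : Vec ℤ n) where

    LowerHolds UpperHolds : ℕ × Form n → Set
    LowerHolds (a , e) = 0ℤ ℤ.≤ + a ℤ.* x ℤ.+ value e ρ
    UpperHolds (b , e) = 0ℤ ℤ.≤ ℤ.- + b ℤ.* x ℤ.+ value e ρ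

    splitFirst-holds : ∀ es → All (Holds (x ∷ ρ)) es →
      All LowerHolds (Split.lower (splitFirst es)) ×
      All UpperHolds (Split.upper (splitFirst es)) ×
      All (Holds ρ) (Split.rest (splitFirst es))
    splitFirst-holds [] [] = [] , [] , []
    splitFirst-holds ((k , + 0 ∷ c) ∷ es) (h ∷ hs) with splitFirst-holds es hs
    ... | l , u , r = l , u , subst (0ℤ ℤ.≤_) (drop k x (dot c ρ)) h ∷ r
      where
      drop : ∀ k x p → k ℤ.+ (0ℤ ℤ.* x ℤ.+ p) ≡ k ℤ.+ p
      drop = solve-∀
    splitFirst-holds ((k , + suc a ∷ c) ∷ es) (h ∷ hs) with splitFirst-holds es hs
    ... | l , u , r = subst (0ℤ ℤ.≤_) (swap k (+ suc a ℤ.* x) (dot c ρ)) h ∷ l , u , r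
      where
      swap : ∀ k y p → k ℤ.+ (y ℤ.+ p) ≡ y ℤ.+ (k ℤ.+ p)
      swap = solve-∀
    splitFirst-holds ((k , -[1+ b ] ∷ c) ∷ es) (h ∷ hs) with splitFirst-holds es hs
    ... | l , u , r = l , subst (0ℤ ℤ.≤_) (swap k (-[1+ b ] ℤ.* x) (dot c ρ)) h ∷ u , r
      where
      swap : ∀ k y p → k ℤ.+ (y ℤ.+ p) ≡ y ℤ.+ (k ℤ.+ p)
      swap = solve-∀

    combine-holds : ∀ l u → LowerHolds l → UpperHolds u → Holds ρ (combine l u)
    combine-holds (a , e) (b , e′) hl hu
      rewrite value-⊞ (+ b ⊡ e) (+ a ⊡ e′) ρ | value-⊡ (+ b) e ρ | value-⊡ (+ a) e′ ρ =
      subst (0ℤ ℤ.≤_) (cancel (+ a) (+ b) x (value e ρ) (value e′ ρ))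
        (ℤₚ.+-mono-≤ (scale b hl) (scale a hu))
      where
      scale : ∀ m {y} → 0ℤ ℤ.≤ y → 0ℤ ℤ.≤ + m ℤ.* y
      scale m {y} h = subst (ℤ._≤ + m ℤ.* y) (ℤₚ.*-zeroʳ (+ m)) (ℤₚ.*-monoˡ-≤-nonNeg (+ m) h)
      cancel : ∀ a b x p q → b ℤ.* (a ℤ.* x ℤ.+ p) ℤ.+ a ℤ.* (ℤ.- b ℤ.* x ℤ.+ q) ≡ b ℤ.* p ℤ.+ a ℤ.* q
      cancel = solve-∀

    combineAll-holds : ∀ ls us r → All LowerHolds ls → All UpperHolds us → All (Holds ρ) r →
                       All (Holds ρ) (combineAll ls us r)
    combineAll-holds []       us r []        hu hr = hr
    combineAll-holds (l ∷ ls) us r (hl ∷ hls) hu hr =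
      Allₚ.++⁺ (Allₚ.map⁺ (All.map (λ {u} → combine-holds l u hl) hu)) (combineAll-holds ls us r hls hu hr)

  Vanishes : ∀ {n} → Vec ℤ n → Form n → Set
  Vanishes ρ e = value e ρ ≡ 0ℤ

  module _ {n : ℕ} (x : ℤ) (ρ : Vec ℤ n) where

    PivotHolds : Pivot n → Set
    PivotHolds (none es)     = All (Vanishes ρ) es
    PivotHolds (some a p es) = + a ℤ.* x ℤ.+ value p ρ ≡ 0ℤ × All (Vanishes (x ∷ ρ)) es

    insertFree-holds : ∀ k c P → Vanishes (x ∷ ρ) (k , 0ℤ ∷ c) → PivotHolds P → PivotHolds (insertFree (k , c) P)
    insertFree-holds k c (none es) h hs = trans (sym (drop k x (dot c ρ))) h ∷ hs
      where
      drop : ∀ k x p → k ℤ.+ (0ℤ ℤ.* x ℤ.+ p) ≡ k ℤ.+ p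
      drop = solve-∀
    insertFree-holds k c (some a p es) h (hp , hs) = hp , h ∷ hs

    findPivot-holds : ∀ es → All (Vanishes (x ∷ ρ)) es → PivotHolds (findPivot es)
    findPivot-holds [] [] = []
    findPivot-holds ((k , + 0 ∷ c) ∷ es) (h ∷ hs) = insertFree-holds k c (findPivot es) h (findPivot-holds es hs)
    findPivot-holds ((k , + suc a ∷ c) ∷ es) (h ∷ hs) = trans (swap k (+ suc a ℤ.* x) (dot c ρ)) h , hs
      where
      swap : ∀ k y p → y ℤ.+ (k ℤ.+ p) ≡ k ℤ.+ (y ℤ.+ p)
      swap = solve-∀
    findPivot-holds ((k , -[1+ a ] ∷ c) ∷ es) (h ∷ hs) = trans (cong (λ z → + suc a ℤ.* x ℤ.+ z)
        (value-⊡ -1ℤ (k , c) ρ))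
        (trans (negate (+ suc a) x k (dot c ρ)) (cong ℤ.-_ h)) , hs
      where
      negate : ∀ a x k p → a ℤ.* x ℤ.+ -1ℤ ℤ.* (k ℤ.+ p) ≡ ℤ.- (k ℤ.+ (ℤ.- a ℤ.* x ℤ.+ p))
      negate = solve-∀

    substitute-value : ∀ a p e → + a ℤ.* x ℤ.+ value p ρ ≡ 0ℤ →
                       value (substitute a p e) ρ ≡ + a ℤ.* value e (x ∷ ρ)
    substitute-value a p (k , c ∷ cs) h
      rewrite value-⊞ (+ a ⊡ (k , cs)) ((ℤ.- c) ⊡ p) ρ | value-⊡ (+ a) (k , cs) ρ | value-⊡ (ℤ.- c) p ρ =
      trans (regroup (+ a) c x k (dot cs ρ) (value p ρ))
        (trans (cong (λ z → + a ℤ.* (k ℤ.+ (c ℤ.* x ℤ.+ dot cs ρ)) ℤ.- c ℤ.* z) h) (vanish _ c))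
      where
      regroup : ∀ a c x k q p → a ℤ.* (k ℤ.+ q) ℤ.+ ℤ.- c ℤ.* p ≡ a ℤ.* (k ℤ.+ (c ℤ.* x ℤ.+ q)) ℤ.- c ℤ.*
          (a ℤ.* x ℤ.+ p)
      regroup = solve-∀
      vanish : ∀ y c → y ℤ.- c ℤ.* 0ℤ ≡ y
      vanish = solve-∀

    substitute-holds : ∀ a p e → + a ℤ.* x ℤ.+ value p ρ ≡ 0ℤ → Holds (x ∷ ρ) e → Holds ρ (substitute a p e)
    substitute-holds a p e hp h rewrite substitute-value a p e hp =
      subst (ℤ._≤ + a ℤ.* value e (x ∷ ρ)) (ℤₚ.*-zeroʳ (+ a)) (ℤₚ.*-monoˡ-≤-nonNeg (+ a) h)

    substitute-vanishes : ∀ a p e → + a ℤ.* x ℤ.+ value p ρ ≡ 0ℤ → Vanishes (x ∷ ρ) e → Vanishes ρ (substitute a p e)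
    substitute-vanishes a p e hp h =
      trans (substitute-value a p e hp) (trans (cong (λ z → + a ℤ.* z) h) (ℤₚ.*-zeroʳ (+ a)))

  refutes-sound : ∀ {n} (eqs es : List (Form n)) → T (refutes eqs es) → ∀ ρ →
                  All (Vanishes ρ) eqs → ¬ All (Holds ρ) es
  refuteStep-sound : ∀ {n} (P : Pivot n) (es : List (Form (suc n))) → T (refuteStep P es) → ∀ x ρ →
                     PivotHolds x ρ P → ¬ All (Holds (x ∷ ρ)) es

  refutes-sound {zero} [] ((+ k , []) ∷ es)      t [] heq (h ∷ hs) = refutes-sound [] es t [] heq hs
  refutes-sound {zero} [] ((-[1+ k ] , []) ∷ es) t [] heq (() ∷ hs)
  refutes-sound {zero} ((+ zero , []) ∷ eqs) es    t [] (h ∷ heq) hs = refutes-sound eqs es t [] heq hs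
  refutes-sound {zero} ((+ suc k , []) ∷ eqs) es   t [] (() ∷ heq) hs
  refutes-sound {zero} ((-[1+ k ] , []) ∷ eqs) es  t [] (() ∷ heq) hs
  refutes-sound {suc n} eqs es t (x ∷ ρ) heq hs =
    refuteStep-sound (findPivot eqs) es t x ρ (findPivot-holds x ρ eqs heq) hs

  refuteStep-sound (none eqs) es t x ρ heq hs =
    let hl , hu , hr = splitFirst-holds x ρ es hs
    in refutes-sound eqs (eliminate es) t ρ heq (combineAll-holds x ρ _ _ _ hl hu hr)
  refuteStep-sound (some a p eqs) es t x ρ (hp , heq) hs =
    refutes-sound (List.map (substitute a p) eqs) (List.map (substitute a p) es) t ρ
      (Allₚ.map⁺ (All.map (λ {e} → substitute-vanishes x ρ a p e hp) heq))
      (Allₚ.map⁺ (All.map (λ {e} → substitute-holds x ρ a p e hp) hs))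

  infixl 6 _:+_ _:-_
  infixl 7 _:*_
  infix  4 _:≤_ _:<_ _:≡_
  infixr 3 _⇒_
  infix  3 ⊢_

  data Expr (n : ℕ) : Set where
    var       : Fin n → Expr n
    #_        : ℕ → Expr n
    _:+_ _:-_ : Expr n → Expr n → Expr n
    _:*_      : ℕ → Expr n → Expr n
    :-_       : Expr n → Expr n

  data Atom (n : ℕ) : Set where
    _:≤_ _:<_ _:≡_ : Expr n → Expr n → Atom n

  data Formula (n : ℕ) : Set where
    _⇒_ : Atom n → Formula n → Formula n
    ⊢_  : Atom n → Formula n
    ⊢⊥  : Formula n

  ⟦_⟧ᵉ : ∀ {n} → Expr n → Vec ℤ n → ℤ
  ⟦ var i ⟧ᵉ   ρ = Vec.lookup ρ i
  ⟦ # k ⟧ᵉ     ρ = + k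
  ⟦ e :+ e′ ⟧ᵉ ρ = ⟦ e ⟧ᵉ ρ ℤ.+ ⟦ e′ ⟧ᵉ ρ
  ⟦ e :- e′ ⟧ᵉ ρ = ⟦ e ⟧ᵉ ρ ℤ.- ⟦ e′ ⟧ᵉ ρ
  ⟦ k :* e ⟧ᵉ  ρ = + k ℤ.* ⟦ e ⟧ᵉ ρ
  ⟦ :- e ⟧ᵉ    ρ = ℤ.- ⟦ e ⟧ᵉ ρ

  ⟦_⟧ᵃ : ∀ {n} → Atom n → Vec ℤ n → Set
  ⟦ e :≤ e′ ⟧ᵃ ρ = ⟦ e ⟧ᵉ ρ ℤ.≤ ⟦ e′ ⟧ᵉ ρ
  ⟦ e :< e′ ⟧ᵃ ρ = ⟦ e ⟧ᵉ ρ ℤ.< ⟦ e′ ⟧ᵉ ρ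
  ⟦ e :≡ e′ ⟧ᵃ ρ = ⟦ e ⟧ᵉ ρ ≡ ⟦ e′ ⟧ᵉ ρ

  ⟦_⟧ᶠ : ∀ {n} → Formula n → Vec ℤ n → Set
  ⟦ a ⇒ φ ⟧ᶠ ρ = ⟦ a ⟧ᵃ ρ → ⟦ φ ⟧ᶠ ρ
  ⟦ ⊢ a ⟧ᶠ   ρ = ⟦ a ⟧ᵃ ρ
  ⟦ ⊢⊥ ⟧ᶠ    ρ = ⊥

  form : ∀ {n} → Expr n → Form n
  form (var i)   = 0ℤ , Vec.replicate _ 0ℤ Vec.[ i ]≔ 1ℤ
  form (# k)     = + k , Vec.replicate _ 0ℤ
  form (e :+ e′) = form e ⊞ form e′
  form (e :- e′) = form e ⊞ -1ℤ ⊡ form e′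
  form (k :* e)  = + k ⊡ form e
  form (:- e)    = -1ℤ ⊡ form e

  dot-0 : ∀ {n} (ρ : Vec ℤ n) → dot (Vec.replicate n 0ℤ) ρ ≡ 0ℤ
  dot-0 []      = refl
  dot-0 (x ∷ ρ) rewrite dot-0 ρ = ℤₚ.+-identityʳ _

  dot-unit : ∀ {n} (i : Fin n) ρ → dot (Vec.replicate n 0ℤ Vec.[ i ]≔ 1ℤ) ρ ≡ Vec.lookup ρ i
  dot-unit zero    (x ∷ ρ) rewrite dot-0 ρ = trans (ℤₚ.+-identityʳ _) (ℤₚ.*-identityˡ x)
  dot-unit (suc i) (x ∷ ρ) = trans (ℤₚ.+-identityˡ _) (dot-unit i ρ)

  form-value : ∀ {n} (e : Expr n) ρ → value (form e) ρ ≡ ⟦ e ⟧ᵉ ρ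
  form-value (var i) ρ   = trans (ℤₚ.+-identityˡ _) (dot-unit i ρ)
  form-value (# k) ρ     = trans (cong (λ z → + k ℤ.+ z) (dot-0 ρ)) (ℤₚ.+-identityʳ (+ k))
  form-value (e :+ e′) ρ = trans (value-⊞ (form e) (form e′) ρ) (cong₂ ℤ._+_ (form-value e ρ) (form-value e′ ρ))
  form-value (e :- e′) ρ = trans (value-⊞ (form e) (-1ℤ ⊡ form e′) ρ)
    (cong₂ ℤ._+_ (form-value e ρ) (trans (value-⊡ -1ℤ (form e′) ρ)
        (trans (ℤₚ.-1*i≡-i _) (cong ℤ.-_ (form-value e′ ρ)))))
  form-value (k :* e) ρ  = trans (value-⊡ (+ k) (form e) ρ) (cong ((+ k) ℤ.*_) (form-value e ρ))
  form-value (:- e) ρ    = trans (value-⊡ -1ℤ (form e) ρ) (trans (ℤₚ.-1*i≡-i _) (cong ℤ.-_ (form-value e ρ)))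

  -- Over ℤ a strict inequality tightens to 1 + e ≤ e′; this is where integrality strengthens a
  -- constraint.
  ≤-form <-form : ∀ {n} → Expr n → Expr n → Form n
  ≤-form e e′ = form (e′ :- e)
  <-form e e′ = form (e′ :- (# 1 :+ e))

  ≤-holds : ∀ {n} (e e′ : Expr n) {ρ} → ⟦ e ⟧ᵉ ρ ℤ.≤ ⟦ e′ ⟧ᵉ ρ → Holds ρ (≤-form e e′)
  ≤-holds e e′ {ρ} h rewrite form-value (e′ :- e) ρ = ℤₚ.i≤j⇒0≤j-i h

  <-holds : ∀ {n} (e e′ : Expr n) {ρ} → ⟦ e ⟧ᵉ ρ ℤ.< ⟦ e′ ⟧ᵉ ρ → Holds ρ (<-form e e′)
  <-holds e e′ {ρ} h = ≤-holds (# 1 :+ e) e′ (ℤₚ.i<j⇒suc[i]≤j h)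

  -- The negation of the conclusion joins the constraints. An equation is split into two strict
  -- inequalities, which are refuted separately.
  valid : ∀ {n} → List (Form n) → List (Form n) → Formula n → Bool
  valid eqs es ((e :≤ e′) ⇒ φ) = valid eqs (≤-form e e′ ∷ es) φ
  valid eqs es ((e :< e′) ⇒ φ) = valid eqs (<-form e e′ ∷ es) φ
  valid eqs es ((e :≡ e′) ⇒ φ) = valid (≤-form e e′ ∷ eqs) es φ
  valid eqs es (⊢ (e :≤ e′))   = refutes eqs (<-form e′ e ∷ es)
  valid eqs es (⊢ (e :< e′))   = refutes eqs (≤-form e′ e ∷ es)
  valid eqs es (⊢ (e :≡ e′))   = refutes eqs (<-form e′ e ∷ es) ∧ refutes eqs (<-form e e′ ∷ es)
  valid eqs es ⊢⊥              = refutes eqs es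

  T-∧⁻ : ∀ {a b} → T (a ∧ b) → T a × T b
  T-∧⁻ {true} {true} _ = tt , tt

  ≡-vanishes : ∀ {n} (e e′ : Expr n) {ρ} → ⟦ e ⟧ᵉ ρ ≡ ⟦ e′ ⟧ᵉ ρ → Vanishes ρ (≤-form e e′)
  ≡-vanishes e e′ {ρ} h = trans (form-value (e′ :- e) ρ) (ℤₚ.i≡j⇒i-j≡0 (sym h))

  module _ {n : ℕ} {eqs es : List (Form n)} where

    refute-> : ∀ (e e′ : Expr n) → T (refutes eqs (<-form e′ e ∷ es)) → ∀ ρ → All (Vanishes ρ) eqs → All (Holds ρ) es
        →
               ⟦ e ⟧ᵉ ρ ℤ.≤ ⟦ e′ ⟧ᵉ ρ
    refute-> e e′ t ρ heq hs = ℤₚ.≮⇒≥ λ gt → refutes-sound eqs _ t ρ heq (<-holds e′ e gt ∷ hs)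

  valid-sound : ∀ {n} eqs es (φ : Formula n) → T (valid eqs es φ) → ∀ ρ →
                All (Vanishes ρ) eqs → All (Holds ρ) es → ⟦ φ ⟧ᶠ ρ
  valid-sound eqs es ((e :≤ e′) ⇒ φ) t ρ heq hs h = valid-sound eqs _ φ t ρ heq (≤-holds e e′ h ∷ hs)
  valid-sound eqs es ((e :< e′) ⇒ φ) t ρ heq hs h = valid-sound eqs _ φ t ρ heq (<-holds e e′ h ∷ hs)
  valid-sound eqs es ((e :≡ e′) ⇒ φ) t ρ heq hs h = valid-sound _ es φ t ρ (≡-vanishes e e′ h ∷ heq) hs
  valid-sound eqs es (⊢ (e :≤ e′)) t ρ heq hs = refute-> e e′ t ρ heq hs
  valid-sound eqs es (⊢ (e :< e′)) t ρ heq hs = ℤₚ.≰⇒> λ ge → refutes-sound eqs _ t ρ heq (≤-holds e′ e ge ∷ hs)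
  valid-sound eqs es (⊢ (e :≡ e′)) t ρ heq hs =
    let t₁ , t₂ = T-∧⁻ {refutes eqs (<-form e′ e ∷ es)} t
    in ℤₚ.≤-antisym (refute-> e e′ t₁ ρ heq hs) (refute-> e′ e t₂ ρ heq hs)
  valid-sound eqs es ⊢⊥ t ρ heq hs = refutes-sound eqs es t ρ heq hs

  Πⁿ : ∀ n → (Vec ℤ n → Set) → Set
  Πⁿ zero    P = P []
  Πⁿ (suc n) P = ∀ x → Πⁿ n (P ∘ (x ∷_))

  abstractⁿ : ∀ n {P : Vec ℤ n → Set} → (∀ ρ → P ρ) → Πⁿ n P
  abstractⁿ zero    f   = f []
  abstractⁿ (suc n) f x = abstractⁿ n (f ∘ (x ∷_))

  variables : ∀ n → Vec (Expr n) n
  variables n = Vec.tabulate var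

  -- The hidden argument is `T` of a closed Boolean, so evaluation during type checking supplies it.
  -- Nonlinear terms such as k * M are passed as variables.
  lia : ∀ n (f : N-ary n (Expr n) (Formula n)) {_ : T (valid [] [] (f $ⁿ variables n))} →
        Πⁿ n ⟦ f $ⁿ variables n ⟧ᶠ
  lia n f {t} = abstractⁿ n λ ρ → valid-sound [] [] (f $ⁿ variables n) t ρ [] []

open LinearArithmetic using (lia; #_; _:+_; _:-_; _:*_; :-_; _:≤_; _:<_; _:≡_; _⇒_; ⊢_; ⊢⊥)

-- Counting and sorting in lists.

module _ {A B : Set} where

  -- The image of the head is cut out of ys; injectivity keeps the other images off it.
  injection-length : ∀ {xs : List A} {ys : List B} (f : A → B) → Unique xs →
    (∀ {x y} → x ∈ xs → y ∈ xs → f x ≡ f y → x ≡ y) → (∀ {x} → x ∈ xs → f x ∈ ys) →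
    length xs ℕ.≤ length ys
  injection-length {xs = []} f _ _ _ = z≤n
  injection-length {xs = x ∷ xs} f (x∉ ∷ u) inj into with ∈-∃++ (into (here refl))
  ... | as , bs , refl = subst (suc (length xs) ℕ.≤_) (sym (Listₚ.length-++-sucʳ as (f x) bs))
          (s≤s (injection-length f u (λ p q → inj (there p) (there q)) into′))
    where
    into′ : ∀ {y} → y ∈ xs → f y ∈ as ++ bs
    into′ {y} y∈ with ∈-++⁻ as (into (there y∈))
    ... | inj₁ p         = ∈-++⁺ˡ p
    ... | inj₂ (there p) = ∈-++⁺ʳ as p
    ... | inj₂ (here eq) = contradiction (sym (inj (there y∈) (here refl) eq)) (All.lookup x∉ y∈)

bijection-length : ∀ {A B : Set} {xs : List A} {ys : List B} (f : A → B) (g : B → A) →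
  Unique xs → Unique ys →
  (∀ {x} → x ∈ xs → f x ∈ ys) → (∀ {y} → y ∈ ys → g y ∈ xs) →
  (∀ {x} → x ∈ xs → g (f x) ≡ x) → (∀ {y} → y ∈ ys → f (g y) ≡ y) →
  length xs ≡ length ys
bijection-length f g ux uy f∈ g∈ gf fg = ℕₚ.≤-antisym
  (injection-length f ux (λ p q eq → trans (sym (gf p)) (trans (cong g eq) (gf q))) f∈)
  (injection-length g uy (λ p q eq → trans (sym (fg p)) (trans (cong f eq) (fg q))) g∈)

same-members-length : ∀ {A : Set} {xs ys : List A} → Unique xs → Unique ys →
  (∀ {x} → x ∈ xs → x ∈ ys) → (∀ {x} → x ∈ ys → x ∈ xs) → length xs ≡ length ys
same-members-length ux uy to from = bijection-length id id ux uy to from (λ _ → refl) (λ _ → refl)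

module _ {A : Set} {_<_ : A → A → Set} (asym : ∀ {x y} → x < y → ¬ y < x) where

  -- If the heads differed, each would come strictly before the other. Lists of beads are identified
  -- in this way from their members alone.
  sorted-≡ : ∀ {xs ys : List A} → AllPairs _<_ xs → AllPairs _<_ ys →
             (∀ {x} → x ∈ xs → x ∈ ys) → (∀ {x} → x ∈ ys → x ∈ xs) → xs ≡ ys
  sorted-≡ {[]}     {[]}     _ _ to from = refl
  sorted-≡ {[]}     {y ∷ ys} _ _ to from with () ← from (here refl)
  sorted-≡ {x ∷ xs} {[]}     _ _ to from with () ← to (here refl)
  sorted-≡ {x ∷ xs} {y ∷ ys} (x< ∷ sx) (y< ∷ sy) to from = cong₂ _∷_ x≡y (sorted-≡ sx sy to′ from′)
    where
    x≡y : x ≡ y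
    x≡y with to (here refl) | from (here refl)
    ... | here eq  | _         = eq
    ... | there _  | here eq   = sym eq
    ... | there p  | there q   = contradiction (All.lookup x< q) (asym (All.lookup y< p))
    to′ : ∀ {z} → z ∈ xs → z ∈ ys
    to′ z∈ with to (there z∈)
    ... | there p   = p
    ... | here refl = contradiction x<y (subst (λ t → ¬ t < _) (sym x≡y) (asym (subst (_< _) x≡y x<y)))
      where x<y = All.lookup x< z∈
    from′ : ∀ {z} → z ∈ ys → z ∈ xs
    from′ z∈ with from (there z∈)
    ... | there p   = p
    ... | here refl = contradiction y<x (subst (λ t → ¬ t < _) x≡y (asym (subst (_< _) (sym x≡y) y<x)))
      where y<x = All.lookup y< z∈

AllPairs-reverse : ∀ {A : Set} {R : A → A → Set} {xs} → AllPairs R xs → AllPairs (flip R) (reverse xs)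
AllPairs-reverse [] = []
AllPairs-reverse {R = R} {x ∷ xs} (r ∷ rs) = subst (AllPairs (flip R)) (sym (Listₚ.unfold-reverse x xs))
  (AllPairsₚ.++⁺ (AllPairs-reverse rs) ([] ∷ []) (All.tabulate λ y∈ → All.lookup r (Anyₚ.reverse⁻ y∈) ∷ []))

-- In a descending list the first failure of c < x entails all later ones.
descending-split : ∀ c {xs} → AllPairs ℤ._>_ xs →
  xs ≡ filter (c ℤₚ.<?_) xs ++ filter (λ x → ¬? (c ℤₚ.<? x)) xs
descending-split c [] = refl
descending-split c {x ∷ xs} (x> ∷ s) with c ℤₚ.<? x
... | yes _ = cong (x ∷_) (descending-split c s)
... | no c≮x = cong₂ _++_ (sym (Listₚ.filter-none (c ℤₚ.<?_) rest≤c))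
                 (cong (x ∷_) (sym (Listₚ.filter-all (λ y → ¬? (c ℤₚ.<? y)) rest≤c)))
  where
  rest≤c : All (λ y → ¬ c ℤ.< y) xs
  rest≤c = All.map (λ y<x c<y → c≮x (ℤₚ.<-trans c<y y<x)) x>

filter-split-length : ∀ {A : Set} {P Q : A → Set} (P? : Decidable P) (Q? : Decidable Q) xs →
  (∀ {x} → Q x → P x) →
  length (filter P? xs) ≡ length (filter Q? xs) ℕ.+ length (filter (λ x → ¬? (Q? x)) (filter P? xs))
filter-split-length P? Q? [] q⇒p = refl
filter-split-length P? Q? (x ∷ xs) q⇒p with P? x
... | no ¬p with Q? x
...   | yes q = contradiction (q⇒p q) ¬p
...   | no _  = filter-split-length P? Q? xs q⇒p
filter-split-length P? Q? (x ∷ xs) q⇒p | yes p with Q? x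
...   | yes q = cong suc (filter-split-length P? Q? xs q⇒p)
...   | no _  = trans (cong suc (filter-split-length P? Q? xs q⇒p)) (sym (ℕₚ.+-suc _ _))

filter-length-mono : ∀ {A : Set} {P Q : A → Set} (P? : Decidable P) (Q? : Decidable Q) xs →
  (∀ {x} → x ∈ xs → P x → Q x) → length (filter P? xs) ℕ.≤ length (filter Q? xs)
filter-length-mono P? Q? [] p⇒q = z≤n
filter-length-mono P? Q? (x ∷ xs) p⇒q with P? x | Q? x | filter-length-mono P? Q? xs (p⇒q ∘ there)
... | yes p | yes q | ih = s≤s ih
... | yes p | no ¬q | ih = contradiction (p⇒q (here refl) p) ¬q
... | no ¬p | yes q | ih = ℕₚ.m≤n⇒m≤1+n ih
... | no ¬p | no ¬q | ih = ih

filter-length-cong : ∀ {A : Set} {P Q : A → Set} (P? : Decidable P) (Q? : Decidable Q) xs →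
  (∀ {x} → x ∈ xs → P x → Q x) → (∀ {x} → x ∈ xs → Q x → P x) →
  length (filter P? xs) ≡ length (filter Q? xs)
filter-length-cong P? Q? xs to from =
  ℕₚ.≤-antisym (filter-length-mono P? Q? xs to) (filter-length-mono Q? P? xs from)

range-suc : ∀ k → range (suc k) ≡ range k ∷ʳ suc k
range-suc k = trans (cong (map suc) (sym (Listₚ.upTo-∷ʳ k))) (Listₚ.map-++ suc (upTo k) [ k ])

Unique⇐sorted : ∀ {xs : List ℤ} → AllPairs ℤ._<_ xs → Unique xs
Unique⇐sorted = AllPairs.map ℤₚ.<⇒≢

filter⁻ : ∀ {A : Set} {P : A → Set} (P? : Decidable P) xs {x} → x ∈ filter P? xs → x ∈ xs × P x
filter⁻ P? xs = ∈-filter⁻ P? {xs = xs}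

-- Parameters, and the congruence of labels modulo N.

module Development (ty : Type) (n : ℕ) (rank≤n : minRank ty ℕ.≤ n) where

  open import Data.Integer.Base using (_+_; _-_; _*_; -_; _≤_; _<_)

  M ν : ℤ
  M = + N n
  ν = + n

  M≡ : M ≡ + 1 + + 2 * ν
  M≡ = cong (λ z → + 1 + z) (ℤₚ.pos-* 2 n)

  2≤minRank : ∀ t → 2 ℕ.≤ minRank t
  2≤minRank C/C = s≤s (s≤s z≤n)
  2≤minRank B/B = s≤s (s≤s z≤n)
  2≤minRank B/D = s≤s (s≤s z≤n)
  2≤minRank D/D = s≤s (s≤s z≤n)

  2≤ν : + 2 ≤ ν
  2≤ν = +≤+ (ℕₚ.≤-trans (2≤minRank ty) rank≤n)

  left-D⇒3≤ : ∀ t → left t ≡ D → 3 ℕ.≤ minRank t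
  left-D⇒3≤ B/B _ = s≤s (s≤s (s≤s z≤n))
  left-D⇒3≤ D/D _ = s≤s (s≤s (s≤s z≤n))

  right-D⇒3≤ : ∀ t → right t ≡ D → 3 ℕ.≤ minRank t
  right-D⇒3≤ B/D _ = s≤s (s≤s (s≤s z≤n))
  right-D⇒3≤ D/D _ = s≤s (s≤s (s≤s z≤n))

  both-D⇒4≤ : ∀ t → left t ≡ D → right t ≡ D → 4 ℕ.≤ minRank t
  both-D⇒4≤ D/D _ _ = s≤s (s≤s (s≤s (s≤s z≤n)))

  left-D⇒3≤ν : left ty ≡ D → + 3 ≤ ν
  left-D⇒3≤ν eq = +≤+ (ℕₚ.≤-trans (left-D⇒3≤ ty eq) rank≤n)

  right-D⇒3≤ν : right ty ≡ D → + 3 ≤ ν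
  right-D⇒3≤ν eq = +≤+ (ℕₚ.≤-trans (right-D⇒3≤ ty eq) rank≤n)

  -- Congruence modulo M.

  infix 4 _≈_ _≈?_

  record _≈_ (x y : ℤ) : Set where
    constructor by
    field
      multiple : ℤ
      equality : x ≡ y + multiple * M

  ≈-refl : ∀ {x} → x ≈ x
  ≈-refl {x} = by 0ℤ (sym (ℤₚ.+-identityʳ x))

  ≡⇒≈ : ∀ {x y} → x ≡ y → x ≈ y
  ≡⇒≈ refl = ≈-refl

  ≈-substʳ : ∀ {x y y′} → y ≡ y′ → x ≈ y → x ≈ y′
  ≈-substʳ refl p = p

  ≈-substˡ : ∀ {x x′ y} → x ≡ x′ → x ≈ y → x′ ≈ y
  ≈-substˡ refl p = p

  ≈-sym : ∀ {x y} → x ≈ y → y ≈ x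
  ≈-sym {x} {y} (by k refl) = by (- k) (back y k M)
    where
    back : ∀ y k m → y ≡ y + k * m + (- k) * m
    back = solve-∀

  ≈-trans : ∀ {x y z} → x ≈ y → y ≈ z → x ≈ z
  ≈-trans {z = z} (by k refl) (by l refl) = by (l + k) (join z k l M)
    where
    join : ∀ z k l m → z + l * m + k * m ≡ z + (l + k) * m
    join = solve-∀

  ≈-neg : ∀ {x y} → x ≈ y → - x ≈ - y
  ≈-neg {y = y} (by k refl) = by (- k) (dist y k M)
    where
    dist : ∀ y k m → - (y + k * m) ≡ - y + (- k) * m
    dist = solve-∀

  ≈-+ : ∀ c {x y} → x ≈ y → x + c ≈ y + c
  ≈-+ c {y = y} (by k refl) = by k (comm y c k M)
    where
    comm : ∀ y c k m → y + k * m + c ≡ y + c + k * m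
    comm = solve-∀

  ≈-shift : ∀ k x → x + k * M ≈ x
  ≈-shift k x = by k refl

  ≈-by : ∀ k {x y y′} → x ≈ y → y ≡ y′ + k * M → x ≈ y′
  ≈-by k p refl = ≈-trans p (≈-shift k _)

  negative-multiple : ∀ j → -[1+ j ] * M ≤ - M
  negative-multiple j = subst (-[1+ j ] * M ≤_) (ℤₚ.-1*i≡-i M) (ℤₚ.*-monoʳ-≤-nonNeg M { -[1+ j ]} { -[1+ 0 ]}
      (-≤- z≤n))

  -- A negative multiple of M is at most - M, and the bound y - M < x leaves no room for it.
  ≈-≤ : ∀ {x y} → x ≈ y → y - M < x → y ≤ x
  ≈-≤ {y = y} (by (+ k) refl) _ = lia 2 (λ y p → # 0 :≤ p ⇒ ⊢ y :≤ y :+ p) y (+ k * M)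
    (subst (0ℤ ≤_) (ℤₚ.pos-* k (N n)) (+≤+ z≤n))
  ≈-≤ {y = y} (by -[1+ k ] refl) lt =
    lia 3 (λ y p m → p :≤ :- m ⇒ y :- m :< y :+ p ⇒ ⊢ y :≤ y :+ p) y (-[1+ k ] * M) M (negative-multiple k) lt

  ≈-≡ : ∀ {x y} → x ≈ y → y - M < x → x < y + M → x ≡ y
  ≈-≡ {x} {y} p lo hi = ℤₚ.≤-antisym
    (≈-≤ (≈-sym p) (lia 3 (λ x y m → x :< y :+ m ⇒ ⊢ x :- m :< y) x y M hi)) (≈-≤ p lo)

  ≈-next : ∀ {x y} → x ≈ y → y < x → y + M ≤ x
  ≈-next {x} {y} p lt = ≈-≤ (≈-by (ℤ.- + 1) p (up y M))
    (lia 3 (λ x y m → y :< x ⇒ ⊢ y :+ m :- m :< x) x y M lt)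
    where
    up : ∀ y m → y ≡ y + m + (- + 1) * m
    up = solve-∀

  ∣⇒≈0 : ∀ {x} → M ∣ x → x ≈ 0ℤ
  ∣⇒≈0 (divides q eq) = by q (trans eq (sym (ℤₚ.+-identityˡ _)))

  ≈0⇒∣ : ∀ {x} → x ≈ 0ℤ → M ∣ x
  ≈0⇒∣ (by q eq) = divides q (trans eq (ℤₚ.+-identityˡ _))

  _≈?_ : ∀ x y → Dec (x ≈ y)
  x ≈? y = map′ (λ { (divides q eq) → by q (to q eq) }) (λ { (by k eq) → divides k (from k eq) }) (M ∣? x - y)
    where
    to : ∀ q → x - y ≡ q * M → x ≡ y + q * M
    to q eq = lia 3 (λ x y p → x :- y :≡ p ⇒ ⊢ x :≡ y :+ p) x y (q * M) eq
    from : ∀ q → x ≡ y + q * M → x - y ≡ q * M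
    from q eq = lia 3 (λ x y p → x :≡ y :+ p ⇒ ⊢ x :- y :≡ p) x y (q * M) eq

  0<M : 0ℤ < M
  0<M = ℤ.+<+ (s≤s z≤n)

  between⇒≉0 : ∀ {x} → 0ℤ < x → x < M → ¬ x ≈ 0ℤ
  between⇒≉0 {x} lo hi p = lia 1 (λ x → # 0 :< x ⇒ x :≡ # 0 ⇒ ⊢⊥) x lo
    (≈-≡ p (lia 2 (λ x m → # 0 :< x ⇒ # 0 :< m ⇒ ⊢ # 0 :- m :< x) x M lo 0<M)
           (lia 2 (λ x m → x :< m ⇒ ⊢ x :< # 0 :+ m) x M hi))

  -- Reflections on labels.

  -- A mirrored periodic map that exchanges x and y sends x to y and - y to - x. Both classes move
  -- by + (y - x) and form `Up`; the classes of their images form `Down`.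
  Up Down : ℤ → ℤ → ℤ → Set
  Up   x y z = z ≈ x ⊎ z ≈ - y
  Down x y z = z ≈ y ⊎ z ≈ - x

  data Moves (g : ℤ → ℤ) (x y z : ℤ) : Set where
    up    : Up x y z → g z ≡ z + (y - x) → Moves g x y z
    down  : Down x y z → g z ≡ z - (y - x) → Moves g x y z
    fixed : ¬ Up x y z → ¬ Down x y z → g z ≡ z → Moves g x y z

  -- g exchanges the classes of x and y, and those of - x and - y.
  record Reflection (g : ℤ → ℤ) (x y : ℤ) : Set where
    field
      move     : ∀ z → Moves g x y z
      disjoint : ∀ {z} → Up x y z → ¬ Down x y z

    up-eq : ∀ {z} → Up x y z → g z ≡ z + (y - x)
    up-eq {z} u with move z
    ... | up _ eq      = eq
    ... | down d _     = contradiction d (disjoint u)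
    ... | fixed ¬u _ _ = contradiction u ¬u

    down-eq : ∀ {z} → Down x y z → g z ≡ z - (y - x)
    down-eq {z} d with move z
    ... | up u _       = contradiction d (disjoint u)
    ... | down _ eq    = eq
    ... | fixed _ ¬d _ = contradiction d ¬d

    fixed-eq : ∀ {z} → ¬ Up x y z → ¬ Down x y z → g z ≡ z
    fixed-eq {z} ¬u ¬d with move z
    ... | up u _       = contradiction u ¬u
    ... | down d _     = contradiction d ¬d
    ... | fixed _ _ eq = eq

  record Involution (g : ℤ → ℤ) : Set where
    field
      shift      : ∀ k z → g (z + k * M) ≡ g z + k * M
      neg        : ∀ z → g (- z) ≡ - g z
      involutive : ∀ z → g (g z) ≡ z

    ≈-image : ∀ {a b} → a ≈ b → g a ≈ g b
    ≈-image {b = b} (by k refl) = by k (shift k b)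

    ≈-transfer : ∀ {a b} → g a ≈ b → a ≈ g b
    ≈-transfer {a} p = ≈-substˡ (involutive a) (≈-image p)

  Up-≈ : ∀ {x y z z′} → z ≈ z′ → Up x y z → Up x y z′
  Up-≈ p (inj₁ q) = inj₁ (≈-trans (≈-sym p) q)
  Up-≈ p (inj₂ q) = inj₂ (≈-trans (≈-sym p) q)

  Down-≈ : ∀ {x y z z′} → z ≈ z′ → Down x y z → Down x y z′
  Down-≈ p (inj₁ q) = inj₁ (≈-trans (≈-sym p) q)
  Down-≈ p (inj₂ q) = inj₂ (≈-trans (≈-sym p) q)

  ≈-neg′ : ∀ {a b} → a ≈ - b → - a ≈ b
  ≈-neg′ p = ≈-substʳ (ℤₚ.neg-involutive _) (≈-neg p)

  ≈-neg″ : ∀ {a b} → - a ≈ b → a ≈ - b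
  ≈-neg″ {a} p = ≈-substˡ (ℤₚ.neg-involutive a) (≈-neg p)

  Up-neg : ∀ {x y z} → Up x y z → Down x y (- z)
  Up-neg (inj₁ p) = inj₂ (≈-neg p)
  Up-neg (inj₂ p) = inj₁ (≈-neg′ p)

  Down-neg : ∀ {x y z} → Down x y z → Up x y (- z)
  Down-neg (inj₁ p) = inj₂ (≈-neg p)
  Down-neg (inj₂ p) = inj₁ (≈-neg′ p)

  Up-neg⁻ : ∀ {x y z} → Up x y (- z) → Down x y z
  Up-neg⁻ {z = z} u = subst (Down _ _) (ℤₚ.neg-involutive z) (Up-neg u)

  Down-neg⁻ : ∀ {x y z} → Down x y (- z) → Up x y z
  Down-neg⁻ {z = z} d = subst (Up _ _) (ℤₚ.neg-involutive z) (Down-neg d)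

  Up-+ : ∀ {x y z} → Up x y z → Down x y (z + (y - x))
  Up-+ {x} {y} (inj₁ p) = inj₁ (≈-substʳ (lia 2 (λ x y → ⊢ x :+ (y :- x) :≡ y) x y) (≈-+ (y - x) p))
  Up-+ {x} {y} (inj₂ p) = inj₂ (≈-substʳ (lia 2 (λ x y → ⊢ :- y :+ (y :- x) :≡ :- x) x y) (≈-+ (y - x) p))

  Down-− : ∀ {x y z} → Down x y z → Up x y (z - (y - x))
  Down-− {x} {y} (inj₁ p) = inj₁ (≈-substʳ (lia 2 (λ x y → ⊢ y :+ :- (y :- x) :≡ x) x y) (≈-+ (- (y - x)) p))
  Down-− {x} {y} (inj₂ p) = inj₂ (≈-substʳ (lia 2 (λ x y → ⊢ :- x :+ :- (y :- x) :≡ :- y) x y) (≈-+ (- (y - x)) p))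

  module _ {g x y} (r : Reflection g x y) where
    open Reflection r

    -- `Up` and `Down` are unions of classes, and they are exchanged by negation and by the move
    -- itself; each law compares two instances of `move`.
    reflection-involution : Involution g
    reflection-involution = record { shift = shift′ ; neg = neg′ ; involutive = inv′ }
      where
      shift′ : ∀ k z → g (z + k * M) ≡ g z + k * M
      shift′ k z with move z
      ... | up u eq = trans (up-eq (Up-≈ (≈-sym (≈-shift k z)) u))
                       (lia 4 (λ w z p d → w :≡ z :+ d ⇒ ⊢ z :+ p :+ d :≡ w :+ p) (g z) z (k * M) (y - x) eq)
      ... | down u eq = trans (down-eq (Down-≈ (≈-sym (≈-shift k z)) u))
                         (lia 4 (λ w z p d → w :≡ z :- d ⇒ ⊢ z :+ p :- d :≡ w :+ p) (g z) z (k * M) (y - x) eq)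
      ... | fixed ¬u ¬d eq = trans (fixed-eq (¬u ∘ Up-≈ (≈-shift k z)) (¬d ∘ Down-≈ (≈-shift k z)))
                              (cong (_+ k * M) (sym eq))
      neg′ : ∀ z → g (- z) ≡ - g z
      neg′ z with move z
      ... | up u eq = trans (down-eq (Up-neg u))
                       (lia 3 (λ w z d → w :≡ z :+ d ⇒ ⊢ :- z :- d :≡ :- w) (g z) z (y - x) eq)
      ... | down u eq = trans (up-eq (Down-neg u))
                         (lia 3 (λ w z d → w :≡ z :- d ⇒ ⊢ :- z :+ d :≡ :- w) (g z) z (y - x) eq)
      ... | fixed ¬u ¬d eq = trans (fixed-eq (¬d ∘ Up-neg⁻) (¬u ∘ Down-neg⁻)) (cong -_ (sym eq))
      inv′ : ∀ z → g (g z) ≡ z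
      inv′ z with move z
      ... | up u eq = trans (cong g eq) (trans (down-eq (Up-+ u)) (lia 2 (λ z d → ⊢ z :+ d :- d :≡ z) z (y - x)))
      ... | down u eq = trans (cong g eq) (trans (up-eq (Down-− u)) (lia 2 (λ z d → ⊢ z :- d :+ d :≡ z) z (y - x)))
      ... | fixed _ _ eq = trans (cong g eq) eq

  reflection-unique : ∀ {g h x y} → Reflection g x y → Reflection h x y → ∀ z → g z ≡ h z
  reflection-unique r s z with Reflection.move r z
  ... | up u eq        = trans eq (sym (Reflection.up-eq s u))
  ... | down d eq      = trans eq (sym (Reflection.down-eq s d))
  ... | fixed ¬u ¬d eq = trans eq (sym (Reflection.fixed-eq s ¬u ¬d))

  -- An involution that commutes with shifts and negation carries the classes of x and y to those of
  -- g x and g y. This transports ρ past a letter in `exchange`.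
  conjugate : ∀ {g ρ x y} → Involution g → Reflection ρ x y → Reflection (g ∘ ρ ∘ g) (g x) (g y)
  conjugate {g} {ρ} {x} {y} i r = record { move = move′ ; disjoint = λ u d → disjoint (Up⇐ u) (Down⇐ d) }
    where
    open Reflection r
    open Involution i
    flip≈ : ∀ {a z} → z ≈ - g a → g z ≈ - a
    flip≈ {a} p = ≈-sym (≈-transfer (≈-sym (≈-substʳ (sym (neg a)) p)))
    flip≈′ : ∀ {a z} → g z ≈ - a → z ≈ - g a
    flip≈′ {a} p = ≈-substʳ (neg a) (≈-transfer p)
    Up⇐ : ∀ {z} → Up (g x) (g y) z → Up x y (g z)
    Up⇐ (inj₁ p) = inj₁ (≈-sym (≈-transfer (≈-sym p)))
    Up⇐ (inj₂ p) = inj₂ (flip≈ p)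
    Down⇐ : ∀ {z} → Down (g x) (g y) z → Down x y (g z)
    Down⇐ (inj₁ p) = inj₁ (≈-sym (≈-transfer (≈-sym p)))
    Down⇐ (inj₂ p) = inj₂ (flip≈ p)
    Up⇒ : ∀ {z} → Up x y (g z) → Up (g x) (g y) z
    Up⇒ (inj₁ p) = inj₁ (≈-transfer p)
    Up⇒ (inj₂ p) = inj₂ (flip≈′ p)
    Down⇒ : ∀ {z} → Down x y (g z) → Down (g x) (g y) z
    Down⇒ (inj₁ p) = inj₁ (≈-transfer p)
    Down⇒ (inj₂ p) = inj₂ (flip≈′ p)
    image : ∀ {a c d z} k → g z ≡ a + k * M → ρ (g z) ≡ g z + d → a + d ≡ c → g (ρ (g z)) ≡ z + (g c - g a)
    image {a} {c} {d} {z} k eq ρeq refl = begin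
      g (ρ (g z))          ≡⟨ cong g (trans ρeq (trans (cong (_+ d) eq) (swap a (k * M) d))) ⟩
      g (a + d + k * M)    ≡⟨ shift k (a + d) ⟩
      g (a + d) + k * M    ≡⟨ lia 4 (λ z p q m → z :≡ p :+ m ⇒ ⊢ q :+ m :≡ z :+ (q :- p)) z (g a) (g (a + d)) (k * M)
                                (trans (sym (involutive z)) (trans (cong g eq) (shift k a))) ⟩
      z + (g (a + d) - g a) ∎
      where
      open ≡-Reasoning
      swap : ∀ a m d → a + m + d ≡ a + d + m
      swap = solve-∀
    move′ : ∀ z → Moves (g ∘ ρ ∘ g) (g x) (g y) z
    move′ z with move (g z)
    ... | up u@(inj₁ (by k eq)) e = up (Up⇒ u) (image k eq e (lia 2 (λ x y → ⊢ x :+ (y :- x) :≡ y) x y))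
    ... | up u@(inj₂ (by k eq)) e = up (Up⇒ u) (trans
            (image k eq e (lia 2 (λ x y → ⊢ :- y :+ (y :- x) :≡ :- x) x y))
            (lia 5 (λ z p q x y → p :≡ :- x ⇒ q :≡ :- y ⇒ ⊢ z :+ (p :- q) :≡ z :+ (y :- x))
               z (g (- x)) (g (- y)) (g x) (g y) (neg x) (neg y)))
    ... | down u@(inj₁ (by k eq)) e = down (Down⇒ u) (trans
            (image k eq e (lia 2 (λ x y → ⊢ y :+ :- (y :- x) :≡ x) x y))
            (lia 3 (λ z x y → ⊢ z :+ (x :- y) :≡ z :- (y :- x)) z (g x) (g y)))
    ... | down u@(inj₂ (by k eq)) e = down (Down⇒ u) (trans
            (image k eq e (lia 2 (λ x y → ⊢ :- x :+ :- (y :- x) :≡ :- y) x y))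
            (lia 5 (λ z p q x y → p :≡ :- x ⇒ q :≡ :- y ⇒ ⊢ z :+ (q :- p) :≡ z :- (y :- x))
               z (g (- x)) (g (- y)) (g x) (g y) (neg x) (neg y)))
    ... | fixed ¬u ¬d e = fixed (¬u ∘ Up⇐) (¬d ∘ Down⇐) (trans (cong g e) (involutive z))

  -- The pairs (x , y) and (- y , - x) and their translates by multiples of M name the same
  -- reflection, so any raised label may serve as its first point.
  rebase : ∀ {g x y p} → Reflection g x y → Up x y p → Reflection g p (p + (y - x))
  rebase {g} {x} {y} {p} r u = record { move = move′ ; disjoint = λ a b → disjoint (Up⇐ u a) (Down⇐ u b) }
    where
    open Reflection r
    δ≡ : ∀ a → a + (y - x) - a ≡ y - x
    δ≡ a = lia 2 (λ a d → ⊢ a :+ d :- a :≡ d) a (y - x)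
    q = p + (y - x)
    q≈ : p ≈ x → q ≈ y
    q≈ e = ≈-substʳ (lia 2 (λ x y → ⊢ x :+ (y :- x) :≡ y) x y) (≈-+ (y - x) e)
    q≈′ : p ≈ - y → q ≈ - x
    q≈′ e = ≈-substʳ (lia 2 (λ x y → ⊢ :- y :+ (y :- x) :≡ :- x) x y) (≈-+ (y - x) e)
    Up⇐ : ∀ {z} → Up x y p → Up p q z → Up x y z
    Up⇐ (inj₁ e) (inj₁ f) = inj₁ (≈-trans f e)
    Up⇐ (inj₁ e) (inj₂ f) = inj₂ (≈-trans f (≈-neg (q≈ e)))
    Up⇐ (inj₂ e) (inj₁ f) = inj₂ (≈-trans f e)
    Up⇐ (inj₂ e) (inj₂ f) = inj₁ (≈-trans f (≈-neg′ (q≈′ e)))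
    Down⇐ : ∀ {z} → Up x y p → Down p q z → Down x y z
    Down⇐ (inj₁ e) (inj₁ f) = inj₁ (≈-trans f (q≈ e))
    Down⇐ (inj₁ e) (inj₂ f) = inj₂ (≈-trans f (≈-neg e))
    Down⇐ (inj₂ e) (inj₁ f) = inj₂ (≈-trans f (q≈′ e))
    Down⇐ (inj₂ e) (inj₂ f) = inj₁ (≈-trans f (≈-neg′ e))
    Up⇒ : ∀ {z} → Up x y p → Up x y z → Up p q z
    Up⇒ (inj₁ e) (inj₁ f) = inj₁ (≈-trans f (≈-sym e))
    Up⇒ (inj₁ e) (inj₂ f) = inj₂ (≈-trans f (≈-neg (≈-sym (q≈ e))))
    Up⇒ (inj₂ e) (inj₁ f) = inj₂ (≈-trans f (≈-sym (≈-neg′ (q≈′ e))))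
    Up⇒ (inj₂ e) (inj₂ f) = inj₁ (≈-trans f (≈-sym e))
    Down⇒ : ∀ {z} → Up x y p → Down x y z → Down p q z
    Down⇒ (inj₁ e) (inj₁ f) = inj₁ (≈-trans f (≈-sym (q≈ e)))
    Down⇒ (inj₁ e) (inj₂ f) = inj₂ (≈-trans f (≈-neg (≈-sym e)))
    Down⇒ (inj₂ e) (inj₁ f) = inj₂ (≈-trans f (≈-sym (≈-neg′ e)))
    Down⇒ (inj₂ e) (inj₂ f) = inj₁ (≈-trans f (≈-sym (q≈′ e)))
    move′ : ∀ z → Moves g p q z
    move′ z with move z
    ... | up v e       = up (Up⇒ u v) (trans e (cong (λ d → z + d) (sym (δ≡ p))))
    ... | down v e     = down (Down⇒ u v) (trans e (cong (λ d → z - d) (sym (δ≡ p))))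
    ... | fixed ¬u ¬d e = fixed (¬u ∘ Up⇐ u) (¬d ∘ Down⇐ u) e

  -- Evaluation of `extend`.

  true-of : ∀ {b} → T b → b ≡ true
  true-of {true} _ = refl

  false-of : ∀ {b} → ¬ T b → b ≡ false
  false-of {false} _ = refl
  false-of {true}  h = contradiction tt h

  ≡ᵇ-true : ∀ {i j} → i ≡ j → (i ≡ᵇ j) ≡ true
  ≡ᵇ-true {i} {j} eq = true-of (ℕₚ.≡⇒≡ᵇ i j eq)

  ≡ᵇ-false : ∀ {i j} → i ≢ j → (i ≡ᵇ j) ≡ false
  ≡ᵇ-false {i} {j} neq = false-of (neq ∘ ℕₚ.≡ᵇ⇒≡ i j)

  ≤ᵇ-true : ∀ {i j} → i ℕ.≤ j → (i ≤ᵇ j) ≡ true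
  ≤ᵇ-true le = true-of (ℕₚ.≤⇒≤ᵇ le)

  ≤ᵇ-false : ∀ {i j} → j ℕ.< i → (i ≤ᵇ j) ≡ false
  ≤ᵇ-false {i} {j} lt = false-of (ℕₚ.<⇒≱ lt ∘ ℕₚ.≤ᵇ⇒≤ i j)

  remainder-unique : ∀ d .{{_ : ℕ.NonZero d}} r q → r ℕ.< d → (+ r + q * + d) %ℕ d ≡ r
  remainder-unique d r q r<d = ℤₚ.+-injective (sym eq)
    where
    z = + r + q * + d
    same : + r + q * + d ≡ + (z %ℕ d) + (z /ℕ d) * + d
    same = a≡a%ℕn+[a/ℕn]*n z d
    k = z /ℕ d - q
    same′ : + r ≡ + (z %ℕ d) + k * + d
    same′ = trans (lia 4 (λ r p s t → r :+ p :≡ s :+ t ⇒ ⊢ r :≡ s :+ (t :- p)) (+ r) (q * + d) (+ (z %ℕ d))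
        ((z /ℕ d) * + d) same)
                  (cong (λ e → + (z %ℕ d) + e) (factor (z /ℕ d) q (+ d)))
      where
      factor : ∀ a b c → a * c - b * c ≡ (a - b) * c
      factor = solve-∀
    eq : + r ≡ + (z %ℕ d)
    eq = go k same′
      where
      s = z %ℕ d
      go : ∀ k → + r ≡ + s + k * + d → + r ≡ + s
      go (+ zero) e = trans e (ℤₚ.+-identityʳ (+ s))
      go (+ suc k) e = ⊥-elim (lia 4 (λ r s d p → r :≡ s :+ (d :+ p) ⇒ r :< d ⇒ # 0 :≤ s ⇒ # 0 :≤ p ⇒ ⊢⊥)
        (+ r) (+ s) (+ d) (+ k * + d) (trans e (cong (λ z → + s + z) (ℤₚ.suc-* (+ k) (+ d)))) (+<+ r<d) (+≤+ z≤n)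
        (subst (0ℤ ≤_) (ℤₚ.pos-* k d) (+≤+ z≤n)))
      go -[1+ k ] e = ⊥-elim (lia 4 (λ r s d p → r :≡ s :+ :- (d :+ p) ⇒ s :< d ⇒ # 0 :≤ r ⇒ # 0 :≤ p ⇒ ⊢⊥)
        (+ r) (+ s) (+ d) (+ k * + d)
        (trans e (cong (λ z → + s + z) (trans (sym (ℤₚ.neg-distribˡ-* (+ suc k) (+ d)))
            (cong -_ (ℤₚ.suc-* (+ k) (+ d))))))
        (+<+ (n%ℕd<d z d)) (+≤+ z≤n)
        (subst (0ℤ ≤_) (ℤₚ.pos-* k d) (+≤+ z≤n)))

  quotient-unique : ∀ d .{{_ : ℕ.NonZero d}} r q → r ℕ.< d → (+ r + q * + d) /ℕ d ≡ q
  quotient-unique d@(suc _) r q r<d = sym (ℤₚ.*-cancelʳ-≡ q ((+ r + q * + d) /ℕ d) (+ d)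
    (lia 3 (λ r p t → r :+ p :≡ r :+ t ⇒ ⊢ p :≡ t) (+ r) (q * + d) _
      (trans (a≡a%ℕn+[a/ℕn]*n (+ r + q * + d) d)
        (cong (λ m → + m + ((+ r + q * + d) /ℕ d) * + d) (remainder-unique d r q r<d)))))

  module _ (f : ℕ → ℤ) where

    -- Restates the function `base` that is local to `extend`; the two agree by computation.
    residueImage : ℕ → ℤ
    residueImage r = if r ≡ᵇ 0 then 0ℤ else if r ≤ᵇ n then f r else + N n - f (N n ∸ r)

    extend-value : ∀ r q → r ℕ.< N n → extend n f (+ r + q * M) ≡ residueImage r + q * M
    extend-value r q r< = cong₂ (λ r q → residueImage r + q * M)
      (remainder-unique (N n) r q r<) (quotient-unique (N n) r q r<)

    residueImage-large : ∀ r → n ℕ.< r → residueImage r ≡ M - f (N n ∸ r)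
    residueImage-large r@(suc _) n<r = cong (if_then f r else + N n - f (N n ∸ r)) (≤ᵇ-false {r} n<r)

    n<N : n ℕ.< N n
    n<N = s≤s (ℕₚ.m≤m+n n _)

    extend-pos : ∀ k q → 1 ℕ.≤ k → k ℕ.≤ n → extend n f (+ k + q * M) ≡ f k + q * M
    extend-pos k@(suc _) q _ k≤ = trans (extend-value k q (ℕₚ.≤-<-trans k≤ n<N))
      (cong (λ b → (if b then f k else + N n - f (N n ∸ k)) + q * M) (≤ᵇ-true k≤))

    extend-zero : ∀ q → extend n f (0ℤ + q * M) ≡ 0ℤ + q * M
    extend-zero q = extend-value 0 q (s≤s z≤n)

    extend-neg : ∀ k q → 1 ℕ.≤ k → k ℕ.≤ n → extend n f (- + k + q * M) ≡ - f k + q * M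
    extend-neg k q 1≤k k≤ = begin
      extend n f (- + k + q * M)           ≡⟨ cong (extend n f) rep ⟩
      extend n f (+ r + (q - + 1) * M)     ≡⟨ extend-value r (q - + 1) r<N ⟩
      residueImage r + (q - + 1) * M       ≡⟨ cong (λ z → z + (q - + 1) * M) value ⟩
      M - f k + (q - + 1) * M              ≡⟨ collect M (f k) q ⟩
      - f k + q * M                        ∎
      where
      open ≡-Reasoning
      k≤N = ℕₚ.≤-trans k≤ (ℕₚ.<⇒≤ n<N)
      r = N n ∸ k
      r<N : r ℕ.< N n
      r<N = ℕₚ.∸-monoʳ-< {N n} 1≤k k≤N
      +r : + r ≡ M - + k
      +r = trans (sym (ℤₚ.⊖-≥ k≤N)) (sym (ℤₚ.m-n≡m⊖n (N n) k))
      collect : ∀ m a q → m - a + (q - + 1) * m ≡ - a + q * m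
      collect = solve-∀
      -- Division wants a nonnegative remainder, hence N - k with one N borrowed from the quotient.
      rep : - + k + q * M ≡ + r + (q - + 1) * M
      rep = trans (expand (+ k) q M) (cong (λ z → z + (q - + 1) * M) (sym +r))
        where
        expand : ∀ k q m → - k + q * m ≡ m - k + (q - + 1) * m
        expand = solve-∀
      n<r : n ℕ.< r
      n<r = ℤₚ.drop‿+<+ (subst (ν <_) (sym +r)
        (lia 3 (λ v m k → m :≡ # 1 :+ 2 :* v ⇒ k :≤ v ⇒ ⊢ v :< m :- k) ν M (+ k) M≡ (+≤+ k≤)))
      value : residueImage r ≡ M - f k
      value = trans (residueImage-large r n<r) (cong (λ z → M - f z) (ℕₚ.m∸[m∸n]≡n k≤N))

  ≈-window : ∀ {x y} → x ≈ y → 0ℤ ≤ x → x < M → 0ℤ ≤ y → y < M → x ≡ y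
  ≈-window {x} {y} p a b c d = ≈-≡ p
    (lia 3 (λ x y m → # 0 :≤ x ⇒ y :< m ⇒ ⊢ y :- m :< x) x y M a d)
    (lia 3 (λ x y m → x :< m ⇒ # 0 :≤ y ⇒ ⊢ x :< y :+ m) x y M b c)

  ≉-opposite : ∀ {x y} → 0ℤ < x + y → x + y < M → ¬ x ≈ - y
  ≉-opposite {x} {y} lo hi p = between⇒≉0 lo hi (≈-substʳ (ℤₚ.+-inverseˡ y) (≈-+ y p))

  -- Representatives 0, k and - k with 1 ≤ k ≤ n instead of 0, ..., 2n: they fit the symmetry w(-i)
  -- = -w(i).
  data SmallResidue (z : ℤ) : Set where
    zeroʳ : ∀ q → z ≡ 0ℤ + q * M → SmallResidue z
    posʳ  : ∀ k q → 1 ℕ.≤ k → k ℕ.≤ n → z ≡ + k + q * M → SmallResidue z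
    negʳ  : ∀ k q → 1 ℕ.≤ k → k ℕ.≤ n → z ≡ - + k + q * M → SmallResidue z

  smallResidue : ∀ z → SmallResidue z
  smallResidue z = go (z %ℕ N n) (n%ℕd<d z (N n)) (z /ℕ N n) (a≡a%ℕn+[a/ℕn]*n z (N n))
    where
    expand : ∀ r q m → r + q * m ≡ - (m - r) + (q + + 1) * m
    expand = solve-∀
    go : ∀ r → r ℕ.< N n → ∀ q → z ≡ + r + q * M → SmallResidue z
    go zero      r<N q e = zeroʳ q e
    go r@(suc _) r<N q e with r ℕₚ.≤? n
    ... | yes r≤n = posʳ r q (s≤s z≤n) r≤n e
    ... | no r≰n  = negʳ (N n ∸ r) (q + + 1) (ℕₚ.m<n⇒0<n∸m r<N) k≤n
                      (trans e (trans (expand (+ r) q M) (cong (λ y → - y + (q + + 1) * M) (sym +k))))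
      where
      +k : + (N n ∸ r) ≡ M - + r
      +k = trans (sym (ℤₚ.⊖-≥ (ℕₚ.<⇒≤ r<N))) (sym (ℤₚ.m-n≡m⊖n (N n) r))
      k≤n : N n ∸ r ℕ.≤ n
      k≤n = ℤₚ.drop‿+≤+ (subst (_≤ ν) (sym +k)
        (lia 3 (λ v m r → m :≡ # 1 :+ 2 :* v ⇒ v :< r ⇒ ⊢ m :- r :≤ v) ν M (+ r) M≡ (+<+ (ℕₚ.≰⇒> r≰n))))

  -- The images of 1, ..., n suffice: shifts preserve the moved classes, negation exchanges raised
  -- and lowered ones, and multiples of M are fixed because neither x nor y is one.
  reflection-fromImages : ∀ (f : ℕ → ℤ) {x y} → ¬ x ≈ 0ℤ → ¬ y ≈ 0ℤ →
    (∀ {z} → Up x y z → ¬ Down x y z) →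
    (∀ k → 1 ℕ.≤ k → k ℕ.≤ n → Moves (λ _ → f k) x y (+ k)) →
    Reflection (extend n f) x y
  reflection-fromImages f {x} {y} x≉0 y≉0 disj images = record { move = move′ ; disjoint = disj }
    where
    ≉-neg : ∀ {z} → ¬ z ≈ 0ℤ → ¬ 0ℤ ≈ - z
    ≉-neg z≉0 p = z≉0 (≈-sym (≈-neg′ p))
    move′ : ∀ z → Moves (extend n f) x y z
    move′ z with smallResidue z
    ... | zeroʳ q refl = fixed
      (λ { (inj₁ p) → x≉0 (≈-sym (≈-trans z≈ p)) ; (inj₂ p) → ≉-neg y≉0 (≈-trans z≈ p) })
      (λ { (inj₁ p) → y≉0 (≈-sym (≈-trans z≈ p)) ; (inj₂ p) → ≉-neg x≉0 (≈-trans z≈ p) })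
      (extend-zero f q)
      where z≈ = ≈-sym (≈-shift q 0ℤ)
    ... | posʳ k q 1≤k k≤n refl with images k 1≤k k≤n
    ...   | up u e = up (Up-≈ (≈-sym (≈-shift q (+ k))) u) (trans (extend-pos f k q 1≤k k≤n)
              (lia 4 (λ a z d p → a :≡ z :+ d ⇒ ⊢ a :+ p :≡ z :+ p :+ d) (f k) (+ k) (y - x) (q * M) e))
    ...   | down u e = down (Down-≈ (≈-sym (≈-shift q (+ k))) u) (trans (extend-pos f k q 1≤k k≤n)
              (lia 4 (λ a z d p → a :≡ z :- d ⇒ ⊢ a :+ p :≡ z :+ p :- d) (f k) (+ k) (y - x) (q * M) e))
    ...   | fixed ¬u ¬d e = fixed (¬u ∘ Up-≈ (≈-shift q (+ k))) (¬d ∘ Down-≈ (≈-shift q (+ k)))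
              (trans (extend-pos f k q 1≤k k≤n) (cong (λ a → a + q * M) e))
    move′ z | negʳ k q 1≤k k≤n refl with images k 1≤k k≤n
    ...   | up u e = down (Down-≈ (≈-sym (≈-shift q (- + k))) (Up-neg u)) (trans (extend-neg f k q 1≤k k≤n)
              (lia 4 (λ a z d p → a :≡ z :+ d ⇒ ⊢ :- a :+ p :≡ :- z :+ p :- d) (f k) (+ k) (y - x) (q * M) e))
    ...   | down u e = up (Up-≈ (≈-sym (≈-shift q (- + k))) (Down-neg u)) (trans (extend-neg f k q 1≤k k≤n)
              (lia 4 (λ a z d p → a :≡ z :- d ⇒ ⊢ :- a :+ p :≡ :- z :+ p :+ d) (f k) (+ k) (y - x) (q * M) e))
    ...   | fixed ¬u ¬d e = fixed (¬d ∘ Up-neg⁻ ∘ Up-≈ (≈-shift q (- + k)))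
        (¬u ∘ Down-neg⁻ ∘ Down-≈ (≈-shift q (- + k)))
              (trans (extend-neg f k q 1≤k k≤n) (cong (λ a → - a + q * M) e))

  -- The generators as simple reflections.

  -- Two labels with such a sum are exchanged by a reflection of the group of
  -- all mirrored permutations, but by none of W̃.
  data Excluded (s : ℤ) : Set where
    evenSum : left ty ≡ D → ∀ k → s ≡ (k + k) * M → Excluded s
    oddSum  : right ty ≡ D → ∀ k → s ≡ (k + k + + 1) * M → Excluded s

  -- `inside` says that no fixed label except a multiple of M lies between a raised label and its
  -- image; `close` says that a raised and a lowered label whose order is reversed are images of
  -- each other or have an excluded sum. Together they make the generator reverse, among roots, only
  -- pairs that it exchanges. The bound 3 is attained by s₀ᴰ.
  record Simple (g : ℤ → ℤ) (x y : ℤ) : Set where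
    field
      reflection : Reflection g x y
      x<y        : x < y
      y-x≤3      : y - x ≤ + 3
      close      : ∀ {p q} → Up x y p → Down x y q → p < q → q < p + (y - x) + (y - x) →
                   q ≡ p + (y - x) ⊎ Excluded (p + q)
      inside     : ∀ {p z} → Up x y p → p < z → z < p + (y - x) → Up x y z ⊎ Down x y z ⊎ z ≈ 0ℤ
      root       : ¬ Excluded (x + y)

  Excluded⇒≈0 : ∀ {s} → Excluded s → s ≈ 0ℤ
  Excluded⇒≈0 (evenSum _ k eq) = by (k + k) (trans eq (sym (ℤₚ.+-identityˡ _)))
  Excluded⇒≈0 (oddSum _ k eq)  = by (k + k + + 1) (trans eq (sym (ℤₚ.+-identityˡ _)))

  odd≢even : ∀ k l → k + k + + 1 ≢ l + l
  odd≢even k l eq with k ℤₚ.<? l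
  ... | yes k<l = lia 2 (λ k l → k :+ k :+ # 1 :≡ l :+ l ⇒ k :< l ⇒ ⊢⊥) k l eq k<l
  ... | no k≮l  = lia 2 (λ k l → k :+ k :+ # 1 :≡ l :+ l ⇒ l :≤ k ⇒ ⊢⊥) k l eq (ℤₚ.≮⇒≥ k≮l)

  odd≢even-multiple : ∀ k l → (k + k + + 1) * M ≢ (l + l) * M
  odd≢even-multiple k l eq = odd≢even k l (ℤₚ.*-cancelʳ-≡ _ _ M eq)

  C≢D : C ≢ D
  C≢D ()

  disjoint-classes : ∀ {x y} → ¬ x ≈ y → ¬ x ≈ - x → ¬ y ≈ - y → ∀ {z} → Up x y z → ¬ Down x y z
  disjoint-classes x≉y x≉-x y≉-y (inj₁ a) (inj₁ b) = x≉y (≈-trans (≈-sym a) b)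
  disjoint-classes x≉y x≉-x y≉-y (inj₁ a) (inj₂ b) = x≉-x (≈-trans (≈-sym a) b)
  disjoint-classes x≉y x≉-x y≉-y (inj₂ a) (inj₁ b) = y≉-y (≈-trans (≈-sym b) a)
  disjoint-classes x≉y x≉-x y≉-y (inj₂ a) (inj₂ b) = x≉y (≈-substʳ (ℤₚ.neg-involutive _)
      (≈-neg″ (≈-sym (≈-trans (≈-sym a) b))))

  difference⇒≉ : ∀ {x y} → x < y → y < x + M → ¬ x ≈ y
  difference⇒≉ {x} {y} lo hi p = ℤₚ.<⇒≢ lo (≈-≡ p
    (lia 3 (λ x y m → y :< x :+ m ⇒ ⊢ y :- m :< x) x y M hi)
    (lia 3 (λ x y m → x :< y ⇒ # 0 :< m ⇒ ⊢ x :< y :+ m) x y M lo 0<M))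

  difference⇒≉′ : ∀ {x y} → x < y → y < x + M → ¬ y ≈ x
  difference⇒≉′ lo hi p = difference⇒≉ lo hi (≈-sym p)

  δ-one : ∀ {x y p q} → y - x ≡ + 1 → p < q → q < p + (y - x) + (y - x) → q ≡ p + (y - x)
  δ-one {x} {y} {p} {q} = lia 4 (λ p q x y → y :- x :≡ # 1 ⇒ p :< q ⇒ q :< p :+ (y :- x) :+ (y :- x) ⇒ ⊢ q :≡ p :+
      (y :- x)) p q x y

  δ-one-inside : ∀ {x y p z} → y - x ≡ + 1 → p < z → z < p + (y - x) → ⊥
  δ-one-inside {x} {y} {p} {z} = lia 4 (λ p z x y → y :- x :≡ # 1 ⇒ p :< z ⇒ z :< p :+ (y :- x) ⇒ ⊢⊥) p z x y

  1≉0 : ¬ + 1 ≈ 0ℤ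
  1≉0 = between⇒≉0 (+<+ (s≤s z≤n)) (lia 2 (λ v m → # 2 :≤ v ⇒ m :≡ # 1 :+ 2 :* v ⇒ ⊢ # 1 :< m) ν M 2≤ν M≡)

  swap-simple : ∀ r → 1 ℕ.≤ r → r ℕ.< n → Simple (extend n (swapImages r)) (+ r) (+ suc r)
  swap-simple r 1≤r r<n = record
    { reflection = reflection-fromImages (swapImages r)
        (between⇒≉0 0<ρ (lia 3 (λ r v m → r :< v ⇒ m :≡ # 1 :+ 2 :* v ⇒ # 0 :< r ⇒ ⊢ r :< m) ρ ν M ρ<ν M≡ 0<ρ))
        (between⇒≉0 (lia 1 (λ r → # 0 :< r ⇒ ⊢ # 0 :< # 1 :+ r) ρ 0<ρ)
            (lia 3 (λ r v m → r :< v ⇒ m :≡ # 1 :+ 2 :* v ⇒ # 0 :< r ⇒ ⊢ # 1 :+ r :< m) ρ ν M ρ<ν M≡ 0<ρ))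
        (disjoint-classes (difference⇒≉ (lia 1 (λ r → ⊢ r :< # 1 :+ r) ρ)
            (lia 3 (λ r v m → # 2 :≤ v ⇒ m :≡ # 1 :+ 2 :* v ⇒ ⊢ # 1 :+ r :< r :+ m) ρ ν M 2≤ν M≡))
          (≉-opposite {ρ} {ρ} (lia 1 (λ r → # 0 :< r ⇒ ⊢ # 0 :< r :+ r) ρ 0<ρ)
              (lia 3 (λ r v m → r :< v ⇒ m :≡ # 1 :+ 2 :* v ⇒ # 0 :< r ⇒ ⊢ r :+ r :< m) ρ ν M ρ<ν M≡ 0<ρ))
          (≉-opposite {+ suc r} {+ suc r} (lia 1 (λ r → # 0 :< r ⇒ ⊢ # 0 :< (# 1 :+ r) :+ (# 1 :+ r)) ρ 0<ρ)
              (lia 3 (λ r v m → r :< v ⇒ m :≡ # 1 :+ 2 :* v ⇒ # 0 :< r ⇒ ⊢ (# 1 :+ r) :+ (# 1 :+ r) :< m) ρ ν M ρ<ν M≡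
              0<ρ)))
        images
    ; x<y    = lia 1 (λ r → ⊢ r :< # 1 :+ r) ρ
    ; y-x≤3  = lia 1 (λ r → ⊢ # 1 :+ r :- r :≤ # 3) ρ
    ; close  = λ {p} {q} _ _ a b → inj₁ (δ-one {ρ} {+ suc r} {p} {q} δ≡1 a b)
    ; inside = λ {p} {z} _ a b → ⊥-elim (δ-one-inside {ρ} {+ suc r} {p} {z} δ≡1 a b)
    ; root   = between⇒≉0 (lia 1 (λ r → # 0 :< r ⇒ ⊢ # 0 :< r :+ (# 1 :+ r)) ρ 0<ρ)
        (lia 3 (λ r v m → r :< v ⇒ m :≡ # 1 :+ 2 :* v ⇒ # 0 :< r ⇒ ⊢ r :+ (# 1 :+ r) :< m) ρ ν M ρ<ν M≡ 0<ρ) ∘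
        Excluded⇒≈0
    }
    where
    ρ = + r
    0<ρ : 0ℤ < ρ
    0<ρ = +<+ 1≤r
    ρ<ν : ρ < ν
    ρ<ν = +<+ r<n
    δ≡1 : + suc r - + r ≡ + 1
    δ≡1 = lia 1 (λ r → ⊢ # 1 :+ r :- r :≡ # 1) ρ
    images : ∀ k → 1 ℕ.≤ k → k ℕ.≤ n → Moves (λ _ → swapImages r k) ρ (+ suc r) (+ k)
    images k 1≤k k≤n with k ℕₚ.≟ r | k ℕₚ.≟ suc r
    ... | yes refl | _ = up (inj₁ ≈-refl) (trans (cong (if_then + suc r else (if r ≡ᵇ suc r then + r else + r))
        (≡ᵇ-true {r} refl))
                           (lia 1 (λ r → ⊢ # 1 :+ r :≡ r :+ (# 1 :+ r :- r)) ρ))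
    ... | no k≢r | yes refl rewrite ≡ᵇ-false k≢r | ≡ᵇ-true {r} refl = down (inj₁ ≈-refl)
        (lia 1 (λ r → ⊢ r :≡ # 1 :+ r :- (# 1 :+ r :- r)) ρ)
    ... | no k≢r | no k≢sr rewrite ≡ᵇ-false k≢r | ≡ᵇ-false k≢sr = fixed
      (λ { (inj₁ p) → k≢r (ℤₚ.+-injective (≈-window p 0≤k k<M (+≤+ z≤n)
          (lia 3 (λ r v m → r :< v ⇒ m :≡ # 1 :+ 2 :* v ⇒ # 0 :< r ⇒ ⊢ r :< m) ρ ν M ρ<ν M≡ 0<ρ)))
         ; (inj₂ p) → ≉-opposite {+ k} {+ suc r} (lia 2 (λ k r → # 0 :≤ k ⇒ # 0 :< r ⇒ ⊢ # 0 :< k :+ (# 1 :+ r)) (+ k)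
             ρ 0≤k 0<ρ)
              (lia 4 (λ k r v m → k :≤ v ⇒ r :< v ⇒ m :≡ # 1 :+ 2 :* v ⇒ ⊢ k :+ (# 1 :+ r) :< m) (+ k) ρ ν M (+≤+ k≤n)
                  ρ<ν M≡) p })
      (λ { (inj₁ p) → k≢sr (ℤₚ.+-injective (≈-window p 0≤k k<M (+≤+ z≤n)
          (lia 3 (λ r v m → r :< v ⇒ m :≡ # 1 :+ 2 :* v ⇒ # 0 :< r ⇒ ⊢ # 1 :+ r :< m) ρ ν M ρ<ν M≡ 0<ρ)))
         ; (inj₂ p) → ≉-opposite {+ k} {ρ} (lia 2 (λ k r → # 0 :≤ k ⇒ # 0 :< r ⇒ ⊢ # 0 :< k :+ r) (+ k) ρ 0≤k 0<ρ)
              (lia 4 (λ k r v m → k :≤ v ⇒ r :< v ⇒ m :≡ # 1 :+ 2 :* v ⇒ ⊢ k :+ r :< m) (+ k) ρ ν M (+≤+ k≤n) ρ<ν M≡)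
                  p })
      refl
      where
      0≤k : 0ℤ ≤ + k
      0≤k = +≤+ z≤n
      k<M : + k < M
      k<M = lia 3 (λ k v m → k :≤ v ⇒ m :≡ # 1 :+ 2 :* v ⇒ # 0 :≤ k ⇒ ⊢ k :< m) (+ k) ν M (+≤+ k≤n) M≡ 0≤k

  -- Here - y = x, so there is one raised and one lowered class, and the single label between them
  -- is a multiple of M. The sum x + y = 0 would be excluded only with left end D.
  leftC-simple : left ty ≡ C → Simple (extend n (leftImages C)) -1ℤ (+ 1)
  leftC-simple left≡C = record
    { reflection = reflection-fromImages (leftImages C)
        (λ p → 1≉0 (≈-neg p))
        1≉0
        (disjoint-classes -1≉1 -1≉1 1≉-1)
        images
    ; x<y    = ℤ.-<+
    ; y-x≤3  = +≤+ (s≤s (s≤s z≤n))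
    ; close  = λ {p} {q} u d a b → inj₁ (≈-≡ (q≈ {p} {q} u d)
        (lia 4 (λ p q v m → # 2 :≤ v ⇒ m :≡ # 1 :+ 2 :* v ⇒ p :< q ⇒ ⊢ p :+ # 2 :- m :< q) p q ν M 2≤ν M≡ a)
        (lia 4 (λ p q v m → # 2 :≤ v ⇒ m :≡ # 1 :+ 2 :* v ⇒ q :< p :+ # 2 :+ # 2 ⇒ ⊢ q :< p :+ # 2 :+ m) p q ν M 2≤ν
            M≡ b))
    ; inside = λ {p} {z} u a b → inj₂ (inj₂ (≈-substˡ (sym (lia 2 (λ p z → p :< z ⇒ z :< p :+ # 2 ⇒ ⊢ z :≡ p :+ # 1) p
        z a b)) (≈-+ (+ 1) (p≈ u))))
    ; root   = λ { (evenSum eq _ _) → C≢D (trans (sym left≡C) eq)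
                 ; (oddSum _ k eq) → odd≢even-multiple k 0ℤ (sym eq) }
    }
    where
    -1≉1 : ¬ -1ℤ ≈ + 1
    -1≉1 = difference⇒≉ ℤ.-<+ (lia 2 (λ v m → # 2 :≤ v ⇒ m :≡ # 1 :+ 2 :* v ⇒ ⊢ # 1 :< :- # 1 :+ m) ν M 2≤ν M≡)
    1≉-1 : ¬ + 1 ≈ -1ℤ
    1≉-1 p = -1≉1 (≈-sym p)
    p≈ : ∀ {p} → Up -1ℤ (+ 1) p → p ≈ -1ℤ
    p≈ (inj₁ a) = a
    p≈ (inj₂ a) = a
    q≈1 : ∀ {q} → Down -1ℤ (+ 1) q → q ≈ + 1
    q≈1 (inj₁ a) = a
    q≈1 (inj₂ a) = a
    q≈ : ∀ {p q} → Up -1ℤ (+ 1) p → Down -1ℤ (+ 1) q → q ≈ p + + 2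
    q≈ u d = ≈-trans (q≈1 d) (≈-+ (+ 2) (≈-sym (p≈ u)))
    images : ∀ k → 1 ℕ.≤ k → k ℕ.≤ n → Moves (λ _ → leftImages C k) -1ℤ (+ 1) (+ k)
    images 1 _ _ = down (inj₁ ≈-refl) refl
    images k@(suc (suc _)) _ k≤n = fixed
      (λ u → k≉-1 (p≈ u))
      (λ d → difference⇒≉ (+<+ (s≤s (s≤s z≤n))) (lia 3 (λ k v m → k :≤ v ⇒ # 2 :≤ v ⇒ m :≡ # 1 :+ 2 :* v ⇒ ⊢ k :< # 1
          :+ m) (+ k) ν M (+≤+ k≤n) 2≤ν M≡) (≈-sym (q≈1 d)))
      refl
      where
      k≉-1 : ¬ + k ≈ -1ℤ
      k≉-1 = ≉-opposite {+ k} {+ 1} (+<+ (s≤s z≤n)) (lia 3 (λ k v m → k :≤ v ⇒ # 2 :≤ v ⇒ m :≡ # 1 :+ 2 :* v ⇒ ⊢ k :+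
          # 1 :< m) (+ k) ν M (+≤+ k≤n) 2≤ν M≡)

  -- The classes of -1 and -2 are raised by 3, those of 2 and 1 lowered. Besides the exchanged pairs
  -- -1, 2 and -2, 1 the pairs -1, 1 and -2, 2 are reversed too; their sums are even multiples of M,
  -- which is the reason for `evenSum`.
  leftD-simple : left ty ≡ D → Simple (extend n (leftImages D)) -1ℤ (+ 2)
  leftD-simple left≡D = record
    { reflection = reflection-fromImages (leftImages D)
        (λ p → difference⇒≉ ℤ.-<+ (lia 2 (λ v m → # 3 :≤ v ⇒ m :≡ # 1 :+ 2 :* v ⇒ ⊢ # 0 :< :- # 1 :+ m) ν M 3≤ν M≡) p)
        (between⇒≉0 (+<+ (s≤s z≤n)) (lia 2 (λ v m → # 3 :≤ v ⇒ m :≡ # 1 :+ 2 :* v ⇒ ⊢ # 2 :< m) ν M 3≤ν M≡))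
        (disjoint-classes
          (difference⇒≉ ℤ.-<+ (lia 2 (λ v m → # 3 :≤ v ⇒ m :≡ # 1 :+ 2 :* v ⇒ ⊢ # 2 :< :- # 1 :+ m) ν M 3≤ν M≡))
          (difference⇒≉ ℤ.-<+ (lia 2 (λ v m → # 3 :≤ v ⇒ m :≡ # 1 :+ 2 :* v ⇒ ⊢ # 1 :< :- # 1 :+ m) ν M 3≤ν M≡))
          (difference⇒≉′ ℤ.-<+ (lia 2 (λ v m → # 3 :≤ v ⇒ m :≡ # 1 :+ 2 :* v ⇒ ⊢ # 2 :< :- # 2 :+ m) ν M 3≤ν M≡)))
        images
    ; x<y    = ℤ.-<+
    ; y-x≤3  = ℤₚ.≤-refl
    ; close  = close′
    ; inside = inside′
    ; root   = between⇒≉0 (+<+ (s≤s z≤n)) (lia 2 (λ v m → # 3 :≤ v ⇒ m :≡ # 1 :+ 2 :* v ⇒ ⊢ # 1 :< m) ν M 3≤ν M≡) ∘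
        Excluded⇒≈0
    }
    where
    3≤ν = left-D⇒3≤ν left≡D
    near : ∀ {p q} → p < q → q < p + + 3 + + 3 → ∀ c → + 2 ≤ c → c ≤ + 4 → q ≈ p + c → q ≡ p + c
    near {p} {q} a b c 2≤c c≤4 e = ≈-≡ e
      (lia 5 (λ p q c v m → # 3 :≤ v ⇒ m :≡ # 1 :+ 2 :* v ⇒ p :< q ⇒ c :≤ # 4 ⇒ ⊢ p :+ c :- m :< q) p q c ν M 3≤ν M≡ a
          c≤4)
      (lia 5 (λ p q c v m → # 3 :≤ v ⇒ m :≡ # 1 :+ 2 :* v ⇒ q :< p :+ # 3 :+ # 3 ⇒ # 2 :≤ c ⇒ ⊢ q :< p :+ c :+ m) p q
          c ν M 3≤ν M≡ b 2≤c)
    double : ∀ c k → c + k * M + (c + k * M + (- c + - c)) ≡ (k + k) * M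
    double = λ c k → ring c k M
      where
      ring : ∀ c k m → c + k * m + (c + k * m + (- c + - c)) ≡ (k + k) * m
      ring = solve-∀
    close′ : ∀ {p q} → Up -1ℤ (+ 2) p → Down -1ℤ (+ 2) q → p < q → q < p + + 3 + + 3 → q ≡ p + + 3 ⊎ Excluded (p + q)
    close′ (inj₁ u) (inj₁ d) a b = inj₁ (near a b (+ 3) (+≤+ (s≤s (s≤s z≤n))) (+≤+ (s≤s (s≤s (s≤s z≤n))))
        (≈-trans d (≈-+ (+ 3) (≈-sym u))))
    close′ (inj₂ u) (inj₂ d) a b = inj₁ (near a b (+ 3) (+≤+ (s≤s (s≤s z≤n))) (+≤+ (s≤s (s≤s (s≤s z≤n))))
        (≈-trans d (≈-+ (+ 3) (≈-sym u))))
    close′ {p} (inj₁ u@(by k eq)) (inj₂ d) a b = inj₂ (evenSum left≡D k (trans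
      (cong (λ z → p + z) (near a b (+ 2) (+≤+ (s≤s (s≤s z≤n))) (+≤+ (s≤s (s≤s z≤n)))
          (≈-trans d (≈-+ (+ 2) (≈-sym u)))))
      (trans (cong (λ p → p + (p + + 2)) eq) (double -1ℤ k))))
    close′ {p} (inj₂ u@(by k eq)) (inj₁ d) a b = inj₂ (evenSum left≡D k (trans
      (cong (λ z → p + z) (near a b (+ 4) (+≤+ (s≤s (s≤s z≤n))) (+≤+ (s≤s (s≤s (s≤s (s≤s z≤n)))))
          (≈-trans d (≈-+ (+ 4) (≈-sym u)))))
      (trans (cong (λ p → p + (p + + 4)) eq) (double (- + 2) k))))
    offsets : ∀ {p z} → p < z → z < p + + 3 → z ≡ p + + 1 ⊎ z ≡ p + + 2
    offsets {p} {z} a b with z ℤₚ.≟ p + + 1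
    ... | yes eq = inj₁ eq
    ... | no z≢  = inj₂ (lia 2 (λ p z → p :+ # 1 :< z ⇒ z :< p :+ # 3 ⇒ ⊢ z :≡ p :+ # 2) p z
      (ℤₚ.≤∧≢⇒< (lia 2 (λ p z → p :< z ⇒ ⊢ p :+ # 1 :≤ z) p z a) (z≢ ∘ sym)) b)
    inside″ : ∀ {p z} → Up -1ℤ (+ 2) p → z ≡ p + + 1 ⊎ z ≡ p + + 2 → Up -1ℤ (+ 2) z ⊎ Down -1ℤ (+ 2) z ⊎ z ≈ 0ℤ
    inside″ (inj₁ e) (inj₁ refl) = inj₂ (inj₂ (≈-+ (+ 1) e))
    inside″ (inj₂ e) (inj₁ refl) = inj₁ (inj₁ (≈-+ (+ 1) e))
    inside″ (inj₁ e) (inj₂ refl) = inj₂ (inj₁ (inj₂ (≈-+ (+ 2) e)))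
    inside″ (inj₂ e) (inj₂ refl) = inj₂ (inj₂ (≈-+ (+ 2) e))
    inside′ : ∀ {p z} → Up -1ℤ (+ 2) p → p < z → z < p + + 3 → Up -1ℤ (+ 2) z ⊎ Down -1ℤ (+ 2) z ⊎ z ≈ 0ℤ
    inside′ u a b = inside″ u (offsets a b)
    images : ∀ k → 1 ℕ.≤ k → k ℕ.≤ n → Moves (λ _ → leftImages D k) -1ℤ (+ 2) (+ k)
    images 1 _ _ = down (inj₂ ≈-refl) refl
    images 2 _ _ = down (inj₁ ≈-refl) refl
    images k@(suc (suc (suc _))) _ k≤n = fixed
      (λ { (inj₁ p) → ≉-opposite {+ k} {+ 1} (+<+ (s≤s z≤n)) (lia 3
          (λ k v m → k :≤ v ⇒ # 3 :≤ v ⇒ m :≡ # 1 :+ 2 :* v ⇒ ⊢ k :+ # 1 :< m) (+ k) ν M (+≤+ k≤n) 3≤ν M≡) p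
         ; (inj₂ p) → ≉-opposite {+ k} {+ 2} (+<+ (s≤s z≤n)) (lia 3
             (λ k v m → k :≤ v ⇒ # 3 :≤ v ⇒ m :≡ # 1 :+ 2 :* v ⇒ ⊢ k :+ # 2 :< m) (+ k) ν M (+≤+ k≤n) 3≤ν M≡) p })
      (λ { (inj₁ p) → difference⇒≉′ (+<+ (s≤s (s≤s (s≤s z≤n)))) (lia 3
          (λ k v m → k :≤ v ⇒ # 3 :≤ v ⇒ m :≡ # 1 :+ 2 :* v ⇒ ⊢ k :< # 2 :+ m) (+ k) ν M (+≤+ k≤n) 3≤ν M≡) p
         ; (inj₂ p) → difference⇒≉′ (+<+ (s≤s (s≤s z≤n))) (lia 3
             (λ k v m → k :≤ v ⇒ # 3 :≤ v ⇒ m :≡ # 1 :+ 2 :* v ⇒ ⊢ k :< # 1 :+ m) (+ k) ν M (+≤+ k≤n) 3≤ν M≡) p })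
      refl

  0<ν : 0ℤ < ν
  0<ν = lia 1 (λ v → # 2 :≤ v ⇒ ⊢ # 0 :< v) ν 2≤ν

  ν≉0 : ¬ ν ≈ 0ℤ
  ν≉0 = between⇒≉0 0<ν (lia 2 (λ v m → # 2 :≤ v ⇒ m :≡ # 1 :+ 2 :* v ⇒ ⊢ v :< m) ν M 2≤ν M≡)

  ν≉-ν : ¬ ν ≈ - ν
  ν≉-ν = ≉-opposite {ν} {ν} (lia 1 (λ v → # 2 :≤ v ⇒ ⊢ # 0 :< v :+ v) ν 2≤ν)
      (lia 2 (λ v m → m :≡ # 1 :+ 2 :* v ⇒ ⊢ v :+ v :< m) ν M M≡)

  -- As M = 2n + 1, the class of - n is that of n + 1, so again the raised classes coincide. The sum
  -- x + y = M is an odd multiple, which is excluded only for right end D.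
  rightC-simple : right ty ≡ C → Simple (extend n (rightImages C n)) ν (+ 1 + ν)
  rightC-simple right≡C = record
    { reflection = reflection-fromImages (rightImages C n) ν≉0
        (between⇒≉0 (+<+ (s≤s z≤n)) (lia 2 (λ v m → # 2 :≤ v ⇒ m :≡ # 1 :+ 2 :* v ⇒ ⊢ # 1 :+ v :< m) ν M 2≤ν M≡))
        (disjoint-classes (difference⇒≉ (lia 1 (λ v → ⊢ v :< # 1 :+ v) ν)
            (lia 2 (λ v m → # 2 :≤ v ⇒ m :≡ # 1 :+ 2 :* v ⇒ ⊢ # 1 :+ v :< v :+ m) ν M 2≤ν M≡))
          ν≉-ν
          (λ p → 1≉0 (≈-trans (by (- + 1) (trans (lia 2 (λ v m → m :≡ # 1 :+ 2 :* v ⇒ ⊢ # 1 :≡ # 1 :+ v :+ (# 1 :+ v)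
              :+ (:- m)) ν M M≡) (cong (λ z → + 1 + ν + (+ 1 + ν) + z) (sym (ℤₚ.-1*i≡-i M)))))
                          (≈-substʳ (ℤₚ.+-inverseˡ (+ 1 + ν)) (≈-+ (+ 1 + ν) p)))))
        images
    ; x<y    = lia 1 (λ v → ⊢ v :< # 1 :+ v) ν
    ; y-x≤3  = lia 1 (λ v → ⊢ # 1 :+ v :- v :≤ # 3) ν
    ; close  = λ {p} {q} _ _ a b → inj₁ (δ-one {ν} {+ 1 + ν} {p} {q} δ≡1 a b)
    ; inside = λ {p} {z} _ a b → ⊥-elim (δ-one-inside {ν} {+ 1 + ν} {p} {z} δ≡1 a b)
    ; root   = λ { (evenSum _ k eq) → odd≢even-multiple 0ℤ k (trans (ℤₚ.*-identityˡ M)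
        (trans (lia 2 (λ v m → m :≡ # 1 :+ 2 :* v ⇒ ⊢ m :≡ v :+ (# 1 :+ v)) ν M M≡) eq))
                 ; (oddSum eq _ _) → C≢D (trans (sym right≡C) eq) }
    }
    where
    δ≡1 : + 1 + ν - ν ≡ + 1
    δ≡1 = lia 1 (λ v → ⊢ # 1 :+ v :- v :≡ # 1) ν
    images : ∀ k → 1 ℕ.≤ k → k ℕ.≤ n → Moves (λ _ → rightImages C n k) ν (+ 1 + ν) (+ k)
    images k 1≤k k≤n with k ℕₚ.≟ n
    ... | yes refl rewrite ≡ᵇ-true {n} refl = up (inj₁ ≈-refl) (lia 1 (λ v → ⊢ # 1 :+ v :≡ v :+ (# 1 :+ v :- v)) ν)
    ... | no k≢n rewrite ≡ᵇ-false k≢n = fixed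
      (λ { (inj₁ p) → difference⇒≉ k<ν (lia 3 (λ k v m → # 1 :≤ k ⇒ m :≡ # 1 :+ 2 :* v ⇒ k :< v ⇒ ⊢ v :< k :+ m) (+ k)
          ν M (+≤+ 1≤k) M≡ k<ν) p
         ; (inj₂ p) → ≉-opposite {+ k} {+ 1 + ν} (lia 2 (λ k v → # 1 :≤ k ⇒ k :< v ⇒ ⊢ # 0 :< k :+ (# 1 :+ v)) (+ k) ν
             (+≤+ 1≤k) k<ν)
              (lia 3 (λ k v m → m :≡ # 1 :+ 2 :* v ⇒ k :< v ⇒ ⊢ k :+ (# 1 :+ v) :< m) (+ k) ν M M≡ k<ν) p })
      (λ { (inj₁ p) → difference⇒≉ {+ k} {+ 1 + ν} (lia 2 (λ k v → k :< v ⇒ ⊢ k :< # 1 :+ v) (+ k) ν k<ν)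
          (lia 3 (λ k v m → # 1 :≤ k ⇒ m :≡ # 1 :+ 2 :* v ⇒ k :< v ⇒ ⊢ # 1 :+ v :< k :+ m) (+ k) ν M (+≤+ 1≤k) M≡ k<ν)
          p
         ; (inj₂ p) → ≉-opposite {+ k} {ν} (lia 2 (λ k v → # 1 :≤ k ⇒ k :< v ⇒ ⊢ # 0 :< k :+ v) (+ k) ν (+≤+ 1≤k) k<ν)
              (lia 3 (λ k v m → m :≡ # 1 :+ 2 :* v ⇒ k :< v ⇒ ⊢ k :+ v :< m) (+ k) ν M M≡ k<ν) p })
      refl
      where
      k<ν : + k < ν
      k<ν = +<+ (ℕₚ.≤∧≢⇒< k≤n k≢n)

  -- Modulo M the raised classes are n and n - 1, the lowered ones n + 2 and n + 1. The pairs n, n +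
  -- 1 and n - 1, n + 2 are reversed without being exchanged; their sums are odd multiples of M,
  -- which is the reason for `oddSum`.
  rightD-simple : right ty ≡ D → Simple (extend n (rightImages D n)) ν (+ 2 + ν)
  rightD-simple right≡D = record
    { reflection = reflection-fromImages (rightImages D n) ν≉0
        (between⇒≉0 (+<+ (s≤s z≤n)) (lia 2 (λ v m → # 3 :≤ v ⇒ m :≡ # 1 :+ 2 :* v ⇒ ⊢ # 2 :+ v :< m) ν M 3≤ν M≡))
        (disjoint-classes (difference⇒≉ (lia 1 (λ v → ⊢ v :< # 2 :+ v) ν)
            (lia 2 (λ v m → # 3 :≤ v ⇒ m :≡ # 1 :+ 2 :* v ⇒ ⊢ # 2 :+ v :< v :+ m) ν M 3≤ν M≡))
          ν≉-ν
          (λ p → between⇒≉0 (+<+ (s≤s z≤n)) (lia 2 (λ v m → # 3 :≤ v ⇒ m :≡ # 1 :+ 2 :* v ⇒ ⊢ # 3 :< m) ν M 3≤ν M≡)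
             (≈-trans (by (- + 1) (trans (lia 2 (λ v m → m :≡ # 1 :+ 2 :* v ⇒ ⊢ # 3 :≡ # 2 :+ v :+ (# 2 :+ v) :+
                 (:- m)) ν M M≡) (cong (λ z → + 2 + ν + (+ 2 + ν) + z) (sym (ℤₚ.-1*i≡-i M)))))
                          (≈-substʳ (ℤₚ.+-inverseˡ (+ 2 + ν)) (≈-+ (+ 2 + ν) p)))))
        images
    ; x<y    = lia 1 (λ v → ⊢ v :< # 2 :+ v) ν
    ; y-x≤3  = lia 1 (λ v → ⊢ # 2 :+ v :- v :≤ # 3) ν
    ; close  = λ {p} {q} u d a b → close′ u d a (subst (λ δ → q < p + δ + δ) δ≡2 b)
    ; inside = λ {p} {z} u a b → inside′ u (lia 2 (λ p z → p :< z ⇒ z :< p :+ # 2 ⇒ ⊢ z :≡ p :+ # 1) p z a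
        (subst (λ δ → z < p + δ) δ≡2 b))
    ; root   = λ ex → 1≉0 (≈-trans (by (- + 1) (trans (lia 2 (λ v m → m :≡ # 1 :+ 2 :* v ⇒ ⊢ # 1 :≡ v :+ (# 2 :+ v) :+
        (:- m)) ν M M≡) (cong (λ z → ν + (+ 2 + ν) + z) (sym (ℤₚ.-1*i≡-i M))))) (Excluded⇒≈0 ex))
    }
    where
    3≤ν = right-D⇒3≤ν right≡D
    δ≡2 : + 2 + ν - ν ≡ + 2
    δ≡2 = lia 1 (λ v → ⊢ # 2 :+ v :- v :≡ # 2) ν
    complement : - ν ≈ + 1 + ν
    complement = by (- + 1) (trans (lia 2 (λ v m → m :≡ # 1 :+ 2 :* v ⇒ ⊢ :- v :≡ # 1 :+ v :+ (:- m)) ν M M≡)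
        (cong (λ z → + 1 + ν + z) (sym (ℤₚ.-1*i≡-i M))))
    complement′ : - (+ 2 + ν) ≈ ν - + 1
    complement′ = by (- + 1) (trans (lia 2 (λ v m → m :≡ # 1 :+ 2 :* v ⇒ ⊢ :- (# 2 :+ v) :≡ v :- # 1 :+ (:- m)) ν M
        M≡) (cong (λ z → ν - + 1 + z) (sym (ℤₚ.-1*i≡-i M))))
    near : ∀ {p q} → p < q → q < p + + 2 + + 2 → ∀ c → + 1 ≤ c → c ≤ + 3 → q ≈ p + c → q ≡ p + c
    near {p} {q} a b c 1≤c c≤3 e = ≈-≡ e
      (lia 5 (λ p q c v m → # 3 :≤ v ⇒ m :≡ # 1 :+ 2 :* v ⇒ p :< q ⇒ c :≤ # 3 ⇒ ⊢ p :+ c :- m :< q) p q c ν M 3≤ν M≡ a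
          c≤3)
      (lia 5 (λ p q c v m → # 3 :≤ v ⇒ m :≡ # 1 :+ 2 :* v ⇒ q :< p :+ # 2 :+ # 2 ⇒ # 1 :≤ c ⇒ ⊢ q :< p :+ c :+ m) p q
          c ν M 3≤ν M≡ b 1≤c)
    odd-sum : ∀ k → (ν + k * M) + (ν + k * M + + 1) ≡ (k + k + + 1) * M
    odd-sum k = trans (ring ν k M) (cong (λ z → (k + k) * M + z) (sym (trans (ℤₚ.*-identityˡ M) (trans M≡ (twice ν))))
        ⟨ trans ⟩ sym (ℤₚ.*-distribʳ-+ M (k + k) (+ 1)))
      where
      ring : ∀ v k m → (v + k * m) + (v + k * m + + 1) ≡ (k + k) * m + (+ 1 + (v + v))
      ring = solve-∀
      twice : ∀ v → + 1 + + 2 * v ≡ + 1 + (v + v)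
      twice = solve-∀
    close′ : ∀ {p q} → Up ν (+ 2 + ν) p → Down ν (+ 2 + ν) q → p < q → q < p + + 2 + + 2 → q ≡ p + (+ 2 + ν - ν) ⊎
        Excluded (p + q)
    close′ {p} (inj₁ u) (inj₁ d) a b = inj₁ (trans (near a b (+ 2) (+≤+ (s≤s z≤n)) (+≤+ (s≤s (s≤s z≤n)))
      (≈-trans d (≈-substˡ (ℤₚ.+-comm ν (+ 2)) (≈-+ (+ 2) (≈-sym u))))) (cong (λ z → p + z) (sym δ≡2)))
    close′ {p} (inj₂ u) (inj₂ d) a b = inj₁ (trans (near a b (+ 2) (+≤+ (s≤s z≤n)) (+≤+ (s≤s (s≤s z≤n)))
      (≈-trans d (≈-substˡ (lia 1 (λ v → ⊢ :- (# 2 :+ v) :+ # 2 :≡ :- v) ν) (≈-+ (+ 2) (≈-sym u)))))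
          (cong (λ z → p + z) (sym δ≡2)))
    close′ {p} {q} (inj₁ u@(by k eq)) (inj₂ d) a b = inj₂ (oddSum right≡D k
        (trans (cong₂ _+_ eq (trans q≡ (cong (λ z → z + + 1) eq))) (odd-sum k)))
      where
      q≡ : q ≡ p + + 1
      q≡ = near a b (+ 1) (+≤+ (s≤s z≤n)) (+≤+ (s≤s z≤n)) (≈-trans d
          (≈-trans complement (≈-substˡ (ℤₚ.+-comm ν (+ 1)) (≈-+ (+ 1) (≈-sym u)))))
    close′ {p} {q} (inj₂ u) (inj₁ d) a b = inj₂ (close″ (≈-trans u complement′))
      where
      ring : ∀ v p → v - + 1 + p + (v - + 1 + p + + 3) ≡ v + p + (v + p + + 1)
      ring = solve-∀
      q≡ : p ≈ ν - + 1 → q ≡ p + + 3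
      q≡ u′ = near a b (+ 3) (+≤+ (s≤s z≤n)) (+≤+ (s≤s (s≤s (s≤s z≤n))))
          (≈-trans d (≈-substˡ (lia 1 (λ v → ⊢ v :- # 1 :+ # 3 :≡ # 2 :+ v) ν) (≈-+ (+ 3) (≈-sym u′))))
      close″ : p ≈ ν - + 1 → Excluded (p + q)
      close″ u′@(by k eq) = oddSum right≡D k (trans (cong₂ _+_ eq (trans (q≡ u′) (cong (λ z → z + + 3) eq)))
          (trans (ring ν (k * M)) (odd-sum k)))
    inside′ : ∀ {p z} → Up ν (+ 2 + ν) p → z ≡ p + + 1 → Up ν (+ 2 + ν) z ⊎ Down ν (+ 2 + ν) z ⊎ z ≈ 0ℤ
    inside′ (inj₁ u) refl = inj₂ (inj₁ (inj₂ (≈-trans (≈-substʳ (ℤₚ.+-comm ν (+ 1)) (≈-+ (+ 1) u))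
        (≈-sym complement))))
    inside′ (inj₂ u) refl = inj₁ (inj₁ (≈-substʳ (lia 1 (λ v → ⊢ v :- # 1 :+ # 1 :≡ v) ν)
        (≈-+ (+ 1) (≈-trans u complement′))))
    images : ∀ k → 1 ℕ.≤ k → k ℕ.≤ n → Moves (λ _ → rightImages D n k) ν (+ 2 + ν) (+ k)
    images k 1≤k k≤n with k ℕₚ.≟ n ∸ 1 | k ℕₚ.≟ n
    ... | yes k≡ | _ rewrite ≡ᵇ-true k≡ = up (inj₂ (≈-substˡ (sym +k) (≈-sym complement′)))
          (lia 2 (λ k v → k :≡ v :- # 1 ⇒ ⊢ v :+ # 1 :≡ k :+ (# 2 :+ v :- v)) (+ k) ν +k)
      where
      +k : + k ≡ ν - + 1
      +k = trans (cong +_ k≡) (trans (sym (ℤₚ.⊖-≥ (ℕₚ.≤-trans 1≤k k≤n))) (sym (ℤₚ.m-n≡m⊖n n 1)))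
    ... | no k≢ | yes refl rewrite ≡ᵇ-false k≢ | ≡ᵇ-true {n} refl = up (inj₁ ≈-refl)
        (lia 1 (λ v → ⊢ v :+ # 2 :≡ v :+ (# 2 :+ v :- v)) ν)
    ... | no k≢ | no k≢n rewrite ≡ᵇ-false k≢ | ≡ᵇ-false k≢n = fixed
      (λ { (inj₁ p) → difference⇒≉ k<ν (lia 3 (λ k v m → # 1 :≤ k ⇒ m :≡ # 1 :+ 2 :* v ⇒ k :< v ⇒ ⊢ v :< k :+ m) (+ k)
          ν M (+≤+ 1≤k) M≡ k<ν) p
         ; (inj₂ p) → ≉-opposite {+ k} {+ 2 + ν} (lia 2 (λ k v → # 1 :≤ k ⇒ k :< v ⇒ ⊢ # 0 :< k :+ (# 2 :+ v)) (+ k) ν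
             (+≤+ 1≤k) k<ν)
              (lia 3 (λ k v m → m :≡ # 1 :+ 2 :* v ⇒ k :+ # 1 :< v ⇒ ⊢ k :+ (# 2 :+ v) :< m) (+ k) ν M M≡ k+1<ν) p })
      (λ { (inj₁ p) → difference⇒≉ {+ k} {+ 2 + ν} (lia 2 (λ k v → k :< v ⇒ ⊢ k :< # 2 :+ v) (+ k) ν k<ν)
          (lia 3 (λ k v m → # 1 :≤ k ⇒ # 3 :≤ v ⇒ m :≡ # 1 :+ 2 :* v ⇒ k :< v ⇒ ⊢ # 2 :+ v :< k :+ m) (+ k) ν M
          (+≤+ 1≤k) 3≤ν M≡ k<ν) p
         ; (inj₂ p) → ≉-opposite {+ k} {ν} (lia 2 (λ k v → # 1 :≤ k ⇒ k :< v ⇒ ⊢ # 0 :< k :+ v) (+ k) ν (+≤+ 1≤k) k<ν)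
              (lia 3 (λ k v m → m :≡ # 1 :+ 2 :* v ⇒ k :< v ⇒ ⊢ k :+ v :< m) (+ k) ν M M≡ k<ν) p })
      refl
      where
      k<n = ℕₚ.≤∧≢⇒< k≤n k≢n
      k<ν : + k < ν
      k<ν = +<+ k<n
      k+1<ν : + k + + 1 < ν
      k+1<ν = +<+ (ℕₚ.≤∧≢⇒< (subst (ℕ._≤ n) (ℕₚ.+-comm 1 k) k<n)
          (λ eq → k≢ (trans (sym (ℕₚ.m+n∸n≡m k 1)) (cong (_∸ 1) eq))))

  -- The generator with a given index.

  gen-right : gen ty n n ≡ extend n (rightImages (right ty) n)
  gen-right = cong₂ (λ b c → extend n (if b then leftImages (left ty) else if c then rightImages (right ty) n else
      swapImages n))
    (≡ᵇ-false {n} {0} n≢0) (≡ᵇ-true {n} refl)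
    where
    n≢0 : n ≢ 0
    n≢0 eq with () ← subst (2 ℕ.≤_) eq (ℤₚ.drop‿+≤+ 2≤ν)

  gen-swap : ∀ {r} → 1 ℕ.≤ r → r ℕ.< n → gen ty n r ≡ extend n (swapImages r)
  gen-swap {r} 1≤r r<n = cong₂ (λ b c → extend n (if b then leftImages (left ty) else if c then rightImages (right ty)
      n else swapImages r))
    (≡ᵇ-false {r} {0} (ℕₚ.>⇒≢ 1≤r)) (≡ᵇ-false (ℕₚ.<⇒≢ r<n))

  swap-gen : ∀ {r} → 1 ℕ.≤ r → r ℕ.< n → Simple (gen ty n r) (+ r) (+ suc r)
  swap-gen {r} 1≤r r<n = subst (λ g → Simple g (+ r) (+ suc r)) (sym (gen-swap 1≤r r<n)) (swap-simple r 1≤r r<n)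

  leftC-gen : left ty ≡ C → Simple (gen ty n 0) -1ℤ (+ 1)
  leftC-gen eq = subst (λ e → Simple (extend n (leftImages e)) -1ℤ (+ 1)) (sym eq) (leftC-simple eq)

  leftD-gen : left ty ≡ D → Simple (gen ty n 0) -1ℤ (+ 2)
  leftD-gen eq = subst (λ e → Simple (extend n (leftImages e)) -1ℤ (+ 2)) (sym eq) (leftD-simple eq)

  rightC-gen : right ty ≡ C → Simple (gen ty n n) ν (+ 1 + ν)
  rightC-gen eq = subst (λ g → Simple g ν (+ 1 + ν)) (sym gen-right)
    (subst (λ e → Simple (extend n (rightImages e n)) ν (+ 1 + ν)) (sym eq) (rightC-simple eq))

  rightD-gen : right ty ≡ D → Simple (gen ty n n) ν (+ 2 + ν)
  rightD-gen eq = subst (λ g → Simple g ν (+ 2 + ν)) (sym gen-right)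
    (subst (λ e → Simple (extend n (rightImages e n)) ν (+ 2 + ν)) (sym eq) (rightD-simple eq))

  leftGen : ∀ e → left ty ≡ e → ∃₂ λ x y → Simple (gen ty n 0) x y
  leftGen C eq = _ , _ , leftC-gen eq
  leftGen D eq = _ , _ , leftD-gen eq

  rightGen : ∀ e → right ty ≡ e → ∃₂ λ x y → Simple (gen ty n n) x y
  rightGen C eq = _ , _ , rightC-gen eq
  rightGen D eq = _ , _ , rightD-gen eq

  simpleGen : ∀ r → r ℕ.≤ n → ∃₂ λ x y → Simple (gen ty n r) x y
  simpleGen zero r≤n = leftGen (left ty) refl
  simpleGen r@(suc _) r≤n = go (ℕₚ.m≤n⇒m<n∨m≡n r≤n)
    where
    go : r ℕ.< n ⊎ r ≡ n → ∃₂ λ x y → Simple (gen ty n r) x y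
    go (inj₁ r<n) = _ , _ , swap-gen (s≤s z≤n) r<n
    go (inj₂ eq)  = subst (λ r → ∃₂ λ x y → Simple (gen ty n r) x y) (sym eq) (rightGen (right ty) refl)

  simple-involution : ∀ {g x y} → Simple g x y → Involution g
  simple-involution s = reflection-involution (Simple.reflection s)

  gen-involution : ∀ r → r ℕ.≤ n → Involution (gen ty n r)
  gen-involution r r≤n = simple-involution (proj₂ (proj₂ (simpleGen r r≤n)))

  Finite-involution : ∀ (r : Fin (suc n)) → Involution (gen ty n (toℕ r))
  Finite-involution r = gen-involution (toℕ r) (Finₚ.toℕ≤pred[n] r)

  -- Exchange condition and minimal representatives.

  -- The pairs to which the exchange argument applies; the property is invariant under all
  -- generators (`Root-image`).
  record Root (p q : ℤ) : Set where
    constructor root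
    field
      p≉0      : ¬ p ≈ 0ℤ
      q≉0      : ¬ q ≈ 0ℤ
      possible : ¬ Excluded (p + q)

  module _ {g x y} (s : Simple g x y) where
    open Simple s
    open Reflection reflection

    private
      δ = y - x
      0<δ : 0ℤ < δ
      0<δ = lia 2 (λ x y → x :< y ⇒ ⊢ # 0 :< y :- x) x y x<y

    not-inside : ∀ {p z} → Up x y p → p < z → z < p + δ → ¬ Up x y z → ¬ Down x y z → ¬ z ≈ 0ℤ → ⊥
    not-inside u a b ¬u ¬d z≉0 with inside u a b
    ... | inj₁ v        = ¬u v
    ... | inj₂ (inj₁ v) = ¬d v
    ... | inj₂ (inj₂ v) = z≉0 v

    -- If p is raised and q fixed, or p fixed and q lowered, a reversal puts a fixed label inside a
    -- moved interval, against `inside`. In every other combination except raised p and lowered q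
    -- the distance does not decrease.
    reversal : ∀ {p q} → ¬ p ≈ 0ℤ → ¬ q ≈ 0ℤ → p < q → g q < g p → Up x y p × Down x y q × q < p + δ + δ
    reversal {p} {q} p≉0 q≉0 p<q gq<gp with move p | move q
    ... | up u e | down d e′ = u , d , lia 5 (λ p q a b d → a :≡ p :+ d ⇒ b :≡ q :- d ⇒ b :< a ⇒ ⊢ q :< p :+ d :+ d)
                                 p q (g p) (g q) δ e e′ gq<gp
    ... | up u e | up _ e′ = ⊥-elim (lia 5 (λ p q a b d → a :≡ p :+ d ⇒ b :≡ q :+ d ⇒ b :< a ⇒ p :< q ⇒ ⊢⊥) p q (g p)
        (g q) δ e e′ gq<gp p<q)
    ... | up u e | fixed ¬u ¬d e′ = ⊥-elim (not-inside u p<q (lia 5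
        (λ p q a b d → a :≡ p :+ d ⇒ b :≡ q ⇒ b :< a ⇒ ⊢ q :< p :+ d) p q (g p) (g q) δ e e′ gq<gp) ¬u ¬d q≉0)
    reversal {p} {q} p≉0 q≉0 p<q gq<gp | down _ e | up _ e′ = ⊥-elim
        (lia 5 (λ p q a b d → a :≡ p :- d ⇒ b :≡ q :+ d ⇒ b :< a ⇒ p :< q ⇒ # 0 :< d ⇒ ⊢⊥) p q (g p) (g q) δ e e′
        gq<gp p<q 0<δ)
    reversal {p} {q} p≉0 q≉0 p<q gq<gp | down _ e | down _ e′ = ⊥-elim
        (lia 5 (λ p q a b d → a :≡ p :- d ⇒ b :≡ q :- d ⇒ b :< a ⇒ p :< q ⇒ # 0 :< d ⇒ ⊢⊥) p q (g p) (g q) δ e e′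
        gq<gp p<q 0<δ)
    reversal {p} {q} p≉0 q≉0 p<q gq<gp | down _ e | fixed _ _ e′ = ⊥-elim
        (lia 5 (λ p q a b d → a :≡ p :- d ⇒ b :≡ q ⇒ b :< a ⇒ p :< q ⇒ # 0 :< d ⇒ ⊢⊥) p q (g p) (g q) δ e e′ gq<gp p<q
        0<δ)
    reversal {p} {q} p≉0 q≉0 p<q gq<gp | fixed _ _ e | up _ e′ = ⊥-elim
        (lia 5 (λ p q a b d → a :≡ p ⇒ b :≡ q :+ d ⇒ b :< a ⇒ p :< q ⇒ # 0 :< d ⇒ ⊢⊥) p q (g p) (g q) δ e e′ gq<gp p<q
        0<δ)
    reversal {p} {q} p≉0 q≉0 p<q gq<gp | fixed _ _ e | fixed _ _ e′ = ⊥-elim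
        (lia 4 (λ p q a b → a :≡ p ⇒ b :≡ q ⇒ b :< a ⇒ p :< q ⇒ ⊢⊥) p q (g p) (g q) e e′ gq<gp p<q)
    -- Negation turns this into a raised - q that overtakes the fixed - p.
    reversal {p} {q} p≉0 q≉0 p<q gq<gp | fixed ¬u ¬d e | down d e′ = ⊥-elim
        (not-inside (Down-neg d) (ℤₚ.neg-mono-< p<q)
      (lia 5 (λ p q a b d → a :≡ p ⇒ b :≡ q :- d ⇒ b :< a ⇒ ⊢ :- p :< :- q :+ d) p q (g p) (g q) δ e e′ gq<gp)
      (¬d ∘ Up-neg⁻) (¬u ∘ Down-neg⁻) (λ v → p≉0 (≈-substˡ (ℤₚ.neg-involutive p) (≈-neg v))))

    -- `close` leaves two possibilities, of which `Root` forbids the excluded sum; `rebase` then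
    -- names the reflection by p.
    reversed-root : ∀ {p q} → Root p q → p < q → g q < g p → Reflection g p q × q ≡ g p
    reversed-root {p} {q} (root p≉0 q≉0 poss) p<q gq<gp with reversal p≉0 q≉0 p<q gq<gp
    ... | u , d , near with close u d p<q near
    ...   | inj₁ refl = rebase reflection u , sym (up-eq u)
    ...   | inj₂ ex   = contradiction ex poss

  module _ {g} (i : Involution g) where
    open Involution i

    g0≡0 : g 0ℤ ≡ 0ℤ
    g0≡0 = lia 1 (λ a → a :≡ :- a ⇒ ⊢ a :≡ # 0) (g 0ℤ) (neg 0ℤ)

    ≈0-image : ∀ {z} → z ≈ 0ℤ → g z ≈ 0ℤ
    ≈0-image p = ≈-substʳ g0≡0 (≈-image p)

    ≈0-image⁻ : ∀ {z} → g z ≈ 0ℤ → z ≈ 0ℤ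
    ≈0-image⁻ p = ≈-substʳ g0≡0 (≈-transfer p)

    -- From g p = k M - g q one gets p = k M - q by applying g, which commutes with shifts and
    -- negation. Hence generators neither create nor destroy excluded sums.
    sum-image : ∀ {p q} k → g p + g q ≡ k * M → p + q ≡ k * M
    sum-image {p} {q} k eq = begin
      p + q                        ≡⟨ cong (_+ q) (sym (involutive p)) ⟩
      g (g p) + q                  ≡⟨ cong (λ z → g z + q) (lia 3 (λ a b c → a :+ b :≡ c ⇒ ⊢ a :≡ :- b :+ c) (g p)
          (g q) (k * M) eq) ⟩
      g (- g q + k * M) + q        ≡⟨ cong (_+ q) (trans (shift k (- g q))
          (cong (_+ k * M) (trans (neg (g q)) (cong -_ (involutive q))))) ⟩
      - q + k * M + q              ≡⟨ lia 2 (λ q c → ⊢ :- q :+ c :+ q :≡ c) q (k * M) ⟩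
      k * M                        ∎
      where open ≡-Reasoning

    Excluded-image : ∀ {p q} → Excluded (g p + g q) → Excluded (p + q)
    Excluded-image (evenSum l k eq) = evenSum l k (sum-image (k + k) eq)
    Excluded-image (oddSum r k eq)  = oddSum r k (sum-image (k + k + + 1) eq)

    Root-image : ∀ {p q} → Root p q → Root (g p) (g q)
    Root-image {p} {q} (root p≉0 q≉0 poss) = root (p≉0 ∘ ≈0-image⁻) (q≉0 ∘ ≈0-image⁻) (poss ∘ Excluded-image)

  private
    Words = List (Fin (suc n))

  word : Words → ℤ → ℤ
  word = ⟦_⟧ ty n

  -- Induction on the word. If the rest t already inverts the pair, it is shortened for the
  -- conjugate g ρ g and the letter is put back in front; otherwise the first letter makes the
  -- inversion, so it acts as ρ itself and is deleted.
  exchange : ∀ (t : Words) {i j ρ} → j < i → word t i < word t j →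
    Root (word t i) (word t j) → Reflection ρ (word t i) (word t j) →
    ∃[ t′ ] suc (length t′) ℕ.≤ length t × (∀ z → word t′ z ≡ ρ (word t z))
  exchange [] j<i i<j _ _ = contradiction i<j (ℤₚ.<-asym j<i)
  exchange (r ∷ t) {i} {j} {ρ} j<i lt rt refln = go (ℤₚ.<-cmp p q)
    where
    g = gen ty n (toℕ r)
    p = word t j
    q = word t i
    inv = Finite-involution r
    open Involution inv
    Shorter : Set
    Shorter = ∃[ t′ ] suc (length t′) ℕ.≤ suc (length t) × (∀ z → word t′ z ≡ ρ (g (word t z)))
    swapRoot : ∀ {a b} → Root a b → Root b a
    swapRoot {a} {b} (root x y z) = root y x (z ∘ subst Excluded (ℤₚ.+-comm b a))
    unreversed : q < p → Shorter
    unreversed lt′ = r ∷ t′ , s≤s len , λ z → trans (cong g (eq z)) (involutive (ρ (g (word t z))))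
      where
      ih = exchange t {i} {j} {g ∘ ρ ∘ g} j<i lt′
             (subst₂ Root (involutive _) (involutive _) (Root-image inv rt))
             (subst₂ (Reflection (g ∘ ρ ∘ g)) (involutive _) (involutive _) (conjugate inv refln))
      t′ = proj₁ ih
      len = proj₁ (proj₂ ih)
      eq = proj₂ (proj₂ ih)
    reversed : p < q → Shorter
    reversed gt = t , ℕₚ.≤-refl , λ z → sym (trans (sym (reflection-unique refl-g refln (g (word t z))))
        (involutive (word t z)))
      where
      rev : Reflection g p q × q ≡ g p
      rev = reversed-root (proj₂ (proj₂ (simpleGen (toℕ r) (Finₚ.toℕ≤pred[n] r))))
        (subst₂ Root (involutive p) (involutive q) (Root-image inv (swapRoot rt))) gt lt
      gp≡q : g p ≡ q
      gp≡q = sym (proj₂ rev)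
      gq≡p : g q ≡ p
      gq≡p = trans (cong g (proj₂ rev)) (involutive p)
      refl-g : Reflection g (g q) (g p)
      refl-g = subst₂ (Reflection g) (sym gq≡p) (sym gp≡q) (proj₁ rev)
    go : Tri (p < q) (p ≡ q) (q < p) → Shorter
    go (tri< gt _ _) = reversed gt
    go (tri≈ _ eq _) = contradiction (cong g (sym eq)) (ℤₚ.<⇒≢ lt)
    go (tri> _ _ lt′) = unreversed lt′

  -- A word of length k for s w u gives one of length k + 1 for w u, hence by minimality a word of
  -- length at most k + 1 for w; `exchange` then removes a letter while multiplying by s.
  gen-minimal : (v : W̃/W ty n) (r : Fin (suc n)) → ∀ {i j} → j < i → fun (perm v) i < fun (perm v) j →
    Root (fun (perm v) i) (fun (perm v) j) → Reflection (gen ty n (toℕ r)) (fun (perm v) i) (fun (perm v) j) →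
    ∀ u k → ℓ[_]≤_ ty n (gen ty n (toℕ r) ∘ fun (perm v) ∘ ⟦_⟧ᵂ ty n u) k →
    ℓ[_]≤_ ty n (gen ty n (toℕ r) ∘ fun (perm v)) k
  gen-minimal v r {i} {j} j<i lt rt refln u k (t , len , eq) =
    let t₂ , len₂ , eq₂ = minimal v u (suc k) (r ∷ t , s≤s len , λ z → trans (cong g (eq z)) (involutive _))
        t₃ , len₃ , eq₃ = exchange t₂ {i} {j} {g} j<i
          (subst₂ _<_ (sym (eq₂ i)) (sym (eq₂ j)) lt)
          (subst₂ Root (sym (eq₂ i)) (sym (eq₂ j)) rt)
          (subst₂ (Reflection g) (sym (eq₂ i)) (sym (eq₂ j)) refln)
    in t₃ , ℕ.s≤s⁻¹ (ℕₚ.≤-trans len₃ len₂) , λ z → trans (eq₃ z) (cong g (eq₂ z))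
    where
    g = gen ty n (toℕ r)
    open Involution (Finite-involution r)

  -- Window lists of an abacus

  module _ (a : Abacus n) where

    private
      β = + bound a

    entries-sorted : AllPairs _<_ (entries a)
    entries-sorted = AllPairsₚ.filter⁺ (entry? n) (AllPairsₚ.map⁺
      (AllPairsₚ.applyUpTo⁺₁ id (suc (2 ℕ.* bound a)) λ i<j _ → ℤₚ.+-monoʳ-< (- β) (+<+ i<j)))

    ∈-entries⁺ : ∀ {b} → - β ≤ b → b ≤ β → Entry n b → b ∈ entries a
    ∈-entries⁺ {b} lo hi e = ∈-filter⁺ (entry? n)
      (subst (_∈ map (λ i → - β + + i) (upTo (suc (2 ℕ.* bound a)))) b≡ (∈-map⁺ (λ i → - β + + i) (∈-upTo⁺ i<))) e
      where
      0≤ : 0ℤ ≤ b + β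
      0≤ = lia 2 (λ b β → :- β :≤ b ⇒ ⊢ # 0 :≤ b :+ β) b β lo
      i = ∣ b + β ∣
      +i : + i ≡ b + β
      +i = ℤₚ.0≤i⇒+∣i∣≡i 0≤
      b≡ : - β + + i ≡ b
      b≡ = lia 3 (λ b β i → i :≡ b :+ β ⇒ ⊢ :- β :+ i :≡ b) b β (+ i) +i
      i< : i ℕ.< suc (2 ℕ.* bound a)
      i< = s≤s (ℤₚ.drop‿+≤+ (subst (+ i ≤_) (sym (ℤₚ.pos-* 2 (bound a)))
        (lia 3 (λ b β i → i :≡ b :+ β ⇒ b :≤ β ⇒ ⊢ i :≤ 2 :* β) b β (+ i) +i hi)))

    ∈-entries⁻ : ∀ {b} → b ∈ entries a → - β ≤ b × b ≤ β × Entry n b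
    ∈-entries⁻ {b} b∈ with ∈-filter⁻ (entry? n) b∈
    ... | b∈w , e with ∈-map⁻ (λ i → - β + + i) b∈w
    ...   | i , i∈ , refl = lia 2 (λ β i → # 0 :≤ i ⇒ ⊢ :- β :≤ :- β :+ i) β (+ i) (+≤+ z≤n)
                          , lia 2 (λ β i → i :≤ 2 :* β ⇒ ⊢ :- β :+ i :≤ β) β (+ i)
                              (subst (+ i ≤_) (ℤₚ.pos-* 2 (bound a)) (+≤+ (ℕ.s≤s⁻¹ (∈-upTo⁻ i∈))))
                          , e

    beads-sorted : AllPairs _<_ (beads a)
    beads-sorted = AllPairsₚ.filter⁺ (bead? a) entries-sorted

    gaps-sorted : AllPairs _<_ (gaps a)
    gaps-sorted = AllPairsₚ.filter⁺ (¬? ∘ bead? a) entries-sorted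

    beads↓-sorted : AllPairs ℤ._>_ (beads↓ a)
    beads↓-sorted = AllPairs-reverse beads-sorted

    ∈-beads↓⁺ : ∀ {b} → - β ≤ b → Entry n b → Bead a b → b ∈ beads↓ a
    ∈-beads↓⁺ lo e bd = Anyₚ.reverse⁺ (∈-filter⁺ (bead? a) (∈-entries⁺ lo (above a _ bd) e) bd)

    ∈-beads↓⁻ : ∀ {b} → b ∈ beads↓ a → Bead a b × Entry n b
    ∈-beads↓⁻ b∈ = let b∈′ , bd = ∈-filter⁻ (bead? a) (Anyₚ.reverse⁻ b∈) in bd , proj₂ (proj₂ (∈-entries⁻ b∈′))

    -- The lower end of the window comes from `below`: an entry under it would be a bead.
    ∈-gaps⁺ : ∀ {b} → b ≤ β → Entry n b → ¬ Bead a b → b ∈ gaps a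
    ∈-gaps⁺ {b} hi e ¬bd = ∈-filter⁺ (¬? ∘ bead? a) (∈-entries⁺ (ℤₚ.≮⇒≥ (¬bd ∘ below a b e)) hi e) ¬bd

    ∈-gaps⁻ : ∀ {b} → b ∈ gaps a → ¬ Bead a b × Entry n b × b ≤ β
    ∈-gaps⁻ b∈ = let b∈′ , ¬bd = ∈-filter⁻ (¬? ∘ bead? a) b∈
                     _ , hi , e = ∈-entries⁻ b∈′
                 in ¬bd , e , hi

    beadsAbove : ℤ → List ℤ
    beadsAbove c = filter (c ℤₚ.<?_) (beads↓ a)

    gapsBelow : ℤ → ℕ
    gapsBelow c = length (filter (ℤₚ._<? c) (gaps a))

    beadsAbove-sorted : ∀ c → AllPairs ℤ._>_ (beadsAbove c)
    beadsAbove-sorted c = AllPairsₚ.filter⁺ (c ℤₚ.<?_) beads↓-sorted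

    ∈-beadsAbove⁺ : ∀ {c b} → 0ℤ ≤ c → c < b → Entry n b → Bead a b → b ∈ beadsAbove c
    ∈-beadsAbove⁺ {c} {b} 0≤c c<b e bd = ∈-filter⁺ (c ℤₚ.<?_) (∈-beads↓⁺
      (lia 3 (λ β b c → # 0 :≤ β ⇒ # 0 :≤ c ⇒ c :< b ⇒ ⊢ :- β :≤ b) β b c (+≤+ z≤n) 0≤c c<b) e bd) c<b

    ∈-beadsAbove⁻ : ∀ {c b} → b ∈ beadsAbove c → c < b × Bead a b × Entry n b
    ∈-beadsAbove⁻ {c} b∈ = let b∈′ , lt = ∈-filter⁻ (c ℤₚ.<?_) b∈ in lt , ∈-beads↓⁻ b∈′

    beadsAbove-unique : ∀ c → Unique (beadsAbove c)
    beadsAbove-unique c = AllPairs.map (λ gt → ≢-sym (ℤₚ.<⇒≢ gt)) (beadsAbove-sorted c)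

    gaps-unique : Unique (gaps a)
    gaps-unique = Unique⇐sorted gaps-sorted

  Entry⇒≉0 : ∀ {b} → Entry n b → ¬ b ≈ 0ℤ
  Entry⇒≉0 e p = e (≈0⇒∣ p)

  ≉0⇒Entry : ∀ {b} → ¬ b ≈ 0ℤ → Entry n b
  ≉0⇒Entry b≉0 d = b≉0 (∣⇒≈0 d)

  opposite : ℤ → ℤ
  opposite b = M + M - b

  opposite-≉0 : ∀ {b} → ¬ b ≈ 0ℤ → ¬ opposite b ≈ 0ℤ
  opposite-≉0 {b} b≉0 p = b≉0 (subst (_≈ 0ℤ) (ℤₚ.neg-involutive b) (≈-neg (≈-trans (by (- + 2) (two b M)) p)))
    where
    two : ∀ b m → - b ≡ m + m - b + (- + 2) * m
    two = solve-∀

  -- Mirrored permutations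

  module _ (v : Mirrored n) where

    private
      w = fun v

    fun-shift⁺ : ∀ k i → w (i + + k * M) ≡ w i + + k * M
    fun-shift⁺ zero    i = trans (cong w (ℤₚ.+-identityʳ i)) (sym (ℤₚ.+-identityʳ (w i)))
    fun-shift⁺ (suc k) i = trans (cong w (one-more i (+ k) M))
      (trans (periodic v _) (trans (cong (_+ M) (fun-shift⁺ k i)) (sym (one-more (w i) (+ k) M))))
      where
      one-more : ∀ i k m → i + (+ 1 + k) * m ≡ i + k * m + m
      one-more = solve-∀

    fun-shift : ∀ k i → w (i + k * M) ≡ w i + k * M
    fun-shift (+ k) i = fun-shift⁺ k i
    fun-shift -[1+ k ] i = sym (trans (cong (λ z → w z + -[1+ k ] * M) (back i (+ suc k) M))
      (trans (cong (_+ -[1+ k ] * M) (fun-shift⁺ (suc k) (i + -[1+ k ] * M))) (forth _ (+ suc k) M)))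
      where
      back : ∀ i k m → i ≡ i + (- k) * m + k * m
      back = solve-∀
      forth : ∀ i k m → i + k * m + (- k) * m ≡ i
      forth = solve-∀

    fun-0 : w 0ℤ ≡ 0ℤ
    fun-0 = lia 1 (λ a → a :≡ :- a ⇒ ⊢ a :≡ # 0) (w 0ℤ) (odd v 0ℤ)

    fun-injective : ∀ {i j} → w i ≡ w j → i ≡ j
    fun-injective = proj₁ (bijective v)

    inverse : ℤ → ℤ
    inverse b = proj₁ (proj₂ (bijective v) b)

    fun-inverse : ∀ b → w (inverse b) ≡ b
    fun-inverse b = proj₂ (proj₂ (bijective v) b) refl

    inverse-fun : ∀ i → inverse (w i) ≡ i
    inverse-fun i = fun-injective (fun-inverse (w i))

    inverse-shift : ∀ k b → inverse (b + k * M) ≡ inverse b + k * M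
    inverse-shift k b = fun-injective (trans (fun-inverse _)
      (sym (trans (fun-shift k (inverse b)) (cong (_+ k * M) (fun-inverse b)))))

    inverse-neg : ∀ b → inverse (- b) ≡ - inverse b
    inverse-neg b = fun-injective (trans (fun-inverse _) (sym (trans (odd v (inverse b)) (cong -_ (fun-inverse b)))))

    fun-≈0 : ∀ {i} → i ≈ 0ℤ → w i ≈ 0ℤ
    fun-≈0 (by k refl) = by k (trans (fun-shift k 0ℤ) (cong (_+ k * M) fun-0))

    inverse-≈0 : ∀ {b} → b ≈ 0ℤ → inverse b ≈ 0ℤ
    inverse-≈0 (by k refl) = by k (fun-injective (trans (fun-inverse _)
      (sym (trans (fun-shift k 0ℤ) (cong (_+ k * M) fun-0)))))

    inverse-≈0⁻ : ∀ {b} → inverse b ≈ 0ℤ → b ≈ 0ℤ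
    inverse-≈0⁻ {b} p = subst (_≈ 0ℤ) (fun-inverse b) (fun-≈0 p)

    fun-≈0⁻ : ∀ {i} → w i ≈ 0ℤ → i ≈ 0ℤ
    fun-≈0⁻ {i} p = subst (_≈ 0ℤ) (inverse-fun i) (inverse-≈0 p)

    -- If b = w(j) - q M with q ≥ 0 and 1 ≤ j < M, then w⁻¹(b) = j - q M.
    bead⇒ : ∀ {b} → AtOrAboveLowest v b → ¬ b ≈ 0ℤ × inverse b < M
    bead⇒ {b} bd = let j , j∈ , p = find (Anyₚ.map⁻ bd) in go (j , p , ∈-upTo⁻ j∈)
      where
      go : ∃[ j ] (b ≤ w (+ suc j) × M ∣ w (+ suc j) - b) × j ℕ.< 2 ℕ.* n → ¬ b ≈ 0ℤ × inverse b < M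
      go (j , (b≤ , divides q eq) , j<) = b≉0 , subst (_< M) (sym inv≡) small
        where
        ι = + suc j
        b≡ : b ≡ w ι + - q * M
        b≡ = trans (lia 3 (λ b w p → w :- b :≡ p ⇒ ⊢ b :≡ w :- p) b (w ι) (q * M) eq)
            (cong (λ z → w ι + z) (ℤₚ.neg-distribˡ-* q M))
        inv≡ : inverse b ≡ ι + - q * M
        inv≡ = trans (cong inverse b≡) (trans (inverse-shift (- q) (w ι)) (cong (_+ - q * M) (inverse-fun ι)))
        ι<M : ι < M
        ι<M = +<+ (s≤s j<)
        b≉0 : ¬ b ≈ 0ℤ
        b≉0 p = between⇒≉0 (+<+ (s≤s z≤n)) ι<M (≈-trans (≈-sym (by (- q) inv≡)) (inverse-≈0 p))
        small : ι + - q * M < M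
        small = lia 4 (λ b w p m → b :≤ w ⇒ w :- b :≡ p ⇒ ⊢ # 0 :≤ p) b (w ι) (q * M) M b≤ eq |>
                λ 0≤p → subst (_< M) (cong (λ z → ι + z) (ℤₚ.neg-distribˡ-* q M))
                  (lia 3 (λ j p m → j :< m ⇒ # 0 :≤ p ⇒ ⊢ j :- p :< m) ι (q * M) M ι<M 0≤p)

    bead⇐ : ∀ {b} → ¬ b ≈ 0ℤ → inverse b < M → AtOrAboveLowest v b
    bead⇐ {b} b≉0 inv<M = go (i %ℕ N n) (n%ℕd<d i (N n)) (i /ℕ N n) (a≡a%ℕn+[a/ℕn]*n i (N n))
      where
      i = inverse b
      go : ∀ r → r ℕ.< N n → ∀ q → i ≡ + r + q * M → AtOrAboveLowest v b
      go zero r< q eq = contradiction (inverse-≈0⁻ (by q eq)) b≉0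
      go (suc r) r< q eq = lose (∈-map⁺ suc (∈-upTo⁺ (ℕ.s≤s⁻¹ r<))) (b≤ q b≡ , divides (- q) (diff b≡))
        where
        ι = + suc r
        b≡ : b ≡ w ι + q * M
        b≡ = trans (sym (fun-inverse b)) (trans (cong w eq) (fun-shift q ι))
        diff : b ≡ w ι + q * M → w ι - b ≡ - q * M
        diff refl = cancel (w ι) q M
          where
          cancel : ∀ a q m → a - (a + q * m) ≡ - q * m
          cancel = solve-∀
        0≤-ι : ι + q * M < M
        0≤-ι = subst (_< M) eq inv<M
        -- A positive multiple would push j + q M beyond M, as j ≥ 1.
        q≤0 : q * M ≤ 0ℤ
        q≤0 = multiple-≤0 q (lia 3 (λ j p m → j :+ p :< m ⇒ # 0 :< j ⇒ ⊢ p :< m) ι (q * M) M 0≤-ι (+<+ (s≤s z≤n)))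
          where
          multiple-≤0 : ∀ q → q * M < M → q * M ≤ 0ℤ
          multiple-≤0 (+ zero) _ = ℤₚ.≤-refl
          multiple-≤0 (+ suc q) lt = ⊥-elim (lia 3 (λ a p m → a :≡ m :+ p ⇒ # 0 :≤ p ⇒ a :< m ⇒ ⊢⊥) (+ suc q * M)
              (+ q * M) M
            (ℤₚ.suc-* (+ q) M) (subst (0ℤ ≤_) (ℤₚ.pos-* q (N n)) (+≤+ z≤n)) lt)
          multiple-≤0 -[1+ q ] _ = lia 2 (λ p m → p :≤ :- m ⇒ # 0 :< m ⇒ ⊢ p :≤ # 0) (-[1+ q ] * M) M
              (negative-multiple q) 0<M
        b≤ : ∀ q → b ≡ w ι + q * M → b ≤ w ι
        b≤ _ eq = lia 3 (λ b w p → b :≡ w :+ p ⇒ p :≤ # 0 ⇒ ⊢ b :≤ w) b (w ι) (q * M) b≡ q≤0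

    gap⇒ : ∀ {b} → ¬ b ≈ 0ℤ → ¬ AtOrAboveLowest v b → M < inverse b
    gap⇒ {b} b≉0 ¬bd = ℤₚ.≤∧≢⇒< (ℤₚ.≮⇒≥ (¬bd ∘ bead⇐ b≉0))
      (λ eq → b≉0 (inverse-≈0⁻ (subst (_≈ 0ℤ) eq (by (+ 1) (sym (trans (ℤₚ.+-identityˡ _) (ℤₚ.*-identityˡ M)))))))

    gap⇐ : ∀ {b} → M < inverse b → ¬ AtOrAboveLowest v b
    gap⇐ lt bd = ℤₚ.<-asym lt (proj₂ (bead⇒ bd))

    inverse-opposite : ∀ b → inverse (opposite b) ≡ M + M - inverse b
    inverse-opposite b = trans (cong inverse (two b M)) (trans (inverse-shift (+ 2) (- b))
      (trans (cong (_+ + 2 * M) (inverse-neg b)) (sym (two (inverse b) M))))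
      where
      two : ∀ b m → m + m - b ≡ - b + + 2 * m
      two = solve-∀

    bead-opposite : ∀ {b} → AtOrAboveLowest v b → ¬ AtOrAboveLowest v (opposite b)
    bead-opposite {b} bd bd′ = lia 3 (λ i j m → j :≡ m :+ m :- i ⇒ i :< m ⇒ j :< m ⇒ ⊢⊥) (inverse b)
        (inverse (opposite b)) M
      (inverse-opposite b) (proj₂ (bead⇒ bd)) (proj₂ (bead⇒ bd′))

    gap-opposite : ∀ {b} → ¬ b ≈ 0ℤ → ¬ AtOrAboveLowest v b → AtOrAboveLowest v (opposite b)
    gap-opposite {b} b≉0 ¬bd = bead⇐ (opposite-≉0 b≉0)
      (lia 3 (λ i j m → j :≡ m :+ m :- i ⇒ m :< i ⇒ ⊢ j :< m) (inverse b) (inverse (opposite b)) M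
        (inverse-opposite b) (gap⇒ b≉0 ¬bd))

    bead-lower : ∀ {b} → AtOrAboveLowest v (b + M) → AtOrAboveLowest v b
    bead-lower {b} bd = bead⇐ (λ p → proj₁ (bead⇒ bd) (≈-trans (by (+ 1)
        (cong (λ z → b + z) (sym (ℤₚ.*-identityˡ M)))) p))
      (lia 3 (λ i j m → j :≡ i :+ m ⇒ j :< m ⇒ # 0 :< m ⇒ ⊢ i :< m) (inverse b) (inverse (b + M)) M
        (trans (cong (λ z → inverse (b + z)) (sym (ℤₚ.*-identityˡ M)))
            (trans (inverse-shift (+ 1) b) (cong (λ z → inverse b + z) (ℤₚ.*-identityˡ M))))
        (proj₂ (bead⇒ bd)) 0<M)

    -- Flushness: along a runner w⁻¹ is increasing.
    bead-≈-≤ : ∀ {b c} → c ≈ b → c ≤ b → AtOrAboveLowest v b → AtOrAboveLowest v c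
    bead-≈-≤ {b} {c} (by k eq) c≤b bd = bead⇐ (λ p → proj₁ (bead⇒ bd) (≈-trans (≈-sym (by k eq)) p))
      (lia 5 (λ b c p i j → c :≡ b :+ p ⇒ j :≡ i :+ p ⇒ c :≤ b ⇒ ⊢ j :≤ i) b c (k * M) (inverse b) (inverse c)
        eq (trans (cong inverse eq) (inverse-shift k b)) c≤b |> λ le → ℤₚ.≤-<-trans le (proj₂ (bead⇒ bd)))

  -- Rows and diagonals of a partition.

  ∈-range⁺ : ∀ {i k} → 1 ℕ.≤ i → i ℕ.≤ k → i ∈ range k
  ∈-range⁺ {suc i} _ i≤k = ∈-map⁺ suc (∈-upTo⁺ i≤k)

  ∈-range⁻ : ∀ {i k} → i ∈ range k → 1 ℕ.≤ i × i ℕ.≤ k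
  ∈-range⁻ i∈ with ∈-map⁻ suc i∈
  ... | j , j∈ , refl = s≤s z≤n , ∈-upTo⁻ j∈

  length-range : ∀ k → length (range k) ≡ k
  length-range k = trans (Listₚ.length-map suc (upTo k)) (Listₚ.length-upTo k)

  range-unique : ∀ k → Unique (range k)
  range-unique k = Uniqueₚ.map⁺ ℕₚ.suc-injective (Uniqueₚ.upTo⁺ k)

  rowLength-≥ : ∀ {c ps qs} i → All (c ℕ.≤_) ps → 1 ℕ.≤ i → i ℕ.≤ length ps → c ℕ.≤ rowLength (ps ++ qs) i
  rowLength-≥ (suc zero)    (p ∷ ps) _ _        = p
  rowLength-≥ (suc (suc i)) (p ∷ ps) _ (s≤s lt) = rowLength-≥ (suc i) ps (s≤s z≤n) lt

  rowLength-≤ : ∀ {c qs} ps i → All (ℕ._≤ c) qs → length ps ℕ.< i → rowLength (ps ++ qs) i ℕ.≤ c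
  rowLength-≤ {qs = []}     []       i             []       _ = z≤n
  rowLength-≤ {qs = _ ∷ _}  []       (suc zero)    (q ∷ _)  _ = q
  rowLength-≤ {qs = _ ∷ _}  []       (suc (suc i)) (_ ∷ qs) _ = rowLength-≤ [] (suc i) qs (s≤s z≤n)
  rowLength-≤ (p ∷ ps) (suc (suc i)) qs (s≤s lt) = rowLength-≤ ps (suc i) qs lt

  rowLength-at : ∀ ps {p qs} → rowLength (ps ++ p ∷ qs) (suc (length ps)) ≡ p
  rowLength-at []           = refl
  rowLength-at (_ ∷ ps) = rowLength-at ps

  -- Row i meets the k-th diagonal iff i + k is at most its length. With l long rows in front this
  -- holds up to i = l; a later row has i ≥ l + 1, so a length of exactly l + k is still too short.
  diagonalLength-++ : ∀ k ps {qs} → All (length ps ℕ.+ k ℕ.≤_) ps → All (ℕ._≤ length ps ℕ.+ k) qs →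
                      diagonalLength k (ps ++ qs) ≡ length ps
  diagonalLength-++ k ps {qs} large small = trans
    (same-members-length (Uniqueₚ.filter⁺ P? (range-unique (length (ps ++ qs)))) (range-unique (length ps)) to from)
    (length-range (length ps))
    where
    P? = λ i → i ℕ.+ k ℕₚ.≤? rowLength (ps ++ qs) i
    to : ∀ {i} → i ∈ filter P? (range (length (ps ++ qs))) → i ∈ range (length ps)
    to {i} i∈ with filter⁻ P? (range (length (ps ++ qs))) i∈
    ... | i∈′ , le = ∈-range⁺ (proj₁ (∈-range⁻ i∈′))
      (ℕₚ.≮⇒≥ λ lt → ℕₚ.<-irrefl refl (ℕₚ.<-≤-trans (ℕₚ.+-monoˡ-< k lt) (ℕₚ.≤-trans le (rowLength-≤ ps i small lt))))
    from : ∀ {i} → i ∈ range (length ps) → i ∈ filter P? (range (length (ps ++ qs)))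
    from {i} i∈ with ∈-range⁻ i∈
    ... | 1≤i , i≤ = ∈-filter⁺ P? (∈-range⁺ 1≤i (ℕₚ.≤-trans i≤ (ℕₚ.≤-trans (ℕₚ.m≤m+n _ _)
        (ℕₚ.≤-reflexive (sym (Listₚ.length-++ ps))))))
      (ℕₚ.≤-trans (ℕₚ.+-monoˡ-≤ k i≤) (rowLength-≥ i large 1≤i i≤))

  -- The peeled row belongs to the lowest bead beyond the label `base`.
  referenceLevel : End → ℤ
  referenceLevel e = M + + referenceDiagonal e

  base : ℤ
  base = referenceLevel (left ty)

  κ : ℕ
  κ = referenceDiagonal (left ty)

  M≤level : ∀ e → M ≤ referenceLevel e
  M≤level C = lia 1 (λ m → ⊢ m :≤ m :+ # 0) M
  M≤level D = lia 1 (λ m → ⊢ m :≤ m :+ # 1) M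

  level≤M+1 : ∀ e → referenceLevel e ≤ M + + 1
  level≤M+1 C = lia 1 (λ m → ⊢ m :+ # 0 :≤ m :+ # 1) M
  level≤M+1 D = lia 1 (λ m → ⊢ m :+ # 1 :≤ m :+ # 1) M

  0≤base : 0ℤ ≤ base
  0≤base = ℤₚ.≤-trans (ℤₚ.<⇒≤ 0<M) (M≤level (left ty))

  M≈0 : M ≈ 0ℤ
  M≈0 = by (+ 1) (sym (trans (ℤₚ.+-identityˡ _) (ℤₚ.*-identityˡ M)))

  2M≈0 : M + M ≈ 0ℤ
  2M≈0 = by (+ 2) (twice M)
    where
    twice : ∀ m → m + m ≡ 0ℤ + + 2 * m
    twice = solve-∀

  between-M⇒≉0 : ∀ {z} → M < z → z < M + M → ¬ z ≈ 0ℤ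
  between-M⇒≉0 {z} lo hi p = between⇒≉0 {z - M} (lia 2 (λ z m → m :< z ⇒ ⊢ # 0 :< z :- m) z M lo)
    (lia 2 (λ z m → z :< m :+ m ⇒ ⊢ z :- m :< m) z M hi)
    (≈-substʳ (ℤₚ.+-inverseʳ M) (≈-+ (- M) (≈-trans p (≈-sym M≈0))))

  M+1≉0 : ¬ M + + 1 ≈ 0ℤ
  M+1≉0 = between-M⇒≉0 (lia 1 (λ m → ⊢ m :< m :+ # 1) M) (lia 2 (λ m v → m :≡ # 1 :+ 2 :* v ⇒ # 2 :≤ v ⇒ ⊢ m :+ # 1 :<
      m :+ m) M ν M≡ 2≤ν)

  -- The reference bead and its row.

  module _ (v : Mirrored n) where

    private
      a = 𝒜 v

    record Reference (b : ℤ) : Set where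
      field
        base<b : base < b
        bead   : AtOrAboveLowest v b
        b≉0    : ¬ b ≈ 0ℤ
        least  : ∀ {x} → ¬ x ≈ 0ℤ → AtOrAboveLowest v x → base < x → b ≤ x

    referenceBeads : List ℤ
    referenceBeads = beadsAbove a base

    snoc-reference : ∀ {xs b} → referenceBeads ≡ xs ∷ʳ b → Reference b
    snoc-reference {xs} {b} eq = record
      { base<b = proj₁ b∈
      ; bead   = proj₁ (proj₂ b∈)
      ; b≉0    = Entry⇒≉0 (proj₂ (proj₂ b∈))
      ; least  = λ {x} x≉0 bd lt → least′ (subst (x ∈_) eq (∈-beadsAbove⁺ a 0≤base lt (≉0⇒Entry x≉0) bd))
      }
      where
      b∈ = ∈-beadsAbove⁻ a (subst (b ∈_) (sym eq) (∈-++⁺ʳ xs (here refl)))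
      sorted : AllPairs ℤ._>_ (xs ∷ʳ b)
      sorted = subst (AllPairs ℤ._>_) eq (beadsAbove-sorted a base)
      last-least : ∀ ys {x} → AllPairs ℤ._>_ (ys ∷ʳ b) → x ∈ ys ∷ʳ b → b ≤ x
      last-least [] _ (here refl) = ℤₚ.≤-refl
      last-least (y ∷ ys) (y> ∷ s) (here refl) = ℤₚ.<⇒≤ (All.lookup y> (∈-++⁺ʳ ys (here refl)))
      last-least (y ∷ ys) (y> ∷ s) (there x∈) = last-least ys s x∈
      least′ : ∀ {x} → x ∈ xs ∷ʳ b → b ≤ x
      least′ = last-least xs sorted

    -- `opposite` reflects the labels in M and interchanges beads and gaps: the abacus is balanced
    -- at M.
    count-opposite : gapsBelow a M ≡ length (beadsAbove a M)
    count-opposite = bijection-length opposite opposite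
      (Uniqueₚ.filter⁺ (ℤₚ._<? M) (gaps-unique a)) (beadsAbove-unique a M) to from
      (λ {x} _ → twice x) (λ {x} _ → twice x)
      where
      twice : ∀ x → opposite (opposite x) ≡ x
      twice x = lia 2 (λ x m → ⊢ m :+ m :- (m :+ m :- x) :≡ x) x M
      to : ∀ {x} → x ∈ filter (ℤₚ._<? M) (gaps a) → opposite x ∈ beadsAbove a M
      to {x} x∈ = let x∈′ , x<M = filter⁻ (ℤₚ._<? M) (gaps a) x∈
                      ¬bd , e , _ = ∈-gaps⁻ a x∈′
                  in ∈-beadsAbove⁺ a (ℤₚ.<⇒≤ 0<M) (lia 2 (λ x m → x :< m ⇒ ⊢ m :< m :+ m :- x) x M x<M)
                       (≉0⇒Entry (opposite-≉0 (Entry⇒≉0 e))) (gap-opposite v (Entry⇒≉0 e) ¬bd)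
      from : ∀ {x} → x ∈ beadsAbove a M → opposite x ∈ filter (ℤₚ._<? M) (gaps a)
      from {x} x∈ = let M<x , bd , e = ∈-beadsAbove⁻ a x∈
                        small = lia 2 (λ x m → m :< x ⇒ ⊢ m :+ m :- x :< m) x M M<x
                    in ∈-filter⁺ (ℤₚ._<? M) (∈-gaps⁺ a
                         (ℤₚ.≤-trans (ℤₚ.<⇒≤ small) (ℤₚ.≤-trans (ℤₚ.<⇒≤ M<x) (above a x bd)))
                         (≉0⇒Entry (opposite-≉0 (Entry⇒≉0 e))) (bead-opposite v bd)) small

    beadsAbove-M+1 : AtOrAboveLowest v (M + + 1) → length (beadsAbove a M) ≡ length (beadsAbove a (M + + 1)) ℕ.+ 1
    beadsAbove-M+1 bd = trans
      (filter-split-length (M ℤₚ.<?_) (M + + 1 ℤₚ.<?_) (beads↓ a) λ {x} lt → lia 2 (λ x m → m :+ # 1 :< x ⇒ ⊢ m :< x)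
          x M lt)
      (cong (length (beadsAbove a (M + + 1)) ℕ.+_) (same-members-length {ys = M + + 1 ∷ []}
        (Uniqueₚ.filter⁺ (λ x → ¬? (M + + 1 ℤₚ.<? x)) (beadsAbove-unique a M)) ([] ∷ [])
        (λ {x} x∈ → let x∈′ , ≮ = filter⁻ (λ x → ¬? (M + + 1 ℤₚ.<? x)) (beadsAbove a M) x∈
                        lt , _ = ∈-beadsAbove⁻ a x∈′
                    in here (lia 2 (λ x m → m :< x ⇒ x :≤ m :+ # 1 ⇒ ⊢ x :≡ m :+ # 1) x M lt (ℤₚ.≮⇒≥ ≮)))
        (λ { (here refl) → ∈-filter⁺ (λ x → ¬? (M + + 1 ℤₚ.<? x))
               (∈-beadsAbove⁺ a (ℤₚ.<⇒≤ 0<M) (lia 1 (λ m → ⊢ m :< m :+ # 1) M) (≉0⇒Entry M+1≉0) bd) (ℤₚ.<-irrefl refl)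
                   })))

    beadsAbove-M+1-gap : ¬ AtOrAboveLowest v (M + + 1) → length (beadsAbove a M) ≡ length (beadsAbove a (M + + 1))
    beadsAbove-M+1-gap ¬bd = filter-length-cong (M ℤₚ.<?_) (M + + 1 ℤₚ.<?_) (beads↓ a)
      (λ {x} x∈ lt → ℤₚ.≤∧≢⇒< (lia 2 (λ x m → m :< x ⇒ ⊢ m :+ # 1 :≤ x) x M lt)
                       λ { refl → ¬bd (proj₁ (∈-beads↓⁻ a x∈)) })
      (λ {x} _ lt → lia 2 (λ x m → m :+ # 1 :< x ⇒ ⊢ m :< x) x M lt)

    module _ {c} (bd : AtOrAboveLowest v c) where

      -- For end C this is `count-opposite`, M being no entry. For end D the label M + 1 accounts
      -- for the extra one in either case: as a bead it is missing from the list on the right, as a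
      -- gap it is counted on the left.
      count-level : ∀ e → referenceLevel e < c →
        gapsBelow a (referenceLevel e + + 1) ≡ length (beadsAbove a (referenceLevel e)) ℕ.+ referenceDiagonal e
      count-level C lt = trans (trans (filter-length-cong (ℤₚ._<? M + 0ℤ + + 1) (ℤₚ._<? M) (gaps a)
          (λ {x} x∈ le → ℤₚ.≤∧≢⇒< (lia 2 (λ x m → x :< m :+ # 0 :+ # 1 ⇒ ⊢ x :≤ m) x M le)
              λ { refl → proj₁ (proj₂ (∈-gaps⁻ a x∈)) (≈0⇒∣ M≈0) })
          (λ {x} _ le → lia 2 (λ x m → x :< m ⇒ ⊢ x :< m :+ # 0 :+ # 1) x M le)) count-opposite)
        (trans (cong (λ z → length (beadsAbove a z)) (sym (ℤₚ.+-identityʳ M))) (sym (ℕₚ.+-identityʳ _)))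
      count-level D lt with bead? a (M + + 1)
      ... | yes bd₁ = trans (trans (filter-length-cong (ℤₚ._<? M + + 1 + + 1) (ℤₚ._<? M) (gaps a)
          (λ {x} x∈ le → ℤₚ.≤∧≢⇒< (lia 2 (λ x m → x :< m :+ # 1 ⇒ ⊢ x :≤ m) x M
                            (ℤₚ.≤∧≢⇒< (lia 2 (λ x m → x :< m :+ # 1 :+ # 1 ⇒ ⊢ x :≤ m :+ # 1) x M le)
                                λ { refl → proj₁ (∈-gaps⁻ a x∈) bd₁ }))
                           λ { refl → proj₁ (proj₂ (∈-gaps⁻ a x∈)) (≈0⇒∣ M≈0) })
          (λ {x} _ le → lia 2 (λ x m → x :< m ⇒ ⊢ x :< m :+ # 1 :+ # 1) x M le)) count-opposite) (beadsAbove-M+1 bd₁)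
      ... | no ¬bd₁ = trans (filter-split-length (ℤₚ._<? M + + 1 + + 1) (ℤₚ._<? M) (gaps a) λ {x} le → lia 2
          (λ x m → x :< m ⇒ ⊢ x :< m :+ # 1 :+ # 1) x M le)
          (cong₂ ℕ._+_ (trans count-opposite (beadsAbove-M+1-gap ¬bd₁))
            (same-members-length {ys = M + + 1 ∷ []}
              (Uniqueₚ.filter⁺ (λ x → ¬? (x ℤₚ.<? M)) (Uniqueₚ.filter⁺ (ℤₚ._<? M + + 1 + + 1) (gaps-unique a)))
                  ([] ∷ [])
              (λ {x} x∈ → let x∈′ , ≮ = filter⁻ (λ x → ¬? (x ℤₚ.<? M)) (filter (ℤₚ._<? M + + 1 + + 1) (gaps a)) x∈
                              x∈″ , le = filter⁻ (ℤₚ._<? M + + 1 + + 1) (gaps a) x∈′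
                          in here (lia 2 (λ x m → m :< x ⇒ x :< m :+ # 1 :+ # 1 ⇒ ⊢ x :≡ m :+ # 1) x M
                               (ℤₚ.≤∧≢⇒< (ℤₚ.≮⇒≥ ≮) λ { refl → proj₁ (proj₂ (∈-gaps⁻ a x∈″)) (≈0⇒∣ M≈0) }) le))
              -- The bead c beyond M + 1 guarantees that M + 1 lies in the window.
              (λ { (here refl) → ∈-filter⁺ (λ x → ¬? (x ℤₚ.<? M)) (∈-filter⁺ (ℤₚ._<? M + + 1 + + 1)
                     (∈-gaps⁺ a (ℤₚ.≤-trans (ℤₚ.<⇒≤ lt) (above a c bd)) (≉0⇒Entry M+1≉0) ¬bd₁)
                     (lia 1 (λ m → ⊢ m :+ # 1 :< m :+ # 1 :+ # 1) M)) (λ lt → lia 1 (λ m → m :+ # 1 :< m ⇒ ⊢⊥) M lt)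
                         })))

    gapsBelow-mono : ∀ {x y} → x ≤ y → gapsBelow a x ℕ.≤ gapsBelow a y
    gapsBelow-mono {x} {y} x≤y = filter-length-mono (ℤₚ._<? x) (ℤₚ._<? y) (gaps a) λ _ lt → ℤₚ.<-≤-trans lt x≤y

    private
      L = referenceBeads
      rest = filter (λ x → ¬? (base ℤₚ.<? x)) (beads↓ a)

    module _ {xs b} (eq : L ≡ xs ∷ʳ b) where

      private
        ref = snoc-reference eq
        open Reference ref
        e = length L

      level-count : gapsBelow a (base + + 1) ≡ e ℕ.+ κ
      level-count = count-level bead (left ty) base<b

      1≤e : 1 ℕ.≤ e
      1≤e = subst (1 ℕ.≤_) (sym (trans (cong length eq) (Listₚ.length-++ xs))) (ℕₚ.m≤n+m 1 (length xs))

      referenceRows-large : All (e ℕ.+ κ ℕ.≤_) (map (gapsBelow a) L)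
      referenceRows-large = Allₚ.map⁺ (All.tabulate λ {x} x∈ → subst (ℕ._≤ gapsBelow a x) level-count
        (gapsBelow-mono (lia 2 (λ r x → r :< x ⇒ ⊢ r :+ # 1 :≤ x) base x (proj₁ (∈-beadsAbove⁻ a x∈)))))

      otherRows-small : All (ℕ._≤ e ℕ.+ κ) (map (gapsBelow a) rest)
      otherRows-small = Allₚ.map⁺ (All.tabulate λ {x} x∈ → subst (gapsBelow a x ℕ.≤_) level-count
        (gapsBelow-mono (lia 2 (λ r x → x :≤ r ⇒ ⊢ x :≤ r :+ # 1) base x
            (ℤₚ.≮⇒≥ (proj₂ (filter⁻ (λ x → ¬? (base ℤₚ.<? x)) (beads↓ a) x∈))))))

      lowerRows : List ℕ
      lowerRows = filter (1 ℕₚ.≤?_) (map (gapsBelow a) rest)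

      partition-split : partition a ≡ map (gapsBelow a) L ++ lowerRows
      partition-split = trans (cong (λ bs → filter (1 ℕₚ.≤?_) (map (gapsBelow a) bs))
          (descending-split base (beads↓-sorted a)))
        (trans (cong (filter (1 ℕₚ.≤?_)) (Listₚ.map-++ (gapsBelow a) L rest))
          (trans (Listₚ.filter-++ (1 ℕₚ.≤?_) (map (gapsBelow a) L) (map (gapsBelow a) rest))
            (cong (_++ lowerRows) (Listₚ.filter-all (1 ℕₚ.≤?_) (All.map (ℕₚ.≤-trans (ℕₚ.≤-trans 1≤e (ℕₚ.m≤m+n e κ)))
                referenceRows-large)))))

      -- By `level-count` the e rows of the reference beads have at least e + κ boxes and all other
      -- rows at most that many, so the κ-th diagonal ends in row e, the row of the lowest reference
      -- bead.
      diagonal-count : diagonalLength κ (partition a) ≡ e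
      diagonal-count = trans (cong (diagonalLength κ) partition-split)
        (trans (diagonalLength-++ κ (map (gapsBelow a) L)
          (subst (λ l → All (l ℕ.+ κ ℕ.≤_) (map (gapsBelow a) L)) (sym (Listₚ.length-map (gapsBelow a) L))
              referenceRows-large)
          (subst (λ l → All (ℕ._≤ l ℕ.+ κ) lowerRows) (sym (Listₚ.length-map (gapsBelow a) L))
              (Allₚ.filter⁺ (1 ℕₚ.≤?_) otherRows-small)))
         (Listₚ.length-map (gapsBelow a) L))

      shape-nonempty : partition a ≢ []
      shape-nonempty eq′ = ℕₚ.<⇒≢ 1≤e (trans (sym (cong (diagonalLength κ) eq′)) diagonal-count)

      reference-row : rowLength (partition a) e ≡ gapsBelow a b
      reference-row = trans (cong₂ rowLength split′ e≡) (rowLength-at (map (gapsBelow a) xs))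
        where
        split′ : partition a ≡ map (gapsBelow a) xs ++ gapsBelow a b ∷ lowerRows
        split′ = trans partition-split (trans (cong (λ l → map (gapsBelow a) l ++ lowerRows) eq)
          (trans (cong (_++ lowerRows) (Listₚ.map-++ (gapsBelow a) xs (b ∷ [])))
              (Listₚ.++-assoc (map (gapsBelow a) xs) _ lowerRows)))
        e≡ : e ≡ suc (length (map (gapsBelow a) xs))
        e≡ = trans (cong length eq) (trans (Listₚ.length-++ xs) (trans (ℕₚ.+-comm (length xs) 1)
            (cong suc (sym (Listₚ.length-map (gapsBelow a) xs)))))

      -- All entries beyond `base` and before b are gaps, since b is the lowest reference bead. The
      -- bound hi is b itself except for b = 2M + 1; there hi = 2M omits the label 2M, which is no
      -- entry.
      gaps-before : ∀ hi → base < hi → hi ≤ b → hi ≤ M + M →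
        (∀ {z} → hi ≤ z → z < b → z ≈ 0ℤ) → + gapsBelow a b ≡ + e + + κ + (hi - base - + 1)
      gaps-before hi base<hi hi≤b hi≤2M blank = begin
        + gapsBelow a b                                 ≡⟨ cong +_
            (filter-split-length (ℤₚ._<? b) (ℤₚ._<? base + + 1) (gaps a)
                                                             λ {x} lt → lia 3 (λ x r b → x :< r :+ # 1 ⇒ r :< b ⇒ ⊢ x
                                                                 :< b) x base b lt base<b) ⟩
        + (gapsBelow a (base + + 1) ℕ.+ length middle)  ≡⟨ cong₂ (λ x y → + (x ℕ.+ y)) level-count middle-length ⟩
        + e + + κ + + h                                 ≡⟨ cong (λ z → + e + + κ + z) +h ⟩
        + e + + κ + (hi - base - + 1)                   ∎
        where
        open ≡-Reasoning
        ≮base? = λ x → ¬? (x ℤₚ.<? base + + 1)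
        middle = filter ≮base? (filter (ℤₚ._<? b) (gaps a))
        h = ∣ hi - base - + 1 ∣
        +h : + h ≡ hi - base - + 1
        +h = ℤₚ.0≤i⇒+∣i∣≡i (lia 2 (λ r h → r :< h ⇒ ⊢ # 0 :≤ h :- r :- # 1) base hi base<hi)
        label : ℕ → ℤ
        label i = base + + 1 + + i
        middle-length : length middle ≡ h
        middle-length = trans (same-members-length
            (Uniqueₚ.filter⁺ ≮base? (Uniqueₚ.filter⁺ (ℤₚ._<? b) (gaps-unique a)))
            (Uniqueₚ.map⁺ {f = label} (λ {i} {j} p → ℤₚ.+-injective
                (lia 3 (λ r i j → r :+ # 1 :+ i :≡ r :+ # 1 :+ j ⇒ ⊢ i :≡ j) base (+ i) (+ j) p)) (Uniqueₚ.upTo⁺ h))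
            to from)
          (trans (Listₚ.length-map label (upTo h)) (Listₚ.length-upTo h))
          where
          to : ∀ {x} → x ∈ middle → x ∈ map label (upTo h)
          to {x} x∈ = subst (_∈ map label (upTo h)) x≡ (∈-map⁺ label (∈-upTo⁺ i<h))
            where
            x∈′ = filter⁻ ≮base? (filter (ℤₚ._<? b) (gaps a)) x∈
            x∈″ = filter⁻ (ℤₚ._<? b) (gaps a) (proj₁ x∈′)
            lo : base + + 1 ≤ x
            lo = ℤₚ.≮⇒≥ (proj₂ x∈′)
            x<hi : x < hi
            x<hi = ℤₚ.≰⇒> λ hi≤x → proj₁ (proj₂ (∈-gaps⁻ a (proj₁ x∈″))) (≈0⇒∣ (blank hi≤x (proj₂ x∈″)))
            i = ∣ x - base - + 1 ∣
            +i : + i ≡ x - base - + 1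
            +i = ℤₚ.0≤i⇒+∣i∣≡i (lia 2 (λ r x → r :+ # 1 :≤ x ⇒ ⊢ # 0 :≤ x :- r :- # 1) base x lo)
            x≡ : label i ≡ x
            x≡ = lia 3 (λ r x i → i :≡ x :- r :- # 1 ⇒ ⊢ r :+ # 1 :+ i :≡ x) base x (+ i) +i
            i<h : i ℕ.< h
            i<h = ℤₚ.drop‿+<+ (subst₂ _<_ (sym +i) (sym +h) (lia 3
                (λ r x h → x :< h ⇒ ⊢ x :- r :- # 1 :< h :- r :- # 1) base x hi x<hi))
          from : ∀ {x} → x ∈ map label (upTo h) → x ∈ middle
          from x∈ with ∈-map⁻ label x∈
          ... | i , i∈ , refl = ∈-filter⁺ ≮base? (∈-filter⁺ (ℤₚ._<? b)
              (∈-gaps⁺ a (ℤₚ.≤-trans (ℤₚ.<⇒≤ x<b) (above a b bead)) (≉0⇒Entry x≉0)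
              (λ bd → ℤₚ.<-irrefl refl (ℤₚ.<-≤-trans x<b (least x≉0 bd base<x)))) x<b)
                  (ℤₚ.≤⇒≯ (lia 2 (λ r i → # 0 :≤ i ⇒ ⊢ r :+ # 1 :≤ r :+ # 1 :+ i) base (+ i) (+≤+ z≤n)))
            where
            x = label i
            base<x : base < x
            base<x = lia 2 (λ r i → # 0 :≤ i ⇒ ⊢ r :< r :+ # 1 :+ i) base (+ i) (+≤+ z≤n)
            x<hi : x < hi
            x<hi = lia 4 (λ r i h hi → i :< h ⇒ h :≡ hi :- r :- # 1 ⇒ ⊢ r :+ # 1 :+ i :< hi) base (+ i) (+ h) hi
                (+<+ (∈-upTo⁻ i∈)) +h
            x<b : x < b
            x<b = ℤₚ.<-≤-trans x<hi hi≤b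
            x≉0 : ¬ x ≈ 0ℤ
            x≉0 = between-M⇒≉0 (ℤₚ.≤-<-trans (M≤level (left ty)) base<x) (ℤₚ.<-≤-trans x<hi hi≤2M)

  -- Residues at the end of a row.

  2≤n : 2 ℕ.≤ n
  2≤n = ℕₚ.≤-trans (2≤minRank ty) rank≤n

  ∥-value : ∀ d {p r} q → p ≡ + r + q * + d → r ℕ.< d → p ∥ d ≡ r
  ∥-value (suc d) {r = r} q refl r<d = remainder-unique (suc d) r q r<d

  bandAt : ℕ → Maybe (Fin 3)
  bandAt 0 = just zero
  bandAt 1 = just (suc zero)
  bandAt 2 = just (suc (suc zero))
  bandAt _ = nothing

  bandPosition-at : ∀ s d → bandPosition n s d ≡ bandAt ((+ d - + s) ∥ (2 ℕ.* n))
  bandPosition-at s d with (+ d - + s) ∥ (2 ℕ.* n)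
  ... | 0 = refl
  ... | 1 = refl
  ... | 2 = refl
  ... | suc (suc (suc _)) = refl

  bandAt-≥3 : ∀ {r} → 3 ℕ.≤ r → bandAt r ≡ nothing
  bandAt-≥3 (s≤s (s≤s (s≤s _))) = refl

  bandPosition-value : ∀ s d {r} q → + d - + s ≡ + r + q * + (2 ℕ.* n) → r ℕ.< 2 ℕ.* n → bandPosition n s d ≡ bandAt r
  bandPosition-value s d q eq r< = trans (bandPosition-at s d) (cong bandAt (∥-value (2 ℕ.* n) q eq r<))

  suc≢ᵇ : ∀ i → (suc i ≡ᵇ i) ≡ false
  suc≢ᵇ i = ≡ᵇ-false {suc i} {i} ℕₚ.1+n≢n

  ≡ᵇ-+ : ∀ i k → (k ℕ.+ i ≡ᵇ i ℕ.+ k) ≡ true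
  ≡ᵇ-+ i k = ≡ᵇ-true (ℕₚ.+-comm k i)

  -- The residue of a band's cell at the end of its row.
  rowEnd : (p q : ℕ) → Fin 3 → Residue
  rowEnd p q zero            = one p
  rowEnd p q (suc zero)      = one q
  rowEnd p q (suc (suc zero)) = both p q

  -- The cell is the last one of its row, so c₁ lies `pos` columns to its left and only the branch
  -- for a row ending at this cell applies.
  threeCells-end : ∀ p q pos ℓ → toℕ pos ℕ.≤ ℓ → lookup (threeCells p q (ℓ ∸ toℕ pos) ℓ) pos ≡ rowEnd p q pos
  threeCells-end p q zero ℓ _ rewrite suc≢ᵇ ℓ | ≡ᵇ-true {ℓ} refl = refl
  threeCells-end p q (suc zero) (suc ℓ) _
    rewrite ≡ᵇ-false {suc (suc ℓ)} {ℓ} (λ eq → ℕₚ.<⇒≢ (s≤s (ℕₚ.n≤1+n ℓ)) (sym eq))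
          | suc≢ᵇ ℓ | ≡ᵇ-+ ℓ 1 = refl
  threeCells-end p q (suc (suc zero)) (suc zero) (s≤s ())
  threeCells-end p q (suc (suc zero)) (suc (suc ℓ)) _
    rewrite ≡ᵇ-false {suc (suc (suc ℓ))} {ℓ} (λ eq → ℕₚ.<⇒≢ (s≤s (ℕₚ.≤-trans (ℕₚ.n≤1+n ℓ) (ℕₚ.n≤1+n _))) (sym eq))
          | ≡ᵇ-false {suc (suc ℓ)} {ℓ} (λ eq → ℕₚ.<⇒≢ (s≤s (ℕₚ.n≤1+n ℓ)) (sym eq))
          | ≡ᵇ-false {suc (suc ℓ)} {ℓ ℕ.+ 1} (λ eq → ℕₚ.<⇒≢ (ℕₚ.≤-reflexive (cong suc (ℕₚ.+-comm ℓ 1))) (sym eq))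
          | ≡ᵇ-+ ℓ 2 = refl

  module _ (ps : Partition) (e c : ℕ) (1≤e : 1 ℕ.≤ e) (row : rowLength ps e ≡ e ℕ.+ c) where

    cell : Cell
    cell = e , e ℕ.+ c

    content-cell : content cell ≡ + c
    content-cell = lia 2 (λ e c → ⊢ e :+ c :- e :≡ c) (+ e) (+ c)

    bandResidue-end : ∀ p q pos → 1 ℕ.≤ c → toℕ pos ℕ.≤ e ℕ.+ c → bandResidue p q ps pos cell ≡ rowEnd p q pos
    bandResidue-end p q pos 1≤c le = trans
      (cong (if_then lookup (threeCells p q (e ℕ.+ c ∸ toℕ pos) (rowLength ps e)) pos
             else lookup (threeCells p q (e ∸ toℕ pos) (columnLength ps (e ℕ.+ c))) pos)
        (true-of (ℕₚ.<⇒<ᵇ (subst (ℕ._≤ e ℕ.+ c) (ℕₚ.+-comm e 1) (ℕₚ.+-monoʳ-≤ e 1≤c)))))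
      (trans (cong (λ ℓ → lookup (threeCells p q (e ℕ.+ c ∸ toℕ pos) ℓ) pos) row)
          (threeCells-end p q pos (e ℕ.+ c) le))

    escalator : Maybe (Fin 3) → Maybe Residue
    escalator (just pos) = just (bandResidue (n ∸ 1) n ps pos cell)
    escalator nothing    = nothing

    escalatorResidue-at : escalatorResidue n ps cell ≡ escalator (bandPosition n (n ∸ 1) c)
    escalatorResidue-at = trans raw (cong (λ z → escalator (bandPosition n (n ∸ 1) ∣ z ∣)) content-cell)
      where
      raw : escalatorResidue n ps cell ≡ escalator (bandPosition n (n ∸ 1) ∣ content cell ∣)
      raw with bandPosition n (n ∸ 1) ∣ content cell ∣
      ... | just _  = refl
      ... | nothing = refl

    descalator : Bool → Maybe (Fin 3) → Maybe Residue
    descalator true  _          = just (mainResidue cell)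
    descalator false (just pos) = just (bandResidue 1 0 ps pos cell)
    descalator false nothing    = nothing

    descalatorResidue-at : descalatorResidue n ps cell ≡ descalator (c ≤ᵇ 1) (bandPosition n (2 ℕ.* n ∸ 1) c)
    descalatorResidue-at = trans raw (cong (λ z → descalator (∣ z ∣ ≤ᵇ 1) (bandPosition n (2 ℕ.* n ∸ 1) ∣ z ∣))
        content-cell)
      where
      raw : descalatorResidue n ps cell ≡ descalator (∣ content cell ∣ ≤ᵇ 1)
          (bandPosition n (2 ℕ.* n ∸ 1) ∣ content cell ∣)
      raw with ∣ content cell ∣ ≤ᵇ 1 | bandPosition n (2 ℕ.* n ∸ 1) ∣ content cell ∣
      ... | true  | _       = refl
      ... | false | just _  = refl
      ... | false | nothing = refl

    +[n∸1] : + (n ∸ 1) ≡ ν - + 1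
    +[n∸1] = trans (sym (ℤₚ.⊖-≥ (ℕₚ.≤-trans (s≤s z≤n) 2≤n))) (sym (ℤₚ.m-n≡m⊖n n 1))

    +2n : + (2 ℕ.* n) ≡ + 2 * ν
    +2n = ℤₚ.pos-* 2 n

    +[2n∸1] : + (2 ℕ.* n ∸ 1) ≡ + 2 * ν - + 1
    +[2n∸1] = trans (sym (ℤₚ.⊖-≥ (ℕₚ.≤-trans (s≤s z≤n) (ℕₚ.≤-trans 2≤n (ℕₚ.m≤m+n n _)))))
        (trans (sym (ℤₚ.m-n≡m⊖n (2 ℕ.* n) 1)) (cong (_- + 1) +2n))

    escalator-at : ∀ r → c ≡ n ∸ 1 ℕ.+ r → r ℕ.≤ 3 ⊎ c ℕ.≤ 2 ℕ.* n → escalatorResidue n ps cell ≡ escalator (bandAt r)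
    escalator-at r c≡ bnd = trans escalatorResidue-at (cong escalator (bandPosition-value (n ∸ 1) c 0ℤ
        (trans (cong (λ z → + z - + (n ∸ 1)) c≡) (lia 2 (λ p r → ⊢ p :+ r :- p :≡ r :+ # 0) (+ (n ∸ 1)) (+ r)))
        (ℤₚ.drop‿+<+ (subst (+ r <_) (sym +2n) (r<2n bnd)))))
      where
      r<2n : r ℕ.≤ 3 ⊎ c ℕ.≤ 2 ℕ.* n → + r < + 2 * ν
      r<2n (inj₁ r≤3) = lia 2 (λ r v → r :≤ # 3 ⇒ # 2 :≤ v ⇒ ⊢ r :< 2 :* v) (+ r) ν (+≤+ r≤3) 2≤ν
      r<2n (inj₂ c≤) = lia 5 (λ r c p t v → c :≤ t ⇒ t :≡ 2 :* v ⇒ c :≡ p :+ r ⇒ p :≡ v :- # 1 ⇒ # 2 :≤ v ⇒ ⊢ r :< 2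
          :* v)
        (+ r) (+ c) (+ (n ∸ 1)) (+ (2 ℕ.* n)) ν (+≤+ c≤) +2n (cong +_ c≡) +[n∸1] 2≤ν

    -- The difference c - (n - 1) is negative; one period 2n more gives the remainder c + n + 1,
    -- which is at least 3 and so outside the band.
    escalator-below : c ℕ.< n ∸ 1 → escalatorResidue n ps cell ≡ nothing
    escalator-below c< = trans escalatorResidue-at (cong escalator
        (trans (bandPosition-value (n ∸ 1) c {c ℕ.+ n ℕ.+ 1} -1ℤ eq lt)
        (bandAt-≥3 (ℤₚ.drop‿+≤+ (lia 2 (λ c v → # 0 :≤ c ⇒ # 2 :≤ v ⇒ ⊢ # 3 :≤ c :+ v :+ # 1) (+ c) ν (+≤+ z≤n)
            2≤ν)))))
      where
      eq : + c - + (n ∸ 1) ≡ + (c ℕ.+ n ℕ.+ 1) + -1ℤ * + (2 ℕ.* n)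
      eq = trans (lia 4 (λ c p v t → p :≡ v :- # 1 ⇒ t :≡ 2 :* v ⇒ ⊢ c :- p :≡ c :+ v :+ # 1 :+ :- t) (+ c)
          (+ (n ∸ 1)) ν (+ (2 ℕ.* n)) +[n∸1] +2n)
                 (cong (λ z → + (c ℕ.+ n ℕ.+ 1) + z) (sym (ℤₚ.-1*i≡-i (+ (2 ℕ.* n)))))
      lt : c ℕ.+ n ℕ.+ 1 ℕ.< 2 ℕ.* n
      lt = ℤₚ.drop‿+<+ (lia 4 (λ c p v t → p :≡ v :- # 1 ⇒ t :≡ 2 :* v ⇒ c :< p ⇒ ⊢ c :+ v :+ # 1 :< t) (+ c)
          (+ (n ∸ 1)) ν (+ (2 ℕ.* n)) +[n∸1] +2n (+<+ c<))

    module _ (1≤c : 1 ℕ.≤ c) where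

      escalator-n-1 : c ≡ n ∸ 1 → escalatorResidue n ps cell ≡ just (one (n ∸ 1))
      escalator-n-1 c≡ = trans (escalator-at 0 (trans c≡ (sym (ℕₚ.+-identityʳ _))) (inj₁ z≤n))
        (cong just (bandResidue-end (n ∸ 1) n zero 1≤c z≤n))

      2≤e+c : 2 ℕ.≤ e ℕ.+ c
      2≤e+c = ℕₚ.+-mono-≤ 1≤e 1≤c

      1≤n : 1 ℕ.≤ n
      1≤n = ℕₚ.≤-trans (s≤s z≤n) 2≤n

      escalator-n : c ≡ n → escalatorResidue n ps cell ≡ just (one n)
      escalator-n c≡ = trans (escalator-at 1 (trans c≡ (sym (ℕₚ.m∸n+n≡m 1≤n))) (inj₁ (s≤s z≤n)))
        (cong just (bandResidue-end (n ∸ 1) n (suc zero) 1≤c (ℕₚ.≤-trans (s≤s z≤n) 2≤e+c)))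

      escalator-n+1 : c ≡ n ℕ.+ 1 → escalatorResidue n ps cell ≡ just (both (n ∸ 1) n)
      escalator-n+1 c≡ = trans (escalator-at 2 (trans c≡ (trans (cong (ℕ._+ 1) (sym (ℕₚ.m∸n+n≡m 1≤n)))
          (ℕₚ.+-assoc (n ∸ 1) 1 1))) (inj₁ (s≤s (s≤s z≤n))))
        (cong just (bandResidue-end (n ∸ 1) n (suc (suc zero)) 1≤c 2≤e+c))

      escalator-above : n ℕ.+ 2 ℕ.≤ c → c ℕ.≤ 2 ℕ.* n → escalatorResidue n ps cell ≡ nothing
      escalator-above lo hi = trans (escalator-at r c≡ (inj₂ hi)) (cong escalator (bandAt-≥3 3≤r))
        where
        r = c ∸ (n ∸ 1)
        n∸1≤c : n ∸ 1 ℕ.≤ c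
        n∸1≤c = ℕₚ.≤-trans (ℕₚ.m∸n≤m n 1) (ℕₚ.≤-trans (ℕₚ.m≤m+n n 2) lo)
        c≡ : c ≡ n ∸ 1 ℕ.+ r
        c≡ = sym (ℕₚ.m+[n∸m]≡n n∸1≤c)
        3≤r : 3 ℕ.≤ r
        3≤r = ℤₚ.drop‿+≤+ (lia 4 (λ r c p v → c :≡ p :+ r ⇒ p :≡ v :- # 1 ⇒ v :+ # 2 :≤ c ⇒ ⊢ # 3 :≤ r)
          (+ r) (+ c) (+ (n ∸ 1)) ν (cong +_ c≡) +[n∸1] (+≤+ lo))

      descalator-inner : 2 ℕ.≤ c → c ℕ.+ 2 ℕ.≤ 2 ℕ.* n → descalatorResidue n ps cell ≡ nothing
      descalator-inner 2≤c c≤ = trans descalatorResidue-at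
        (cong₂ descalator (≤ᵇ-false 2≤c) (trans (bandPosition-value (2 ℕ.* n ∸ 1) c {c ℕ.+ 1} -1ℤ eq lt)
          (bandAt-≥3 (subst (3 ℕ.≤_) (ℕₚ.+-comm 1 c) (s≤s 2≤c)))))
        where
        eq : + c - + (2 ℕ.* n ∸ 1) ≡ + (c ℕ.+ 1) + -1ℤ * + (2 ℕ.* n)
        eq = trans (lia 4 (λ c p v t → p :≡ 2 :* v :- # 1 ⇒ t :≡ 2 :* v ⇒ ⊢ c :- p :≡ c :+ # 1 :+ :- t) (+ c)
            (+ (2 ℕ.* n ∸ 1)) ν (+ (2 ℕ.* n)) +[2n∸1] +2n)
                 (cong (λ z → + (c ℕ.+ 1) + z) (sym (ℤₚ.-1*i≡-i (+ (2 ℕ.* n)))))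
        lt : c ℕ.+ 1 ℕ.< 2 ℕ.* n
        lt = subst (ℕ._≤ 2 ℕ.* n) (ℕₚ.+-suc c 1) c≤

      -- Position 0 is content 2n - 1 and position 1 is content 2n; by `reference-range` no peeled
      -- row ends farther right.
      descalator-end : ∀ pos → toℕ pos ℕ.≤ 1 → bandAt (toℕ pos) ≡ just pos → c ℕ.+ 1 ≡ 2 ℕ.* n ℕ.+ toℕ pos →
                       descalatorResidue n ps cell ≡ just (rowEnd 1 0 pos)
      descalator-end pos pos≤1 at c≡ = trans descalatorResidue-at
        (trans (cong₂ descalator (≤ᵇ-false {c} {1} 2≤c) (trans (bandPosition-value (2 ℕ.* n ∸ 1) c {toℕ pos} 0ℤ
            (lia 4 (λ c p v k → c :+ # 1 :≡ 2 :* v :+ k ⇒ p :≡ 2 :* v :- # 1 ⇒ ⊢ c :- p :≡ k :+ # 0) (+ c)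
                (+ (2 ℕ.* n ∸ 1)) ν (+ toℕ pos) +c≡ +[2n∸1])
            (ℤₚ.drop‿+<+ (subst (+ toℕ pos <_) (sym +2n) (lia 2 (λ k v → k :≤ # 1 ⇒ # 2 :≤ v ⇒ ⊢ k :< 2 :* v)
                (+ toℕ pos) ν (+≤+ pos≤1) 2≤ν)))) at))
          (cong just (bandResidue-end 1 0 pos 1≤c (ℕₚ.≤-trans pos≤1 (ℕₚ.≤-trans (s≤s z≤n) 2≤e+c)))))
        where
        +c≡ : + c + + 1 ≡ + 2 * ν + + toℕ pos
        +c≡ = trans (cong +_ c≡) (cong (_+ + toℕ pos) +2n)
        2≤c : 2 ℕ.≤ c
        2≤c = ℤₚ.drop‿+≤+ (lia 3 (λ c v k → c :+ # 1 :≡ 2 :* v :+ k ⇒ # 0 :≤ k ⇒ # 2 :≤ v ⇒ ⊢ # 2 :≤ c) (+ c) ν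
            (+ toℕ pos) +c≡ (+≤+ z≤n) 2≤ν)

      fixed-end : c ℕ.< 2 ℕ.* n → fixedResidue n cell ≡ one (if c ≤ᵇ n then c else 2 ℕ.* n ∸ c)
      fixed-end c< = cong (λ k → one (if k ≤ᵇ n then k else 2 ℕ.* n ∸ k))
        (trans (cong (_∥ (2 ℕ.* n)) content-cell) (∥-value (2 ℕ.* n) {+ c} {c} 0ℤ (sym (ℤₚ.+-identityʳ (+ c))) c<))

    descalator-1 : c ≡ 1 → descalatorResidue n ps cell ≡ just (mainResidue (e , e ℕ.+ 1))
    descalator-1 refl = descalatorResidue-at

    fixed-0 : c ≡ 0 → fixedResidue n cell ≡ one 0
    fixed-0 refl = cong (λ k → one (if k ≤ᵇ n then k else 2 ℕ.* n ∸ k))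
        (trans (cong (_∥ (2 ℕ.* n)) content-cell) (∥-value (2 ℕ.* n) {+ c} {c} 0ℤ (sym (ℤₚ.+-identityʳ (+ c)))
            (ℕₚ.≤-trans (s≤s z≤n) (ℕₚ.≤-trans 2≤n (ℕₚ.m≤m+n n _)))))

  -- The sum i + j is 4m + 1 here and 4m + 3 in `main-odd`. The parity of the peeled row is supplied
  -- by `level-parity`.
  main-even : ∀ m → mainResidue (2 ℕ.* m , 2 ℕ.* m ℕ.+ 1) ≡ one 1
  main-even m = trans (cong (if_then one 0 else (if (2 ℕ.* m ℕ.+ (2 ℕ.* m ℕ.+ 1)) ℕ.% 4 ≡ᵇ 1 then one 1 else one 0))
      (≡ᵇ-false {2 ℕ.* m} {2 ℕ.* m ℕ.+ 1} (λ eq → ℕₚ.<⇒≢ (ℕₚ.≤-reflexive (ℕₚ.+-comm 1 (2 ℕ.* m))) eq)))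
    (cong (λ k → if k ≡ᵇ 1 then one 1 else one 0) (trans (cong (ℕ._% 4) (four m)) (DivMod.[m+kn]%n≡m%n 1 m 4)))
    where
    four : ∀ m → 2 ℕ.* m ℕ.+ (2 ℕ.* m ℕ.+ 1) ≡ 1 ℕ.+ m ℕ.* 4
    four = solveℕ

  main-odd : ∀ m → mainResidue (1 ℕ.+ 2 ℕ.* m , 1 ℕ.+ 2 ℕ.* m ℕ.+ 1) ≡ one 0
  main-odd m = trans (cong (if_then one 0 else (if (1 ℕ.+ 2 ℕ.* m ℕ.+ (1 ℕ.+ 2 ℕ.* m ℕ.+ 1)) ℕ.% 4 ≡ᵇ 1 then one 1
      else one 0))
      (≡ᵇ-false {1 ℕ.+ 2 ℕ.* m} {1 ℕ.+ 2 ℕ.* m ℕ.+ 1} (λ eq → ℕₚ.<⇒≢ (ℕₚ.≤-reflexive (ℕₚ.+-comm 1 (1 ℕ.+ 2 ℕ.* m)))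
          eq)))
    (cong (λ k → if k ≡ᵇ 1 then one 1 else one 0) (trans (cong (ℕ._% 4) (four m)) (DivMod.[m+kn]%n≡m%n 3 m 4)))
    where
    four : ∀ m → 1 ℕ.+ 2 ℕ.* m ℕ.+ (1 ℕ.+ 2 ℕ.* m ℕ.+ 1) ≡ 3 ℕ.+ m ℕ.* 4
    four = solveℕ

  -- Parity

  -- The map i ↦ w(i) + M carries the labels of the parity condition onto the beads beyond M:
  -- w⁻¹(w(i) + M) = i + M is smaller than M exactly when i < 0, and i = 0 is fixed by w.
  left-even : (v : Mirrored n) → LeftParity D v → 2 ∣ₙ length (beadsAbove (𝒜 v) M)
  left-even v (is , u , iff , even) = subst (2 ∣ₙ_) (bijection-length f g u (beadsAbove-unique a M) f∈ g∈ gf fg) even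
    where
    a = 𝒜 v
    w = fun v
    f g : ℤ → ℤ
    f i = w i + M
    g b = inverse v b - M
    shift-M : ∀ i → w (i + M) ≡ w i + M
    shift-M i = periodic v i
    gf′ : ∀ i → inverse v (w i + M) ≡ i + M
    gf′ i = fun-injective v (trans (fun-inverse v _) (sym (shift-M i)))
    f∈ : ∀ {i} → i ∈ is → f i ∈ beadsAbove a M
    f∈ {i} i∈ = ∈-beadsAbove⁺ a (ℤₚ.<⇒≤ 0<M) (lia 2 (λ w m → # 1 :≤ w ⇒ ⊢ m :< w :+ m) (w i) M 1≤w)
      (≉0⇒Entry fi≉0) (bead⇐ v fi≉0 (subst (_< M) (sym (gf′ i)) (lia 2 (λ i m → i :< # 0 ⇒ ⊢ i :+ m :< m) i M i<0)))
      where
      i≤0 = proj₁ (Equivalence.to (iff i) i∈)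
      1≤w = proj₂ (Equivalence.to (iff i) i∈)
      i≉0 : ¬ i ≈ 0ℤ
      i≉0 (by k eq) = lia 3 (λ i w p → i :≡ p ⇒ w :≡ p ⇒ i :≤ # 0 ⇒ # 1 :≤ w ⇒ ⊢⊥) i (w i) (k * M)
          (trans eq (ℤₚ.+-identityˡ _))
        (trans (cong w eq) (trans (fun-shift v k 0ℤ) (trans (cong (_+ k * M) (fun-0 v)) (ℤₚ.+-identityˡ _)))) i≤0 1≤w
      i<0 : i < 0ℤ
      i<0 = ℤₚ.≤∧≢⇒< i≤0 λ eq → i≉0 (≡⇒≈ eq)
      fi≉0 : ¬ f i ≈ 0ℤ
      fi≉0 p = i≉0 (fun-≈0⁻ v (≈-trans (by -1ℤ (back (w i) M)) p))
        where
        back : ∀ w m → w ≡ w + m + -1ℤ * m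
        back = solve-∀
    w-g : ∀ b → w (g b) ≡ b - M
    w-g b = lia 3 (λ p q m → p :+ m :≡ q ⇒ ⊢ p :≡ q :- m) (w (g b)) b M
      (trans (sym (shift-M (g b))) (trans (cong w (lia 2 (λ b m → ⊢ b :- m :+ m :≡ b) (inverse v b) M))
          (fun-inverse v b)))
    g∈ : ∀ {b} → b ∈ beadsAbove a M → g b ∈ is
    g∈ {b} b∈ = let M<b , bd , _ = ∈-beadsAbove⁻ a b∈ in Equivalence.from (iff (g b))
      ( lia 2 (λ b m → b :< m ⇒ ⊢ b :- m :≤ # 0) (inverse v b) M (proj₂ (bead⇒ v bd))
      , subst (+ 1 ≤_) (sym (w-g b)) (lia 2 (λ b m → m :< b ⇒ ⊢ # 1 :≤ b :- m) b M M<b) )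
    gf : ∀ {i} → i ∈ is → g (f i) ≡ i
    gf {i} _ = lia 3 (λ p i m → p :≡ i :+ m ⇒ ⊢ p :- m :≡ i) (inverse v (f i)) i M (gf′ i)
    fg : ∀ {b} → b ∈ beadsAbove a M → f (g b) ≡ b
    fg {b} _ = lia 3 (λ p b m → p :≡ b :- m ⇒ ⊢ p :+ m :≡ b) (w (g b)) b M (w-g b)

  left-even′ : (v : Mirrored n) → W̃ ty n v → left ty ≡ D → 2 ∣ₙ length (beadsAbove (𝒜 v) M)
  left-even′ v (lp , _) eq = left-even v (subst (λ e → LeftParity e v) eq lp)

  -- Without beads beyond M there are, by `count-opposite`, no gaps below M, so no bead has a gap
  -- before it.
  empty-shape : (v : Mirrored n) → beadsAbove (𝒜 v) M ≡ [] → partition (𝒜 v) ≡ []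
  empty-shape v none = Listₚ.filter-none (1 ℕₚ.≤?_) (Allₚ.map⁺ (All.tabulate λ {b} b∈ →
    ℕₚ.<⇒≱ (s≤s (ℕₚ.≤-trans (gapsBelow-mono v (small b∈)) (ℕₚ.≤-reflexive
        (trans (count-opposite v) (cong length none)))))))
    where
    small : ∀ {b} → b ∈ beads↓ (𝒜 v) → b ≤ M
    small {b} b∈ = ℤₚ.≮⇒≥ λ lt → absurd (subst (b ∈_) none (∈-filter⁺ (M ℤₚ.<?_) b∈ lt))
      where
      absurd : ¬ b ∈ []
      absurd ()

  -- For left end D a bead at M + 1 could remain, but it would be the only bead beyond M, against
  -- the even count.
  no-reference : (v : Mirrored n) → W̃ ty n v → referenceBeads v ≡ [] → beadsAbove (𝒜 v) M ≡ []
  no-reference v wt none = go (left ty) refl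
    where
    a = 𝒜 v
    go : ∀ e → left ty ≡ e → beadsAbove a M ≡ []
    go C eq = trans (cong (beadsAbove a) (sym (trans (cong referenceLevel eq) (ℤₚ.+-identityʳ M)))) none
    go D eq = decide (bead? a (M + + 1))
      where
      none′ : length (beadsAbove a (M + + 1)) ≡ 0
      none′ = cong length (trans (cong (beadsAbove a) (sym (cong referenceLevel eq))) none)
      empty : ∀ {xs : List ℤ} → length xs ≡ 0 → xs ≡ []
      empty {[]} _ = refl
      decide : Dec (AtOrAboveLowest v (M + + 1)) → beadsAbove a M ≡ []
      decide (no ¬bd) = empty (trans (beadsAbove-M+1-gap v ¬bd) none′)
      decide (yes bd) = impossible (left-even′ v wt eq)
        where
        odd-one : ∀ q → 1 ≢ 2 ℕ.* q
        odd-one (suc q) eq with () ← ℕₚ.suc-injective (trans eq (cong suc (ℕₚ.+-suc q (q ℕ.+ 0))))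
        impossible : 2 ∣ₙ length (beadsAbove a M) → beadsAbove a M ≡ []
        impossible (dividesₙ q e) = contradiction
          (trans (sym (trans (beadsAbove-M+1 v bd) (cong (ℕ._+ 1) none′))) (trans e (ℕₚ.*-comm q 2))) (odd-one q)

  -- Residues of the row ends that occur

  onlyFor-C : ∀ {E r} → E ≡ C → onlyFor E r ≡ nothing
  onlyFor-C refl = refl

  onlyFor-nothing : ∀ E {r} → r ≡ nothing → onlyFor E r ≡ nothing
  onlyFor-nothing C _  = refl
  onlyFor-nothing D eq = eq

  onlyFor-D : ∀ {E r q} → E ≡ D → r ≡ q → onlyFor E r ≡ q
  onlyFor-D refl eq = eq

  orElse-cong : ∀ {p p′ q q′ f} → p ≡ p′ → q ≡ q′ → (p orElse q orElse f) ≡ (p′ orElse q′ orElse f)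
  orElse-cong refl refl = refl

  -- The fixed residue of content c when 0 ≤ c < 2n.
  peeled : ℕ → ℕ
  peeled c = if c ≤ᵇ n then c else 2 ℕ.* n ∸ c

  End-cases : ∀ E → E ≡ C ⊎ E ≡ D
  End-cases C = inj₁ refl
  End-cases D = inj₂ refl

  module _ (ps : Partition) (e c : ℕ) (1≤e : 1 ℕ.≤ e) (row : rowLength ps e ≡ e ℕ.+ c) where

    private
      box = e , e ℕ.+ c
      esc = escalatorResidue n ps box
      desc = descalatorResidue n ps box

    residue-0 : left ty ≡ C → c ≡ 0 → residue ty n ps box ≡ one 0
    residue-0 l≡C c≡0 = trans (orElse-cong {f = fixedResidue n box}
        (onlyFor-nothing (right ty) (escalator-below ps e c 1≤e row
            (subst (ℕ._< n ∸ 1) (sym c≡0) (ℕₚ.m<n⇒0<n∸m 2≤n))))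
        (onlyFor-C l≡C))
      (fixed-0 ps e c 1≤e row c≡0)

    residue-1 : left ty ≡ D → c ≡ 1 → residue ty n ps box ≡ mainResidue (e , e ℕ.+ 1)
    residue-1 l≡D c≡1 = orElse-cong {f = fixedResidue n box} (esc-nothing (End-cases (right ty)))
        (onlyFor-D l≡D (descalator-1 ps e c 1≤e row c≡1))
      where
      esc-nothing : right ty ≡ C ⊎ right ty ≡ D → onlyFor (right ty) esc ≡ nothing
      esc-nothing (inj₁ r≡C) = onlyFor-C r≡C
      esc-nothing (inj₂ r≡D) = onlyFor-nothing (right ty) (escalator-below ps e c 1≤e row
        (subst (ℕ._< n ∸ 1) (sym c≡1) (ℕₚ.∸-monoˡ-≤ 1 (ℕₚ.≤-trans (s≤s (s≤s (s≤s z≤n)))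
            (ℕₚ.≤-trans (both-D⇒4≤ ty l≡D r≡D) rank≤n)))))

    n+2≤2n : n ℕ.+ 2 ℕ.≤ 2 ℕ.* n
    n+2≤2n = ℕₚ.+-monoʳ-≤ n (ℕₚ.≤-trans 2≤n (ℕₚ.≤-reflexive (sym (ℕₚ.+-identityʳ n))))

    residue-2n : left ty ≡ D → c ≡ 2 ℕ.* n → residue ty n ps box ≡ one 0
    residue-2n l≡D c≡ = orElse-cong {f = fixedResidue n box}
      (onlyFor-nothing (right ty) (escalator-above ps e c 1≤e row 1≤c (subst (n ℕ.+ 2 ℕ.≤_) (sym c≡) n+2≤2n)
          (ℕₚ.≤-reflexive c≡)))
      (onlyFor-D l≡D (descalator-end ps e c 1≤e row 1≤c (suc zero) (s≤s z≤n) refl (cong (ℕ._+ 1) c≡)))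
      where
      1≤c : 1 ℕ.≤ c
      1≤c = subst (1 ℕ.≤_) (sym c≡) (ℕₚ.≤-trans (s≤s z≤n) (ℕₚ.≤-trans (ℕₚ.m≤n+m 2 n) n+2≤2n))

    residue-n : right ty ≡ D → c ≡ n → residue ty n ps box ≡ one n
    residue-n r≡D c≡ = cong (_orElse (onlyFor (left ty) desc orElse fixedResidue n box))
      (onlyFor-D r≡D (escalator-n ps e c 1≤e row (subst (1 ℕ.≤_) (sym c≡) (ℕₚ.≤-trans (s≤s z≤n) 2≤n)) c≡))

    residue-n+1 : right ty ≡ D → c ≡ n ℕ.+ 1 → residue ty n ps box ≡ both (n ∸ 1) n
    residue-n+1 r≡D c≡ = cong (_orElse (onlyFor (left ty) desc orElse fixedResidue n box))
      (onlyFor-D r≡D (escalator-n+1 ps e c 1≤e row (subst (1 ℕ.≤_) (sym c≡) (ℕₚ.m≤n+m 1 n)) c≡))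

    module _ (1≤c : 1 ℕ.≤ c) (c<2n : c ℕ.< 2 ℕ.* n) (2≤c : left ty ≡ D → 2 ℕ.≤ c)
             (c≢ : right ty ≡ D → c ≢ n × c ≢ n ℕ.+ 1) where

      private
        fixed≡ : fixedResidue n box ≡ one (peeled c)
        fixed≡ = fixed-end ps e c 1≤e row 1≤c c<2n

      left-part : left ty ≡ C ⊎ left ty ≡ D → (onlyFor (left ty) desc orElse fixedResidue n box) ≡ one (peeled c)
      left-part (inj₁ l≡C) = trans (cong (_orElse fixedResidue n box) (onlyFor-C l≡C)) fixed≡
      left-part (inj₂ l≡D) = go (ℕₚ.m≤n⇒m<n∨m≡n c<2n)
        where
        n<c : suc c ≡ 2 ℕ.* n → n ℕ.< c
        n<c eq = ℕ.s≤s⁻¹ (ℕₚ.≤-trans (ℕₚ.≤-reflexive (ℕₚ.+-comm 2 n)) (ℕₚ.≤-trans n+2≤2n (ℕₚ.≤-reflexive (sym eq))))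
        go : suc c ℕ.< 2 ℕ.* n ⊎ suc c ≡ 2 ℕ.* n → (onlyFor (left ty) desc orElse fixedResidue n box) ≡ one (peeled c)
        go (inj₁ lt) = trans (cong (_orElse fixedResidue n box) (onlyFor-nothing (left ty)
          (descalator-inner ps e c 1≤e row 1≤c (2≤c l≡D) (subst (ℕ._≤ 2 ℕ.* n) (ℕₚ.+-comm 2 c) lt)))) fixed≡
        go (inj₂ eq) = trans (cong (_orElse fixedResidue n box) (onlyFor-D l≡D
          (descalator-end ps e c 1≤e row 1≤c zero z≤n refl (trans (ℕₚ.+-comm c 1)
              (trans eq (sym (ℕₚ.+-identityʳ _)))))))
          (cong one (sym (trans (cong (if_then c else 2 ℕ.* n ∸ c) (≤ᵇ-false (n<c eq)))
            (trans (cong (_∸ c) (sym eq)) (ℕₚ.m+n∸n≡m 1 c)))))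

      -- Off the special contents the band rules agree with the fixed residues: a row ending at the
      -- first cell of an escalator or descalator, with content n - 1 or 2n - 1, receives n - 1 or
      -- 1.
      residue-generic : residue ty n ps box ≡ one (peeled c)
      residue-generic = go (End-cases (right ty))
        where
        tail = onlyFor (left ty) desc orElse fixedResidue n box
        blank : onlyFor (right ty) esc ≡ nothing → residue ty n ps box ≡ one (peeled c)
        blank eq = trans (cong (_orElse tail) eq) (left-part (End-cases (left ty)))
        go : right ty ≡ C ⊎ right ty ≡ D → residue ty n ps box ≡ one (peeled c)
        go (inj₁ r≡C) = blank (onlyFor-C r≡C)
        go (inj₂ r≡D) = compare (ℕₚ.<-cmp c (n ∸ 1))
          where
          compare : Tri (c ℕ.< n ∸ 1) (c ≡ n ∸ 1) (n ∸ 1 ℕ.< c) → residue ty n ps box ≡ one (peeled c)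
          compare (tri< lt _ _) = blank (onlyFor-nothing (right ty) (escalator-below ps e c 1≤e row lt))
          compare (tri≈ _ eq _) = trans (cong (_orElse tail) (onlyFor-D r≡D (escalator-n-1 ps e c 1≤e row 1≤c eq)))
            (cong one (sym (trans (cong (if_then c else 2 ℕ.* n ∸ c)
                (≤ᵇ-true (ℕₚ.≤-trans (ℕₚ.≤-reflexive eq) (ℕₚ.m∸n≤m n 1)))) eq)))
          compare (tri> _ _ gt) = blank (onlyFor-nothing (right ty)
              (escalator-above ps e c 1≤e row 1≤c n+2≤c (ℕₚ.<⇒≤ c<2n)))
            where
            n≤c : n ℕ.≤ c
            n≤c = subst (ℕ._≤ c) (ℕₚ.suc-pred n {{ℕ.>-nonZero (ℕₚ.≤-trans (s≤s z≤n) 2≤n)}}) gt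
            n+2≤c : n ℕ.+ 2 ℕ.≤ c
            n+2≤c = subst (ℕ._≤ c) (trans (cong suc (ℕₚ.+-comm n 1)) (ℕₚ.+-comm 2 n) )
              (ℕₚ.≤∧≢⇒< (subst (ℕ._≤ c) (ℕₚ.+-comm 1 n) (ℕₚ.≤∧≢⇒< n≤c (proj₁ (c≢ r≡D) ∘ sym))) (proj₂ (c≢ r≡D) ∘ sym))

  -- The recorded box.

  isD-C : ∀ {E} → E ≡ C → isD E ≡ false
  isD-C refl = refl

  isD-D : ∀ {E} → E ≡ D → isD E ≡ true
  isD-D refl = refl

  skipped : Type → ℕ → Cell → Bool
  skipped t r (d , c) = (isD (right t) ∧ (r ≡ᵇ n) ∧ (c ≡ᵇ d ℕ.+ n))
                        ∨ (isD (left t) ∧ (r ≡ᵇ 0) ∧ ((c ≡ᵇ d) ∨ (c ≡ᵇ d ℕ.+ 2 ℕ.* n)))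

  record-plain : ∀ r d c → skipped ty r (d , c) ≡ false → recordedBox ty n r (d , c) ≡ (d , c)
  record-plain r d c eq = cong (if_then (d , c ∸ 1) else (d , c)) eq

  record-skip : ∀ r d c → skipped ty r (d , c) ≡ true → recordedBox ty n r (d , c) ≡ (d , c ∸ 1)
  record-skip r d c eq = cong (if_then (d , c ∸ 1) else (d , c)) eq

  ∧-false : ∀ {a b c} → a ≡ false ⊎ b ≡ false ⊎ c ≡ false → (a ∧ b ∧ c) ≡ false
  ∧-false {false}               _                  = refl
  ∧-false {true} {false}        _                  = refl
  ∧-false {true} {true} {false} _                  = refl
  ∧-false {true} {true} {true}  (inj₂ (inj₁ ()))
  ∧-false {true} {true} {true}  (inj₂ (inj₂ ()))

  ∨-false : ∀ {a b} → a ≡ false → b ≡ false → (a ∨ b) ≡ false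
  ∨-false refl refl = refl

  not-skipped : ∀ {r d c} → right ty ≡ C ⊎ r ≢ n ⊎ c ≢ d ℕ.+ n →
    left ty ≡ C ⊎ r ≢ 0 ⊎ (c ≢ d × c ≢ d ℕ.+ 2 ℕ.* n) → skipped ty r (d , c) ≡ false
  not-skipped {r} {d} {c} p q = ∨-false (∧-false (rightPart p)) (∧-false (leftPart q))
    where
    rightPart : right ty ≡ C ⊎ r ≢ n ⊎ c ≢ d ℕ.+ n → isD (right ty) ≡ false ⊎ (r ≡ᵇ n) ≡ false ⊎ (c ≡ᵇ d ℕ.+ n) ≡
        false
    rightPart (inj₁ e)        = inj₁ (isD-C e)
    rightPart (inj₂ (inj₁ e)) = inj₂ (inj₁ (≡ᵇ-false e))
    rightPart (inj₂ (inj₂ e)) = inj₂ (inj₂ (≡ᵇ-false e))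
    leftPart : left ty ≡ C ⊎ r ≢ 0 ⊎ (c ≢ d × c ≢ d ℕ.+ 2 ℕ.* n) →
               isD (left ty) ≡ false ⊎ (r ≡ᵇ 0) ≡ false ⊎ ((c ≡ᵇ d) ∨ (c ≡ᵇ d ℕ.+ 2 ℕ.* n)) ≡ false
    leftPart (inj₁ e)              = inj₁ (isD-C e)
    leftPart (inj₂ (inj₁ e))       = inj₂ (inj₁ (≡ᵇ-false e))
    leftPart (inj₂ (inj₂ (e , f))) = inj₂ (inj₂ (∨-false (≡ᵇ-false e) (≡ᵇ-false f)))

  skipped-n : ∀ {d c} → right ty ≡ D → c ≡ d ℕ.+ n → skipped ty n (d , c) ≡ true
  skipped-n {d} {c} r≡D eq = cong₂ _∨_ (cong₂ _∧_ (isD-D r≡D) (cong₂ _∧_ (≡ᵇ-true {n} refl) (≡ᵇ-true eq))) refl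

  skipped-0 : ∀ {d c} → left ty ≡ D → c ≡ d ℕ.+ 2 ℕ.* n → skipped ty 0 (d , c) ≡ true
  skipped-0 {d} {c} l≡D eq = trans (cong (λ z → isD (right ty) ∧ (0 ≡ᵇ n) ∧ (c ≡ᵇ d ℕ.+ n) ∨ z) (cong₂ _∧_ (isD-D l≡D)
    (trans (cong ((c ≡ᵇ d) ∨_) (≡ᵇ-true eq)) (Boolₚ.∨-zeroʳ _)))) (Boolₚ.∨-zeroʳ _)

  -- Case analysis of a peeling step.

  -- b is the peeled bead, δ the distance by which s_r lowers it, and ψ the content of the recorded
  -- box. A primed case belongs to the other of the two classes lowered by the same generator. In
  -- `leftD′` and `rightD` the last box lies on the skipped diagonal 2n or n, so ψ is one less than
  -- its content. The last field of `unit` decides the star.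
  data Kind (b δ : ℤ) (r ψ : ℕ) : Set where
    unit    : δ ≡ + 1 → M + + 2 ≤ b → b < M + M → (right ty ≡ D → b ≢ M + (ν + + 1) × b ≢ M + (ν + + 2)) →
              + ψ ≡ b - M - + 1 → (b ≡ M + ν → r ≡ n ∸ 1) → Kind b δ r ψ
    leftC   : left ty ≡ C → δ ≡ + 2 → b ≡ M + + 1 → + ψ ≡ 0ℤ → Kind b δ r ψ
    leftD   : left ty ≡ D → δ ≡ + 3 → b ≡ M + + 2 → + ψ ≡ + 1 → Kind b δ r ψ
    leftD′  : left ty ≡ D → δ ≡ + 3 → b ≡ M + M + + 1 → + ψ ≡ M - + 2 → Kind b δ r ψ
    rightD  : right ty ≡ D → δ ≡ + 2 → b ≡ M + (ν + + 1) → + ψ ≡ ν - + 1 → r ≡ n → Kind b δ r ψ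
    rightD′ : right ty ≡ D → δ ≡ + 2 → b ≡ M + (ν + + 2) → + ψ ≡ ν + + 1 → r ≡ n → Kind b δ r ψ

  record PeelCase (v : Mirrored n) (e : ℕ) (b : ℤ) : Set where
    field
      r       : ℕ
      r≤n     : r ℕ.≤ n
      {x y}   : ℤ
      simple  : Simple (gen ty n r) x y
      isDown  : Down x y b
      gap     : ¬ AtOrAboveLowest v (b - (y - x))
      ψ       : ℕ
      kind    : Kind b (y - x) r ψ
      residue≡ : peelingResidue n (residue ty n (partition (𝒜 v)) (e , rowLength (partition (𝒜 v)) e)) ≡ just r
      record≡  : recordedBox ty n r (e , rowLength (partition (𝒜 v)) e) ≡ (e , e ℕ.+ ψ)

  base-D : left ty ≡ D → base ≡ M + + 1
  base-D = cong referenceLevel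

  base-C : left ty ≡ C → base ≡ M
  base-C eq = trans (cong referenceLevel eq) (ℤₚ.+-identityʳ M)

  2M : + 2 * M ≡ M + M
  2M = twice M
    where
    twice : ∀ m → + 2 * m ≡ m + m
    twice = solve-∀

  +[2n] : + (2 ℕ.* n) ≡ + 2 * ν
  +[2n] = ℤₚ.pos-* 2 n

  module _ (c : ℕ) where

    peeled-small : c ℕ.≤ n → peeled c ≡ c
    peeled-small c≤n = cong (if_then c else 2 ℕ.* n ∸ c) (≤ᵇ-true c≤n)

    peeled-large : n ℕ.< c → peeled c ≡ 2 ℕ.* n ∸ c
    peeled-large n<c = cong (if_then c else 2 ℕ.* n ∸ c) (≤ᵇ-false n<c)

  record UnitStep (c : ℕ) (b : ℤ) : Set where
    field
      r≤n    : peeled c ℕ.≤ n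
      r≢0    : peeled c ≢ 0
      r≢n    : right ty ≡ C ⊎ peeled c ≢ n
      {x y}  : ℤ
      simple : Simple (gen ty n (peeled c)) x y
      isDown : Down x y b
      δ≡1    : y - x ≡ + 1

  -- Content c < n is served by s_c on the class of c + 1, content n by sₙ of type C, and content c
  -- > n by s_r with r = 2n - c on the mirrored class, since c + 1 + M = - r + 2M.
  unitStep : ∀ c {b} → 1 ℕ.≤ c → c ℕ.< 2 ℕ.* n → (right ty ≡ D → c ≢ n) → b ≡ + c + + 1 + M → UnitStep c b
  unitStep c {b} 1≤c c<2n c≢n b≡ = go (ℕₚ.<-cmp c n)
    where
    go : Tri (c ℕ.< n) (c ≡ n) (n ℕ.< c) → UnitStep c b
    go (tri< c<n _ _) = record
      { r≤n = subst (ℕ._≤ n) (sym p≡) (ℕₚ.<⇒≤ c<n) ; r≢0 = λ eq → ℕₚ.>⇒≢ 1≤c (trans (sym p≡) eq)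
      ; r≢n = inj₂ λ eq → ℕₚ.<⇒≢ c<n (trans (sym p≡) eq)
      ; x = + c ; y = + suc c ; simple = subst (λ r → Simple (gen ty n r) (+ c) (+ suc c)) (sym p≡) (swap-gen 1≤c c<n)
      ; isDown = inj₁ (by (+ 1) (trans b≡ (trans (lia 2 (λ c m → ⊢ c :+ # 1 :+ m :≡ # 1 :+ c :+ m) (+ c) M)
          (cong (λ z → + suc c + z) (sym (ℤₚ.*-identityˡ M))))))
      ; δ≡1 = lia 1 (λ c → ⊢ # 1 :+ c :- c :≡ # 1) (+ c) }
      where
      p≡ : peeled c ≡ c
      p≡ = peeled-small c (ℕₚ.<⇒≤ c<n)
    go (tri≈ _ c≡n _) = byEnd (End-cases (right ty))
      where
      p≡ : peeled c ≡ n
      p≡ = trans (peeled-small c (ℕₚ.≤-reflexive c≡n)) c≡n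
      byEnd : right ty ≡ C ⊎ right ty ≡ D → UnitStep c b
      byEnd (inj₂ r≡D) = contradiction c≡n (c≢n r≡D)
      byEnd (inj₁ r≡C) = record
        { r≤n = ℕₚ.≤-reflexive p≡ ; r≢0 = λ eq → ℕₚ.>⇒≢ (ℕₚ.≤-trans (s≤s z≤n) 2≤n) (trans (sym p≡) eq)
        ; r≢n = inj₁ r≡C
        ; x = ν ; y = + 1 + ν ; simple = subst (λ r → Simple (gen ty n r) ν (+ 1 + ν)) (sym p≡) (rightC-gen r≡C)
        ; isDown = inj₁ (by (+ 1) (trans b≡ (trans (lia 3 (λ c m v → c :≡ v ⇒ ⊢ c :+ # 1 :+ m :≡ # 1 :+ v :+ m) (+ c)
            M ν (cong +_ c≡n)) (cong (λ z → + 1 + ν + z) (sym (ℤₚ.*-identityˡ M))))))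
        ; δ≡1 = lia 1 (λ c → ⊢ # 1 :+ c :- c :≡ # 1) ν }
    go (tri> _ _ n<c) = record
      { r≤n = subst (ℕ._≤ n) (sym p≡) (ℕₚ.<⇒≤ r<n) ; r≢0 = λ eq → ℕₚ.>⇒≢ 1≤r (trans (sym p≡) eq)
      ; r≢n = inj₂ λ eq → ℕₚ.<⇒≢ r<n (trans (sym p≡) eq)
      ; x = + r ; y = + suc r ; simple = subst (λ r → Simple (gen ty n r) (+ (2 ℕ.* n ∸ c)) (+ suc (2 ℕ.* n ∸ c)))
          (sym p≡) (swap-gen 1≤r r<n)
      ; isDown = inj₂ (by (+ 2) (trans b≡ (trans (lia 5 (λ r c v t m → r :≡ t :- c ⇒ t :≡ 2 :* v ⇒ m :≡ # 1 :+ 2 :* v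
          ⇒ ⊢ c :+ # 1 :+ m :≡ :- r :+ (m :+ m))
          (+ r) (+ c) ν (+ (2 ℕ.* n)) M +r +[2n] M≡) (cong (λ z → - + r + z) (sym 2M)))))
      ; δ≡1 = lia 1 (λ c → ⊢ # 1 :+ c :- c :≡ # 1) (+ r) }
      where
      r = 2 ℕ.* n ∸ c
      p≡ : peeled c ≡ r
      p≡ = peeled-large c n<c
      1≤r : 1 ℕ.≤ r
      1≤r = ℕₚ.m<n⇒0<n∸m c<2n
      +r : + r ≡ + (2 ℕ.* n) - + c
      +r = trans (sym (ℤₚ.⊖-≥ (ℕₚ.<⇒≤ c<2n))) (sym (ℤₚ.m-n≡m⊖n (2 ℕ.* n) c))
      r<n : r ℕ.< n
      r<n = ℤₚ.drop‿+<+ (lia 4 (λ r c v t → r :≡ t :- c ⇒ t :≡ 2 :* v ⇒ v :< c ⇒ ⊢ r :< v) (+ r) (+ c) ν (+ (2 ℕ.* n))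
          +r +[2n] (+<+ n<c))

  module _ (v : Mirrored n) (wt : W̃ ty n v) {xs b} (eq : referenceBeads v ≡ xs ∷ʳ b) where

    private
      a = 𝒜 v
      e = length (referenceBeads v)
      ps = partition a
      ref = snoc-reference v eq
      open Reference ref
      1≤e′ = 1≤e v eq

    M<b : M < b
    M<b = ℤₚ.≤-<-trans (M≤level (left ty)) base<b

    -- By flushness b - M is a bead below b, so it cannot lie beyond `base`; hence b ≤ M + `base` ≤
    -- 2M + 1, and 2M is no entry.
    reference-range : b < M + M ⊎ (b ≡ M + M + + 1 × left ty ≡ D)
    reference-range = go (ℤₚ.<-cmp b (M + M))
      where
      go : Tri (b < M + M) (b ≡ M + M) (M + M < b) → b < M + M ⊎ (b ≡ M + M + + 1 × left ty ≡ D)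
      go (tri< lt _ _) = inj₁ lt
      go (tri≈ _ eq _) = contradiction (≈-trans (≡⇒≈ eq) 2M≈0) b≉0
      go (tri> _ _ gt) = inj₂ (lia 3 (λ b m r → m :< b :- m ⇒ b :- m :≤ r ⇒ r :≤ m :+ # 1 ⇒ ⊢ b :≡ m :+ m :+ # 1) b M
          base M<b′ b′≤base (level≤M+1 (left ty))
                       , byEnd (End-cases (left ty)))
        where
        b′≈ : b - M ≈ b
        b′≈ = by -1ℤ (cong (λ z → b + z) (sym (ℤₚ.-1*i≡-i M)))
        M<b′ : M < b - M
        M<b′ = lia 2 (λ b m → m :+ m :< b ⇒ ⊢ m :< b :- m) b M gt
        b′≤base : b - M ≤ base
        b′≤base = ℤₚ.≮⇒≥ λ lt → lia 2 (λ b m → # 0 :< m ⇒ b :≤ b :- m ⇒ ⊢⊥) b M 0<M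
          (least (λ p → b≉0 (≈-trans (≈-sym b′≈) p))
            (bead-≈-≤ v b′≈ (lia 2 (λ b m → # 0 :< m ⇒ ⊢ b :- m :≤ b) b M 0<M) bead) lt)
        byEnd : left ty ≡ C ⊎ left ty ≡ D → left ty ≡ D
        byEnd (inj₂ l≡D) = l≡D
        byEnd (inj₁ l≡C) = ⊥-elim (lia 3 (λ b m r → m :< b :- m ⇒ b :- m :≤ r ⇒ r :≡ m ⇒ ⊢⊥) b M base M<b′ b′≤base
            (base-C l≡C))

    unbead : ∀ {z} → base < z → z < b → ¬ z ≈ 0ℤ → ¬ AtOrAboveLowest v z
    unbead lo hi z≉0 bd = ℤₚ.<-irrefl refl (ℤₚ.<-≤-trans hi (least z≉0 bd lo))

    row-at : ∀ {c} hi → base < hi → hi ≤ b → hi ≤ M + M → (∀ {z} → hi ≤ z → z < b → z ≈ 0ℤ) →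
             + c ≡ hi - M - + 1 → rowLength ps e ≡ e ℕ.+ c
    row-at {c} hi p q s t c≡ = trans (reference-row v eq) (ℤₚ.+-injective (trans (gaps-before v eq hi p q s t)
      (lia 5 (λ e k h m c → c :≡ h :- m :- # 1 ⇒ ⊢ e :+ k :+ (h :- (m :+ k) :- # 1) :≡ e :+ c) (+ e) (+ κ) hi M (+ c)
          c≡)))

    -- The number of beads beyond M is even, and it exceeds e by one exactly if M + 1 is a bead.
    level-parity : left ty ≡ D → (AtOrAboveLowest v (M + + 1) × ∃[ m ] e ≡ 1 ℕ.+ 2 ℕ.* m)
                               ⊎ (¬ AtOrAboveLowest v (M + + 1) × ∃[ m ] e ≡ 2 ℕ.* m)
    level-parity l≡D = go (bead? a (M + + 1)) (left-even′ v wt l≡D)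
      where
      e≡ : e ≡ length (beadsAbove a (M + + 1))
      e≡ = cong (λ z → length (beadsAbove a z)) (base-D l≡D)
      odd-half : ∀ q → e ℕ.+ 1 ≡ 2 ℕ.* q → ∃[ m ] e ≡ 1 ℕ.+ 2 ℕ.* m
      odd-half zero eq′ with () ← trans (ℕₚ.+-comm 1 e) eq′
      odd-half (suc q) eq′ = q , ℕₚ.suc-injective (trans (ℕₚ.+-comm 1 e)
          (trans eq′ (cong suc (ℕₚ.+-suc q (q ℕ.+ 0)))))
      go : Dec (AtOrAboveLowest v (M + + 1)) → 2 ∣ₙ length (beadsAbove a M) → _
      go (yes bd) (dividesₙ q eq′) = inj₁ (bd , odd-half q (trans (cong (ℕ._+ 1) e≡)
          (trans (sym (beadsAbove-M+1 v bd)) (trans eq′ (ℕₚ.*-comm q 2)))))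
      go (no ¬bd) (dividesₙ q eq′) = inj₂ (¬bd , q , trans e≡ (trans (sym (beadsAbove-M+1-gap v ¬bd))
          (trans eq′ (ℕₚ.*-comm q 2))))

    top-case : b ≡ M + M + + 1 → left ty ≡ D → PeelCase v e b
    top-case b≡ l≡D = record
      { r = 0 ; r≤n = z≤n ; x = -1ℤ ; y = + 2 ; simple = leftD-gen l≡D
      ; isDown = inj₂ (by (+ 2) (trans b≡ (trans (ℤₚ.+-comm (M + M) (+ 1)) (cong (λ z → + 1 + z) (sym 2M)))))
      ; gap = unbead (lia 4 (λ b m v r → b :≡ m :+ m :+ # 1 ⇒ r :≡ m :+ # 1 ⇒ m :≡ # 1 :+ 2 :* v ⇒ # 3 :≤ v ⇒ ⊢ r :< b
          :- # 3) b M ν base b≡ (base-D l≡D) M≡ 3≤ν)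
          (lia 1 (λ b → ⊢ b :- # 3 :< b) b)
          (between-M⇒≉0 (lia 3 (λ b m v → b :≡ m :+ m :+ # 1 ⇒ m :≡ # 1 :+ 2 :* v ⇒ # 3 :≤ v ⇒ ⊢ m :< b :- # 3) b M ν
              b≡ M≡ 3≤ν)
            (lia 2 (λ b m → b :≡ m :+ m :+ # 1 ⇒ ⊢ b :- # 3 :< m :+ m) b M b≡))
      ; ψ = 2 ℕ.* n ∸ 1
      ; kind = leftD′ l≡D refl b≡ (trans (+[2n∸1] ps e (2 ℕ.* n) 1≤e′ row)
          (lia 2 (λ m v → m :≡ # 1 :+ 2 :* v ⇒ ⊢ 2 :* v :- # 1 :≡ m :- # 2) M ν M≡))
      ; residue≡ = trans (cong (λ l → peelingResidue n (residue ty n ps (e , l))) row)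
          (cong (peelingResidue n) (residue-2n ps e (2 ℕ.* n) 1≤e′ row l≡D refl))
      ; record≡ = trans (cong (λ l → recordedBox ty n 0 (e , l)) row)
          (trans (record-skip 0 e (e ℕ.+ 2 ℕ.* n) (skipped-0 {e} l≡D refl))
          (cong (e ,_) (ℕₚ.+-∸-assoc e (ℕₚ.≤-trans (s≤s z≤n) (ℕₚ.≤-trans 2≤n (ℕₚ.m≤m+n n _))))))
      }
      where
      3≤ν = left-D⇒3≤ν l≡D
      row : rowLength ps e ≡ e ℕ.+ 2 ℕ.* n
      row = row-at (M + M)
        (lia 3 (λ m v r → r :≡ m :+ # 1 ⇒ m :≡ # 1 :+ 2 :* v ⇒ # 3 :≤ v ⇒ ⊢ r :< m :+ m) M ν base (base-D l≡D) M≡ 3≤ν)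
        (lia 2 (λ b m → b :≡ m :+ m :+ # 1 ⇒ ⊢ m :+ m :≤ b) b M b≡) ℤₚ.≤-refl
        (λ {z} lo hi → ≈-trans (≡⇒≈ (lia 3 (λ z b m → m :+ m :≤ z ⇒ z :< b ⇒ b :≡ m :+ m :+ # 1 ⇒ ⊢ z :≡ m :+ m) z b M
            lo hi b≡)) 2M≈0)
        (trans +[2n] (lia 2 (λ m v → m :≡ # 1 :+ 2 :* v ⇒ ⊢ 2 :* v :≡ m :+ m :- m :- # 1) M ν M≡))

    module _ (b<2M : b < M + M) where

      c : ℕ
      c = ∣ b - M - + 1 ∣

      +c : + c ≡ b - M - + 1
      +c = ℤₚ.0≤i⇒+∣i∣≡i (lia 2 (λ b m → m :< b ⇒ ⊢ # 0 :≤ b :- m :- # 1) b M M<b)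

      b≡c : b ≡ + c + + 1 + M
      b≡c = lia 3 (λ b m c → c :≡ b :- m :- # 1 ⇒ ⊢ b :≡ c :+ # 1 :+ m) b M (+ c) +c

      row : rowLength ps e ≡ e ℕ.+ c
      row = row-at b base<b ℤₚ.≤-refl (ℤₚ.<⇒≤ b<2M) (λ lo hi → ⊥-elim (ℤₚ.<⇒≱ hi lo)) +c

      c<2n : c ℕ.< 2 ℕ.* n
      c<2n = ℤₚ.drop‿+<+ (lia 5 (λ b m c v t → c :≡ b :- m :- # 1 ⇒ b :< m :+ m ⇒ m :≡ # 1 :+ 2 :* v ⇒ t :≡ 2 :* v ⇒
          ⊢ c :< t) b M (+ c) ν (+ (2 ℕ.* n)) +c b<2M M≡ +[2n])

      toResidue : ∀ {q r} → residue ty n ps (e , e ℕ.+ c) ≡ q → peelingResidue n q ≡ just r →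
                  peelingResidue n (residue ty n ps (e , rowLength ps e)) ≡ just r
      toResidue q≡ r≡ = trans (cong (λ l → peelingResidue n (residue ty n ps (e , l))) row)
          (trans (cong (peelingResidue n) q≡) r≡)

      plainRecord : ∀ {r} → right ty ≡ C ⊎ r ≢ n ⊎ e ℕ.+ c ≢ e ℕ.+ n →
        left ty ≡ C ⊎ r ≢ 0 ⊎ (e ℕ.+ c ≢ e × e ℕ.+ c ≢ e ℕ.+ 2 ℕ.* n) →
        recordedBox ty n r (e , rowLength ps e) ≡ (e , e ℕ.+ c)
      plainRecord {r} p q = trans (cong (λ l → recordedBox ty n r (e , l)) row)
          (record-plain r e (e ℕ.+ c) (not-skipped {r} {e} p q))

      low-case : c ≡ 0 → PeelCase v e b
      low-case c≡0 = byEnd (End-cases (left ty))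
        where
        b≡ : b ≡ M + + 1
        b≡ = lia 3 (λ b m c → c :≡ b :- m :- # 1 ⇒ c :≡ # 0 ⇒ ⊢ b :≡ m :+ # 1) b M (+ c) +c (cong +_ c≡0)
        byEnd : left ty ≡ C ⊎ left ty ≡ D → PeelCase v e b
        byEnd (inj₂ l≡D) = contradiction (trans (base-D l≡D) (sym b≡)) (ℤₚ.<⇒≢ base<b)
        byEnd (inj₁ l≡C) = record
          { r = 0 ; r≤n = z≤n ; x = -1ℤ ; y = + 1 ; simple = leftC-gen l≡C
          ; isDown = inj₁ (by (+ 1) (trans b≡ (trans (ℤₚ.+-comm M (+ 1))
              (cong (λ z → + 1 + z) (sym (ℤₚ.*-identityˡ M))))))
          -- b - 2 = M - 1 is not beyond `base`; it is a gap as the opposite of the bead M + 1.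
          ; gap = subst (¬_ ∘ AtOrAboveLowest v) (lia 2 (λ b m → b :≡ m :+ # 1 ⇒ ⊢ m :+ m :- b :≡ b :- # 2) b M b≡)
              (bead-opposite v bead)
          ; ψ = c ; kind = leftC l≡C refl b≡ (cong +_ c≡0)
          ; residue≡ = toResidue (residue-0 ps e c 1≤e′ row l≡C c≡0) refl
          ; record≡ = plainRecord (inj₂ (inj₁ (λ eq → ℕₚ.>⇒≢ (ℕₚ.≤-trans (s≤s z≤n) 2≤n) (sym eq)))) (inj₁ l≡C) }

      rightD-case : right ty ≡ D → c ≡ n → PeelCase v e b
      rightD-case r≡D c≡n = record
        { r = n ; r≤n = ℕₚ.≤-refl ; x = ν ; y = + 2 + ν ; simple = rightD-gen r≡D
        ; isDown = inj₂ (by (+ 2) (trans (lia 3 (λ b m v → b :≡ m :+ (v :+ # 1) ⇒ m :≡ # 1 :+ 2 :* v ⇒ ⊢ b :≡ :- v :+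
            (m :+ m)) b M ν b≡ M≡) (cong (λ z → - ν + z) (sym 2M))))
        ; gap = subst (¬_ ∘ AtOrAboveLowest v) (sym (cong (λ z → b - z) δ≡2)) (unbead
            (lia 4 (λ b m v r → b :≡ m :+ (v :+ # 1) ⇒ # 3 :≤ v ⇒ r :≤ m :+ # 1 ⇒ ⊢ r :< b :- # 2) b M ν base b≡ 3≤ν
                (level≤M+1 (left ty)))
            (lia 1 (λ b → ⊢ b :- # 2 :< b) b)
            (between-M⇒≉0 (lia 3 (λ b m v → b :≡ m :+ (v :+ # 1) ⇒ # 3 :≤ v ⇒ ⊢ m :< b :- # 2) b M ν b≡ 3≤ν)
              (lia 2 (λ b m → b :< m :+ m ⇒ ⊢ b :- # 2 :< m :+ m) b M b<2M)))
        ; ψ = c ∸ 1 ; kind = rightD r≡D δ≡2 b≡ (trans (cong (λ k → + (k ∸ 1)) c≡n) (+[n∸1] ps e c 1≤e′ row)) refl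
        ; residue≡ = toResidue (residue-n ps e c 1≤e′ row r≡D c≡n) refl
        ; record≡ = trans (cong (λ l → recordedBox ty n n (e , l)) row)
            (trans (record-skip n e (e ℕ.+ c) (skipped-n {e} r≡D (cong (e ℕ.+_) c≡n)))
            (cong (e ,_) (ℕₚ.+-∸-assoc e (subst (1 ℕ.≤_) (sym c≡n) (ℕₚ.≤-trans (s≤s z≤n) 2≤n))))) }
        where
        3≤ν = right-D⇒3≤ν r≡D
        δ≡2 : + 2 + ν - ν ≡ + 2
        δ≡2 = lia 1 (λ v → ⊢ # 2 :+ v :- v :≡ # 2) ν
        b≡ : b ≡ M + (ν + + 1)
        b≡ = lia 4 (λ b m c v → c :≡ b :- m :- # 1 ⇒ c :≡ v ⇒ ⊢ b :≡ m :+ (v :+ # 1)) b M (+ c) ν +c (cong +_ c≡n)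

      rightD′-case : right ty ≡ D → c ≡ n ℕ.+ 1 → PeelCase v e b
      rightD′-case r≡D c≡ = record
        { r = n ; r≤n = ℕₚ.≤-refl ; x = ν ; y = + 2 + ν ; simple = rightD-gen r≡D
        ; isDown = inj₁ (by (+ 1) (trans (lia 3 (λ b m v → b :≡ m :+ (v :+ # 2) ⇒ ⊢ b :≡ # 2 :+ v :+ m) b M ν b≡)
            (cong (λ z → + 2 + ν + z) (sym (ℤₚ.*-identityˡ M)))))
        ; gap = subst (¬_ ∘ AtOrAboveLowest v) (sym (cong (λ z → b - z) δ≡2)) (unbead
            (lia 4 (λ b m v r → b :≡ m :+ (v :+ # 2) ⇒ # 3 :≤ v ⇒ r :≤ m :+ # 1 ⇒ ⊢ r :< b :- # 2) b M ν base b≡ 3≤ν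
                (level≤M+1 (left ty)))
            (lia 1 (λ b → ⊢ b :- # 2 :< b) b)
            (between-M⇒≉0 (lia 3 (λ b m v → b :≡ m :+ (v :+ # 2) ⇒ # 3 :≤ v ⇒ ⊢ m :< b :- # 2) b M ν b≡ 3≤ν)
              (lia 2 (λ b m → b :< m :+ m ⇒ ⊢ b :- # 2 :< m :+ m) b M b<2M)))
        ; ψ = c ; kind = rightD′ r≡D δ≡2 b≡ (cong +_ c≡) refl
        ; residue≡ = toResidue (residue-n+1 ps e c 1≤e′ row r≡D c≡)
            (cong (if_then just n else nothing) (cong₂ _∧_ (≡ᵇ-true {n ∸ 1} refl) (≡ᵇ-true {n} refl)))
        ; record≡ = plainRecord (inj₂ (inj₂ λ eq′ → ℕₚ.1+n≢n (trans (ℕₚ.+-comm 1 n)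
            (trans (sym c≡) (ℕₚ.+-cancelˡ-≡ e c n eq′)))))
            (inj₂ (inj₁ λ eq′ → ℕₚ.>⇒≢ (ℕₚ.≤-trans (s≤s z≤n) 2≤n) eq′)) }
        where
        3≤ν = right-D⇒3≤ν r≡D
        δ≡2 : + 2 + ν - ν ≡ + 2
        δ≡2 = lia 1 (λ v → ⊢ # 2 :+ v :- v :≡ # 2) ν
        b≡ : b ≡ M + (ν + + 2)
        b≡ = lia 4 (λ b m c v → c :≡ b :- m :- # 1 ⇒ c :≡ v :+ # 1 ⇒ ⊢ b :≡ m :+ (v :+ # 2)) b M (+ c) ν +c
            (cong +_ c≡)

      leftD-case : left ty ≡ D → c ≡ 1 → AtOrAboveLowest v (M + + 1) → (∃[ m ] e ≡ 1 ℕ.+ 2 ℕ.* m) → PeelCase v e b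
      leftD-case l≡D c≡1 bd (m , e≡) = record
        { r = 0 ; r≤n = z≤n ; x = -1ℤ ; y = + 2 ; simple = leftD-gen l≡D
        ; isDown = inj₁ (by (+ 1) (trans b≡ (trans (ℤₚ.+-comm M (+ 2))
            (cong (λ z → + 2 + z) (sym (ℤₚ.*-identityˡ M))))))
        -- b - 3 = M - 1 is the opposite of M + 1, which is a bead in this case.
        ; gap = subst (¬_ ∘ AtOrAboveLowest v) (lia 2 (λ b m → b :≡ m :+ # 2 ⇒ ⊢ m :+ m :- (m :+ # 1) :≡ b :- # 3) b M
            b≡) (bead-opposite v bd)
        ; ψ = c ; kind = leftD l≡D refl b≡ (cong +_ c≡1)
        ; residue≡ = toResidue (trans (residue-1 ps e c 1≤e′ row l≡D c≡1)
            (trans (cong (λ e → mainResidue (e , e ℕ.+ 1)) e≡) (main-odd m))) refl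
        ; record≡ = plainRecord (inj₂ (inj₁ (λ eq → ℕₚ.>⇒≢ (ℕₚ.≤-trans (s≤s z≤n) 2≤n) (sym eq))))
            (inj₂ (inj₂ ((λ eq′ → ℕₚ.0≢1+n (trans (sym (ℕₚ.+-cancelˡ-≡ e c 0 (trans eq′ (sym (ℕₚ.+-identityʳ e)))))
                c≡1))
                        , λ eq′ → ℕₚ.<⇒≢ c<2n (ℕₚ.+-cancelˡ-≡ e c (2 ℕ.* n) eq′)))) }
        where
        b≡ : b ≡ M + + 2
        b≡ = lia 3 (λ b m c → c :≡ b :- m :- # 1 ⇒ c :≡ # 1 ⇒ ⊢ b :≡ m :+ # 2) b M (+ c) +c (cong +_ c≡1)

      unit-case : 1 ℕ.≤ c → (right ty ≡ D → c ≢ n × c ≢ n ℕ.+ 1) → ¬ AtOrAboveLowest v (b - + 1) →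
                  residue ty n ps (e , e ℕ.+ c) ≡ one (peeled c) → PeelCase v e b
      unit-case 1≤c c≢ gap₁ res = record
        { r = peeled c ; r≤n = r≤n ; x = x ; y = y ; simple = simple ; isDown = isDown
        ; gap = subst (¬_ ∘ AtOrAboveLowest v) (cong (λ z → b - z) (sym δ≡1)) gap₁
        ; ψ = c
        ; kind = unit δ≡1 (lia 3 (λ b m c → c :≡ b :- m :- # 1 ⇒ # 1 :≤ c ⇒ ⊢ m :+ # 2 :≤ b) b M (+ c) +c (+≤+ 1≤c))
            b<2M
            (λ r≡D → (λ b≡ → proj₁ (c≢ r≡D) (ℤₚ.+-injective (lia 4
                (λ b m c v → c :≡ b :- m :- # 1 ⇒ b :≡ m :+ (v :+ # 1) ⇒ ⊢ c :≡ v) b M (+ c) ν +c b≡)))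
                   , (λ b≡ → proj₂ (c≢ r≡D) (ℤₚ.+-injective (lia 4
                       (λ b m c v → c :≡ b :- m :- # 1 ⇒ b :≡ m :+ (v :+ # 2) ⇒ ⊢ c :≡ v :+ # 1) b M (+ c) ν +c b≡))))
            +c
            (λ b≡ → let c≡ = ℤₚ.+-injective (trans (lia 4 (λ b m c v → c :≡ b :- m :- # 1 ⇒ b :≡ m :+ v ⇒ ⊢ c :≡ v :- # 1) b M (+ c) ν +c b≡) (sym (+[n∸1] ps e c 1≤e′ row)))
                    in trans (peeled-small c (ℕₚ.≤-trans (ℕₚ.≤-reflexive c≡) (ℕₚ.m∸n≤m n 1))) c≡)
        ; residue≡ = toResidue res refl
        ; record≡ = plainRecord (assoc r≢n) (inj₂ (inj₁ r≢0)) }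
        where
        open UnitStep (unitStep c 1≤c c<2n (proj₁ ∘ c≢) b≡c)
        assoc : right ty ≡ C ⊎ peeled c ≢ n → right ty ≡ C ⊎ peeled c ≢ n ⊎ e ℕ.+ c ≢ e ℕ.+ n
        assoc (inj₁ p) = inj₁ p
        assoc (inj₂ p) = inj₂ (inj₁ p)

      generic-case : 1 ℕ.≤ c → (left ty ≡ D → 2 ℕ.≤ c) → (right ty ≡ D → c ≢ n × c ≢ n ℕ.+ 1) → PeelCase v e b
      generic-case 1≤c 2≤c c≢ = unit-case 1≤c c≢
        (unbead (base<b-1 (End-cases (left ty))) (lia 1 (λ b → ⊢ b :- # 1 :< b) b)
          (between-M⇒≉0 (lia 3 (λ b m c → c :≡ b :- m :- # 1 ⇒ # 1 :≤ c ⇒ ⊢ m :< b :- # 1) b M (+ c) +c (+≤+ 1≤c))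
            (lia 2 (λ b m → b :< m :+ m ⇒ ⊢ b :- # 1 :< m :+ m) b M b<2M)))
        (residue-generic ps e c 1≤e′ row 1≤c c<2n 2≤c c≢)
        where
        base<b-1 : left ty ≡ C ⊎ left ty ≡ D → base < b - + 1
        base<b-1 (inj₁ l≡C) = lia 4 (λ b m c r → c :≡ b :- m :- # 1 ⇒ # 1 :≤ c ⇒ r :≡ m ⇒ ⊢ r :< b :- # 1) b M (+ c)
            base +c (+≤+ 1≤c) (base-C l≡C)
        base<b-1 (inj₂ l≡D) = lia 4 (λ b m c r → c :≡ b :- m :- # 1 ⇒ # 2 :≤ c ⇒ r :≡ m :+ # 1 ⇒ ⊢ r :< b :- # 1) b M
            (+ c) base +c (+≤+ (2≤c l≡D)) (base-D l≡D)

      -- The main descalator decides. If M + 1 is a bead, then e is odd, the residue is 0 and s₀ᴰ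
      -- lowers M + 2 to M - 1; if it is a gap, then e is even, the residue is 1 and s₁ lowers M + 2
      -- to M + 1.
      one-case : left ty ≡ D → c ≡ 1 → PeelCase v e b
      one-case l≡D c≡1 = go (level-parity l≡D)
        where
        b-1≡ : M + + 1 ≡ b - + 1
        b-1≡ = lia 3 (λ b m c → c :≡ b :- m :- # 1 ⇒ c :≡ # 1 ⇒ ⊢ m :+ # 1 :≡ b :- # 1) b M (+ c) +c (cong +_ c≡1)
        go : (AtOrAboveLowest v (M + + 1) × ∃[ m ] e ≡ 1 ℕ.+ 2 ℕ.* m) ⊎
            (¬ AtOrAboveLowest v (M + + 1) × ∃[ m ] e ≡ 2 ℕ.* m) → PeelCase v e b
        go (inj₁ (bd , m)) = leftD-case l≡D c≡1 bd m
        go (inj₂ (¬bd , m , e≡)) = unit-case (ℕₚ.≤-reflexive (sym c≡1))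
          (λ _ → (λ c≡n → ℕₚ.<⇒≢ 2≤n (trans (sym c≡1) c≡n)) , (λ c≡ → ℕₚ.<⇒≢ 2≤n
              (trans (sym c≡1) (trans c≡ (absurd c≡)))))
          (subst (¬_ ∘ AtOrAboveLowest v) b-1≡ ¬bd)
          (trans (residue-1 ps e c 1≤e′ row l≡D c≡1) (trans (cong (λ e → mainResidue (e , e ℕ.+ 1)) e≡)
            (trans (main-even m) (cong one (sym (trans (peeled-small c
                (ℕₚ.≤-trans (ℕₚ.≤-reflexive c≡1) (ℕₚ.≤-trans (s≤s z≤n) 2≤n))) c≡1))))))
          where
          absurd : c ≡ n ℕ.+ 1 → n ℕ.+ 1 ≡ n
          absurd c≡ = contradiction (trans (sym c≡1) c≡) (ℕₚ.<⇒≢ (ℕₚ.≤-trans 2≤n (ℕₚ.m≤m+n n 1)))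

      inner-case : PeelCase v e b
      inner-case = go (c ℕₚ.≟ 0) (c ℕₚ.≟ 1) (c ℕₚ.≟ n) (c ℕₚ.≟ n ℕ.+ 1) (End-cases (left ty)) (End-cases (right ty))
        where
        1≤ : c ≢ 0 → 1 ℕ.≤ c
        1≤ = ℕₚ.n≢0⇒n>0
        2≤ : c ≢ 0 → c ≢ 1 → 2 ℕ.≤ c
        2≤ c≢0 c≢1 = ℕₚ.≤∧≢⇒< (1≤ c≢0) (c≢1 ∘ sym)
        go : Dec (c ≡ 0) → Dec (c ≡ 1) → Dec (c ≡ n) → Dec (c ≡ n ℕ.+ 1) →
             left ty ≡ C ⊎ left ty ≡ D → right ty ≡ C ⊎ right ty ≡ D → PeelCase v e b
        go (yes c≡0) _ _ _ _ _ = low-case c≡0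
        go (no c≢0) c≟1 c≟n c≟n+1 l r = left-go c≟1 l
          where
          right-go : Dec (c ≡ n) → Dec (c ≡ n ℕ.+ 1) → right ty ≡ C ⊎ right ty ≡ D → (left ty ≡ D → 2 ℕ.≤ c)
              → PeelCase v e b
          right-go (yes c≡n) _ (inj₂ r≡D) _ = rightD-case r≡D c≡n
          right-go (no _) (yes c≡) (inj₂ r≡D) _ = rightD′-case r≡D c≡
          right-go (no c≢n) (no c≢) (inj₂ _) 2≤c = generic-case (1≤ c≢0) 2≤c (λ _ → c≢n , c≢)
          right-go _ _ (inj₁ r≡C) 2≤c = generic-case (1≤ c≢0) 2≤c (λ r≡D → contradiction (trans (sym r≡C) r≡D) C≢D)
          left-go : Dec (c ≡ 1) → left ty ≡ C ⊎ left ty ≡ D → PeelCase v e b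
          left-go (yes c≡1) (inj₂ l≡D) = one-case l≡D c≡1
          left-go (no c≢1) (inj₂ _) = right-go c≟n c≟n+1 r (λ _ → 2≤ c≢0 c≢1)
          left-go _ (inj₁ l≡C) = right-go c≟n c≟n+1 r (λ l≡D → contradiction (trans (sym l≡C) l≡D) C≢D)

    peelCase : PeelCase v e b
    peelCase = go reference-range
      where
      go : b < M + M ⊎ (b ≡ M + M + + 1 × left ty ≡ D) → PeelCase v e b
      go (inj₁ b<2M)        = inner-case b<2M
      go (inj₂ (b≡ , l≡D)) = top-case b≡ l≡D

  -- Left multiplication moves the beads by the generator

  Moved : (ℤ → ℤ) → Mirrored n → Mirrored n → Set
  Moved g v v′ = ∀ z → AtOrAboveLowest v′ z ⇔ AtOrAboveLowest v (g z)

  -- Because the generators of W keep entries below M there, the abacus depends only on the coset. A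
  -- step by 1 could only reach M, which is no entry; sₙᴰ steps by 2, but M - 1 lies in no raised
  -- class.
  window-step : ∀ r → 1 ℕ.≤ r → r ℕ.≤ n → ∀ {i} → ¬ i ≈ 0ℤ → i < M → gen ty n r i < M
  window-step r 1≤r r≤n {i} i≉0 i<M = go (ℕₚ.m≤n⇒m<n∨m≡n r≤n)
    where
    unit-step : ∀ {g x y} → Simple g x y → y - x ≡ + 1 → g i < M
    unit-step {g} {x} {y} s δ≡1 = byMove (move i)
      where
      open Reflection (Simple.reflection s)
      gi≉0 : ¬ g i ≈ 0ℤ
      gi≉0 = i≉0 ∘ ≈0-image⁻ (simple-involution s)
      byMove : Moves g x y i → g i < M
      byMove (up _ e) = ℤₚ.≤∧≢⇒< (lia 4 (λ i gi d m → gi :≡ i :+ d ⇒ d :≡ # 1 ⇒ i :< m ⇒ ⊢ gi :≤ m) i (g i) (y - x) M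
          e δ≡1 i<M)
        λ eq → gi≉0 (≈-trans (≡⇒≈ eq) M≈0)
      byMove (down _ e) = lia 4 (λ i gi d m → gi :≡ i :- d ⇒ d :≡ # 1 ⇒ i :< m ⇒ ⊢ gi :< m) i (g i) (y - x) M e δ≡1
          i<M
      byMove (fixed _ _ e) = subst (_< M) (sym e) i<M
    right-step : right ty ≡ C ⊎ right ty ≡ D → gen ty n n i < M
    right-step (inj₁ r≡C) = unit-step (rightC-gen r≡C) (lia 1 (λ v → ⊢ # 1 :+ v :- v :≡ # 1) ν)
    right-step (inj₂ r≡D) = byMove (move i)
      where
      3≤ν = right-D⇒3≤ν r≡D
      open Reflection (Simple.reflection (rightD-gen r≡D))
      gi = gen ty n n i
      gi≉0 : ¬ gi ≈ 0ℤ
      gi≉0 = i≉0 ∘ ≈0-image⁻ (simple-involution (rightD-gen r≡D))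
      notTop : Up ν (+ 2 + ν) i → i ≢ M - + 1
      notTop (inj₁ p) eq = difference⇒≉′ {ν} {M - + 1} (lia 2 (λ m v → m :≡ # 1 :+ 2 :* v ⇒ # 3 :≤ v ⇒ ⊢ v :< m
          :- # 1) M ν M≡ 3≤ν)
        (lia 2 (λ m v → # 3 :≤ v ⇒ ⊢ m :- # 1 :< v :+ m) M ν 3≤ν) (≈-substˡ eq p)
      notTop (inj₂ p) eq = ≉-opposite {M - + 1} {+ 2 + ν - M} (lia 2
          (λ m v → # 3 :≤ v ⇒ ⊢ # 0 :< m :- # 1 :+ (# 2 :+ v :- m)) M ν 3≤ν)
        (lia 2 (λ m v → m :≡ # 1 :+ 2 :* v ⇒ # 3 :≤ v ⇒ ⊢ m :- # 1 :+ (# 2 :+ v :- m) :< m) M ν M≡ 3≤ν)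
        (≈-trans (≈-substˡ eq p) (≈-neg (by (+ 1) (trans (lia 2 (λ m v → ⊢ # 2 :+ v :≡ # 2 :+ v :- m :+ m) M ν)
            (cong (λ z → + 2 + ν - M + z) (sym (ℤₚ.*-identityˡ M)))))))
      byMove : Moves (gen ty n n) ν (+ 2 + ν) i → gi < M
      byMove (up u e) = ℤₚ.≤∧≢⇒< (lia 4 (λ i gi v m → gi :≡ i :+ (# 2 :+ v :- v) ⇒ i :< m :- # 1 ⇒ ⊢ gi :≤ m) i gi ν M
          e
          (ℤₚ.≤∧≢⇒< (lia 2 (λ i m → i :< m ⇒ ⊢ i :≤ m :- # 1) i M i<M) (notTop u)))
        λ eq → gi≉0 (≈-trans (≡⇒≈ eq) M≈0)
      byMove (down _ e) = lia 4 (λ i gi v m → gi :≡ i :- (# 2 :+ v :- v) ⇒ i :< m ⇒ ⊢ gi :< m) i gi ν M e i<M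
      byMove (fixed _ _ e) = subst (_< M) (sym e) i<M
    go : r ℕ.< n ⊎ r ≡ n → gen ty n r i < M
    go (inj₁ r<n) = unit-step (swap-gen 1≤r r<n) (lia 1 (λ r → ⊢ # 1 :+ r :- r :≡ # 1) (+ r))
    go (inj₂ eq)  = subst (λ r → gen ty n r i < M) (sym eq) (right-step (End-cases (right ty)))

  word-window : ∀ u {i} → ¬ i ≈ 0ℤ → i < M → ¬ ⟦_⟧ᵂ ty n u i ≈ 0ℤ × ⟦_⟧ᵂ ty n u i < M
  word-window [] i≉0 i<M = i≉0 , i<M
  word-window (r ∷ u) {i} i≉0 i<M = let p , q = word-window u i≉0 i<M in
    p ∘ ≈0-image⁻ (gen-involution (suc (toℕ r)) (Finₚ.toℕ<n r)) , window-step (suc (toℕ r)) (s≤s z≤n) (Finₚ.toℕ<n r) p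
        q

  word-shift : ∀ u k z → ⟦_⟧ᵂ ty n u (z + k * M) ≡ ⟦_⟧ᵂ ty n u z + k * M
  word-shift [] k z = refl
  word-shift (r ∷ u) k z = trans (cong (gen ty n (suc (toℕ r))) (word-shift u k z)) (shift k (⟦_⟧ᵂ ty n u z))
    where
    open Involution (gen-involution (suc (toℕ r)) (Finₚ.toℕ<n r))

  word-neg : ∀ u z → ⟦_⟧ᵂ ty n u (- z) ≡ - ⟦_⟧ᵂ ty n u z
  word-neg [] z = refl
  word-neg (r ∷ u) z = trans (cong (gen ty n (suc (toℕ r))) (word-neg u z)) (neg (⟦_⟧ᵂ ty n u z))
    where
    open Involution (gen-involution (suc (toℕ r)) (Finₚ.toℕ<n r))

  word-window⁻ : ∀ u {i} → ¬ i ≈ 0ℤ → M < i → M < ⟦_⟧ᵂ ty n u i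
  word-window⁻ u {i} i≉0 M<i = lia 3 (λ p q m → p :≡ :- q :+ 2 :* m ⇒ p :< m ⇒ ⊢ m :< q) (W (opposite i)) (W i) M
    (trans (cong W (two i M)) (trans (word-shift u (+ 2) (- i)) (cong (_+ + 2 * M) (word-neg u i))))
    (proj₂ (word-window u (opposite-≉0 i≉0) (lia 2 (λ i m → m :< i ⇒ ⊢ m :+ m :- i :< m) i M M<i)))
    where
    W = ⟦_⟧ᵂ ty n u
    two : ∀ b m → m + m - b ≡ - b + + 2 * m
    two = solve-∀

  -- `inverse v (g z)` is u applied to `inverse v′ z`, and an element of W moves no entry across M.
  acts⇒moved : ∀ {r} → r ℕ.≤ n → ∀ v v′ u → fun v′ ≗ gen ty n r ∘ fun v ∘ ⟦_⟧ᵂ ty n u → Moved (gen ty n r) v v′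
  acts⇒moved {r} r≤n v v′ u eq z = mk⇔ to from
    where
    g = gen ty n r
    i = inverse v′ z
    W = ⟦_⟧ᵂ ty n u
    open Involution (gen-involution r r≤n)
    inv≡ : inverse v (g z) ≡ W i
    inv≡ = fun-injective v (trans (fun-inverse v (g z)) (trans (cong g (trans (sym (fun-inverse v′ z)) (eq i)))
        (involutive (fun v (W i)))))
    to : AtOrAboveLowest v′ z → AtOrAboveLowest v (g z)
    to bd = let z≉0 , i<M = bead⇒ v′ bd
                _ , p = word-window u (z≉0 ∘ inverse-≈0⁻ v′) i<M
            in bead⇐ v (z≉0 ∘ ≈0-image⁻ (gen-involution r r≤n)) (subst (_< M) (sym inv≡) p)
    from : AtOrAboveLowest v (g z) → AtOrAboveLowest v′ z
    from bd = let gz≉0 , lt = bead⇒ v bd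
                  z≉0 = λ p → gz≉0 (≈0-image (gen-involution r r≤n) p)
              in bead⇐ v′ z≉0 (ℤₚ.≰⇒> λ M≤i → ℤₚ.<-asym (subst (_< M) inv≡ lt)
                   (word-window⁻ u (z≉0 ∘ inverse-≈0⁻ v′) (ℤₚ.≤∧≢⇒< M≤i λ eq → z≉0
                       (inverse-≈0⁻ v′ (≈-trans (≡⇒≈ (sym eq)) M≈0)))))

  -- One peeling step on the beads

  module Stepping (v v′ : Mirrored n) (wt : W̃ ty n v) {xs b} (eq : referenceBeads v ≡ xs ∷ʳ b)
              (pc : PeelCase v (length (referenceBeads v)) b) (moved : Moved (gen ty n (PeelCase.r pc)) v v′) where

    open PeelCase pc
    open Reference (snoc-reference v eq)
    open Simple simple using (reflection; x<y; y-x≤3; inside)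
    open Reflection reflection

    g : ℤ → ℤ
    g = gen ty n r

    open Involution (simple-involution simple)

    δ : ℤ
    δ = y - x

    1≤δ : + 1 ≤ δ
    1≤δ = lia 2 (λ x y → x :< y ⇒ ⊢ # 1 :≤ y :- x) x y x<y

    M<b′ : M < b
    M<b′ = M<b v wt eq

    g-b : g b ≡ b - δ
    g-b = down-eq isDown

    up-class : ∀ {z} → Up x y z → z ≈ b - δ ⊎ z ≈ - b
    up-class {z} = go isDown
      where
      go : Down x y b → Up x y z → z ≈ b - δ ⊎ z ≈ - b
      go (inj₁ d) (inj₁ u) = inj₁ (≈-trans u (≈-sym (≈-substʳ (lia 2 (λ x y → ⊢ y :+ :- (y :- x) :≡ x) x y)
          (≈-+ (- δ) d))))
      go (inj₁ d) (inj₂ u) = inj₂ (≈-trans u (≈-neg (≈-sym d)))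
      go (inj₂ d) (inj₁ u) = inj₂ (≈-trans u (≈-sym (≈-neg′ d)))
      go (inj₂ d) (inj₂ u) = inj₁ (≈-trans u (≈-sym (≈-substʳ (lia 2 (λ x y → ⊢ :- x :+ :- (y :- x) :≡ :- y) x y)
          (≈-+ (- δ) d))))

    down-class : ∀ {z} → Down x y z → z ≈ b ⊎ z ≈ δ - b
    down-class {z} d = go (up-class (Down-− d))
      where
      z≡ : z - δ + δ ≡ z
      z≡ = lia 2 (λ z d → ⊢ z :- d :+ d :≡ z) z δ
      go : z - δ ≈ b - δ ⊎ z - δ ≈ - b → z ≈ b ⊎ z ≈ δ - b
      go (inj₁ p) = inj₁ (≈-substˡ z≡ (≈-substʳ (lia 2 (λ z d → ⊢ z :- d :+ d :≡ z) b δ) (≈-+ δ p)))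
      go (inj₂ p) = inj₂ (≈-substˡ z≡ (≈-substʳ (ℤₚ.+-comm (- b) δ) (≈-+ δ p)))

    -- The raised runners are those of b - δ and of - b. Both b - δ and the opposite 2M - b are
    -- gaps, so a bead on these runners is smaller by at least M.
    up-bead : ∀ {z} → Up x y z → AtOrAboveLowest v z → z ≤ b - δ - M ⊎ z ≤ M - b
    up-bead {z} u bd = go (up-class u)
      where
      go : z ≈ b - δ ⊎ z ≈ - b → z ≤ b - δ - M ⊎ z ≤ M - b
      go (inj₁ p) = inj₁ (lia 3 (λ z c m → z :+ m :≤ c ⇒ ⊢ z :≤ c :- m) z (b - δ) M
        (≈-next (≈-sym p) (ℤₚ.≰⇒> λ le → gap (bead-≈-≤ v (≈-sym p) le bd))))
      go (inj₂ p) = inj₂ (lia 3 (λ z b m → z :+ m :≤ m :+ m :- b ⇒ ⊢ z :≤ m :- b) z b M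
        (≈-next (≈-sym p′) (ℤₚ.≰⇒> λ le → bead-opposite v bead (bead-≈-≤ v (≈-sym p′) le bd))))
        where
        p′ : z ≈ opposite b
        p′ = ≈-trans p (≈-sym (by (+ 2) (two b M)))
          where
          two : ∀ b m → m + m - b ≡ - b + + 2 * m
          two = solve-∀

    5≤M : + 5 ≤ M
    5≤M = lia 2 (λ m v → m :≡ # 1 :+ 2 :* v ⇒ # 2 :≤ v ⇒ ⊢ # 5 :≤ m) M ν M≡ 2≤ν

    -- With the bounds on b this keeps raised beads out of the reference region, so no new reference
    -- bead appears.
    up-bead-low : ∀ {z} → Up x y z → AtOrAboveLowest v z → z + δ ≤ base
    up-bead-low {z} u bd = go (up-bead u bd) (reference-range v wt eq)
      where
      go : z ≤ b - δ - M ⊎ z ≤ M - b → b < M + M ⊎ (b ≡ M + M + + 1 × left ty ≡ D) → z + δ ≤ base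
      go (inj₁ le) (inj₁ lt) = lia 5 (λ z b d m r → z :≤ b :- d :- m ⇒ b :< m :+ m ⇒ m :≤ r ⇒ ⊢ z :+ d :≤ r) z b δ M
          base le lt (M≤level (left ty))
      go (inj₁ le) (inj₂ (b≡ , l≡D)) = lia 5 (λ z b d m r → z :≤ b :- d :- m ⇒ b :≡ m :+ m :+ # 1 ⇒ r :≡ m :+ # 1 ⇒
          ⊢ z :+ d :≤ r) z b δ M base le b≡ (base-D l≡D)
      go (inj₂ le) _ = lia 5 (λ z b d m r → z :≤ m :- b ⇒ m :< b ⇒ d :≤ # 3 ⇒ # 5 :≤ m ⇒ m :≤ r ⇒ ⊢ z :+ d :≤ r) z b δ
          M base le M<b′ y-x≤3 5≤M (M≤level (left ty))

    reference-not-up : ∀ {z} → base < z → AtOrAboveLowest v z → ¬ Up x y z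
    reference-not-up {z} lt bd u = lia 3 (λ z d r → z :+ d :≤ r ⇒ r :< z ⇒ # 1 :≤ d ⇒ ⊢⊥) z δ base (up-bead-low u bd)
        lt 1≤δ

    L = referenceBeads v

    ∈L⁻ : ∀ {z} → z ∈ L → base < z × AtOrAboveLowest v z × ¬ z ≈ 0ℤ
    ∈L⁻ z∈ = let lt , bd , e = ∈-beadsAbove⁻ (𝒜 v) z∈ in lt , bd , Entry⇒≉0 e

    ∈L⁺ : ∀ {z} → base < z → AtOrAboveLowest v z → z ∈ L
    ∈L⁺ lt bd = ∈-beadsAbove⁺ (𝒜 v) 0≤base lt (≉0⇒Entry (proj₁ (bead⇒ v bd))) bd

    ∈xs⇒∈L : ∀ {z} → z ∈ xs → z ∈ L
    ∈xs⇒∈L {z} z∈ = subst (z ∈_) (sym eq) (∈-++⁺ˡ z∈)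

    xs>b : ∀ {z} → z ∈ xs → b < z
    xs>b = go xs (subst (AllPairs ℤ._>_) eq (beadsAbove-sorted (𝒜 v) base))
      where
      go : ∀ ys {z} → AllPairs ℤ._>_ (ys ∷ʳ b) → z ∈ ys → b < z
      go (y ∷ ys) (y> ∷ _) (here refl) = All.lookup y> (∈-++⁺ʳ ys (here refl))
      go (y ∷ ys) (_ ∷ s) (there z∈) = go ys s z∈

    g-injective : ∀ {p q} → g p ≡ g q → p ≡ q
    g-injective {p} {q} e = trans (sym (involutive p)) (trans (cong g e) (involutive q))

    g-mono : ∀ {p q} → p ∈ L → q ∈ L → p < q → g p < g q
    g-mono {p} {q} p∈ q∈ p<q = go (ℤₚ.<-cmp (g p) (g q))
      where
      go : Tri (g p < g q) (g p ≡ g q) (g q < g p) → g p < g q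
      go (tri< lt _ _) = lt
      go (tri≈ _ e _)  = contradiction (g-injective e) (ℤₚ.<⇒≢ p<q)
      go (tri> _ _ gt) = let lt , bd , p≉0 = ∈L⁻ p∈
                             _ , _ , q≉0 = ∈L⁻ q∈
                         in contradiction (proj₁ (reversal simple p≉0 q≉0 p<q gt)) (reference-not-up lt bd)

    data Lowered (z : ℤ) : Set where
      moves : Down x y z → g z ≡ z - δ → Lowered z
      stays : ¬ Down x y z → g z ≡ z → Lowered z

    lowered : ∀ {z} → z ∈ L → Lowered z
    lowered {z} z∈ = go (move z)
      where
      go : Moves g x y z → Lowered z
      go (up u _)       = let lt , bd , _ = ∈L⁻ z∈ in contradiction u (reference-not-up lt bd)
      go (down d e)     = moves d e
      go (fixed _ ¬d e) = stays ¬d e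

    -- Only b itself can leave the reference region. Another lowered bead on its runner is at least
    -- b + M; on the mirrored runner either b - δ ≥ `base` already, or the runner is that of M + 1
    -- and z lies at least M beyond this label.
    down-far : ∀ {z} → Down x y z → b < z → base < z - δ
    down-far {z} d b<z = go (down-class d)
      where
      same : z ≈ b → base < z - δ
      same p = lia 5 (λ z b d m r → b :+ m :≤ z ⇒ d :≤ # 3 ⇒ # 5 :≤ m ⇒ r :≤ m :+ # 1 ⇒ m :< b ⇒ ⊢ r :< z :- d) z b δ
          M base
        (≈-next p b<z) y-x≤3 5≤M (level≤M+1 (left ty)) M<b′
      near : base ≤ b - δ → base < z - δ
      near le = lia 4 (λ z b d r → b :< z ⇒ r :≤ b :- d ⇒ ⊢ r :< z :- d) z b δ base b<z le
      byKind : Kind b δ r ψ → z ≈ δ - b → base < z - δ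
      byKind (unit δ≡1 lo hi _ _ _) _ = near (lia 4 (λ b d m r → d :≡ # 1 ⇒ m :+ # 2 :≤ b ⇒ r :≤ m :+ # 1 ⇒ ⊢ r :≤ b
          :- d) b δ M base δ≡1 lo (level≤M+1 (left ty)))
      byKind (leftC _ δ≡2 b≡ _) p = same (≈-trans p (by (- + 2) (trans
          (lia 3 (λ b d m → d :≡ # 2 ⇒ b :≡ m :+ # 1 ⇒ ⊢ d :- b :≡ b :+ :- (m :+ m)) b δ M δ≡2 b≡)
          (cong (λ z → b + z) (trans (cong -_ (sym 2M)) (ℤₚ.neg-distribˡ-* (+ 2) M))))))
      byKind (leftD l≡D δ≡3 b≡ _) p = lia 5 (λ z d m r v → m :+ # 1 :+ m :≤ z ⇒ d :≡ # 3 ⇒ m :≡ # 1 :+ 2 :* v ⇒ # 3 :≤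
          v ⇒ r :≡ m :+ # 1 ⇒ ⊢ r :< z :- d) z δ M base ν
        (≈-next z≈ (lia 3 (λ z b m → b :< z ⇒ b :≡ m :+ # 2 ⇒ ⊢ m :+ # 1 :< z) z b M b<z b≡)) δ≡3 M≡ (left-D⇒3≤ν l≡D)
            (base-D l≡D)
        where
        z≈ : z ≈ M + + 1
        z≈ = ≈-trans p (by (- + 2) (trans (lia 3 (λ b d m → d :≡ # 3 ⇒ b :≡ m :+ # 2 ⇒ ⊢ d :- b :≡ m :+ # 1 :+
            :- (m :+ m)) b δ M δ≡3 b≡) (cong (λ z → M + + 1 + z)
            (trans (cong -_ (sym 2M)) (ℤₚ.neg-distribˡ-* (+ 2) M)))))
      byKind (leftD′ l≡D δ≡3 b≡ _) _ = near (lia 5 (λ b d m r v → d :≡ # 3 ⇒ b :≡ m :+ m :+ # 1 ⇒ m :≡ # 1 :+ 2 :* v ⇒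
          # 3 :≤ v ⇒ r :≤ m :+ # 1 ⇒ ⊢ r :≤ b :- d) b δ M base ν δ≡3 b≡ M≡ (left-D⇒3≤ν l≡D) (level≤M+1 (left ty)))
      byKind (rightD r≡D δ≡2 b≡ _ _) _ = near (lia 5 (λ b d m r v → d :≡ # 2 ⇒ b :≡ m :+ (v :+ # 1) ⇒ # 3 :≤ v ⇒ r :≤
          m :+ # 1 ⇒ ⊢ r :≤ b :- d) b δ M base ν δ≡2 b≡ (right-D⇒3≤ν r≡D) (level≤M+1 (left ty)))
      byKind (rightD′ r≡D δ≡2 b≡ _ _) _ = near (lia 5 (λ b d m r v → d :≡ # 2 ⇒ b :≡ m :+ (v :+ # 2) ⇒ # 3 :≤ v ⇒ r :≤
          m :+ # 1 ⇒ ⊢ r :≤ b :- d) b δ M base ν δ≡2 b≡ (right-D⇒3≤ν r≡D) (level≤M+1 (left ty)))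
      go : z ≈ b ⊎ z ≈ δ - b → base < z - δ
      go (inj₁ p) = same p
      go (inj₂ p) = byKind kind p

    g-far : ∀ {z} → z ∈ xs → base < g z
    g-far {z} z∈ = go (lowered (∈xs⇒∈L z∈))
      where
      go : Lowered z → base < g z
      go (moves d e) = subst (base <_) (sym e) (down-far d (xs>b z∈))
      go (stays _ e) = subst (base <_) (sym e) (proj₁ (∈L⁻ (∈xs⇒∈L z∈)))

    L′ = referenceBeads v′

    -- Both lists are descending with the same members: g keeps the order of the reference beads,
    -- and a raised bead ends at or below `base`.
    moved-beads : L′ ≡ filter (base ℤₚ.<?_) (map g L)
    moved-beads = sorted-≡ (λ p q → ℤₚ.<-asym p q) (beadsAbove-sorted (𝒜 v′) base)
      (AllPairsₚ.filter⁺ (base ℤₚ.<?_) (AllPairsₚ.map⁺ (map-sorted (beadsAbove-sorted (𝒜 v) base) id))) to from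
      where
      map-sorted : ∀ {ys} → AllPairs ℤ._>_ ys → (∀ {z} → z ∈ ys → z ∈ L) → AllPairs (λ p q → g p ℤ.> g q) ys
      map-sorted [] _ = []
      map-sorted (y> ∷ s) sub = All.tabulate (λ z∈ → g-mono (sub (there z∈)) (sub (here refl)) (All.lookup y> z∈)) ∷
          map-sorted s (sub ∘ there)
      to : ∀ {z} → z ∈ L′ → z ∈ filter (base ℤₚ.<?_) (map g L)
      to {z} z∈ = ∈-filter⁺ (base ℤₚ.<?_) (subst (_∈ map g L) (involutive z) (∈-map⁺ g (∈L⁺ base<gz bd))) lt
        where
        z∈′ = ∈-beadsAbove⁻ (𝒜 v′) z∈
        lt = proj₁ z∈′
        bd : AtOrAboveLowest v (g z)
        bd = Equivalence.to (moved z) (proj₁ (proj₂ z∈′))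
        base<gz : base < g z
        base<gz = ℤₚ.≰⇒> λ le → go le (move (g z))
          where
          go : g z ≤ base → Moves g x y (g z) → ⊥
          go le (up u e) = ℤₚ.<⇒≱ lt (subst (_≤ base) (trans (sym e) (involutive z)) (up-bead-low u bd))
          go le (down _ e) = lia 4 (λ p z d r → z :≡ p :- d ⇒ # 1 :≤ d ⇒ p :≤ r ⇒ r :< z ⇒ ⊢⊥) (g z) z δ base
              (trans (sym (involutive z)) e) 1≤δ le lt
          go le (fixed _ _ e) = ℤₚ.<⇒≱ lt (subst (_≤ base) (trans (sym e) (involutive z)) le)
      from : ∀ {z} → z ∈ filter (base ℤₚ.<?_) (map g L) → z ∈ L′
      from {z} z∈ = go (∈-map⁻ g (proj₁ z∈′))
        where
        z∈′ = filter⁻ (base ℤₚ.<?_) (map g L) z∈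
        go : ∃[ p ] p ∈ L × z ≡ g p → z ∈ L′
        go (p , p∈ , refl) = ∈-beadsAbove⁺ (𝒜 v′) 0≤base (proj₂ z∈′) (≉0⇒Entry (proj₁ (bead⇒ v′ bd))) bd
          where
          bd : AtOrAboveLowest v′ (g p)
          bd = Equivalence.from (moved (g p)) (subst (AtOrAboveLowest v) (sym (involutive p))
              (proj₁ (proj₂ (∈L⁻ p∈))))

    data Next : Set where
      gone : ¬ base < b - δ → L′ ≡ map g xs → Next
      kept : base < b - δ → L′ ≡ map g xs ∷ʳ (b - δ) → Next

    next : Next
    next = go (base ℤₚ.<? b - δ)
      where
      split : L′ ≡ map g xs ++ filter (base ℤₚ.<?_) (b - δ ∷ [])
      split = trans moved-beads (trans (cong (λ l → filter (base ℤₚ.<?_) (map g l)) eq)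
        (trans (cong (filter (base ℤₚ.<?_)) (trans (Listₚ.map-++ g xs (b ∷ []))
            (cong (λ z → map g xs ++ z ∷ []) g-b)))
        (trans (Listₚ.filter-++ (base ℤₚ.<?_) (map g xs) (b - δ ∷ []))
          (cong (_++ filter (base ℤₚ.<?_) (b - δ ∷ [])) (Listₚ.filter-all (base ℤₚ.<?_)
              (Allₚ.map⁺ (All.tabulate g-far)))))))
      go : Dec (base < b - δ) → Next
      go (yes lt) = kept lt (trans split (cong (map g xs ++_) (Listₚ.filter-accept (base ℤₚ.<?_) {xs = []} lt)))
      go (no ≮)   = gone ≮ (trans split (trans (cong (map g xs ++_) (Listₚ.filter-reject (base ℤₚ.<?_) {xs = []} ≮))
          (Listₚ.++-identityʳ _)))

  -- Gaps of a window and lowest beads.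

  positive-multiple : ∀ q → 0ℤ < q * M → M ≤ q * M
  positive-multiple (+ zero) (+<+ ())
  positive-multiple (+ suc q) _ = lia 3 (λ a p m → a :≡ m :+ p ⇒ # 0 :≤ p ⇒ ⊢ m :≤ a) (+ suc q * M) (+ q * M) M
    (ℤₚ.suc-* (+ q) M) (subst (0ℤ ≤_) (ℤₚ.pos-* q (N n)) (+≤+ z≤n))
  positive-multiple -[1+ q ] lt = ⊥-elim (lia 2 (λ p m → p :≤ :- m ⇒ # 0 :< m ⇒ # 0 :< p ⇒ ⊢⊥) (-[1+ q ] * M) M
      (negative-multiple q) 0<M lt)

  inclusion-exclusion : ∀ {A : Set} {P Q : A → Set} (P? : Decidable P) (Q? : Decidable Q) xs
      → (∀ {x} → x ∈ xs → P x ⊎ Q x) →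
    length (filter P? xs) ℕ.+ length (filter Q? xs) ≡ length xs ℕ.+ length (filter (λ x → P? x ×-dec Q? x) xs)
  inclusion-exclusion P? Q? [] _ = refl
  inclusion-exclusion P? Q? (x ∷ xs) or with P? x | Q? x | inclusion-exclusion P? Q? xs (or ∘ there)
  ... | yes p | yes q | ih = cong suc (trans (ℕₚ.+-suc _ _) (trans (cong suc ih) (sym (ℕₚ.+-suc _ _))))
  ... | yes p | no ¬q | ih = cong suc ih
  ... | no ¬p | yes q | ih = trans (ℕₚ.+-suc _ _) (cong suc ih)
  ... | no ¬p | no ¬q | ih with or (here refl)
  ...   | inj₁ p = contradiction p ¬p
  ...   | inj₂ q = contradiction q ¬q

  runners : List ℕ
  runners = range (2 ℕ.* n)

  ∈-runners⁻ : ∀ {j} → j ∈ runners → 0ℤ < + j × + j < M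
  ∈-runners⁻ j∈ = let p , q = ∈-range⁻ j∈ in +<+ p , +<+ (s≤s q)

  module _ (v : Mirrored n) where

    private
      w = fun v

    lowestBelow : ℤ → ℕ
    lowestBelow c = length (filter (λ j → w (+ j) ℤₚ.<? c) runners)

    runner-≉0 : ∀ {j} → j ∈ runners → ¬ w (+ j) ≈ 0ℤ
    runner-≉0 j∈ p = let lo , hi = ∈-runners⁻ j∈ in between⇒≉0 lo hi (fun-≈0⁻ v p)

    runner-bead : ∀ {j} → j ∈ runners → AtOrAboveLowest v (w (+ j))
    runner-bead {j} j∈ = bead⇐ v (runner-≉0 j∈) (subst (_< M) (sym (inverse-fun v (+ j))) (proj₂ (∈-runners⁻ j∈)))

    -- The gaps of b's window of N labels lie on the runners whose lowest bead
    -- is more than one level above b.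
    gapsBetween-lowestBelow : ∀ v₂ → (∀ z → AtOrAboveLowest v₂ z ⇔ AtOrAboveLowest v z) → ∀ {b} → AtOrAboveLowest v b
        →
      gapsBetween ty (𝒜 v₂) (b - M) b ≡ lowestBelow (b - M)
    gapsBetween-lowestBelow v₂ same {b} bd = bijection-length f g
        (Uniqueₚ.filter⁺ inside? (gaps-unique (𝒜 v₂))) (Uniqueₚ.filter⁺ low? (range-unique (2 ℕ.* n))) f∈ g∈ gf fg
      where
      inside? : Decidable (λ t → b - M < t × t < b)
      inside? t = (b - M ℤₚ.<? t) ×-dec (t ℤₚ.<? b)
      low? = λ j → w (+ j) ℤₚ.<? b - M
      f : ℤ → ℕ
      f t = inverse v t %ℕ N n
      q : ℕ → ℤ
      q j = (b - w (+ j)) /ℕ N n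
      -- The label on the runner of w(j) that is greater than b - M and at most b.
      g : ℕ → ℤ
      g j = w (+ j) + q j * M
      ρ : ℕ → ℕ
      ρ j = (b - w (+ j)) %ℕ N n
      g≡ : ∀ j → g j ≡ b - + ρ j
      g≡ j = lia 4 (λ b w r p → b :- w :≡ r :+ p ⇒ ⊢ w :+ p :≡ b :- r) b (w (+ j)) (+ ρ j) (q j * M)
          (a≡a%ℕn+[a/ℕn]*n (b - w (+ j)) (N n))
      ρ<M : ∀ j → + ρ j < M
      ρ<M j = +<+ (n%ℕd<d (b - w (+ j)) (N n))
      g-lo : ∀ j → b - M < g j
      g-lo j = lia 4 (λ b g r m → g :≡ b :- r ⇒ r :< m ⇒ ⊢ b :- m :< g) b (g j) (+ ρ j) M (g≡ j) (ρ<M j)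
      g-hi : ∀ j → g j ≤ b
      g-hi j = lia 3 (λ b g r → g :≡ b :- r ⇒ # 0 :≤ r ⇒ ⊢ g :≤ b) b (g j) (+ ρ j) (g≡ j) (+≤+ z≤n)
      inverse-g : ∀ j → inverse v (g j) ≡ + j + q j * M
      inverse-g j = trans (inverse-shift v (q j) (w (+ j))) (cong (_+ q j * M) (inverse-fun v (+ j)))
      list⁻ : ∀ {t} → t ∈ filter inside? (gaps (𝒜 v₂)) → (b - M < t × t < b) × ¬ t ≈ 0ℤ × M < inverse v t
      list⁻ {t} t∈ = let t∈′ , in′ = filter⁻ inside? (gaps (𝒜 v₂)) t∈
                         ¬bd , e , _ = ∈-gaps⁻ (𝒜 v₂) t∈′
                     in in′ , Entry⇒≉0 e , gap⇒ v (Entry⇒≉0 e) (¬bd ∘ Equivalence.from (same t))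
      decompose : ∀ t → inverse v t ≡ + f t + inverse v t /ℕ N n * M
      decompose t = a≡a%ℕn+[a/ℕn]*n (inverse v t) (N n)
      w-f : ∀ t → t ≡ w (+ f t) + inverse v t /ℕ N n * M
      w-f t = trans (sym (fun-inverse v t)) (trans (cong w (decompose t)) (fun-shift v (inverse v t /ℕ N n) (+ f t)))
      f<N : ∀ t → f t ℕ.< N n
      f<N t = n%ℕd<d (inverse v t) (N n)
      f∈ : ∀ {t} → t ∈ filter inside? (gaps (𝒜 v₂)) → f t ∈ filter low? runners
      f∈ {t} t∈ = ∈-filter⁺ low? (∈-range⁺ (ℕₚ.n≢0⇒n>0 f≢0) (ℕ.s≤s⁻¹ (f<N t))) low
        where
        t∈′ = list⁻ t∈
        p = inverse v t /ℕ N n * M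
        f≢0 : f t ≢ 0
        f≢0 eq = proj₁ (proj₂ t∈′) (inverse-≈0⁻ v (by (inverse v t /ℕ N n)
            (trans (decompose t) (cong (λ k → + k + p) eq))))
        M≤p : M ≤ p
        M≤p = positive-multiple (inverse v t /ℕ N n) (lia 4 (λ i r p m → i :≡ r :+ p ⇒ r :< m ⇒ m :< i ⇒ ⊢ # 0 :< p)
            (inverse v t) (+ f t) p M
          (decompose t) (+<+ (f<N t)) (proj₂ (proj₂ t∈′)))
        low : w (+ f t) < b - M
        low = lia 5 (λ t w p b m → t :≡ w :+ p ⇒ m :≤ p ⇒ t :< b ⇒ ⊢ w :< b :- m) t (w (+ f t)) p b M (w-f t) M≤p
            (proj₂ (proj₁ t∈′))
      g∈ : ∀ {j} → j ∈ filter low? runners → g j ∈ filter inside? (gaps (𝒜 v₂))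
      g∈ {j} j∈ = ∈-filter⁺ inside? (∈-gaps⁺ (𝒜 v₂) (ℤₚ.≤-trans (g-hi j)
          (above (𝒜 v₂) b (Equivalence.from (same b) bd))) (≉0⇒Entry g≉0)
          (gap⇐ v gap′ ∘ Equivalence.to (same (g j)))) (g-lo j , g<b)
        where
        j∈′ = filter⁻ low? runners j∈
        0<j = proj₁ (∈-runners⁻ (proj₁ j∈′))
        p = q j * M
        M≤p : M ≤ p
        M≤p = positive-multiple (q j) (lia 5 (λ b m g w p → b :- m :< g ⇒ g :≡ w :+ p ⇒ w :< b :- m ⇒ ⊢ # 0 :< p) b M
            (g j) (w (+ j)) p (g-lo j) refl (proj₂ j∈′))
        gap′ : M < inverse v (g j)
        gap′ = lia 4 (λ i j p m → i :≡ j :+ p ⇒ m :≤ p ⇒ # 0 :< j ⇒ ⊢ m :< i) (inverse v (g j)) (+ j) p M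
            (inverse-g j) M≤p 0<j
        g≉0 : ¬ g j ≈ 0ℤ
        g≉0 e = runner-≉0 (proj₁ j∈′) (≈-trans (≈-sym (≈-shift (q j) (w (+ j)))) e)
        g<b : g j < b
        g<b = ℤₚ.≤∧≢⇒< (g-hi j) λ e → gap⇐ v (subst (λ z → M < inverse v z) e gap′) bd
      gf : ∀ {t} → t ∈ filter inside? (gaps (𝒜 v₂)) → g (f t) ≡ t
      gf {t} t∈ = ≈-≡ (≈-trans (≈-shift (q (f t)) (w (+ f t))) (≈-sym (by (inverse v t /ℕ N n) (w-f t))))
        (lia 4 (λ t b g m → t :< b ⇒ b :- m :< g ⇒ ⊢ t :- m :< g) t b (g (f t)) M (proj₂ (proj₁ (list⁻ t∈)))
            (g-lo (f t)))
        (lia 4 (λ t b g m → g :≤ b ⇒ b :- m :< t ⇒ ⊢ g :< t :+ m) t b (g (f t)) M (g-hi (f t))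
            (proj₁ (proj₁ (list⁻ t∈))))
      fg : ∀ {j} → j ∈ filter low? runners → f (g j) ≡ j
      fg {j} j∈ = trans (cong (_%ℕ N n) (inverse-g j)) (remainder-unique (N n) j (q j)
          (s≤s (proj₂ (∈-range⁻ (proj₁ (filter⁻ low? runners j∈))))))

    middle? : ∀ c → Decidable (λ j → w (+ j) < c × M - c < w (+ j))
    middle? c j = (w (+ j) ℤₚ.<? c) ×-dec (M - c ℤₚ.<? w (+ j))

    -- The map j ↦ N - j sends w(j) to M - w(j), so the count is also that of the lowest beads
    -- beyond M - c. As M < 2c, the two conditions cover all 2n runners and overlap in the middle.
    lowestBelow-double : ∀ {c} → M < c + c → lowestBelow c ℕ.+ lowestBelow c ≡ 2 ℕ.* n ℕ.+ length
        (filter (middle? c) runners)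
    lowestBelow-double {c} M<2c = trans (cong (lowestBelow c ℕ.+_) mirror)
      (trans (inclusion-exclusion low? high? runners (λ {j} _ → either (w (+ j) ℤₚ.<? c)))
        (cong (ℕ._+ length (filter (middle? c) runners)) (length-range (2 ℕ.* n))))
      where
      low? = λ j → w (+ j) ℤₚ.<? c
      high? = λ j → M - c ℤₚ.<? w (+ j)
      either : ∀ {z} → Dec (z < c) → z < c ⊎ M - c < z
      either (yes lt) = inj₁ lt
      either {z} (no ≮) = inj₂ (lia 3 (λ z c m → m :< c :+ c ⇒ c :≤ z ⇒ ⊢ m :- c :< z) z c M M<2c (ℤₚ.≮⇒≥ ≮))
      flipped : ℕ → ℕ
      flipped j = N n ∸ j
      module _ {j} (j∈ : j ∈ runners) where
        j≤N : j ℕ.≤ N n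
        j≤N = ℕₚ.≤-trans (proj₂ (∈-range⁻ j∈)) (ℕₚ.n≤1+n _)
        +flipped : + flipped j ≡ - + j + + 1 * M
        +flipped = trans (sym (ℤₚ.⊖-≥ j≤N)) (trans (sym (ℤₚ.m-n≡m⊖n (N n) j))
            (trans (ℤₚ.+-comm M (- + j)) (cong (λ z → - + j + z) (sym (ℤₚ.*-identityˡ M)))))
        w-flip : w (+ flipped j) ≡ M - w (+ j)
        w-flip = trans (cong w +flipped) (trans (fun-shift v (+ 1) (- + j))
            (trans (cong₂ _+_ (odd v (+ j)) (ℤₚ.*-identityˡ M)) (ℤₚ.+-comm (- w (+ j)) M)))
        flip∈ : flipped j ∈ runners
        flip∈ = ∈-range⁺ (ℕₚ.m<n⇒0<n∸m (s≤s (proj₂ (∈-range⁻ j∈))))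
            (ℕₚ.≤-trans (ℕₚ.∸-monoʳ-≤ (N n) (proj₁ (∈-range⁻ j∈))) ℕₚ.≤-refl)
        flip-flip : flipped (flipped j) ≡ j
        flip-flip = ℕₚ.m∸[m∸n]≡n j≤N
      mirror : lowestBelow c ≡ length (filter high? runners)
      mirror = bijection-length flipped flipped (Uniqueₚ.filter⁺ low? (range-unique (2 ℕ.* n)))
          (Uniqueₚ.filter⁺ high? (range-unique (2 ℕ.* n)))
        (λ {j} j∈ → let j∈′ , lt = filter⁻ low? runners j∈ in ∈-filter⁺ high? (flip∈ j∈′)
          (subst (M - c <_) (sym (w-flip j∈′)) (lia 3 (λ w c m → w :< c ⇒ ⊢ m :- c :< m :- w) (w (+ j)) c M lt)))
        (λ {j} j∈ → let j∈′ , lt = filter⁻ high? runners j∈ in ∈-filter⁺ low? (flip∈ j∈′)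
          (subst (_< c) (sym (w-flip j∈′)) (lia 3 (λ w c m → m :- c :< w ⇒ ⊢ m :- w :< c) (w (+ j)) c M lt)))
        (λ j∈ → flip-flip (proj₁ (filter⁻ low? runners j∈))) (λ j∈ → flip-flip (proj₁ (filter⁻ high? runners j∈)))

    -- If every label strictly between M - c and c is the lowest bead of its runner, the middle has
    -- 2c - M - 1 members, and twice the count is 2n + 2c - M - 1 = 2(c - 1).
    lowestBelow-full : ∀ {c} → M < c + c → (∀ {t} → M - c < t → t < c → 0ℤ < inverse v t × inverse v t < M) →
                       + lowestBelow c ≡ c - + 1
    lowestBelow-full {c} M<2c full = lia 5 (λ k c h v m → k :+ k :≡ 2 :* v :+ h ⇒ h :≡ c :+ c :- m :- # 1 ⇒ m :≡ # 1
        :+ 2 :* v ⇒ ⊢ k :≡ c :- # 1)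
      (+ lowestBelow c) c (+ h) ν M
      (trans (cong +_ (lowestBelow-double M<2c)) (cong₂ (λ a b → a + + b) +[2n] middle-length)) +h M≡
      where
      h = ∣ c + c - M - + 1 ∣
      +h : + h ≡ c + c - M - + 1
      +h = ℤₚ.0≤i⇒+∣i∣≡i (lia 2 (λ c m → m :< c :+ c ⇒ ⊢ # 0 :≤ c :+ c :- m :- # 1) c M M<2c)
      label : ℕ → ℤ
      label i = M - c + + 1 + + i
      labels = map label (upTo h)
      ∈-labels⁺ : ∀ {t} → M - c < t → t < c → t ∈ labels
      ∈-labels⁺ {t} lo hi = subst (_∈ labels) label≡ (∈-map⁺ label (∈-upTo⁺ i<h))
        where
        i = ∣ t - (M - c) - + 1 ∣
        +i : + i ≡ t - (M - c) - + 1
        +i = ℤₚ.0≤i⇒+∣i∣≡i (lia 2 (λ t l → l :< t ⇒ ⊢ # 0 :≤ t :- l :- # 1) t (M - c) lo)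
        label≡ : label i ≡ t
        label≡ = lia 3 (λ t l i → i :≡ t :- l :- # 1 ⇒ ⊢ l :+ # 1 :+ i :≡ t) t (M - c) (+ i) +i
        i<h : i ℕ.< h
        i<h = ℤₚ.drop‿+<+ (subst₂ _<_ (sym +i) (sym +h) (lia 3 (λ t c m → t :< c ⇒ ⊢ t :- (m :- c) :- # 1 :< c :+ c
            :- m :- # 1) t c M hi))
      ∈-labels⁻ : ∀ {t} → t ∈ labels → M - c < t × t < c
      ∈-labels⁻ t∈ = go (∈-map⁻ label t∈)
        where
        go : ∀ {t} → ∃[ i ] i ∈ upTo h × t ≡ label i → M - c < t × t < c
        go (i , i∈ , refl) = lia 2 (λ l i → # 0 :≤ i ⇒ ⊢ l :< l :+ # 1 :+ i) (M - c) (+ i) (+≤+ z≤n)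
                           , lia 4 (λ c m i h → i :< h ⇒ h :≡ c :+ c :- m :- # 1 ⇒ ⊢ m :- c :+ # 1 :+ i :< c) c M
                               (+ i) (+ h) (+<+ (∈-upTo⁻ i∈)) +h
      middle-length : length (filter (middle? c) runners) ≡ h
      middle-length = trans (bijection-length (λ j → w (+ j)) (λ t → ∣ inverse v t ∣)
          (Uniqueₚ.filter⁺ (middle? c) (range-unique (2 ℕ.* n)))
          (Uniqueₚ.map⁺ {f = label} (λ {i} {j} p → ℤₚ.+-injective
              (lia 3 (λ l i j → l :+ # 1 :+ i :≡ l :+ # 1 :+ j ⇒ ⊢ i :≡ j) (M - c) (+ i) (+ j) p)) (Uniqueₚ.upTo⁺ h))
          (λ j∈ → let _ , hi , lo = filter⁻ (middle? c) runners j∈ in ∈-labels⁺ lo hi)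
          (λ {t} t∈ → let lo , hi = ∈-labels⁻ t∈ in ∈-filter⁺ (middle? c)
             (∈-range⁺ (ℤₚ.drop‿+<+ (subst (0ℤ <_) (sym (+inv lo hi)) (proj₁ (full lo hi))))
                 (ℕ.s≤s⁻¹ (ℤₚ.drop‿+<+ (subst (_< M) (sym (+inv lo hi)) (proj₂ (full lo hi))))))
             (subst (_< c) (sym (w-inv lo hi)) hi , subst (M - c <_) (sym (w-inv lo hi)) lo))
          (λ {j} _ → cong ∣_∣ (inverse-fun v (+ j)))
          (λ {t} t∈ → let lo , hi = ∈-labels⁻ t∈ in w-inv lo hi))
        (trans (Listₚ.length-map label (upTo h)) (Listₚ.length-upTo h))
        where
        +inv : ∀ {t} → M - c < t → t < c → + ∣ inverse v t ∣ ≡ inverse v t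
        +inv lo hi = ℤₚ.0≤i⇒+∣i∣≡i (ℤₚ.<⇒≤ (proj₁ (full lo hi)))
        w-inv : ∀ {t} → M - c < t → t < c → w (+ ∣ inverse v t ∣) ≡ t
        w-inv {t} lo hi = trans (cong w (+inv lo hi)) (fun-inverse v t)

    lowestBelow-cong : ∀ {c d} → c ≤ d → (∀ {j} → j ∈ runners → c ≤ w (+ j) → w (+ j) < d → ⊥) → lowestBelow d ≡
        lowestBelow c
    lowestBelow-cong {c} {d} c≤d none = filter-length-cong (λ j → w (+ j) ℤₚ.<? d) (λ j → w (+ j) ℤₚ.<? c) runners
      (λ j∈ lt → ℤₚ.≰⇒> λ le → none j∈ le lt) (λ _ lt → ℤₚ.<-≤-trans lt c≤d)

    lowestBelow-mono : ∀ {c d} → c ≤ d → lowestBelow c ℕ.≤ lowestBelow d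
    lowestBelow-mono {c} {d} c≤d = filter-length-mono (λ j → w (+ j) ℤₚ.<? c) (λ j → w (+ j) ℤₚ.<? d) runners λ _ lt
        → ℤₚ.<-≤-trans lt c≤d

  -- Sizes of the parts

  size : Mirrored n → ℤ → ℤ
  size v b = proj₁ (beadPart ty (𝒜 v) b)

  size-low : ∀ v {b} → b ≤ M + ν → size v b ≡ b - M + x₀ ty
  size-low v {b} le with + (N n ℕ.+ n) ℤₚ.<? b
  ... | yes lt = contradiction le (ℤₚ.<⇒≱ lt)
  ... | no _   = refl

  size-high : ∀ v {b} → M + ν < b → size v b ≡ + gapsBetween ty (𝒜 v) (b - M) b + (+ 1 + x₀ ty + xₙ ty)
  size-high v {b} lt with + (N n ℕ.+ n) ℤₚ.<? b
  ... | yes _ = refl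
  ... | no ≮  = contradiction lt ≮

  same-refl : ∀ (v : Mirrored n) z → AtOrAboveLowest v z ⇔ AtOrAboveLowest v z
  same-refl v z = mk⇔ id id

  x₀≡ : x₀ ty ≡ - + κ
  x₀≡ = go (left ty)
    where
    go : ∀ E → offset E ≡ - + referenceDiagonal E
    go C = refl
    go D = refl

  module _ (v : Mirrored n) (wt : W̃ ty n v) {xs b} (eq : referenceBeads v ≡ xs ∷ʳ b) where

    open Reference (snoc-reference v eq)

    private
      gap-above : ∀ {z} → M + + 1 < z → z < b → z < M + M → ¬ AtOrAboveLowest v z
      gap-above {z} lo hi hi′ = unbead v wt eq (ℤₚ.≤-<-trans (level≤M+1 (left ty)) lo) hi
        (between-M⇒≉0 (lia 2 (λ z m → m :+ # 1 :< z ⇒ ⊢ m :< z) z M lo) hi′)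
      ≉0-above : ∀ {z} → M + + 1 < z → z < M + M → ¬ z ≈ 0ℤ
      ≉0-above {z} lo hi′ = between-M⇒≉0 (lia 2 (λ z m → m :+ # 1 :< z ⇒ ⊢ m :< z) z M lo) hi′
      -- t is a bead because its opposite is a gap, and the lowest one of its runner because t + M
      -- is a gap.
      lowest : ∀ {t} → M + + 1 < t + M → t + M < b → t + M < M + M → M + + 1 < opposite t → opposite t < b → opposite
          t < M + M →
               0ℤ < inverse v t × inverse v t < M
      lowest {t} a c d a′ c′ d′ =
          lia 3 (λ i j m → j :≡ i :+ m ⇒ m :< j ⇒ ⊢ # 0 :< i) (inverse v t) (inverse v (t + M)) M
            (trans (cong (λ z → inverse v (t + z)) (sym (ℤₚ.*-identityˡ M)))
                (trans (inverse-shift v (+ 1) t) (cong (λ z → inverse v t + z) (ℤₚ.*-identityˡ M))))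
            (gap⇒ v (≉0-above a d) (gap-above a c d))
        , proj₂ (bead⇒ v (subst (AtOrAboveLowest v) (lia 2 (λ t m → ⊢ m :+ m :- (m :+ m :- t) :≡ t) t M)
            (gap-opposite v (≉0-above a′ d′) (gap-above a′ c′ d′))))

    -- For t between 2M - b and b - M both t + M and 2M - t lie between M + 1 and b, so both are
    -- gaps and `lowest` applies.
    reference-count : M + ν < b → b < M + M → + lowestBelow v (b - M) ≡ b - M - + 1
    reference-count lo hi = lowestBelow-full v
      (lia 3 (λ b m v → m :+ v :< b ⇒ m :≡ # 1 :+ 2 :* v ⇒ ⊢ m :< b :- m :+ (b :- m)) b M ν lo M≡)
      λ {t} l h → lowest
        (lia 3 (λ t b m → m :- (b :- m) :< t ⇒ b :< m :+ m ⇒ ⊢ m :+ # 1 :< t :+ m) t b M l hi)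
        (lia 3 (λ t b m → t :< b :- m ⇒ ⊢ t :+ m :< b) t b M h)
        (lia 3 (λ t b m → t :< b :- m ⇒ b :< m :+ m ⇒ ⊢ t :+ m :< m :+ m) t b M h hi)
        (lia 3 (λ t b m → t :< b :- m ⇒ b :< m :+ m ⇒ ⊢ m :+ # 1 :< m :+ m :- t) t b M h hi)
        (lia 3 (λ t b m → m :- (b :- m) :< t ⇒ ⊢ m :+ m :- t :< b) t b M l)
        (lia 3 (λ t b m → m :- (b :- m) :< t ⇒ b :< m :+ m ⇒ ⊢ m :+ m :- t :< m :+ m) t b M l hi)

    -- Now b - M = M + 1 is a bead, so its opposite M - 1 is a gap, and M is no entry. No lowest
    -- bead lies at these two labels, and the count is the one for c = M - 1.
    reference-count-top : b ≡ M + M + + 1 → + lowestBelow v (b - M) ≡ M - + 2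
    reference-count-top b≡ = trans (cong (λ z → + lowestBelow v z)
        (lia 2 (λ b m → b :≡ m :+ m :+ # 1 ⇒ ⊢ b :- m :≡ m :+ # 1) b M b≡))
      (trans (cong +_ (lowestBelow-cong v (lia 1 (λ m → ⊢ m :- # 1 :≤ m :+ # 1) M) none))
        (trans (lowestBelow-full v (lia 1 (λ m → # 5 :≤ m ⇒ ⊢ m :< m :- # 1 :+ (m :- # 1)) M 5≤M) λ {t} l h → lowest
          (lia 2 (λ t m → m :- (m :- # 1) :< t ⇒ ⊢ m :+ # 1 :< t :+ m) t M l)
          (lia 3 (λ t b m → t :< m :- # 1 ⇒ b :≡ m :+ m :+ # 1 ⇒ ⊢ t :+ m :< b) t b M h b≡)
          (lia 2 (λ t m → t :< m :- # 1 ⇒ ⊢ t :+ m :< m :+ m) t M h)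
          (lia 2 (λ t m → t :< m :- # 1 ⇒ ⊢ m :+ # 1 :< m :+ m :- t) t M h)
          (lia 3 (λ t b m → m :- (m :- # 1) :< t ⇒ b :≡ m :+ m :+ # 1 ⇒ ⊢ m :+ m :- t :< b) t b M l b≡)
          (lia 2 (λ t m → m :- (m :- # 1) :< t ⇒ ⊢ m :+ m :- t :< m :+ m) t M l))
         (lia 1 (λ m → ⊢ m :- # 1 :- # 1 :≡ m :- # 2) M)))
      where
      5≤M : + 5 ≤ M
      5≤M = lia 2 (λ m v → m :≡ # 1 :+ 2 :* v ⇒ # 2 :≤ v ⇒ ⊢ # 5 :≤ m) M ν M≡ 2≤ν
      bead-M+1 : AtOrAboveLowest v (M + + 1)
      bead-M+1 = bead-lower v (subst (AtOrAboveLowest v) (lia 2 (λ b m → b :≡ m :+ m :+ # 1 ⇒ ⊢ b :≡ m :+ # 1 :+ m) b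
          M b≡) bead)
      none : ∀ {j} → j ∈ runners → M - + 1 ≤ fun v (+ j) → fun v (+ j) < M + + 1 → ⊥
      none {j} j∈ lo hi = go (ℤₚ.<-cmp (fun v (+ j)) M)
        where
        go : Tri (fun v (+ j) < M) (fun v (+ j) ≡ M) (M < fun v (+ j)) → ⊥
        go (tri< lt _ _) = bead-opposite v bead-M+1 (subst (AtOrAboveLowest v)
          (lia 2 (λ w m → m :- # 1 :≤ w ⇒ w :< m ⇒ ⊢ w :≡ m :+ m :- (m :+ # 1)) (fun v (+ j)) M lo lt)
              (runner-bead v j∈))
        go (tri≈ _ e _) = runner-≉0 v j∈ (≈-trans (≡⇒≈ e) M≈0)
        go (tri> _ _ gt) = lia 2 (λ w m → m :< w ⇒ w :< m :+ # 1 ⇒ ⊢⊥) (fun v (+ j)) M gt hi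

    size-reference-low : b ≤ M + ν → size v b ≡ b - M - + κ
    size-reference-low le = trans (size-low v le) (cong (λ z → b - M + z) x₀≡)

    size-reference-high : M + ν < b → b < M + M → size v b ≡ b - M - + κ + xₙ ty
    size-reference-high lo hi = trans (size-high v lo) (lia 6 (λ g b m x k y → g :≡ b :- m :- # 1 ⇒ x :≡ :- k ⇒ ⊢ g :+
        (# 1 :+ x :+ y) :≡ b :- m :- k :+ y)
      (+ gapsBetween ty (𝒜 v) (b - M) b) b M (x₀ ty) (+ κ) (xₙ ty)
      (trans (cong +_ (gapsBetween-lowestBelow v v (same-refl v) bead)) (reference-count lo hi)) x₀≡)

    size-reference-top : left ty ≡ D → b ≡ M + M + + 1 → size v b ≡ M - + 2 + xₙ ty
    size-reference-top l≡D b≡ = trans (size-high v (lia 3 (λ b m v → b :≡ m :+ m :+ # 1 ⇒ m :≡ # 1 :+ 2 :* v ⇒ # 2 :≤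
        v ⇒ ⊢ m :+ v :< b) b M ν b≡ M≡ 2≤ν))
      (lia 4 (λ g m x y → g :≡ m :- # 2 ⇒ x :≡ :- # 1 ⇒ ⊢ g :+ (# 1 :+ x :+ y) :≡ m :- # 2 :+ y)
      (+ gapsBetween ty (𝒜 v) (b - M) b) M (x₀ ty) (xₙ ty)
      (trans (cong +_ (gapsBetween-lowestBelow v v (same-refl v) bead)) (reference-count-top b≡)) (cong offset l≡D))

  -- Effect of a step on the sizes.

  act : ∀ {g} → Involution g → Mirrored n → Mirrored n
  act {g} i v = record
    { fun       = g ∘ fun v
    ; bijective = (λ {p} {q} e → fun-injective v (trans (sym (involutive _)) (trans (cong g e) (involutive _))))
                , λ y → inverse v (g y) , λ { refl → trans (cong g (fun-inverse v (g y))) (involutive y) }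
    ; periodic  = λ k → trans (cong g (periodic v k)) (trans (cong (λ m → g (fun v k + m)) (sym (ℤₚ.*-identityˡ M)))
                    (trans (shift (+ 1) (fun v k)) (cong (λ m → g (fun v k) + m) (ℤₚ.*-identityˡ M))))
    ; odd       = λ k → trans (cong g (odd v k)) (neg (fun v k))
    }
    where open Involution i

  act-moved : ∀ {g} (i : Involution g) v → Moved g v (act i v)
  act-moved {g} i v z = mk⇔
    (λ bd → let z≉0 , lt = bead⇒ (act i v) bd in bead⇐ v (z≉0 ∘ ≈0-image⁻ i) lt)
    (λ bd → let gz≉0 , lt = bead⇒ v bd in bead⇐ (act i v) (gz≉0 ∘ ≈0-image i) lt)

  Kind-upper : ∀ {b δ r ψ} → Kind b δ r ψ → + ψ ≤ b - M - + 1
  Kind-upper (unit _ _ _ _ e _) = ℤₚ.≤-reflexive e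
  Kind-upper {b} {ψ = ψ} (leftC _ _ b≡ e) = lia 3 (λ b m p → b :≡ m :+ # 1 ⇒ p :≡ # 0 ⇒ ⊢ p :≤ b :- m :- # 1) b M
      (+ ψ) b≡ e
  Kind-upper {b} {ψ = ψ} (leftD _ _ b≡ e) = lia 3 (λ b m p → b :≡ m :+ # 2 ⇒ p :≡ # 1 ⇒ ⊢ p :≤ b :- m :- # 1) b M
      (+ ψ) b≡ e
  Kind-upper {b} {ψ = ψ} (leftD′ _ _ b≡ e) = lia 3 (λ b m p → b :≡ m :+ m :+ # 1 ⇒ p :≡ m :- # 2 ⇒ ⊢ p :≤ b :- m
      :- # 1) b M (+ ψ) b≡ e
  Kind-upper {b} {ψ = ψ} (rightD _ _ b≡ e _) = lia 4 (λ b m p v → b :≡ m :+ (v :+ # 1) ⇒ p :≡ v :- # 1 ⇒ ⊢ p :≤ b :- m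
      :- # 1) b M (+ ψ) ν b≡ e
  Kind-upper {b} {ψ = ψ} (rightD′ _ _ b≡ e _) = lia 4 (λ b m p v → b :≡ m :+ (v :+ # 2) ⇒ p :≡ v :+ # 1 ⇒ ⊢ p :≤ b
      :- m :- # 1) b M (+ ψ) ν b≡ e

  -- Later boxes of the same row have content at most b - δ - M - 1 (`cols` of `Summary`), so they
  -- stand strictly to the left of the present one.
  Kind-lower : ∀ {b δ r ψ} → Kind b δ r ψ → b - δ - M - + 1 < + ψ
  Kind-lower {b} {δ} {ψ = ψ} (unit d _ _ _ e _) = lia 4 (λ b m p d → d :≡ # 1 ⇒ p :≡ b :- m :- # 1 ⇒ ⊢ b :- d :- m
      :- # 1 :< p) b M (+ ψ) δ d e
  Kind-lower {b} {δ} {ψ = ψ} (leftC _ d b≡ e) = lia 4 (λ b m p d → d :≡ # 2 ⇒ b :≡ m :+ # 1 ⇒ p :≡ # 0 ⇒ ⊢ b :- d :- m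
      :- # 1 :< p) b M (+ ψ) δ d b≡ e
  Kind-lower {b} {δ} {ψ = ψ} (leftD _ d b≡ e) = lia 4 (λ b m p d → d :≡ # 3 ⇒ b :≡ m :+ # 2 ⇒ p :≡ # 1 ⇒ ⊢ b :- d :- m
      :- # 1 :< p) b M (+ ψ) δ d b≡ e
  Kind-lower {b} {δ} {ψ = ψ} (leftD′ _ d b≡ e) = lia 4 (λ b m p d → d :≡ # 3 ⇒ b :≡ m :+ m :+ # 1 ⇒ p :≡ m :- # 2 ⇒
      ⊢ b :- d :- m :- # 1 :< p) b M (+ ψ) δ d b≡ e
  Kind-lower {b} {δ} {ψ = ψ} (rightD _ d b≡ e _) = lia 5 (λ b m p d v → d :≡ # 2 ⇒ b :≡ m :+ (v :+ # 1) ⇒ p :≡ v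
      :- # 1 ⇒ ⊢ b :- d :- m :- # 1 :< p) b M (+ ψ) δ ν d b≡ e
  Kind-lower {b} {δ} {ψ = ψ} (rightD′ _ d b≡ e _) = lia 5 (λ b m p d v → d :≡ # 2 ⇒ b :≡ m :+ (v :+ # 2) ⇒ p :≡ v :+
      # 1 ⇒ ⊢ b :- d :- m :- # 1 :< p) b M (+ ψ) δ ν d b≡ e

  small⇒≉0 : ∀ k → 1 ℕ.≤ k → + k ≤ + 4 → ¬ + k ≈ 0ℤ
  small⇒≉0 k 1≤k k≤4 = between⇒≉0 (+<+ 1≤k) (lia 3 (λ k m v → k :≤ # 4 ⇒ m :≡ # 1 :+ 2 :* v ⇒ # 2 :≤ v ⇒ ⊢ k :< m)
      (+ k) M ν k≤4 M≡ 2≤ν)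

  module StepSizes (v v′ : Mirrored n) (wt : W̃ ty n v) (wt′ : W̃ ty n v′) {xs b} (eq : referenceBeads v ≡ xs ∷ʳ b)
              (pc : PeelCase v (length (referenceBeads v)) b) (moved : Moved (gen ty n (PeelCase.r pc)) v v′) where

    open PeelCase pc hiding (x; y)
    open Reference (snoc-reference v eq)
    open Stepping v v′ wt eq pc moved

    private
      inv : Involution g
      inv = simple-involution simple
      v″ = act inv v

    same-beads : ∀ z → AtOrAboveLowest v′ z ⇔ AtOrAboveLowest v″ z
    same-beads z = mk⇔ (Equivalence.from (act-moved inv v z) ∘ Equivalence.to (moved z))
                       (Equivalence.from (moved z) ∘ Equivalence.to (act-moved inv v z))

    -- The bead M + n + 2 is lowered to M + n together with b = M + n + 1 and thereby crosses the
    -- boundary between the two formulas for a part.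
    Exceptional : ℤ → Set
    Exceptional z = δ ≡ + 2 × b ≡ M + (ν + + 1) × z ≡ M + (ν + + 2)

    exceptional? : ∀ z → Dec (Exceptional z)
    exceptional? z = (δ ℤₚ.≟ + 2) ×-dec (b ℤₚ.≟ M + (ν + + 1)) ×-dec (z ℤₚ.≟ M + (ν + + 2))

    opposite-sum : ∀ {z} → z ≈ δ - b → z + b - δ ≈ 0ℤ
    opposite-sum {z} p = ≈-substʳ (lia 2 (λ d b → ⊢ d :- b :+ (b :- d) :≡ # 0) δ b)
        (≈-substˡ (lia 3 (λ z b d → ⊢ z :+ (b :- d) :≡ z :+ b :- d) z b δ) (≈-+ (b - δ) p))

    between-2M⇒≉0 : ∀ {z} → M + M < z → z < M + M + M → ¬ z ≈ 0ℤ
    between-2M⇒≉0 {z} lo hi p = between-M⇒≉0 {z - M} (lia 2 (λ z m → m :+ m :< z ⇒ ⊢ m :< z :- m) z M lo)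
        (lia 2 (λ z m → z :< m :+ m :+ m ⇒ ⊢ z :- m :< m :+ m) z M hi)
      (≈-trans (by -1ℤ (cong (λ k → z + k) (sym (ℤₚ.-1*i≡-i M)))) p)

    -- On b's runner a lowered z would be at least b + M. On the mirrored runner z + b - δ would be
    -- a multiple of M strictly between 2M and 3M, unless b already exceeds M + n and leaves no room
    -- for z.
    low-fixed : ∀ {z} → z ∈ xs → z ≤ M + ν → g z ≡ z
    low-fixed {z} z∈ le = go (lowered (∈xs⇒∈L z∈))
      where
      b<z = xs>b z∈
      far : ¬ z ≈ b
      far p = lia 4 (λ z b m v → b :+ m :≤ z ⇒ z :≤ m :+ v ⇒ m :< b ⇒ m :≡ # 1 :+ 2 :* v ⇒ # 2 :≤ v ⇒ ⊢⊥) z b M ν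
          (≈-next p b<z) le M<b′ M≡ 2≤ν
      byKind : Kind b δ r ψ → ¬ z ≈ δ - b
      byKind (unit d lo _ _ _ _) p = between-2M⇒≉0
        (lia 4 (λ z b m d → d :≡ # 1 ⇒ m :+ # 2 :≤ b ⇒ b :< z ⇒ ⊢ m :+ m :< z :+ b :- d) z b M δ d lo b<z)
        (lia 5 (λ z b m d v → d :≡ # 1 ⇒ b :< z ⇒ z :≤ m :+ v ⇒ m :≡ # 1 :+ 2 :* v ⇒ ⊢ z :+ b :- d :< m :+ m :+ m) z b
            M δ ν d b<z le M≡)
        (opposite-sum p)
      byKind (leftC _ d b≡ _) p = between-2M⇒≉0
        (lia 4 (λ z b m d → d :≡ # 2 ⇒ b :≡ m :+ # 1 ⇒ b :< z ⇒ ⊢ m :+ m :< z :+ b :- d) z b M δ d b≡ b<z)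
        (lia 5 (λ z b m d v → d :≡ # 2 ⇒ b :< z ⇒ z :≤ m :+ v ⇒ m :≡ # 1 :+ 2 :* v ⇒ ⊢ z :+ b :- d :< m :+ m :+ m) z b
            M δ ν d b<z le M≡)
        (opposite-sum p)
      byKind (leftD _ d b≡ _) p = between-2M⇒≉0
        (lia 4 (λ z b m d → d :≡ # 3 ⇒ b :≡ m :+ # 2 ⇒ b :< z ⇒ ⊢ m :+ m :< z :+ b :- d) z b M δ d b≡ b<z)
        (lia 5 (λ z b m d v → d :≡ # 3 ⇒ b :< z ⇒ z :≤ m :+ v ⇒ m :≡ # 1 :+ 2 :* v ⇒ ⊢ z :+ b :- d :< m :+ m :+ m) z b
            M δ ν d b<z le M≡)
        (opposite-sum p)
      byKind (leftD′ _ _ b≡ _) _ = lia 4 (λ z b m v → b :≡ m :+ m :+ # 1 ⇒ b :< z ⇒ z :≤ m :+ v ⇒ m :≡ # 1 :+ 2 :* v ⇒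
          # 2 :≤ v ⇒ ⊢⊥) z b M ν b≡ b<z le M≡ 2≤ν
      byKind (rightD _ _ b≡ _ _) _ = lia 4 (λ z b m v → b :≡ m :+ (v :+ # 1) ⇒ b :< z ⇒ z :≤ m :+ v ⇒ ⊢⊥) z b M ν b≡
          b<z le
      byKind (rightD′ _ _ b≡ _ _) _ = lia 4 (λ z b m v → b :≡ m :+ (v :+ # 2) ⇒ b :< z ⇒ z :≤ m :+ v ⇒ ⊢⊥) z b M ν b≡
          b<z le
      notDown : z ≈ b ⊎ z ≈ δ - b → ⊥
      notDown (inj₁ p) = far p
      notDown (inj₂ p) = byKind kind p
      go : Lowered z → g z ≡ z
      go (moves d _) = ⊥-elim (notDown (down-class d))
      go (stays _ e) = e

    -- On the mirrored runner, unless z > b rules it out directly, a fall to M + n or below would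
    -- make z + b - δ a multiple of M strictly between 2M and 3M; only the exceptional pair escapes
    -- this.
    high-stays : ∀ {z} → z ∈ xs → M + ν < z → ¬ Exceptional z → M + ν < g z
    high-stays {z} z∈ lt ¬ex = go (lowered (∈xs⇒∈L z∈))
      where
      b<z = xs>b z∈
      same : z ≈ b → M + ν < z - δ
      same p = lia 5 (λ z b d m v → b :+ m :≤ z ⇒ d :≤ # 3 ⇒ m :< b ⇒ m :≡ # 1 :+ 2 :* v ⇒ # 2 :≤ v ⇒ ⊢ m :+ v :< z
          :- d) z b δ M ν
        (≈-next p b<z) (Simple.y-x≤3 simple) M<b′ M≡ 2≤ν
      far : ∀ {c} → δ ≡ c → M + M < z + b - δ → z + b - δ ≈ 0ℤ → M + M + M ≤ z + b - δ
      far _ lo p = ℤₚ.≮⇒≥ λ hi → between-2M⇒≉0 lo hi p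
      close-case : z ≈ δ - b → z - δ ≤ M + ν → Kind b δ r ψ → ⊥
      close-case p le (unit d lo hi _ _ _) = lia 5 (λ z b d m v → m :+ m :+ m :≤ z :+ b :- d ⇒ d :≡ # 1 ⇒ z :- d :≤ m
          :+ v ⇒ b :< z ⇒ m :≡ # 1 :+ 2 :* v ⇒ ⊢⊥) z b δ M ν
        (far d (lia 4 (λ z b m d → d :≡ # 1 ⇒ m :+ # 2 :≤ b ⇒ b :< z ⇒ ⊢ m :+ m :< z :+ b :- d) z b M δ d lo b<z)
            (opposite-sum p)) d le b<z M≡
      close-case p le (leftC _ d b≡ _) = lia 5 (λ z b d m v → m :+ m :+ m :≤ z :+ b :- d ⇒ d :≡ # 2 ⇒ z :- d :≤ m :+ v
          ⇒ b :≡ m :+ # 1 ⇒ m :≡ # 1 :+ 2 :* v ⇒ # 2 :≤ v ⇒ ⊢⊥) z b δ M ν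
        (far d (lia 4 (λ z b m d → d :≡ # 2 ⇒ b :≡ m :+ # 1 ⇒ b :< z ⇒ ⊢ m :+ m :< z :+ b :- d) z b M δ d b≡ b<z)
            (opposite-sum p)) d le b≡ M≡ 2≤ν
      close-case p le (leftD l≡D d b≡ _) = lia 5 (λ z b d m v → m :+ m :+ m :≤ z :+ b :- d ⇒ d :≡ # 3 ⇒ z :- d :≤ m :+
          v ⇒ b :≡ m :+ # 2 ⇒ m :≡ # 1 :+ 2 :* v ⇒ # 3 :≤ v ⇒ ⊢⊥) z b δ M ν
        (far d (lia 4 (λ z b m d → d :≡ # 3 ⇒ b :≡ m :+ # 2 ⇒ b :< z ⇒ ⊢ m :+ m :< z :+ b :- d) z b M δ d b≡ b<z)
            (opposite-sum p)) d le b≡ M≡ (left-D⇒3≤ν l≡D)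
      close-case p le (leftD′ l≡D d b≡ _) = lia 5 (λ z b d m v → b :≡ m :+ m :+ # 1 ⇒ d :≡ # 3 ⇒ z :- d :≤ m :+ v ⇒ b
          :< z ⇒ m :≡ # 1 :+ 2 :* v ⇒ # 3 :≤ v ⇒ ⊢⊥) z b δ M ν b≡ d le b<z M≡ (left-D⇒3≤ν l≡D)
      close-case p le (rightD r≡D d b≡ _ _) = ¬ex (d , b≡ , lia 5
          (λ z b d m v → d :≡ # 2 ⇒ b :≡ m :+ (v :+ # 1) ⇒ z :- d :≤ m :+ v ⇒ b :< z ⇒ ⊢ z :≡ m :+ (v :+ # 2)) z b δ M
          ν d b≡ le b<z)
      close-case p le (rightD′ r≡D d b≡ _ _) = lia 5 (λ z b d m v → d :≡ # 2 ⇒ b :≡ m :+ (v :+ # 2) ⇒ z :- d :≤ m :+ v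
          ⇒ b :< z ⇒ ⊢⊥) z b δ M ν d b≡ le b<z
      byClass : z ≈ b ⊎ z ≈ δ - b → M + ν < z - δ
      byClass (inj₁ p) = same p
      byClass (inj₂ p) = ℤₚ.≰⇒> λ le → close-case p le kind
      go : Lowered z → M + ν < g z
      go (moves d e) = subst (M + ν <_) (sym e) (byClass (down-class d))
      go (stays _ e) = subst (M + ν <_) (sym e) lt

    -- A runner whose lowest bead z lies below x - N still does so, relative to
    -- the moved x, after the step; hence no runner is gained or lost.
    no-crossing : ∀ {x z} → x ∈ xs → M + ν < x → ¬ Exceptional x → Up (PeelCase.x pc) (PeelCase.y pc) z
        → AtOrAboveLowest v z →
      Down (PeelCase.x pc) (PeelCase.y pc) (x - M) → z < x - M → x - M < z + δ + δ → ⊥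
    no-crossing {x} {z} x∈ high ¬ex u bd d z<y y< = byClass (down-class d) (up-bead u bd)
      where
      y = x - M
      b<x = xs>b x∈
      b-M<y : b - M < y
      b-M<y = lia 3 (λ b x m → b :< x ⇒ ⊢ b :- m :< x :- m) b x M b<x
      δ≤3 = Simple.y-x≤3 simple
      -- Between b - M and b - M + δ there are at most two labels, and y + b - δ has to be a
      -- multiple of M.
      near : y < b - M + δ → y ≈ δ - b → Kind b δ r ψ → ⊥
      near lt p (unit d _ _ _ _ _) = lia 4 (λ y b m d → y :< b :- m :+ d ⇒ b :- m :< y ⇒ d :≡ # 1 ⇒ ⊢⊥) y b M δ lt
          b-M<y d
      near lt p (leftC _ d b≡ _) = small⇒≉0 1 (s≤s z≤n) (+≤+ (s≤s z≤n))
        (≈-substˡ (lia 5 (λ y b m d v → d :≡ # 2 ⇒ b :≡ m :+ # 1 ⇒ y :< b :- m :+ d ⇒ b :- m :< y ⇒ ⊢ y :+ b :- d :- m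
            :≡ # 1) y b M δ ν d b≡ lt b-M<y)
          (≈-trans (by -1ℤ (cong (λ k → y + b - δ + k) (sym (ℤₚ.-1*i≡-i M)))) (opposite-sum p)))
      near lt p (leftD l≡D d b≡ _) = between⇒≉0 {y + b - δ - M}
        (lia 4 (λ y b m d → d :≡ # 3 ⇒ b :≡ m :+ # 2 ⇒ b :- m :< y ⇒ ⊢ # 0 :< y :+ b :- d :- m) y b M δ d b≡ b-M<y)
        (lia 5 (λ y b m d v → d :≡ # 3 ⇒ b :≡ m :+ # 2 ⇒ y :< b :- m :+ d ⇒ m :≡ # 1 :+ 2 :* v ⇒ # 3 :≤ v ⇒ ⊢ y :+ b
            :- d :- m :< m) y b M δ ν d b≡ lt M≡ (left-D⇒3≤ν l≡D))
          (≈-trans (by -1ℤ (cong (λ k → y + b - δ + k) (sym (ℤₚ.-1*i≡-i M)))) (opposite-sum p))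
      near lt p (leftD′ l≡D d b≡ _) = split (y ℤₚ.≟ M + + 2)
        where
        split : Dec (y ≡ M + + 2) → ⊥
        -- Flushness makes y = M + 2 a bead; it lies beyond `base` and below b, against the choice
        -- of b.
        split (yes e) = ℤₚ.<⇒≱ (lia 3 (λ y b m → y :≡ m :+ # 2 ⇒ b :≡ m :+ m :+ # 1 ⇒ # 5 :≤ m ⇒ ⊢ y :< b) y b M e b≡
            5≤M)
          (least y≉0 (bead-≈-≤ v y≈x (lia 2 (λ x m → # 0 :< m ⇒ ⊢ x :- m :≤ x) x M 0<M)
              (proj₁ (proj₂ (∈L⁻ (∈xs⇒∈L x∈)))))
            (lia 3 (λ y m r → y :≡ m :+ # 2 ⇒ r :≤ m :+ # 1 ⇒ ⊢ r :< y) y M base e (level≤M+1 (left ty))))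
          where
          y≈x : y ≈ x
          y≈x = by -1ℤ (cong (λ k → x + k) (sym (ℤₚ.-1*i≡-i M)))
          y≉0 : ¬ y ≈ 0ℤ
          y≉0 q = proj₂ (proj₂ (∈L⁻ (∈xs⇒∈L x∈))) (≈-trans (≈-sym y≈x) q)
        split (no ≢) = small⇒≉0 1 (s≤s z≤n) (+≤+ (s≤s z≤n))
          (≈-substˡ (lia 4 (λ y b m d → d :≡ # 3 ⇒ b :≡ m :+ m :+ # 1 ⇒ y :≡ m :+ # 3 ⇒ ⊢ y :+ b :- d :+
              :- (m :+ m :+ m) :≡ # 1) y b M δ d b≡
              (lia 4 (λ y b m d → d :≡ # 3 ⇒ b :≡ m :+ m :+ # 1 ⇒ y :< b :- m :+ d ⇒ m :+ # 2 :< y ⇒ ⊢ y :≡ m :+ # 3)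
                  y b M δ d b≡ lt
                (ℤₚ.≤∧≢⇒< (lia 3 (λ y b m → b :≡ m :+ m :+ # 1 ⇒ b :- m :< y ⇒ ⊢ m :+ # 2 :≤ y) y b M b≡ b-M<y)
                    (≢ ∘ sym))))
            (≈-trans (by (- + 3) (cong (λ k → y + b - δ + k) (thrice M))) (opposite-sum p)))
          where
          thrice : ∀ m → - (m + m + m) ≡ (- + 3) * m
          thrice = solve-∀
      near lt p (rightD r≡D d b≡ _ _) = ¬ex (d , b≡ , lia 5 (λ x b m d v → d :≡ # 2 ⇒ b :≡ m :+ (v :+ # 1) ⇒ x :- m :<
          b :- m :+ d ⇒ b :- m :< x :- m ⇒ ⊢ x :≡ m :+ (v :+ # 2)) x b M δ ν d b≡ lt b-M<y)
      near lt p (rightD′ r≡D d b≡ _ _) = small⇒≉0 2 (s≤s z≤n) (+≤+ (s≤s (s≤s z≤n)))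
        (≈-substˡ (lia 5 (λ y b m d v → d :≡ # 2 ⇒ b :≡ m :+ (v :+ # 2) ⇒ y :< b :- m :+ d ⇒ b :- m :< y ⇒ m :≡ # 1 :+
            2 :* v ⇒ ⊢ y :+ b :- d :+ :- (m :+ m) :≡ # 2) y b M δ ν d b≡ lt b-M<y M≡)
          (≈-trans (by (- + 2) (cong (λ k → y + b - δ + k) (twice M))) (opposite-sum p)))
        where
        twice : ∀ m → - (m + m) ≡ (- + 2) * m
        twice = solve-∀
      first : Kind b δ r ψ → δ ≤ + 2 ⊎ M + + 2 ≤ b
      first (unit _ lo _ _ _ _)    = inj₂ lo
      first (leftC _ d _ _)        = inj₁ (ℤₚ.≤-reflexive d)
      first (leftD _ _ b≡ _)       = inj₂ (ℤₚ.≤-reflexive (sym b≡))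
      first (leftD′ _ _ b≡ _)      = inj₂ (lia 2 (λ b m → b :≡ m :+ m :+ # 1 ⇒ # 5 :≤ m ⇒ ⊢ m :+ # 2 :≤ b) b M b≡ 5≤M)
      first (rightD _ d _ _ _)     = inj₁ (ℤₚ.≤-reflexive d)
      first (rightD′ _ d _ _ _)    = inj₁ (ℤₚ.≤-reflexive d)
      lowZ : z ≤ M - b → y ≈ δ - b → δ ≤ + 2 ⊎ M + + 2 ≤ b → ⊥
      lowZ le p f = clash f
        where
        y≤ : y ≤ M + (δ - b)
        y≤ = ≈-≤ (≈-sym (≈-trans p (by -1ℤ (trans (lia 2 (λ c m → ⊢ c :≡ m :+ c :+ :- m) (δ - b) M)
            (cong (λ k → M + (δ - b) + k) (sym (ℤₚ.-1*i≡-i M)))))))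
          (lia 5 (λ y z b d m → y :< z :+ d :+ d ⇒ z :≤ m :- b ⇒ d :≤ # 3 ⇒ # 5 :≤ m ⇒ ⊢ y :- m :< m :+ (d :- b)) y z
              b δ M y< le δ≤3 5≤M)
        clash : δ ≤ + 2 ⊎ M + + 2 ≤ b → ⊥
        clash (inj₁ d) = lia 4 (λ y b d m → y :≤ m :+ (d :- b) ⇒ b :- m :< y ⇒ d :≤ # 2 ⇒ m :< b ⇒ ⊢⊥) y b δ M y≤
            b-M<y d M<b′
        clash (inj₂ f) = lia 4 (λ y b d m → y :≤ m :+ (d :- b) ⇒ b :- m :< y ⇒ d :≤ # 3 ⇒ m :+ # 2 :≤ b ⇒ ⊢⊥) y b δ M
            y≤ b-M<y δ≤3 f
      byClass : y ≈ b ⊎ y ≈ δ - b → z ≤ b - δ - M ⊎ z ≤ M - b → ⊥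
      byClass (inj₁ p) (inj₁ le) = lia 5 (λ y z b d m → b :≤ y ⇒ y :< z :+ d :+ d ⇒ z :≤ b :- d :- m ⇒ d :≤ # 3 ⇒ # 5
          :≤ m ⇒ ⊢⊥) y z b δ M (≈-≤ p b-M<y) y< le δ≤3 5≤M
      byClass (inj₁ p) (inj₂ le) = lia 5 (λ y z b d m → b :≤ y ⇒ y :< z :+ d :+ d ⇒ z :≤ m :- b ⇒ d :≤ # 3 ⇒ m :< b ⇒
          # 5 :≤ m ⇒ ⊢⊥) y z b δ M (≈-≤ p b-M<y) y< le δ≤3 M<b′ 5≤M
      byClass (inj₂ p) (inj₁ le) = near (lia 5 (λ y z b d m → y :< z :+ d :+ d ⇒ z :≤ b :- d :- m ⇒ ⊢ y :< b :- m :+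
          d) y z b δ M y< le) p kind
      byClass (inj₂ p) (inj₂ le) = lowZ le p (first kind)

    -- Each lowest bead is compared with y = x - M. If y overtook it, then y and hence x would be in
    -- a raised class, which `reference-not-up` forbids; the other direction is `no-crossing`.
    -- Equality does not occur, since y + M is a bead.
    count-kept : ∀ {x} → x ∈ xs → M + ν < x → ¬ Exceptional x → lowestBelow v″ (g x - M) ≡ lowestBelow v (x - M)
    count-kept {x} x∈ high ¬ex = filter-length-cong (λ j → g (fun v (+ j)) ℤₚ.<? g x - M)
        (λ j → fun v (+ j) ℤₚ.<? x - M) runners to from
      where
      y = x - M
      x∈L = ∈xs⇒∈L x∈
      x-bead = proj₁ (proj₂ (∈L⁻ x∈L))
      y≈x : y ≈ x
      y≈x = by -1ℤ (cong (λ k → x + k) (sym (ℤₚ.-1*i≡-i M)))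
      y≉0 : ¬ y ≈ 0ℤ
      y≉0 q = proj₂ (proj₂ (∈L⁻ x∈L)) (≈-trans (≈-sym y≈x) q)
      g-y : g y ≡ g x - M
      g-y = trans (cong (λ k → g (x + k)) (sym (ℤₚ.-1*i≡-i M))) (trans (Involution.shift inv -1ℤ x)
          (cong (λ k → g x + k) (ℤₚ.-1*i≡-i M)))
      distinct : ∀ {j} → j ∈ runners → fun v (+ j) ≢ y
      distinct {j} j∈ e = lia 3 (λ i j m → j :≡ i :- m ⇒ i :< m ⇒ # 0 :< j ⇒ ⊢⊥) (inverse v x) (+ j) M
        (trans (sym (inverse-fun v (+ j))) (trans (cong (inverse v)
            (trans e (cong (λ k → x + k) (sym (ℤₚ.-1*i≡-i M)))))
          (trans (inverse-shift v -1ℤ x) (cong (λ k → inverse v x + k) (ℤₚ.-1*i≡-i M)))))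
        (proj₂ (bead⇒ v x-bead)) (proj₁ (∈-runners⁻ j∈))
      to : ∀ {j} → j ∈ runners → g (fun v (+ j)) < g x - M → fun v (+ j) < y
      to {j} j∈ lt = go (ℤₚ.<-cmp (fun v (+ j)) y)
        where
        go : Tri (fun v (+ j) < y) (fun v (+ j) ≡ y) (y < fun v (+ j)) → fun v (+ j) < y
        go (tri< l _ _) = l
        go (tri≈ _ e _) = contradiction e (distinct j∈)
        go (tri> _ _ gt) = contradiction (Up-≈ y≈x (proj₁ (reversal simple y≉0 (runner-≉0 v j∈) gt
            (subst (g (fun v (+ j)) <_) (sym g-y) lt))))
          (reference-not-up (proj₁ (∈L⁻ x∈L)) x-bead)
      from : ∀ {j} → j ∈ runners → fun v (+ j) < y → g (fun v (+ j)) < g x - M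
      from {j} j∈ lt = subst (g (fun v (+ j)) <_) g-y (go (ℤₚ.<-cmp (g (fun v (+ j))) (g y)))
        where
        go : Tri (g (fun v (+ j)) < g y) (g (fun v (+ j)) ≡ g y) (g y < g (fun v (+ j))) → g (fun v (+ j)) < g y
        go (tri< l _ _) = l
        go (tri≈ _ e _) = contradiction (g-injective e) (ℤₚ.<⇒≢ lt)
        go (tri> _ _ gt) = let u , d , near = reversal simple (runner-≉0 v j∈) y≉0 lt gt
                           in ⊥-elim (no-crossing x∈ high ¬ex u (runner-bead v j∈) d lt near)

    down-class⁻ : ∀ {z} → z ≈ δ - b → Down (PeelCase.x pc) (PeelCase.y pc) z
    down-class⁻ {z} p = go isDown
      where
      X = PeelCase.x pc
      Y = PeelCase.y pc
      go : Down X Y b → Down X Y z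
      go (inj₁ q) = inj₂ (≈-trans p (≈-substʳ (lia 2 (λ x y → ⊢ :- y :+ (y :- x) :≡ :- x) X Y)
          (≈-substˡ (ℤₚ.+-comm (- b) δ) (≈-+ δ (≈-neg q)))))
      go (inj₂ q) = inj₁ (≈-trans p (≈-substʳ (lia 2 (λ x y → ⊢ x :+ (y :- x) :≡ y) X Y)
          (≈-substˡ (ℤₚ.+-comm (- b) δ) (≈-+ δ (≈-neg′ q)))))

    xₙ-right : Kind b δ r ψ → δ ≡ + 2 → b ≡ M + (ν + + 1) → right ty ≡ D
    xₙ-right (unit d _ _ _ _ _) d′ _ = contradiction (trans (sym d) d′) λ ()
    xₙ-right (leftC _ _ b≡ _) _ b≡′ = ⊥-elim (lia 3 (λ b m v → b :≡ m :+ # 1 ⇒ b :≡ m :+ (v :+ # 1) ⇒ # 2 :≤ v ⇒ ⊢⊥) b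
        M ν b≡ b≡′ 2≤ν)
    xₙ-right (leftD _ d _ _) d′ _ = contradiction (trans (sym d) d′) λ ()
    xₙ-right (leftD′ _ d _ _) d′ _ = contradiction (trans (sym d) d′) λ ()
    xₙ-right (rightD r≡D _ _ _ _) _ _ = r≡D
    xₙ-right (rightD′ r≡D _ _ _ _) _ _ = r≡D

    -- Afterwards the part is n + x₀ by the low formula. Before, n + 1 is no lowest bead because b =
    -- M + n + 1 is a bead, so the count at n + 2 equals that at n + 1, which is n; with xₙ = -1 the
    -- high formula gives n + x₀ as well.
    exceptional-size : ∀ {x} → x ∈ xs → Exceptional x → size v′ (g x) ≡ size v x
    exceptional-size {x} x∈ (d , b≡ , x≡) = trans (cong (size v′) gx≡) (trans (size-low v′ ℤₚ.≤-refl)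
      (sym (trans (size-high v (lia 3 (λ x m v → x :≡ m :+ (v :+ # 2) ⇒ ⊢ m :+ v :< x) x M ν x≡))
        (lia 5 (λ k v m x₀ xₙ → k :≡ v ⇒ xₙ :≡ :- # 1 ⇒ ⊢ k :+ (# 1 :+ x₀ :+ xₙ) :≡ m :+ v :- m :+ x₀)
            (+ gapsBetween ty (𝒜 v) (x - M) x) ν M (x₀ ty) (xₙ ty)
          count (cong offset (xₙ-right kind d b≡))))))
      where
      x-bead = proj₁ (proj₂ (∈L⁻ (∈xs⇒∈L x∈)))
      gx≡ : g x ≡ M + ν
      gx≡ = trans (Reflection.down-eq (Simple.reflection simple)
          (down-class⁻ (by (+ 3) (trans (lia 5 (λ x b d m v → d :≡ # 2 ⇒ b :≡ m :+ (v :+ # 1) ⇒ x :≡ m :+ (v :+ # 2) ⇒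
          m :≡ # 1 :+ 2 :* v ⇒ ⊢ x :≡ d :- b :+ (m :+ m :+ m)) x b δ M ν d b≡ x≡ M≡)
          (cong (λ k → δ - b + k) (thrice M))))))
        (lia 4 (λ x d m v → d :≡ # 2 ⇒ x :≡ m :+ (v :+ # 2) ⇒ ⊢ x :- d :≡ m :+ v) x δ M ν d x≡)
        where
        thrice : ∀ m → m + m + m ≡ + 3 * m
        thrice = solve-∀
      count : + gapsBetween ty (𝒜 v) (x - M) x ≡ ν
      count = trans (cong +_ (trans (gapsBetween-lowestBelow v v (same-refl v) x-bead)
          (trans (cong (lowestBelow v) (lia 3 (λ x m v → x :≡ m :+ (v :+ # 2) ⇒ ⊢ x :- m :≡ v :+ # 2) x M ν x≡))
            (lowestBelow-cong v (lia 1 (λ v → ⊢ v :+ # 1 :≤ v :+ # 2) ν) none))))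
        -- No label lies strictly between M - (n + 1) = n and n + 1, so the condition is vacuous.
        (trans (lowestBelow-full v (lia 2 (λ m v → m :≡ # 1 :+ 2 :* v ⇒ ⊢ m :< v :+ # 1 :+ (v :+ # 1)) M ν M≡)
            (λ {t} l h → ⊥-elim (lia 3 (λ t m v → m :≡ # 1 :+ 2 :* v ⇒ m :- (v :+ # 1) :< t ⇒ t :< v :+ # 1 ⇒ ⊢⊥) t M
                ν M≡ l h)))
          (lia 1 (λ v → ⊢ v :+ # 1 :- # 1 :≡ v) ν))
        where
        none : ∀ {j} → j ∈ runners → ν + + 1 ≤ fun v (+ j) → fun v (+ j) < ν + + 2 → ⊥
        none {j} j∈ lo hi = lia 3 (λ i j m → i :≡ j :+ m ⇒ i :< m ⇒ # 0 :< j ⇒ ⊢⊥) (inverse v b) (+ j) M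
          (trans (cong (inverse v) (trans (lia 4 (λ b w m v → b :≡ m :+ (v :+ # 1) ⇒ v :+ # 1 :≤ w ⇒ w :< v :+ # 2 ⇒
              ⊢ b :≡ w :+ m) b (fun v (+ j)) M ν b≡ lo hi)
              (cong (λ k → fun v (+ j) + k) (sym (ℤₚ.*-identityˡ M)))))
            (trans (inverse-shift v (+ 1) (fun v (+ j))) (cong₂ _+_ (inverse-fun v (+ j)) (ℤₚ.*-identityˡ M))))
          (proj₂ (bead⇒ v bead)) (proj₁ (∈-runners⁻ j∈))

    size-kept : ∀ {x} → x ∈ xs → size v′ (g x) ≡ size v x
    size-kept {x} x∈ = go (M + ν ℤₚ.<? x) (exceptional? x)
      where
      go : Dec (M + ν < x) → Dec (Exceptional x) → size v′ (g x) ≡ size v x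
      go (no ≮) _ = trans (cong (size v′) (low-fixed x∈ (ℤₚ.≮⇒≥ ≮)))
          (trans (size-low v′ (ℤₚ.≮⇒≥ ≮)) (sym (size-low v (ℤₚ.≮⇒≥ ≮))))
      go (yes _) (yes ex) = exceptional-size x∈ ex
      go (yes lt) (no ¬ex) = trans (size-high v′ (high-stays x∈ lt ¬ex))
          (trans (cong (λ k → + k + (+ 1 + x₀ ty + xₙ ty)) counts) (sym (size-high v lt)))
        where
        x-bead = proj₁ (proj₂ (∈L⁻ (∈xs⇒∈L x∈)))
        bead″ : AtOrAboveLowest v″ (g x)
        bead″ = Equivalence.from (act-moved inv v (g x)) (subst (AtOrAboveLowest v)
            (sym (Involution.involutive inv x)) x-bead)
        counts : gapsBetween ty (𝒜 v′) (g x - M) (g x) ≡ gapsBetween ty (𝒜 v) (x - M) x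
        counts = trans (gapsBetween-lowestBelow v″ v′ same-beads bead″)
            (trans (count-kept x∈ lt ¬ex) (sym (gapsBetween-lowestBelow v v (same-refl v) x-bead)))

    middle-kept : b < M + ν → ∀ {x} → x ∈ xs → does (g x ℤₚ.≟ M + ν) ≡ does (x ℤₚ.≟ M + ν)
    middle-kept b< {x} x∈ = go (M + ν ℤₚ.<? x)
      where
      no≟ : ∀ {p} → p ≢ M + ν → does (p ℤₚ.≟ M + ν) ≡ false
      no≟ {p} ≢ with p ℤₚ.≟ M + ν
      ... | yes e = contradiction e ≢
      ... | no _  = refl
      go : Dec (M + ν < x) → does (g x ℤₚ.≟ M + ν) ≡ does (x ℤₚ.≟ M + ν)
      go (no ≮)   = cong (λ z → does (z ℤₚ.≟ M + ν)) (low-fixed x∈ (ℤₚ.≮⇒≥ ≮))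
      go (yes lt) = trans (no≟ λ e → ℤₚ.<⇒≢ (high-stays x∈ lt λ { (_ , b≡ , _) → lia 3
          (λ b m v → b :≡ m :+ (v :+ # 1) ⇒ b :< m :+ v ⇒ ⊢⊥) b M ν b≡ b< }) (sym e))
                          (sym (no≟ λ e → ℤₚ.<⇒≢ lt (sym e)))

    -- The steps across the boundary of the two formulas are the one from M + n + 1 with right end
    -- C, where δ = 1 and xₙ = 0, and those of sₙᴰ, where δ = 2 and xₙ = -1; so the loss is one in
    -- each.
    size-next : base < b - δ → L′ ≡ map g xs ∷ʳ (b - δ) → size v b ≡ size v′ (b - δ) + + 1
    size-next lt eq′ = byKind kind
      where
      b′ = b - δ
      low : b ≤ M + ν → size v b ≡ b - M - + κ
      low = size-reference-low v wt eq
      high : M + ν < b → b < M + M → size v b ≡ b - M - + κ + xₙ ty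
      high = size-reference-high v wt eq
      low′ : b′ ≤ M + ν → size v′ b′ ≡ b′ - M - + κ
      low′ = size-reference-low v′ wt′ eq′
      high′ : M + ν < b′ → b′ < M + M → size v′ b′ ≡ b′ - M - + κ + xₙ ty
      high′ = size-reference-high v′ wt′ eq′
      M≤base = M≤level (left ty)
      byKind : Kind b δ r ψ → size v b ≡ size v′ b′ + + 1
      byKind (unit d lo hi notD _ _) = go (ℤₚ.<-cmp b (M + (ν + + 1))) (End-cases (right ty))
        where
        go : Tri (b < M + (ν + + 1)) (b ≡ M + (ν + + 1)) (M + (ν + + 1) < b) → right ty ≡ C ⊎ right ty ≡ D → size v b
            ≡ size v′ b′ + + 1
        go (tri< l _ _) _ = lia 6 (λ s s′ b d m k → s :≡ b :- m :- k ⇒ s′ :≡ b :- d :- m :- k ⇒ d :≡ # 1 ⇒ ⊢ s :≡ s′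
            :+ # 1) (size v b) (size v′ b′) b δ M (+ κ)
          (low (lia 3 (λ b m v → b :< m :+ (v :+ # 1) ⇒ ⊢ b :≤ m :+ v) b M ν l))
          (low′ (lia 4 (λ b m v d → b :< m :+ (v :+ # 1) ⇒ d :≡ # 1 ⇒ ⊢ b :- d :≤ m :+ v) b M ν δ l d)) d
        go (tri> _ _ l) _ = lia 7 (λ s s′ b d m k x → s :≡ b :- m :- k :+ x ⇒ s′ :≡ b :- d :- m :- k :+ x ⇒ d :≡ # 1 ⇒
            ⊢ s :≡ s′ :+ # 1) (size v b) (size v′ b′) b δ M (+ κ) (xₙ ty)
          (high (lia 3 (λ b m v → m :+ (v :+ # 1) :< b ⇒ ⊢ m :+ v :< b) b M ν l) hi)
          (high′ (lia 4 (λ b m v d → m :+ (v :+ # 1) :< b ⇒ d :≡ # 1 ⇒ ⊢ m :+ v :< b :- d) b M ν δ l d)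
              (lia 3 (λ b m d → b :< m :+ m ⇒ d :≡ # 1 ⇒ ⊢ b :- d :< m :+ m) b M δ hi d)) d
        go (tri≈ _ b≡ _) (inj₁ r≡C) = lia 7 (λ s s′ b d m k x → s :≡ b :- m :- k :+ x ⇒ s′ :≡ b :- d :- m :- k ⇒ d :≡
            # 1 ⇒ x :≡ # 0 ⇒ ⊢ s :≡ s′ :+ # 1) (size v b) (size v′ b′) b δ M (+ κ) (xₙ ty)
          (high (lia 3 (λ b m v → b :≡ m :+ (v :+ # 1) ⇒ ⊢ m :+ v :< b) b M ν b≡) hi)
          (low′ (lia 4 (λ b m v d → b :≡ m :+ (v :+ # 1) ⇒ d :≡ # 1 ⇒ ⊢ b :- d :≤ m :+ v) b M ν δ b≡ d)) d
              (cong offset r≡C)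
        go (tri≈ _ b≡ _) (inj₂ r≡D) = contradiction b≡ (proj₁ (notD r≡D))
      byKind (leftC _ d b≡ _) = ⊥-elim (lia 4 (λ b d m r → r :< b :- d ⇒ d :≡ # 2 ⇒ b :≡ m :+ # 1 ⇒ m :≤ r ⇒ ⊢⊥) b δ M
          base lt d b≡ M≤base)
      byKind (leftD _ d b≡ _) = ⊥-elim (lia 4 (λ b d m r → r :< b :- d ⇒ d :≡ # 3 ⇒ b :≡ m :+ # 2 ⇒ m :≤ r ⇒ ⊢⊥) b δ M
          base lt d b≡ M≤base)
      byKind (leftD′ l≡D d b≡ _) = lia 7 (λ s s′ b d m k x → s :≡ m :- # 2 :+ x ⇒ s′ :≡ b :- d :- m :- k :+ x ⇒ d :≡
          # 3 ⇒ b :≡ m :+ m :+ # 1 ⇒ k :≡ # 1 ⇒ ⊢ s :≡ s′ :+ # 1) (size v b) (size v′ b′) b δ M (+ κ) (xₙ ty)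
          (size-reference-top v wt eq l≡D b≡)
          (high′ (lia 4 (λ b m v d → b :≡ m :+ m :+ # 1 ⇒ d :≡ # 3 ⇒ m :≡ # 1 :+ 2 :* v ⇒ # 2 :≤ v ⇒ ⊢ m :+ v :< b
              :- d) b M ν δ b≡ d M≡ 2≤ν) (lia 3 (λ b m d → b :≡ m :+ m :+ # 1 ⇒ d :≡ # 3 ⇒ ⊢ b :- d :< m :+ m) b M δ
              b≡ d))
          d b≡ (cong (λ e → + referenceDiagonal e) l≡D)
      byKind (rightD r≡D d b≡ _ _) = lia 7 (λ s s′ b d m k x → s :≡ b :- m :- k :+ x ⇒ s′ :≡ b :- d :- m :- k ⇒ d :≡
          # 2 ⇒ x :≡ :- # 1 ⇒ ⊢ s :≡ s′ :+ # 1) (size v b) (size v′ b′) b δ M (+ κ) (xₙ ty)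
          (high (lia 3 (λ b m v → b :≡ m :+ (v :+ # 1) ⇒ ⊢ m :+ v :< b) b M ν b≡)
              (lia 3 (λ b m v → b :≡ m :+ (v :+ # 1) ⇒ m :≡ # 1 :+ 2 :* v ⇒ # 2 :≤ v ⇒ ⊢ b :< m :+ m) b M ν b≡ M≡
              2≤ν))
          (low′ (lia 4 (λ b m v d → b :≡ m :+ (v :+ # 1) ⇒ d :≡ # 2 ⇒ ⊢ b :- d :≤ m :+ v) b M ν δ b≡ d)) d
              (cong offset r≡D)
      byKind (rightD′ r≡D d b≡ _ _) = lia 7 (λ s s′ b d m k x → s :≡ b :- m :- k :+ x ⇒ s′ :≡ b :- d :- m :- k ⇒ d :≡
          # 2 ⇒ x :≡ :- # 1 ⇒ ⊢ s :≡ s′ :+ # 1) (size v b) (size v′ b′) b δ M (+ κ) (xₙ ty)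
          (high (lia 3 (λ b m v → b :≡ m :+ (v :+ # 2) ⇒ ⊢ m :+ v :< b) b M ν b≡)
              (lia 3 (λ b m v → b :≡ m :+ (v :+ # 2) ⇒ m :≡ # 1 :+ 2 :* v ⇒ # 2 :≤ v ⇒ ⊢ b :< m :+ m) b M ν b≡ M≡
              2≤ν))
          (low′ (lia 4 (λ b m v d → b :≡ m :+ (v :+ # 2) ⇒ d :≡ # 2 ⇒ ⊢ b :- d :≤ m :+ v) b M ν δ b≡ d)) d
              (cong offset r≡D)

    -- A bead that leaves the reference region stood at `base` + 1.
    size-last : ¬ base < b - δ → size v b ≡ + 1
    size-last ≮ = byKind kind
      where
      le : b - δ ≤ base
      le = ℤₚ.≮⇒≥ ≮
      M≤base = M≤level (left ty)
      base≤ = level≤M+1 (left ty)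
      finish : b ≡ base + + 1 → size v b ≡ + 1
      finish e = trans (size-reference-low v wt eq (lia 4 (λ b m r v → b :≡ r :+ # 1 ⇒ r :≤ m :+ # 1 ⇒ # 2 :≤ v ⇒ ⊢ b
          :≤ m :+ v) b M base ν e base≤ 2≤ν))
        (lia 3 (λ b m k → b :≡ m :+ k :+ # 1 ⇒ ⊢ b :- m :- k :≡ # 1) b M (+ κ) e)
      byKind : Kind b δ r ψ → size v b ≡ + 1
      byKind (unit d lo _ _ _ _) = finish (lia 3 (λ b d r → b :- d :≤ r ⇒ d :≡ # 1 ⇒ r :< b ⇒ ⊢ b :≡ r :+ # 1) b δ
          base le d base<b)
      byKind (leftC l≡C d b≡ _) = finish (trans b≡ (cong (_+ + 1) (sym (base-C l≡C))))
      byKind (leftD l≡D d b≡ _) = finish (lia 3 (λ b m r → b :≡ m :+ # 2 ⇒ r :≡ m :+ # 1 ⇒ ⊢ b :≡ r :+ # 1) b M base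
          b≡ (base-D l≡D))
      byKind (leftD′ l≡D d b≡ _) = ⊥-elim (lia 4 (λ b d m r → b :- d :≤ r ⇒ d :≡ # 3 ⇒ b :≡ m :+ m :+ # 1 ⇒ r :≤ m :+
          # 1 ⇒ # 5 :≤ m ⇒ ⊢⊥) b δ M base le d b≡ base≤ 5≤M)
      byKind (rightD r≡D d b≡ _ _) = ⊥-elim (lia 5 (λ b d m r v → b :- d :≤ r ⇒ d :≡ # 2 ⇒ b :≡ m :+ (v :+ # 1) ⇒ r :≤
          m :+ # 1 ⇒ # 3 :≤ v ⇒ ⊢⊥) b δ M base ν le d b≡ base≤ (right-D⇒3≤ν r≡D))
      byKind (rightD′ r≡D d b≡ _ _) = ⊥-elim (lia 5 (λ b d m r v → b :- d :≤ r ⇒ d :≡ # 2 ⇒ b :≡ m :+ (v :+ # 2) ⇒ r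
          :≤ m :+ # 1 ⇒ # 3 :≤ v ⇒ ⊢⊥) b δ M base ν le d b≡ base≤ (right-D⇒3≤ν r≡D))

  -- Boxes, rows and stars of an upper diagram.

  module _ {A : Set} where

    any-cong : ∀ {p q : A → Bool} xs → (∀ {x} → x ∈ xs → p x ≡ q x) → any p xs ≡ any q xs
    any-cong []       _  = refl
    any-cong (x ∷ xs) eq = cong₂ _∨_ (eq (here refl)) (any-cong xs (eq ∘ there))

    any-false : ∀ {p : A → Bool} xs → (∀ {x} → x ∈ xs → p x ≡ false) → any p xs ≡ false
    any-false []       _  = refl
    any-false (x ∷ xs) eq = cong₂ _∨_ (eq (here refl)) (any-false xs (eq ∘ there))

    all-true : ∀ {p : A → Bool} xs → (∀ {x} → x ∈ xs → p x ≡ true) → all p xs ≡ true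
    all-true []       _  = refl
    all-true (x ∷ xs) eq = cong₂ _∧_ (eq (here refl)) (all-true xs (eq ∘ there))

    all-false : ∀ {p : A → Bool} {x xs} → x ∈ xs → p x ≡ false → all p xs ≡ false
    all-false {p} {xs = _ ∷ xs} (here refl) eq = cong (_∧ all p xs) eq
    all-false {p} {xs = y ∷ _} (there x∈) eq = trans (cong (p y ∧_) (all-false x∈ eq)) (Boolₚ.∧-zeroʳ (p y))

    all-cong : ∀ {p q : A → Bool} xs → (∀ {x} → x ∈ xs → p x ≡ q x) → all p xs ≡ all q xs
    all-cong []       _  = refl
    all-cong (x ∷ xs) eq = cong₂ _∧_ (eq (here refl)) (all-cong xs (eq ∘ there))

    all-∷ʳ : ∀ (p : A → Bool) xs y → all p (xs ∷ʳ y) ≡ all p xs ∧ p y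
    all-∷ʳ p []       y = Boolₚ.∧-identityʳ (p y)
    all-∷ʳ p (x ∷ xs) y = trans (cong (p x ∧_) (all-∷ʳ p xs y)) (sym (Boolₚ.∧-assoc (p x) (all p xs) (p y)))

  <ᵇ-true : ∀ {i j} → i ℕ.< j → (i <ᵇ j) ≡ true
  <ᵇ-true lt = true-of (ℕₚ.<⇒<ᵇ lt)

  <ᵇ-false : ∀ {i j} → j ℕ.≤ i → (i <ᵇ j) ≡ false
  <ᵇ-false {i} {j} le = false-of (ℕₚ.≤⇒≯ le ∘ ℕₚ.<ᵇ⇒< i j)

  ∈-boxes⁻ : ∀ U {c} → c ∈ boxes U → ∃[ s ] (c , s) ∈ U
  ∈-boxes⁻ U c∈ = go (∈-map⁻ proj₁ (∈-deduplicate⁻ (≡-dec ℕₚ._≟_ ℕₚ._≟_) (map proj₁ U) c∈))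
    where
    go : ∀ {c} → ∃[ p ] p ∈ U × c ≡ proj₁ p → ∃[ s ] (c , s) ∈ U
    go ((_ , s) , p∈ , refl) = s , p∈

  module NewBox (e j r : ℕ) (U : UpperDiagram) (fresh : ∀ {c s} → (c , s) ∈ U → (e , j) ≢ c) where

    U⁺ : UpperDiagram
    U⁺ = ((e , j) , r) ∷ U

    -- `deduplicate` keeps the head and filters its copies from the rest; freshness means that there
    -- are none.
    boxes-new : boxes U⁺ ≡ (e , j) ∷ boxes U
    boxes-new = cong ((e , j) ∷_) (Listₚ.filter-all (λ c → ¬? (≡-dec ℕₚ._≟_ ℕₚ._≟_ (e , j) c))
      (All.tabulate λ c∈ → fresh (proj₂ (∈-boxes⁻ U c∈))))

    boxesInRow-new : boxesInRow U⁺ e ≡ suc (boxesInRow U e)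
    boxesInRow-new = trans (cong (λ bs → length (filter (λ c → proj₁ c ℕₚ.≟ e) bs)) boxes-new)
      (cong length (Listₚ.filter-accept (λ c → proj₁ c ℕₚ.≟ e) {x = e , j} {xs = boxes U} refl))

    boxesInRow-other : ∀ {i} → i ≢ e → boxesInRow U⁺ i ≡ boxesInRow U i
    boxesInRow-other {i} i≢e = trans (cong (λ bs → length (filter (λ c → proj₁ c ℕₚ.≟ i) bs)) boxes-new)
      (cong length (Listₚ.filter-reject (λ c → proj₁ c ℕₚ.≟ i) {x = e , j} {xs = boxes U} (i≢e ∘ sym)))

    private
      rightOf : ℕ → ℕ → Cell → Bool
      rightOf i k c = not ((proj₁ c ≡ᵇ i) ∧ (k <ᵇ proj₂ c))
      test : ℕ → ℕ → List Cell → Cell × ℕ → Bool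
      test q i bs p = (proj₁ (proj₁ p) ≡ᵇ i) ∧ (proj₂ p ≡ᵇ q) ∧ all (rightOf i (proj₂ (proj₁ p))) bs

    rightmost-other : ∀ q {i} → i ≢ e → rightmostHasResidue U⁺ q i ≡ rightmostHasResidue U q i
    rightmost-other q {i} i≢e = trans (cong (λ bs → any (test q i bs) U⁺) boxes-new)
      (cong₂ _∨_ (cong (λ b → b ∧ (r ≡ᵇ q) ∧ all (rightOf i j) ((e , j) ∷ boxes U)) e≢i)
        (any-cong U λ {p} _ → cong (λ b → (proj₁ (proj₁ p) ≡ᵇ i) ∧ (proj₂ p ≡ᵇ q) ∧
            (not (b ∧ (proj₂ (proj₁ p) <ᵇ j)) ∧ all (rightOf i (proj₂ (proj₁ p))) (boxes U))) e≢i))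
      where
      e≢i : (e ≡ᵇ i) ≡ false
      e≢i = ≡ᵇ-false (i≢e ∘ sym)

    -- The other boxes of row e stand to the left of the new one, which alone passes the test for
    -- the rightmost box.
    rightmost-new : ∀ q → (∀ {i k s} → ((i , k) , s) ∈ U → i ≡ e → k ℕ.< j) → rightmostHasResidue U⁺ q e ≡ (r ≡ᵇ q)
    rightmost-new q left = trans (cong (λ bs → any (test q e bs) U⁺) boxes-new)
      (trans (cong₂ _∨_ first (any-false U λ {p} p∈ → others p p∈)) (Boolₚ.∨-identityʳ _))
      where
      bs = (e , j) ∷ boxes U
      e≡e : (e ≡ᵇ e) ≡ true
      e≡e = ≡ᵇ-true {e} refl
      none-right : ∀ {c} → c ∈ bs → rightOf e j c ≡ true
      none-right (here refl) = trans (cong (λ b → not ((e ≡ᵇ e) ∧ b)) (<ᵇ-false (ℕₚ.≤-refl {j})))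
          (cong not (Boolₚ.∧-zeroʳ (e ≡ᵇ e)))
      none-right {i , k} (there c∈) = go (i ℕₚ.≟ e)
        where
        go : Dec (i ≡ e) → rightOf e j (i , k) ≡ true
        go (yes i≡e) = trans (cong (λ b → not ((i ≡ᵇ e) ∧ b)) (<ᵇ-false (ℕₚ.<⇒≤ (left (proj₂ (∈-boxes⁻ U c∈)) i≡e))))
            (cong not (Boolₚ.∧-zeroʳ (i ≡ᵇ e)))
        go (no i≢e)  = cong (λ b → not (b ∧ (j <ᵇ k))) (≡ᵇ-false i≢e)
      first : test q e bs ((e , j) , r) ≡ (r ≡ᵇ q)
      first = trans (cong₂ (λ b d → b ∧ (r ≡ᵇ q) ∧ d) e≡e (all-true bs none-right)) (Boolₚ.∧-identityʳ _)
      others : ∀ p → p ∈ U → test q e bs p ≡ false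
      others ((i , k) , s) p∈ = go (i ℕₚ.≟ e)
        where
        go : Dec (i ≡ e) → test q e bs ((i , k) , s) ≡ false
        go (no i≢e)  = cong (λ b → b ∧ (s ≡ᵇ q) ∧ all (rightOf e k) bs) (≡ᵇ-false i≢e)
        go (yes i≡e) = trans (cong (λ b → (i ≡ᵇ e) ∧ (s ≡ᵇ q) ∧ b) (all-false {p = rightOf e k} {xs = bs} (here refl)
            (trans (cong₂ (λ b d → not (b ∧ d)) e≡e (<ᵇ-true (left p∈ i≡e))) refl)))
          (trans (cong ((i ≡ᵇ e) ∧_) (Boolₚ.∧-zeroʳ (s ≡ᵇ q))) (Boolₚ.∧-zeroʳ (i ≡ᵇ e)))

  starred-C : ∀ U t i → right t ≡ C → starred U t n i ≡ false
  starred-C U C/C i _ = refl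
  starred-C U B/B i _ = refl

  starSize-D : ∀ t → right t ≡ D → starSize t n ≡ just (n ∸ referenceDiagonal (left t))
  starSize-D B/D _ = refl
  starSize-D D/D _ = refl

  starred-just : ∀ U t i {m} → starSize t n ≡ just m → starred U t n i ≡ isLastOfSize U m i ∧ rightmostHasResidue U
      (n ∸ 1) i
  starred-just U t i eq with starSize t n | eq
  ... | just _ | refl = refl

  map-pair : ∀ {A B : Set} {X Y : Set} {f : A → X} {f′ : B → X} {g : A → Y} {g′ : B → Y} as bs →
    map f as ≡ map f′ bs → map g as ≡ map g′ bs → map (λ a → f a , g a) as ≡ map (λ b → f′ b , g′ b) bs
  map-pair []       []       _ _ = refl
  map-pair (a ∷ as) (b ∷ bs) p q = cong₂ _∷_ (cong₂ _,_ (Listₚ.∷-injectiveˡ p) (Listₚ.∷-injectiveˡ q))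
                                     (map-pair as bs (Listₚ.∷-injectiveʳ p) (Listₚ.∷-injectiveʳ q))

  map-cong-∈ : ∀ {A B : Set} {f g : A → B} xs → (∀ {x} → x ∈ xs → f x ≡ g x) → map f xs ≡ map g xs
  map-cong-∈ []       _  = refl
  map-cong-∈ (x ∷ xs) eq = cong₂ _∷_ (eq (here refl)) (map-cong-∈ xs (eq ∘ there))

  map-∷ʳ : ∀ {A B : Set} (f : A → B) xs x → map f (xs ∷ʳ x) ≡ map f xs ∷ʳ f x
  map-∷ʳ f xs x = Listₚ.map-++ f xs (x ∷ [])

  map-avoid : ∀ {A B C : Set} {f : A → C} {g : B → C} {c} as bs → map f as ≡ map g bs →
    (∀ {b} → b ∈ bs → g b ≢ c) → ∀ {a} → a ∈ as → f a ≢ c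
  map-avoid (a ∷ as) (b ∷ bs) eq avoid (here refl) e = avoid (here refl) (trans (sym (Listₚ.∷-injectiveˡ eq)) e)
  map-avoid (a ∷ as) (b ∷ bs) eq avoid (there a∈) e  = map-avoid as bs (Listₚ.∷-injectiveʳ eq) (avoid ∘ there) a∈ e

  map-all-false : ∀ {A B : Set} {f : A → Bool} {g : B → Bool} as bs → length as ≡ length bs →
    (∀ {a} → a ∈ as → f a ≡ false) → (∀ {b} → b ∈ bs → g b ≡ false) → map f as ≡ map g bs
  map-all-false []       []       _  _ _ = refl
  map-all-false (a ∷ as) (b ∷ bs) eq p q = cong₂ _∷_ (trans (p (here refl)) (sym (q (here refl))))
    (map-all-false as bs (ℕₚ.suc-injective eq) (p ∘ there) (q ∘ there))

  -- The invariant of a peeling.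

  star : ℤ → Bool
  star x = isD (right ty) ∧ does (x ℤₚ.≟ M + ν)

  star-no : ∀ {x} → x ≢ M + ν → star x ≡ false
  star-no {x} x≢ = go (x ℤₚ.≟ M + ν)
    where
    go : (d : Dec (x ≡ M + ν)) → isD (right ty) ∧ does d ≡ false
    go (yes e) = contradiction e x≢
    go (no _)  = Boolₚ.∧-zeroʳ (isD (right ty))

  star-yes : ∀ {x} → right ty ≡ D → x ≡ M + ν → star x ≡ true
  star-yes {x} r≡D x≡ = go (x ℤₚ.≟ M + ν)
    where
    go : (d : Dec (x ≡ M + ν)) → isD (right ty) ∧ does d ≡ true
    go (yes _) = trans (Boolₚ.∧-identityʳ _) (isD-D r≡D)
    go (no ≢)  = contradiction x≡ ≢

  -- The rows of U correspond in order to the reference beads of v. The bound `cols` on the lowest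
  -- row is what makes the next recorded box of that row a new one.
  record Summary (v : Mirrored n) (U : UpperDiagram) : Set where
    private
      L = referenceBeads v
      e = length L
    field
      rows≤ : ∀ {c s} → (c , s) ∈ U → proj₁ c ℕ.≤ e
      top   : max 0 (map proj₁ (boxes U)) ≡ e
      cols  : ∀ {xs b} → L ≡ xs ∷ʳ b → ∀ {i k s} → ((i , k) , s) ∈ U → i ≡ e → + k ≤ + e + (b - M - + 1)
      sizes : map (λ i → + boxesInRow U i) (range e) ≡ map (size v) L
      stars : map (starred U ty n) (range e) ≡ map star L

  length-∷ʳ : ∀ {A : Set} (xs : List A) {x} → length (xs ∷ʳ x) ≡ suc (length xs)
  length-∷ʳ xs = trans (Listₚ.length-++ xs) (ℕₚ.+-comm (length xs) 1)

  boxesInRow-none : ∀ U {i} → (∀ {c s} → (c , s) ∈ U → proj₁ c ≢ i) → boxesInRow U i ≡ 0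
  boxesInRow-none U {i} none = cong length (Listₚ.filter-none (λ c → proj₁ c ℕₚ.≟ i)
      (All.tabulate λ c∈ → none (proj₂ (∈-boxes⁻ U c∈))))

  module _ (v v′ : Mirrored n) (wt : W̃ ty n v) (wt′ : W̃ ty n v′) {xs b} (eq : referenceBeads v ≡ xs ∷ʳ b)
           (pc : PeelCase v (length (referenceBeads v)) b) (moved : Moved (gen ty n (PeelCase.r pc)) v v′)
           (U : UpperDiagram) (prior : Summary v′ U) where

    open PeelCase pc using (r; ψ; kind)
    open Reference (snoc-reference v eq) using (bead)
    open Stepping v v′ wt eq pc moved
    open StepSizes v v′ wt wt′ eq pc moved
    open Summary prior

    private
      e = length (referenceBeads v)
      s = length xs
      e′ = length (referenceBeads v′)
      box : ℕ → ℤ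
      box i = + boxesInRow U i

    e≡ : e ≡ suc s
    e≡ = trans (cong length eq) (length-∷ʳ xs)

    -- Common form of the two outcomes of `Next`: after `gone`, row e has no box in U yet; after
    -- `kept`, it is the last row of U and belongs to b - δ.
    record Before : Set where
      field
        prefix   : map box (range s) ≡ map (size v′) (map g xs)
        prefix★  : map (starred U ty n) (range s) ≡ map star (map g xs)
        last     : + suc (boxesInRow U e) ≡ size v b
        oldRows  : ∀ {c t} → (c , t) ∈ U → proj₁ c ℕ.≤ e
        oldCols  : ∀ {i k t} → ((i , k) , t) ∈ U → i ≡ e → k ℕ.< e ℕ.+ ψ
        allRows  : ∀ (p : ℕ → Bool) → p e ≡ true → all p (range e′) ≡ all p (range s)

    before : Before
    before = go next
      where
      range-e : range e ≡ range s ∷ʳ e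
      range-e = trans (cong range e≡) (trans (range-suc s) (cong (range s ∷ʳ_) (sym e≡)))
      go : Next → Before
      go (gone ≮ eq′) = record
        { prefix = trans (cong (λ k → map box (range k)) (sym e′≡)) (trans sizes (cong (map (size v′)) eq′))
        ; prefix★ = trans (cong (λ k → map (starred U ty n) (range k)) (sym e′≡)) (trans stars (cong (map star) eq′))
        ; last = trans (cong (λ k → + suc k) (boxesInRow-none U none)) (sym (size-last ≮))
        ; oldRows = λ c∈ → ℕₚ.<⇒≤ (old c∈)
        ; oldCols = λ c∈ i≡ → contradiction i≡ (none c∈)
        ; allRows = λ p _ → cong (λ k → all p (range k)) e′≡ }
        where
        e′≡ : e′ ≡ s
        e′≡ = trans (cong length eq′) (Listₚ.length-map g xs)
        old : ∀ {c t} → (c , t) ∈ U → proj₁ c ℕ.< e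
        old c∈ = subst (_ ℕ.<_) (sym e≡) (s≤s (subst (_ ℕ.≤_) e′≡ (rows≤ c∈)))
        none : ∀ {c t} → (c , t) ∈ U → proj₁ c ≢ e
        none c∈ = ℕₚ.<⇒≢ (old c∈)
      go (kept lt eq′) = record
        { prefix = proj₁ sizes′
        ; prefix★ = proj₁ stars′
        ; last = trans (trans (cong (λ z → + 1 + z) (proj₂ sizes′)) (ℤₚ.+-comm (+ 1) (size v′ (b - δ))))
            (sym (size-next lt eq′))
        ; oldRows = λ c∈ → subst (_ ℕ.≤_) e′≡ (rows≤ c∈)
        ; oldCols = λ {i} {k} c∈ i≡ → ℤₚ.drop‿+<+ (lia 5 (λ k e ψ b m → k :≤ e :+ (b :- m :- # 1) ⇒ b :- m :- # 1 :< ψ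
            ⇒ ⊢ k :< e :+ ψ) (+ k) (+ e) (+ ψ) (b - δ) M
            (subst (λ z → + k ≤ + z + (b - δ - M - + 1)) e′≡ (cols eq′ c∈ (trans i≡ (sym e′≡)))) (Kind-lower kind))
        ; allRows = λ p pe → trans (cong (all p) range-e′) (trans (all-∷ʳ p (range s) e)
            (trans (cong (all p (range s) ∧_) pe) (Boolₚ.∧-identityʳ _))) }
        where
        e′≡ : e′ ≡ e
        e′≡ = trans (cong length eq′) (trans (length-∷ʳ (map g xs))
            (trans (cong suc (Listₚ.length-map g xs)) (sym e≡)))
        range-e′ : range e′ ≡ range s ∷ʳ e
        range-e′ = trans (cong range e′≡) range-e
        sizes′ : map box (range s) ≡ map (size v′) (map g xs) × box e ≡ size v′ (b - δ)
        sizes′ = Listₚ.∷ʳ-injective _ _ (trans (sym (trans (cong (map box) range-e′) (map-∷ʳ box (range s) e)))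
          (trans sizes (trans (cong (map (size v′)) eq′) (map-∷ʳ (size v′) (map g xs) (b - δ)))))
        stars′ : map (starred U ty n) (range s) ≡ map star (map g xs) × starred U ty n e ≡ star (b - δ)
        stars′ = Listₚ.∷ʳ-injective _ _ (trans (sym (trans (cong (map (starred U ty n)) range-e′)
            (map-∷ʳ (starred U ty n) (range s) e)))
          (trans stars (trans (cong (map star) eq′) (map-∷ʳ star (map g xs) (b - δ)))))

    open Before before

    fresh : ∀ {c t} → (c , t) ∈ U → (e , e ℕ.+ ψ) ≢ c
    fresh c∈ refl = ℕₚ.<-irrefl refl (oldCols c∈ refl)

    open NewBox e (e ℕ.+ ψ) r U fresh

    private
      range-e : range e ≡ range s ∷ʳ e
      range-e = trans (cong range e≡) (trans (range-suc s) (cong (range s ∷ʳ_) (sym e≡)))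
      below-e : ∀ {i} → i ∈ range s → i ℕ.< e
      below-e i∈ = subst (_ ℕ.<_) (sym e≡) (s≤s (proj₂ (∈-range⁻ i∈)))

    prefix⁺ : map (λ i → + boxesInRow U⁺ i) (range s) ≡ map (size v) xs
    prefix⁺ = trans (map-cong-∈ (range s) λ i∈ → cong +_ (boxesInRow-other (ℕₚ.<⇒≢ (below-e i∈))))
      (trans prefix (trans (sym (Listₚ.map-∘ xs)) (map-cong-∈ xs size-kept)))

    last⁺ : + boxesInRow U⁺ e ≡ size v b
    last⁺ = trans (cong +_ boxesInRow-new) last

    -- In the high range a part is, up to a constant, the number of lowest beads below the label
    -- minus M, and this number grows with the label.
    size-mono : M + ν < b → ∀ {x} → x ∈ xs → size v b ≤ size v x
    size-mono high {x} x∈ = subst₂ _≤_ (sym (part high bead)) (sym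
        (part (ℤₚ.<-trans high (xs>b x∈)) (proj₁ (proj₂ (∈L⁻ (∈xs⇒∈L x∈))))))
      (ℤₚ.+-monoˡ-≤ (+ 1 + x₀ ty + xₙ ty) (+≤+ (lowestBelow-mono v (ℤₚ.+-monoˡ-≤ (- M) (ℤₚ.<⇒≤ (xs>b x∈))))))
      where
      part : ∀ {z} → M + ν < z → AtOrAboveLowest v z → size v z ≡ + lowestBelow v (z - M) + (+ 1 + x₀ ty + xₙ ty)
      part {z} hi bd = trans (size-high v hi) (cong (λ k → + k + (+ 1 + x₀ ty + xₙ ty))
          (gapsBetween-lowestBelow v v (same-refl v) bd))

    module _ (r≡D : right ty ≡ D) where

      m★ : ℕ
      m★ = n ∸ κ

      κ≤1 : ∀ E → referenceDiagonal E ℕ.≤ 1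
      κ≤1 C = z≤n
      κ≤1 D = s≤s z≤n

      +m : + m★ ≡ ν - + κ
      +m = trans (sym (ℤₚ.⊖-≥ (ℕₚ.≤-trans (κ≤1 (left ty)) (ℕₚ.≤-trans (s≤s z≤n) 2≤n)))) (sym (ℤₚ.m-n≡m⊖n n κ))

      -- The starred size occurs for b = M + n, whose recorded box has residue n - 1, and for b = M
      -- + n + 1, with residue n. In the third case row e is too short to affect the stars, in the
      -- fourth every row is too long.
      data StarCase : Set where
        onMiddle    : b ≡ M + ν → r ≡ n ∸ 1 → size v b ≡ + m★ → StarCase
        justAbove   : M + ν < b → r ≡ n → size v b ≡ + m★ → StarCase
        belowMiddle : b < M + ν → size v b < + m★ → StarCase
        aboveMiddle : M + ν < b → + m★ < size v b → StarCase

      private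
        3≤ν = right-D⇒3≤ν r≡D
        low-case★ : b < M + ν → StarCase
        low-case★ lt = belowMiddle lt (lia 6 (λ s b m k v p → s :≡ b :- m :- k ⇒ p :≡ v :- k ⇒ b :< m :+ v ⇒ ⊢ s :< p)
            (size v b) b M (+ κ) ν (+ m★)
          (size-reference-low v wt eq (ℤₚ.<⇒≤ lt)) +m lt)
        high-size : M + ν < b → b < M + M → size v b ≡ b - M - + κ - + 1
        high-size lo hi = trans (size-reference-high v wt eq lo hi) (cong (λ z → b - M - + κ + z) (cong offset r≡D))

      starCase : StarCase
      starCase = byKind kind
        where
        byKind : Kind b δ r ψ → StarCase
        byKind (unit d lo hi notD e r≡) = go (ℤₚ.<-cmp b (M + ν))
          where
          go : Tri (b < M + ν) (b ≡ M + ν) (M + ν < b) → StarCase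
          go (tri< lt _ _) = low-case★ lt
          go (tri≈ _ b≡ _) = onMiddle b≡ (r≡ b≡) (lia 6 (λ s b m k v p → s :≡ b :- m :- k ⇒ p :≡ v :- k ⇒ b :≡ m :+ v
              ⇒ ⊢ s :≡ p) (size v b) b M (+ κ) ν (+ m★)
            (size-reference-low v wt eq (ℤₚ.≤-reflexive b≡)) +m b≡)
          go (tri> _ _ gt) = aboveMiddle gt (lia 6 (λ s b m k v p → s :≡ b :- m :- k :- # 1 ⇒ p :≡ v :- k ⇒ m :+
              (v :+ # 1) :< b ⇒ ⊢ p :< s) (size v b) b M (+ κ) ν (+ m★)
            (high-size gt hi) +m (ℤₚ.≤∧≢⇒< (lia 3 (λ b m v → m :+ v :< b ⇒ ⊢ m :+ (v :+ # 1) :≤ b) b M ν gt)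
                (proj₁ (notD r≡D) ∘ sym)))
        byKind (leftC _ d b≡ _) = low-case★ (lia 3 (λ b m v → b :≡ m :+ # 1 ⇒ # 3 :≤ v ⇒ ⊢ b :< m :+ v) b M ν b≡ 3≤ν)
        byKind (leftD _ d b≡ _) = low-case★ (lia 3 (λ b m v → b :≡ m :+ # 2 ⇒ # 3 :≤ v ⇒ ⊢ b :< m :+ v) b M ν b≡ 3≤ν)
        byKind (leftD′ l≡D d b≡ _) = aboveMiddle (lia 3 (λ b m v → b :≡ m :+ m :+ # 1 ⇒ m :≡ # 1 :+ 2 :* v ⇒ # 3 :≤ v
            ⇒ ⊢ m :+ v :< b) b M ν b≡ M≡ 3≤ν)
          (lia 6 (λ s m k v p x → s :≡ m :- # 2 :+ x ⇒ x :≡ :- # 1 ⇒ p :≡ v :- k ⇒ # 0 :≤ k ⇒ m :≡ # 1 :+ 2 :* v ⇒ # 3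
              :≤ v ⇒ ⊢ p :< s) (size v b) M (+ κ) ν (+ m★) (xₙ ty)
            (size-reference-top v wt eq l≡D b≡) (cong offset r≡D) +m (+≤+ z≤n) M≡ 3≤ν)
        byKind (rightD _ d b≡ _ r≡) = justAbove gt r≡ (lia 6 (λ s b m k v p → s :≡ b :- m :- k :- # 1 ⇒ p :≡ v :- k ⇒
            b :≡ m :+ (v :+ # 1) ⇒ ⊢ s :≡ p) (size v b) b M (+ κ) ν (+ m★)
            (high-size gt (lia 3 (λ b m v → b :≡ m :+ (v :+ # 1) ⇒ m :≡ # 1 :+ 2 :* v ⇒ # 3 :≤ v ⇒ ⊢ b :< m :+ m) b M
                ν b≡ M≡ 3≤ν)) +m b≡)
          where
          gt : M + ν < b
          gt = lia 3 (λ b m v → b :≡ m :+ (v :+ # 1) ⇒ ⊢ m :+ v :< b) b M ν b≡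
        byKind (rightD′ _ d b≡ _ r≡) = aboveMiddle gt (lia 6 (λ s b m k v p → s :≡ b :- m :- k :- # 1 ⇒ p :≡ v :- k ⇒
            b :≡ m :+ (v :+ # 2) ⇒ ⊢ p :< s) (size v b) b M (+ κ) ν (+ m★)
            (high-size gt (lia 3 (λ b m v → b :≡ m :+ (v :+ # 2) ⇒ m :≡ # 1 :+ 2 :* v ⇒ # 3 :≤ v ⇒ ⊢ b :< m :+ m) b M
                ν b≡ M≡ 3≤ν)) +m b≡)
          where
          gt : M + ν < b
          gt = lia 3 (λ b m v → b :≡ m :+ (v :+ # 2) ⇒ ⊢ m :+ v :< b) b M ν b≡

    top⁺ : max 0 (map proj₁ (boxes U⁺)) ≡ e
    top⁺ = trans (cong (λ bs → max 0 (map proj₁ bs)) boxes-new)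
      (max≈v⁺ (here refl) (ℕₚ.≤-refl ∷ Allₚ.map⁺ (All.tabulate λ c∈ → oldRows (proj₂ (∈-boxes⁻ U c∈)))) z≤n)

    rows⁺ : rows U⁺ ≡ range e
    rows⁺ = cong range top⁺

    later : UpperDiagram → ℕ → ℕ → ℕ → Bool
    later V m i i′ = not ((i <ᵇ i′) ∧ (boxesInRow V i′ ≡ᵇ m))

    later-last : ∀ V {m i} → boxesInRow V e ≢ m → later V m i e ≡ true
    later-last V {m} {i} ≢ = trans (cong (λ b → not ((i <ᵇ e) ∧ b)) (≡ᵇ-false ≢)) (cong not (Boolₚ.∧-zeroʳ (i <ᵇ e)))

    lastOfSize⁺ : ∀ m i → isLastOfSize U⁺ m i ≡ (boxesInRow U⁺ i ≡ᵇ m) ∧ all (later U⁺ m i) (range e)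
    lastOfSize⁺ m i = cong (λ rs → (boxesInRow U⁺ i ≡ᵇ m) ∧ all (later U⁺ m i) rs) rows⁺

    module _ (r≡D : right ty ≡ D) where

      private
        m = m★ r≡D
        starred-at : ∀ V i → starred V ty n i ≡ isLastOfSize V m i ∧ rightmostHasResidue V (n ∸ 1) i
        starred-at V i = starred-just V ty i (starSize-D ty r≡D)
        not-size : ∀ i → boxesInRow U⁺ i ≢ m → starred U⁺ ty n i ≡ false
        not-size i ≢ = trans (starred-at U⁺ i) (cong (λ b → (b ∧ all (later U⁺ m i) (rows U⁺)) ∧ rightmostHasResidue
            U⁺ (n ∸ 1) i) (≡ᵇ-false ≢))
        -- Row e lies lower and has the same size.
        beaten : size v b ≡ + m → ∀ {i} → i ∈ range s → starred U⁺ ty n i ≡ false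
        beaten sz {i} i∈ = trans (starred-at U⁺ i) (cong (_∧ rightmostHasResidue U⁺ (n ∸ 1) i)
          (trans (lastOfSize⁺ m i) (trans (cong ((boxesInRow U⁺ i ≡ᵇ m) ∧_)
              (all-false {p = later U⁺ m i} {x = e} (∈-range⁺ (subst (1 ℕ.≤_) (sym e≡) (s≤s z≤n)) ℕₚ.≤-refl)
            (trans (cong₂ (λ a b → not (a ∧ b)) (<ᵇ-true (below-e i∈)) (≡ᵇ-true (ℤₚ.+-injective (trans last⁺ sz))))
                refl))) (Boolₚ.∧-zeroʳ _))))
        last-of-size : size v b ≡ + m → isLastOfSize U⁺ m e ≡ true
        last-of-size sz = trans (lastOfSize⁺ m e) (cong₂ _∧_ (≡ᵇ-true (ℤₚ.+-injective (trans last⁺ sz)))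
          (all-true (range e) λ {i′} i∈ → cong (λ b → not (b ∧ (boxesInRow U⁺ i′ ≡ᵇ m)))
              (<ᵇ-false (proj₂ (∈-range⁻ i∈)))))
        last-star : starred U⁺ ty n e ≡ isLastOfSize U⁺ m e ∧ (r ≡ᵇ n ∸ 1)
        last-star = trans (starred-at U⁺ e) (cong (isLastOfSize U⁺ m e ∧_) (rightmost-new (n ∸ 1) oldCols))
        lengths : length (range s) ≡ length xs
        lengths = length-range s
        above★ : M + ν < b → ∀ {x} → x ∈ xs → star x ≡ false
        above★ gt x∈ = star-no λ e → ℤₚ.<⇒≢ (ℤₚ.<-trans gt (xs>b x∈)) (sym e)

      stars-D : map (starred U⁺ ty n) (range s) ≡ map star xs × starred U⁺ ty n e ≡ star b
      stars-D = go (starCase r≡D)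
        where
        go : StarCase r≡D → map (starred U⁺ ty n) (range s) ≡ map star xs × starred U⁺ ty n e ≡ star b
        go (onMiddle b≡ r≡ sz) =
          map-all-false (range s) xs lengths (beaten sz) (λ x∈ → star-no λ e → ℤₚ.<⇒≢ (xs>b x∈) (trans b≡ (sym e))) ,
          trans last-star (trans (cong₂ _∧_ (last-of-size sz) (≡ᵇ-true r≡)) (sym (star-yes r≡D b≡)))
        go (justAbove gt r≡ sz) =
          map-all-false (range s) xs lengths (beaten sz) (above★ gt) ,
          trans last-star (trans (cong (isLastOfSize U⁺ m e ∧_) (≡ᵇ-false λ r≡′ → ℕₚ.<⇒≢
              (ℕₚ.∸-monoʳ-< {n} (s≤s z≤n) (ℕₚ.≤-trans (s≤s z≤n) 2≤n)) (trans (sym r≡′) r≡)))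
            (trans (Boolₚ.∧-zeroʳ _) (sym (star-no λ e → ℤₚ.<⇒≢ gt (sym e)))))
        go (aboveMiddle gt sz) =
          map-all-false (range s) xs lengths
            (λ {i} i∈ → not-size i λ e → map-avoid {c = + m} (range s) xs prefix⁺
                (λ x∈ e′ → ℤₚ.<⇒≢ (ℤₚ.<-≤-trans sz (size-mono gt x∈)) (sym e′)) i∈ (cong +_ e))
            (above★ gt) ,
          trans (not-size e λ e′ → ℤₚ.<⇒≢ sz (trans (cong +_ (sym e′)) last⁺))
              (sym (star-no λ e′ → ℤₚ.<⇒≢ gt (sym e′)))
        go (belowMiddle lt sz) =
          trans (map-cong-∈ (range s) same) (trans prefix★ (trans (sym (Listₚ.map-∘ xs))
              (map-cong-∈ xs λ x∈ → cong (isD (right ty) ∧_) (middle-kept lt x∈)))) ,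
          trans (not-size e new≢) (sym (star-no λ e′ → ℤₚ.<⇒≢ lt e′))
          where
          new≢ : boxesInRow U⁺ e ≢ m
          new≢ e′ = ℤₚ.<⇒≢ sz (trans (sym last⁺) (cong +_ e′))
          old≢ : boxesInRow U e ≢ m
          old≢ e′ = lia 3 (λ p s m → # 1 :+ p :≡ s ⇒ s :< m ⇒ p :≡ m ⇒ ⊢⊥) (+ boxesInRow U e) (size v b) (+ m) last sz
              (cong +_ e′)
          same : ∀ {i} → i ∈ range s → starred U⁺ ty n i ≡ starred U ty n i
          same {i} i∈ = trans (starred-at U⁺ i) (trans (cong₂ _∧_ lasts (rightmost-other (n ∸ 1) i≢e))
              (sym (starred-at U i)))
            where
            i≢e = ℕₚ.<⇒≢ (below-e i∈)
            lasts : isLastOfSize U⁺ m i ≡ isLastOfSize U m i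
            lasts = trans (lastOfSize⁺ m i) (cong₂ _∧_ (cong (_≡ᵇ m) (boxesInRow-other i≢e)) (begin
              all (later U⁺ m i) (range e)                       ≡⟨ cong (all (later U⁺ m i)) range-e ⟩
              all (later U⁺ m i) (range s ∷ʳ e)                  ≡⟨ all-∷ʳ (later U⁺ m i) (range s) e ⟩
              all (later U⁺ m i) (range s) ∧ later U⁺ m i e      ≡⟨ cong (all (later U⁺ m i) (range s) ∧_)
                  (later-last U⁺ {m} {i} new≢) ⟩
              all (later U⁺ m i) (range s) ∧ true                ≡⟨ Boolₚ.∧-identityʳ _ ⟩
              all (later U⁺ m i) (range s)                       ≡⟨ all-cong (range s)
                  (λ {i′} i′∈ → cong (λ k → not ((i <ᵇ i′) ∧ (k ≡ᵇ m))) (boxesInRow-other (ℕₚ.<⇒≢ (below-e i′∈)))) ⟩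
              all (later U m i) (range s)                        ≡⟨ allRows (later U m i) (later-last U {m} {i} old≢)
                  ⟨
              all (later U m i) (range e′)                       ≡⟨ cong (λ k → all (later U m i) (range k)) (sym top)
                  ⟩
              all (later U m i) (rows U)                         ∎))
              where open ≡-Reasoning

    stars-step : map (starred U⁺ ty n) (range s) ≡ map star xs × starred U⁺ ty n e ≡ star b
    stars-step = go (End-cases (right ty))
      where
      go : right ty ≡ C ⊎ right ty ≡ D → map (starred U⁺ ty n) (range s) ≡ map star xs × starred U⁺ ty n e ≡ star b
      go (inj₂ r≡D) = stars-D r≡D
      go (inj₁ r≡C) = map-all-false (range s) xs (length-range s) (λ {i} _ → starred-C U⁺ ty i r≡C)
          (λ {x} _ → star-C x)
                    , trans (starred-C U⁺ ty e r≡C) (sym (star-C b))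
        where
        star-C : ∀ x → star x ≡ false
        star-C x = cong (_∧ does (x ℤₚ.≟ M + ν)) (isD-C r≡C)

    summary-step : Summary v (((e , e ℕ.+ ψ) , r) ∷ U)
    summary-step = record
      { rows≤ = λ { (here refl) → ℕₚ.≤-refl ; (there c∈) → oldRows c∈ }
      ; top   = top⁺
      ; cols  = cols⁺
      ; sizes = assemble (λ i → + boxesInRow U⁺ i) (size v) prefix⁺ last⁺
      ; stars = assemble (starred U⁺ ty n) star (proj₁ stars-step) (proj₂ stars-step)
      }
      where
      assemble : ∀ {X : Set} (f : ℕ → X) (h : ℤ → X) → map f (range s) ≡ map h xs → f e ≡ h b → map f (range e) ≡ map
          h (referenceBeads v)
      assemble f h p q = trans (cong (map f) range-e) (trans (map-∷ʳ f (range s) e)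
          (trans (cong₂ _∷ʳ_ p q) (sym (trans (cong (map h) eq) (map-∷ʳ h xs b)))))
      cols⁺ : ∀ {ys c} → referenceBeads v ≡ ys ∷ʳ c → ∀ {i k t} → ((i , k) , t) ∈ U⁺ → i ≡ e → + k ≤ + e
          + (c - M - + 1)
      cols⁺ {ys} {c} eq₂ = subst (λ z → ∀ {i k t} → ((i , k) , t) ∈ U⁺ → i ≡ e → + k ≤ + e + (z - M - + 1))
          (proj₂ (Listₚ.∷ʳ-injective xs ys (trans (sym eq) eq₂))) bounded
        where
        bounded : ∀ {i k t} → ((i , k) , t) ∈ U⁺ → i ≡ e → + k ≤ + e + (b - M - + 1)
        bounded (here refl) _ = ℤₚ.+-monoʳ-≤ (+ e) (Kind-upper kind)
        bounded {k = k} (there c∈) i≡ = ℤₚ.≤-trans (+≤+ (ℕₚ.<⇒≤ (oldCols c∈ i≡)))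
            (ℤₚ.+-monoʳ-≤ (+ e) (Kind-upper kind))

  -- Evaluation of an arbitrary peeling.

  snocView : ∀ {A : Set} (xs : List A) → xs ≡ [] ⊎ (∃₂ λ ys y → xs ≡ ys ∷ʳ y)
  snocView xs with initLast xs
  ... | []      = inj₁ refl
  ... | ys ∷ʳ′ y = inj₂ (ys , y , refl)

  module _ (w : W̃/W ty n) {xs b} (eq : referenceBeads (perm w) ≡ xs ∷ʳ b) where

    private
      v = perm w
      e = length (referenceBeads v)
      pc = peelCase v (inW̃ w) eq
      open PeelCase pc

    peelingRow≡ : peelingRow ty n w ≡ e
    peelingRow≡ = diagonal-count v eq

    peelingResidue≡ : peelingResidue n (residue ty n (shape ty n w) (peelingBox ty n w)) ≡ just r
    peelingResidue≡ = trans (cong (λ d → peelingResidue n (residue ty n (shape ty n w)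
        (d , rowLength (shape ty n w) d))) peelingRow≡) residue≡

    recordedBox≡ : recordedBox ty n r (peelingBox ty n w) ≡ (e , e ℕ.+ ψ)
    recordedBox≡ = trans (cong (λ d → recordedBox ty n r (d , rowLength (shape ty n w) d)) peelingRow≡) record≡

  summary-empty : ∀ v → referenceBeads v ≡ [] → Summary v []
  summary-empty v none = record
    { rows≤ = λ () ; top = sym (cong length none) ; cols = λ _ ()
    ; sizes = trans (cong (λ L → map (λ i → + boxesInRow [] i) (range (length L))) none)
        (sym (cong (map (size v)) none))
    ; stars = trans (cong (λ L → map (starred [] ty n) (range (length L))) none) (sym (cong (map star) none)) }

  -- Induction on the peeling. The residue fixes r, so the given step is that of `peelCase`; the
  -- beads of the given representative follow from `acts⇒moved`.
  summary : ∀ {w U} → Peels ty n w U → Summary (perm w) U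
  summary {w} (done empty) = go (snocView (referenceBeads (perm w)))
    where
    go : referenceBeads (perm w) ≡ [] ⊎ (∃₂ λ ys y → referenceBeads (perm w) ≡ ys ∷ʳ y) → Summary (perm w) []
    go (inj₁ none)         = summary-empty (perm w) none
    go (inj₂ (_ , _ , eq)) = contradiction empty (shape-nonempty (perm w) eq)
  summary {w} (peel {v′ = w′} {r = r} {U = U} nonempty _ res (u , acts) rest) = go
      (snocView (referenceBeads (perm w)))
    where
    go : referenceBeads (perm w) ≡ [] ⊎ (∃₂ λ ys y → referenceBeads (perm w) ≡ ys ∷ʳ y) →
         Summary (perm w) ((recordedBox ty n r (peelingBox ty n w) , r) ∷ U)
    go (inj₁ none) = contradiction (empty-shape (perm w) (no-reference (perm w) (inW̃ w) none)) nonempty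
    go (inj₂ (_ , _ , eq)) = subst (λ q → Summary (perm w) ((recordedBox ty n q (peelingBox ty n w) , q) ∷ U))
        (sym r≡)
        (subst (λ c → Summary (perm w) ((c , PeelCase.r pc) ∷ U)) (sym (recordedBox≡ w eq))
          (summary-step (perm w) (perm w′) (inW̃ w) (inW̃ w′) eq pc moved U (summary rest)))
      where
      pc = peelCase (perm w) (inW̃ w) eq
      r≡ : r ≡ PeelCase.r pc
      r≡ = Maybeₚ.just-injective (trans (sym res) (peelingResidue≡ w eq))
      moved : Moved (gen ty n (PeelCase.r pc)) (perm w) (perm w′)
      moved = acts⇒moved (PeelCase.r≤n pc) (perm w) (perm w′) u (subst
          (λ q → fun (perm w′) ≗ gen ty n q ∘ fun (perm w) ∘ ⟦_⟧ᵂ ty n u) r≡ acts)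

  beadPart≡ : ∀ v x → beadPart ty (𝒜 v) x ≡ (size v x , star x)
  beadPart≡ v x with + (N n ℕ.+ n) ℤₚ.<? x
  ... | yes lt = cong (+ gapsBetween ty (𝒜 v) (x - M) x + (+ 1 + x₀ ty + xₙ ty) ,_)
      (sym (star-no λ e → ℤₚ.<⇒≢ lt (sym e)))
  ... | no _   = refl

  -- With left end D a bead at M + 1 is among the beads of `beadParts` without being a reference
  -- bead; its part has size M + 1 - M - 1 = 0 and is dropped.
  beadParts≡ : ∀ v → beadParts ty (𝒜 v) ≡ dropZeros (map (beadPart ty (𝒜 v)) (referenceBeads v))
  beadParts≡ v = go (End-cases (left ty))
    where
    a = 𝒜 v
    zero? : Decidable (λ (p : Part) → ¬ proj₁ p ≡ 0ℤ)
    zero? p = ¬? (proj₁ p ℤₚ.≟ 0ℤ)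
    part = beadPart ty a
    go : left ty ≡ C ⊎ left ty ≡ D → beadParts ty a ≡ dropZeros (map part (referenceBeads v))
    go (inj₁ l≡C) = cong (λ c → dropZeros (map part (beadsAbove a c))) (sym (base-C l≡C))
    go (inj₂ l≡D) = trans (decide (bead? a (M + + 1))) (cong (λ c → dropZeros (map part (beadsAbove a c)))
        (sym (base-D l≡D)))
      where
      above-M : ∀ {x} → x ∈ beadsAbove a (M + + 1) → x ∈ beadsAbove a M
      above-M {x} x∈ = let lt , bd , en = ∈-beadsAbove⁻ a x∈ in
        ∈-beadsAbove⁺ a (ℤₚ.<⇒≤ 0<M) (lia 2 (λ x m → m :+ # 1 :< x ⇒ ⊢ m :< x) x M lt) en bd
      above-M⁻ : ∀ {x} → x ∈ beadsAbove a M → x ≢ M + + 1 → x ∈ beadsAbove a (M + + 1)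
      above-M⁻ {x} x∈ x≢ = let lt , bd , en = ∈-beadsAbove⁻ a x∈ in
        ∈-beadsAbove⁺ a (ℤₚ.<⇒≤ (ℤₚ.<-trans 0<M (lia 1 (λ m → ⊢ m :< m :+ # 1) M)))
            (ℤₚ.≤∧≢⇒< (lia 2 (λ x m → m :< x ⇒ ⊢ m :+ # 1 :≤ x) x M lt) (x≢ ∘ sym)) en bd
      asym : ∀ {p q : ℤ} → p ℤ.> q → ¬ q ℤ.> p
      asym p q = ℤₚ.<-asym p q
      dropped : ¬ ¬ size v (M + + 1) ≡ 0ℤ
      dropped ≢ = ≢ (trans (size-low v (lia 2 (λ m v → # 2 :≤ v ⇒ ⊢ m :+ # 1 :≤ m :+ v) M ν 2≤ν))
        (lia 2 (λ m x → x :≡ :- # 1 ⇒ ⊢ m :+ # 1 :- m :+ x :≡ # 0) M (x₀ ty) (cong offset l≡D)))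
      decide : Dec (AtOrAboveLowest v (M + + 1)) → dropZeros (map part (beadsAbove a M)) ≡ dropZeros
          (map part (beadsAbove a (M + + 1)))
      decide (no ¬bd) = cong (λ l → dropZeros (map part l)) (sorted-≡ asym (beadsAbove-sorted a M)
          (beadsAbove-sorted a (M + + 1))
        (λ x∈ → above-M⁻ x∈ λ { refl → ¬bd (proj₁ (proj₂ (∈-beadsAbove⁻ a x∈))) }) above-M)
      decide (yes bd) = trans (cong (λ l → dropZeros (map part l)) split)
        (trans (cong dropZeros (map-∷ʳ part (beadsAbove a (M + + 1)) (M + + 1)))
          (trans (Listₚ.filter-++ zero? (map part (beadsAbove a (M + + 1))) (part (M + + 1) ∷ []))
            (trans (cong (dropZeros (map part (beadsAbove a (M + + 1))) ++_)
                (Listₚ.filter-reject zero? {x = part (M + + 1)} {xs = []} dropped))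
              (Listₚ.++-identityʳ _))))
        where
        last-sorted : ∀ ys → AllPairs ℤ._>_ ys → (∀ {y} → y ∈ ys → M + + 1 < y) → AllPairs ℤ._>_ (ys ∷ʳ (M + + 1))
        last-sorted ys s lt = AllPairsₚ.++⁺ s ([] ∷ []) (All.tabulate λ y∈ → lt y∈ ∷ [])
        split : beadsAbove a M ≡ beadsAbove a (M + + 1) ∷ʳ (M + + 1)
        split = sorted-≡ asym (beadsAbove-sorted a M) (last-sorted _ (beadsAbove-sorted a (M + + 1))
            (λ y∈ → proj₁ (∈-beadsAbove⁻ a y∈))) to from
          where
          to : ∀ {x} → x ∈ beadsAbove a M → x ∈ beadsAbove a (M + + 1) ∷ʳ (M + + 1)
          to {x} x∈ = pick (x ℤₚ.≟ M + + 1)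
            where
            pick : Dec (x ≡ M + + 1) → x ∈ beadsAbove a (M + + 1) ∷ʳ (M + + 1)
            pick (yes e) = ∈-++⁺ʳ (beadsAbove a (M + + 1)) (here e)
            pick (no ≢)  = ∈-++⁺ˡ (above-M⁻ x∈ ≢)
          from : ∀ {x} → x ∈ beadsAbove a (M + + 1) ∷ʳ (M + + 1) → x ∈ beadsAbove a M
          from x∈ = pick (∈-++⁻ (beadsAbove a (M + + 1)) x∈)
            where
            pick : ∀ {x} → x ∈ beadsAbove a (M + + 1) ⊎ x ∈ (M + + 1) ∷ [] → x ∈ beadsAbove a M
            pick (inj₁ p) = above-M p
            pick (inj₂ (here refl)) = ∈-beadsAbove⁺ a (ℤₚ.<⇒≤ 0<M) (lia 1 (λ m → ⊢ m :< m :+ # 1) M) (≉0⇒Entry M+1≉0)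
                bd

  rowParts≡ : ∀ v {U} → Summary v U → rowParts U ty n ≡ beadParts ty (𝒜 v)
  rowParts≡ v {U} s = trans (cong dropZeros (trans (cong (λ k → map (λ i → + boxesInRow U i , starred U ty n i)
      (range k)) top)
      (trans (map-pair (range (length L)) L sizes stars) (Listₚ.map-cong (λ x → sym (beadPart≡ v x)) L))))
          (sym (beadParts≡ v))
    where
    L = referenceBeads v
    open Summary s

  -- Parities under left multiplication

  record Enumerates (P : ℤ → Set) (is : List ℤ) : Set where
    constructor enumerates
    field
      unique  : Unique is
      members : ∀ i → i ∈ is ⇔ P i

  toggle : ∀ {P P′ : ℤ → Set} {is} p → Enumerates P is → Dec (P p) → (∀ i → i ≢ p → P′ i ⇔ P i) → P′ p ⇔ (¬ P p) →
    ∃[ is′ ] Enumerates P′ is′ × (length is′ ≡ suc (length is) ⊎ suc (length is′) ≡ length is)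
  toggle {P} {P′} {is} p (enumerates u mem) (no ¬Pp) off at = p ∷ is , enumerates
      (All.tabulate (λ i∈ e → ¬Pp (Equivalence.to (mem p) (subst (_∈ is) (sym e) i∈))) ∷ u) members , inj₁ refl
    where
    members : ∀ i → i ∈ p ∷ is ⇔ P′ i
    members i = mk⇔ to from
      where
      to : i ∈ p ∷ is → P′ i
      to (here refl) = Equivalence.from at ¬Pp
      to (there i∈)  = Equivalence.from (off i λ { refl → ¬Pp (Equivalence.to (mem i) i∈) })
          (Equivalence.to (mem i) i∈)
      from : P′ i → i ∈ p ∷ is
      from q = pick (i ℤₚ.≟ p)
        where
        pick : Dec (i ≡ p) → i ∈ p ∷ is
        pick (yes e) = here e
        pick (no ≢)  = there (Equivalence.from (mem i) (Equivalence.to (off i ≢) q))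
  toggle {P} {P′} {is} p (enumerates u mem) (yes Pp) off at = is′ , enumerates (Uniqueₚ.filter⁺ ≢p? u) members , inj₂
      (same-members-length
      (All.tabulate (λ i∈ e → proj₂ (filter⁻ ≢p? is i∈) (sym e)) ∷ Uniqueₚ.filter⁺ ≢p? u) u
      (λ { (here refl) → Equivalence.from (mem p) Pp ; (there i∈) → proj₁ (filter⁻ ≢p? is i∈) })
      (λ {i} i∈ → pick i∈ (i ℤₚ.≟ p)))
    where
    ≢p? : Decidable (λ i → ¬ i ≡ p)
    ≢p? i = ¬? (i ℤₚ.≟ p)
    is′ = filter ≢p? is
    pick : ∀ {i} → i ∈ is → Dec (i ≡ p) → i ∈ p ∷ is′
    pick i∈ (yes e) = here e
    pick i∈ (no ≢)  = there (∈-filter⁺ ≢p? i∈ ≢)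
    members : ∀ i → i ∈ is′ ⇔ P′ i
    members i = mk⇔
      (λ i∈ → let i∈′ , ≢ = filter⁻ ≢p? is i∈ in Equivalence.from (off i ≢) (Equivalence.to (mem i) i∈′))
      (λ q → let ≢ = λ e → Equivalence.to at (subst P′ e q) Pp in ∈-filter⁺ ≢p? (Equivalence.from (mem i) (Equivalence.to (off i ≢) q)) ≢)

  2∣-suc-suc : ∀ {m} → 2 ∣ₙ m → 2 ∣ₙ suc (suc m)
  2∣-suc-suc (dividesₙ q eq) = dividesₙ (suc q) (cong (λ k → ℕ.suc (ℕ.suc k)) eq)

  2∣-suc-suc⁻ : ∀ {m} → 2 ∣ₙ suc (suc m) → 2 ∣ₙ m
  2∣-suc-suc⁻ (dividesₙ (suc q) eq) = dividesₙ q (ℕₚ.suc-injective (ℕₚ.suc-injective eq))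

  toggle-twice : ∀ {P P′ : ℤ → Set} p q → p ≢ q → EvenlyMany P → Dec (P p) → Dec (P q) →
    (∀ i → i ≢ p → i ≢ q → P′ i ⇔ P i) → P′ p ⇔ (¬ P p) → P′ q ⇔ (¬ P q) → EvenlyMany P′
  toggle-twice {P} {P′} p q p≢q (is , u , mem , even) p? q? off at-p at-q = go
      (toggle {P} {P₁} p (enumerates u mem) p? off₁ at₁)
    where
    -- The set after the change at p alone.
    P₁ : ℤ → Set
    P₁ i = (i ≡ p × ¬ P i) ⊎ (i ≢ p × P i)
    off₁ : ∀ i → i ≢ p → P₁ i ⇔ P i
    off₁ i ≢ = mk⇔ (λ { (inj₁ (e , _)) → contradiction e ≢ ; (inj₂ (_ , x)) → x }) (λ x → inj₂ (≢ , x))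
    at₁ : P₁ p ⇔ (¬ P p)
    at₁ = mk⇔ (λ { (inj₁ (_ , x)) → x ; (inj₂ (≢ , _)) → contradiction refl ≢ }) (λ x → inj₁ (refl , x))
    P₁q⇔ : P₁ q ⇔ P q
    P₁q⇔ = off₁ q (p≢q ∘ sym)
    off₂ : ∀ i → i ≢ q → P′ i ⇔ P₁ i
    off₂ i i≢q = pick (i ℤₚ.≟ p)
      where
      pick : Dec (i ≡ p) → P′ i ⇔ P₁ i
      pick (yes refl) = mk⇔ (Equivalence.from at₁ ∘ Equivalence.to at-p) (Equivalence.from at-p ∘ Equivalence.to at₁)
      pick (no i≢p)   = mk⇔ (Equivalence.from (off₁ i i≢p) ∘ Equivalence.to (off i i≢p i≢q))
          (Equivalence.from (off i i≢p i≢q) ∘ Equivalence.to (off₁ i i≢p))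
    P₁q? : Dec (P₁ q)
    P₁q? = pick q?
      where
      pick : Dec (P q) → Dec (P₁ q)
      pick (yes x) = yes (Equivalence.from P₁q⇔ x)
      pick (no ¬x) = no (¬x ∘ Equivalence.to P₁q⇔)
    at₂ : P′ q ⇔ (¬ P₁ q)
    at₂ = mk⇔ (λ x y → Equivalence.to at-q x (Equivalence.to P₁q⇔ y))
        (λ x → Equivalence.from at-q (x ∘ Equivalence.from P₁q⇔))
    go : ∃[ is₁ ] Enumerates P₁ is₁ × (length is₁ ≡ suc (length is) ⊎ suc (length is₁) ≡ length is) → EvenlyMany P′
    go (is₁ , en₁ , len₁) = go₂ (toggle {P₁} {P′} q en₁ P₁q? off₂ at₂)
      where
      go₂ : ∃[ is₂ ] Enumerates P′ is₂ × (length is₂ ≡ suc (length is₁) ⊎ suc (length is₂) ≡ length is₁) → EvenlyMany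
          P′
      go₂ (is₂ , enumerates u₂ mem₂ , len₂) = is₂ , u₂ , mem₂ , parity len₁ len₂
        where
        parity : length is₁ ≡ suc (length is) ⊎ suc (length is₁) ≡ length is → length is₂ ≡ suc (length is₁) ⊎ suc
            (length is₂) ≡ length is₁ → 2 ∣ₙ length is₂
        parity (inj₁ x) (inj₁ y) = subst (2 ∣ₙ_) (sym (trans y (cong suc x))) (2∣-suc-suc even)
        parity (inj₁ x) (inj₂ y) = subst (2 ∣ₙ_) (sym (ℕₚ.suc-injective (trans y x))) even
        parity (inj₂ x) (inj₁ y) = subst (2 ∣ₙ_) (sym (trans y x)) even
        parity (inj₂ x) (inj₂ y) = 2∣-suc-suc⁻ (subst (2 ∣ₙ_) (sym (trans (cong suc y) x)) even)

  -- The bound is written `+ 1 + T ≤ f i` so that T = 0 and T = n give, by computation, the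
  -- conditions in `LeftParity` and `RightParity`.
  Crossing : ℤ → (ℤ → ℤ) → ℤ → Set
  Crossing T f i = i ≤ T × + 1 + T ≤ f i

  crossing-unchanged : ∀ {T f f′} → (∀ i → + 1 + T ≤ f′ i ⇔ + 1 + T ≤ f i) → EvenlyMany (Crossing T f) → EvenlyMany
      (Crossing T f′)
  crossing-unchanged same (is , u , mem , even) = is , u , (λ i → mk⇔
    (λ i∈ → let a , b = Equivalence.to (mem i) i∈ in a , Equivalence.from (same i) b)
    (λ { (a , b) → Equivalence.from (mem i) (a , Equivalence.to (same i) b) })) , even

  -- A generator sᴰ exchanges c₁, c₂ with H - c₂, H - c₁, all other labels
  -- staying on their side of T; this changes two crossings.
  crossing-toggled : ∀ {g} (inv : Involution g) (v : Mirrored n) {T H c₁ c₂} → T < c₁ → T < c₂ → c₁ ≢ c₂ → H - c₁ ≤ T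
      → H - c₂ ≤ T →
    (∀ i → fun v (H - i) ≡ H - fun v i) → g c₁ ≡ H - c₂ → g c₂ ≡ H - c₁ →
    (∀ i → T < i → H - i ≤ T) → (∀ i → ¬ i ≈ 0ℤ → i ≤ T → T < H - i) → ¬ c₁ ≈ 0ℤ → ¬ c₂ ≈ 0ℤ →
    (∀ z → z ≤ T → T < g z → z ≡ H - c₁ ⊎ z ≡ H - c₂) →
    EvenlyMany (Crossing T (fun v)) → EvenlyMany (Crossing T (g ∘ fun v))
  crossing-toggled {g} inv v {T} {H} {c₁} {c₂} T<c₁ T<c₂ c₁≢c₂ c₁′≤T c₂′≤T mirror g-c₁ g-c₂ flip↓ flip↑ c₁≉0 c₂≉0
      across =
    λ even → toggle-twice {P} {P′} (point c₁) (point c₂) distinct even (decide (point c₁)) (decide (point c₂)) off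
      (at c₁ c₂ T<c₁ T<c₂ c₁′≤T c₂′≤T g-c₁ (back c₂ g-c₂) c₁≉0) (at c₂ c₁ T<c₂ T<c₁ c₂′≤T c₁′≤T g-c₂ (back c₁ g-c₁)
          c₂≉0)
    where
    open Involution inv
    w = fun v
    P P′ : ℤ → Set
    P  = Crossing T w
    P′ = Crossing T (g ∘ w)
    decide : ∀ i → Dec (P i)
    decide i = (i ℤₚ.≤? T) ×-dec (+ 1 + T ℤₚ.≤? w i)
    pos : ∀ {z} → T < z → + 1 + T ≤ z
    pos {z} = lia 2 (λ t z → t :< z ⇒ ⊢ # 1 :+ t :≤ z) T z
    pos⁻ : ∀ {z} → + 1 + T ≤ z → T < z
    pos⁻ {z} = lia 2 (λ t z → # 1 :+ t :≤ z ⇒ ⊢ t :< z) T z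
    -- Of the positions of c and of H - c exactly one is at most T; there the exchange changes the
    -- crossing.
    pointAt : ∀ c → Dec (inverse v c ≤ T) → ℤ
    pointAt c (yes _) = inverse v c
    pointAt c (no _)  = H - inverse v c
    point : ℤ → ℤ
    point c = pointAt c (inverse v c ℤₚ.≤? T)
    back : ∀ c {z} → g c ≡ z → g z ≡ c
    back c refl = involutive c
    w-flip : ∀ c → w (H - inverse v c) ≡ H - c
    w-flip c = trans (mirror (inverse v c)) (cong (λ z → H - z) (fun-inverse v c))
    data PointCase (c : ℤ) : Set where
      upper : point c ≡ inverse v c → inverse v c ≤ T → w (point c) ≡ c → PointCase c
      lower : point c ≡ H - inverse v c → T < inverse v c → w (point c) ≡ H - c → PointCase c
    pointCase : ∀ c → PointCase c
    pointCase c = go (inverse v c ℤₚ.≤? T) refl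
      where
      go : (d : Dec (inverse v c ≤ T)) → point c ≡ pointAt c d → PointCase c
      go (yes le) e = upper e le (trans (cong w e) (fun-inverse v c))
      go (no ≰)   e = lower e (ℤₚ.≰⇒> ≰) (trans (cong w e) (w-flip c))
    distinct : point c₁ ≢ point c₂
    distinct e = go (pointCase c₁) (pointCase c₂)
      where
      go : PointCase c₁ → PointCase c₂ → ⊥
      go (upper _ _ x) (upper _ _ y) = c₁≢c₂ (trans (sym x) (trans (cong w e) y))
      go (upper _ _ x) (lower _ _ y) = ℤₚ.<⇒≱ T<c₁ (subst (_≤ T) (trans (sym y) (trans (cong w (sym e)) x)) c₂′≤T)
      go (lower _ _ x) (upper _ _ y) = ℤₚ.<⇒≱ T<c₂ (subst (_≤ T) (trans (sym x) (trans (cong w e) y)) c₁′≤T)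
      go (lower _ _ x) (lower _ _ y) = c₁≢c₂ (lia 3 (λ h c d → h :- c :≡ h :- d ⇒ ⊢ c :≡ d) H c₁ c₂
          (trans (sym x) (trans (cong w e) y)))
    at : ∀ c d → T < c → T < d → H - c ≤ T → H - d ≤ T → g c ≡ H - d → g (H - c) ≡ d → ¬ c ≈ 0ℤ → P′ (point c) ⇔
        (¬ P (point c))
    at c d T<c T<d c′ d′ gc gc′ c≉0 = go (pointCase c)
      where
      go : PointCase c → P′ (point c) ⇔ (¬ P (point c))
      go (upper e le x) = mk⇔
        (λ { (_ , y) → ⊥-elim (ℤₚ.<⇒≱ (pos⁻ (subst (+ 1 + T ≤_) (trans (cong g x) gc) y)) d′) })
        (λ ¬p → ⊥-elim (¬p (subst (_≤ T) (sym e) le , subst (+ 1 + T ≤_) (sym x) (pos T<c))))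
      go (lower e lt x) = mk⇔
        (λ _ → λ { (_ , y) → ℤₚ.<⇒≱ (pos⁻ (subst (+ 1 + T ≤_) x y)) c′ })
        (λ _ → subst (_≤ T) (sym e) (flip↓ _ lt) , subst (+ 1 + T ≤_) (sym (trans (cong g x) gc′)) (pos T<d))
    at-point : ∀ c i → i ≤ T → ¬ c ≈ 0ℤ → w i ≡ c ⊎ w i ≡ H - c → i ≡ point c
    at-point c i i≤T c≉0 hit = go (pointCase c) hit
      where
      i≡ : w i ≡ c → i ≡ inverse v c
      i≡ e = trans (sym (inverse-fun v i)) (cong (inverse v) e)
      i≡′ : w i ≡ H - c → i ≡ H - inverse v c
      i≡′ e = fun-injective v (trans e (sym (w-flip c)))
      go : PointCase c → w i ≡ c ⊎ w i ≡ H - c → i ≡ point c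
      go (upper e _ _) (inj₁ h) = trans (i≡ h) (sym e)
      go (lower e _ _) (inj₂ h) = trans (i≡′ h) (sym e)
      go (upper e le _) (inj₂ h) = ⊥-elim (ℤₚ.<⇒≱ (flip↑ (inverse v c) (c≉0 ∘ inverse-≈0⁻ v) le)
          (subst (_≤ T) (i≡′ h) i≤T))
      go (lower e lt _) (inj₁ h) = ⊥-elim (ℤₚ.<⇒≱ lt (subst (_≤ T) (i≡ h) i≤T))
    off : ∀ i → i ≢ point c₁ → i ≢ point c₂ → P′ i ⇔ P i
    off i ≢₁ ≢₂ = mk⇔ (λ { (i≤T , y) → i≤T , pos (ℤₚ.≰⇒> λ le → rises i≤T le (pos⁻ y)) })
                     (λ { (i≤T , y) → i≤T , pos (ℤₚ.≰⇒> λ le → falls i≤T le (pos⁻ y)) })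
      where
      rises : i ≤ T → w i ≤ T → T < g (w i) → ⊥
      rises i≤T le gt = go (across (w i) le gt)
        where
        go : w i ≡ H - c₁ ⊎ w i ≡ H - c₂ → ⊥
        go (inj₁ e) = ≢₁ (at-point c₁ i i≤T c₁≉0 (inj₂ e))
        go (inj₂ e) = ≢₂ (at-point c₂ i i≤T c₂≉0 (inj₂ e))
      falls : i ≤ T → g (w i) ≤ T → T < w i → ⊥
      falls i≤T le gt = go (across (g (w i)) le (subst (T <_) (sym (involutive (w i))) gt))
        where
        go : g (w i) ≡ H - c₁ ⊎ g (w i) ≡ H - c₂ → ⊥
        go (inj₁ e) = ≢₂ (at-point c₂ i i≤T c₂≉0 (inj₁ (trans (sym (involutive (w i)))
            (trans (cong g e) (back c₂ g-c₂)))))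
        go (inj₂ e) = ≢₁ (at-point c₁ i i≤T c₁≉0 (inj₁ (trans (sym (involutive (w i)))
            (trans (cong g e) (back c₁ g-c₁)))))

  -- A negative entry is shifted by M to apply `window-step`, and negation gives the positive ones.
  -- Hence s₁, ..., sₙ leave the crossings at 0 unchanged.
  positive-kept : ∀ {r} → 1 ℕ.≤ r → r ℕ.≤ n → ∀ {z} → 0ℤ < z → 0ℤ < gen ty n r z
  positive-kept {r} 1≤r r≤n {z} 0<z = lia 2 (λ g h → h :≡ :- g ⇒ h :< # 0 ⇒ ⊢ # 0 :< g) (g z) (g (- z)) (neg z)
      (negative (- z) (lia 1 (λ z → # 0 :< z ⇒ ⊢ :- z :< # 0) z 0<z))
    where
    g = gen ty n r
    inv = gen-involution r r≤n
    open Involution inv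
    +M : ∀ z → g (z + M) ≡ g z + M
    +M z = trans (cong (λ m → g (z + m)) (sym (ℤₚ.*-identityˡ M)))
        (trans (shift (+ 1) z) (cong (λ m → g z + m) (ℤₚ.*-identityˡ M)))
    negative : ∀ z → z < 0ℤ → g z < 0ℤ
    negative z z<0 = go (z ≈? 0ℤ)
      where
      go : Dec (z ≈ 0ℤ) → g z < 0ℤ
      go (yes (by k e)) = subst (_< 0ℤ) (sym (trans (cong g e) (trans (shift k 0ℤ)
          (trans (cong (_+ k * M) (g0≡0 inv)) (sym e))))) z<0
      go (no z≉0) = lia 3 (λ g h m → h :≡ g :+ m ⇒ h :< m ⇒ ⊢ g :< # 0) (g z) (g (z + M)) M (+M z)
        (window-step r 1≤r r≤n (λ p → z≉0 (≈-trans (≈-sym (by (+ 1) (cong (λ m → z + m) (sym (ℤₚ.*-identityˡ M)))))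
            p))
          (lia 2 (λ z m → z :< # 0 ⇒ ⊢ z :+ m :< m) z M z<0))

  -- Passing n would need a raised label within reach of n. The classes r and - r - 1 raised by a
  -- swap avoid n itself; those raised by s₀, namely -1 and with end D also -2, avoid the last
  -- labels up to n.
  low-kept : ∀ {r} → r ℕ.< n → ∀ {z} → z ≤ ν → gen ty n r z ≤ ν
  low-kept {zero} _ {z} z≤ν = go (left ty) refl
    where
    go : ∀ E → left ty ≡ E → gen ty n 0 z ≤ ν
    go C l≡C = byMove (move z)
      where
      open Reflection (Simple.reflection (leftC-gen l≡C))
      far : ∀ {z} → z ≤ ν → z ≈ -1ℤ → z + + 2 ≤ ν
      far {z} z≤ν p = ℤₚ.≮⇒≥ λ lt → between⇒≉0 {z + + 1} (lia 2 (λ z v → v :< z :+ # 2 ⇒ # 2 :≤ v ⇒ ⊢ # 0 :< z :+ # 1)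
          z ν lt 2≤ν)
        (lia 3 (λ z v m → z :≤ v ⇒ m :≡ # 1 :+ 2 :* v ⇒ # 2 :≤ v ⇒ ⊢ z :+ # 1 :< m) z ν M z≤ν M≡ 2≤ν) (≈-+ (+ 1) p)
      byMove : Moves (gen ty n 0) -1ℤ (+ 1) z → gen ty n 0 z ≤ ν
      byMove (up (inj₁ p) e) = subst (_≤ ν) (sym e) (far z≤ν p)
      byMove (up (inj₂ p) e) = subst (_≤ ν) (sym e) (far z≤ν p)
      byMove (down _ e) = lia 3 (λ g z v → g :≡ z :- # 2 ⇒ z :≤ v ⇒ ⊢ g :≤ v) (gen ty n 0 z) z ν e z≤ν
      byMove (fixed _ _ e) = subst (_≤ ν) (sym e) z≤ν
    go D l≡D = byMove (move z)
      where
      3≤ν = left-D⇒3≤ν l≡D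
      open Reflection (Simple.reflection (leftD-gen l≡D))
      byMove : Moves (gen ty n 0) -1ℤ (+ 2) z → gen ty n 0 z ≤ ν
      byMove (up u e) = subst (_≤ ν) (sym e) (ℤₚ.≮⇒≥ λ lt → clash lt u)
        where
        clash : ν < z + + 3 → Up -1ℤ (+ 2) z → ⊥
        clash lt (inj₁ p) = between⇒≉0 {z + + 1} (lia 2 (λ z v → v :< z :+ # 3 ⇒ # 3 :≤ v ⇒ ⊢ # 0 :< z :+ # 1) z ν lt
            3≤ν)
          (lia 3 (λ z v m → z :≤ v ⇒ m :≡ # 1 :+ 2 :* v ⇒ # 3 :≤ v ⇒ ⊢ z :+ # 1 :< m) z ν M z≤ν M≡ 3≤ν) (≈-+ (+ 1) p)
        clash lt (inj₂ p) = between⇒≉0 {z + + 2} (lia 2 (λ z v → v :< z :+ # 3 ⇒ # 3 :≤ v ⇒ ⊢ # 0 :< z :+ # 2) z ν lt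
            3≤ν)
          (lia 3 (λ z v m → z :≤ v ⇒ m :≡ # 1 :+ 2 :* v ⇒ # 3 :≤ v ⇒ ⊢ z :+ # 2 :< m) z ν M z≤ν M≡ 3≤ν) (≈-+ (+ 2) p)
      byMove (down _ e) = lia 3 (λ g z v → g :≡ z :- # 3 ⇒ z :≤ v ⇒ ⊢ g :≤ v) (gen ty n 0 z) z ν e z≤ν
      byMove (fixed _ _ e) = subst (_≤ ν) (sym e) z≤ν
  low-kept {r@(suc _)} r<n {z} z≤ν = byMove (move z)
    where
    open Reflection (Simple.reflection (swap-gen (s≤s z≤n) r<n))
    g = gen ty n r
    byMove : Moves g (+ r) (+ suc r) z → g z ≤ ν
    byMove (up u e) = lia 4 (λ g z v r → g :≡ z :+ (# 1 :+ r :- r) ⇒ z :< v ⇒ ⊢ g :≤ v) (g z) z ν (+ r) e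
        (ℤₚ.≤∧≢⇒< z≤ν λ { refl → clash u })
      where
      r<ν : + r < ν
      r<ν = +<+ r<n
      clash : Up (+ r) (+ suc r) ν → ⊥
      clash (inj₁ p) = difference⇒≉′ r<ν (lia 3 (λ r v m → # 0 :≤ r ⇒ m :≡ # 1 :+ 2 :* v ⇒ # 2 :≤ v ⇒ ⊢ v :< r :+ m)
          (+ r) ν M (+≤+ z≤n) M≡ 2≤ν) p
      clash (inj₂ p) = ≉-opposite {ν} {+ suc r} (lia 2 (λ r v → # 0 :≤ r ⇒ # 2 :≤ v ⇒ ⊢ # 0 :< v :+ (# 1 :+ r)) (+ r)
          ν (+≤+ z≤n) 2≤ν)
        (lia 3 (λ r v m → r :< v ⇒ m :≡ # 1 :+ 2 :* v ⇒ ⊢ v :+ (# 1 :+ r) :< m) (+ r) ν M r<ν M≡) p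
    byMove (down _ e) = lia 4 (λ g z v r → g :≡ z :- (# 1 :+ r :- r) ⇒ z :≤ v ⇒ ⊢ g :≤ v) (g z) z ν (+ r) e z≤ν
    byMove (fixed _ _ e) = subst (_≤ ν) (sym e) z≤ν

  module _ (v : Mirrored n) where

    private
      w = fun v

    -- s₀ᴰ exchanges 1 with -2 and 2 with -1, so the mirror is i ↦ - i, that is H = 0.
    left-toggled : left ty ≡ D → EvenlyMany (Crossing 0ℤ w) → EvenlyMany (Crossing 0ℤ (gen ty n 0 ∘ w))
    left-toggled l≡D = crossing-toggled inv v {0ℤ} {0ℤ} {+ 1} {+ 2} (+<+ (s≤s z≤n)) (+<+ (s≤s z≤n)) (λ ()) ℤ.-≤+ ℤ.-≤+
      (λ i → trans (cong w (ℤₚ.+-identityˡ (- i))) (trans (odd v i) (sym (ℤₚ.+-identityˡ (- w i)))))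
      (down-eq (inj₂ ≈-refl)) (down-eq (inj₁ ≈-refl))
      (λ i → lia 1 (λ i → # 0 :< i ⇒ ⊢ # 0 :- i :≤ # 0) i)
      (λ i i≉0 le → lia 1 (λ i → i :< # 0 ⇒ ⊢ # 0 :< # 0 :- i) i (ℤₚ.≤∧≢⇒< le (i≉0 ∘ ≡⇒≈)))
      1≉0 (small⇒≉0 2 (s≤s z≤n) (+≤+ (s≤s (s≤s z≤n)))) across
      where
      g = gen ty n 0
      inv = simple-involution (leftD-gen l≡D)
      open Reflection (Simple.reflection (leftD-gen l≡D))
      across : ∀ z → z ≤ 0ℤ → 0ℤ < g z → z ≡ -1ℤ ⊎ z ≡ - + 2
      across z le gt = byMove (move z)
        where
        byMove : Moves g -1ℤ (+ 2) z → z ≡ -1ℤ ⊎ z ≡ - + 2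
        byMove (up _ e) = go (z ℤₚ.≟ 0ℤ) (z ℤₚ.≟ -1ℤ)
          where
          go : Dec (z ≡ 0ℤ) → Dec (z ≡ -1ℤ) → z ≡ -1ℤ ⊎ z ≡ - + 2
          go (yes z≡0) _ = contradiction (trans (sym (g0≡0 inv)) (cong g (sym z≡0))) (ℤₚ.<⇒≢ gt)
          go (no _) (yes z≡) = inj₁ z≡
          go (no z≢0) (no z≢) = inj₂ (lia 2 (λ z g → g :≡ z :+ # 3 ⇒ # 0 :< g ⇒ z :< :- # 1 ⇒ ⊢ z :≡ :- # 2) z (g z) e
              gt
            (ℤₚ.≤∧≢⇒< (lia 1 (λ z → z :< # 0 ⇒ ⊢ z :≤ :- # 1) z (ℤₚ.≤∧≢⇒< le z≢0)) z≢))
        byMove (down _ e) = ⊥-elim (lia 2 (λ z g → g :≡ z :- # 3 ⇒ # 0 :< g ⇒ z :≤ # 0 ⇒ ⊢⊥) z (g z) e gt le)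
        byMove (fixed _ _ e) = ⊥-elim (ℤₚ.<⇒≱ gt (subst (_≤ 0ℤ) (sym e) le))

    -- sₙᴰ exchanges n + 1 with n - 1 and n + 2 with n, so the mirror is i ↦ M - i.
    right-toggled : right ty ≡ D → EvenlyMany (Crossing ν w) → EvenlyMany (Crossing ν (gen ty n n ∘ w))
    right-toggled r≡D = crossing-toggled inv v {ν} {M} {ν + + 1} {ν + + 2}
      (lia 1 (λ v → ⊢ v :< v :+ # 1) ν) (lia 1 (λ v → ⊢ v :< v :+ # 2) ν)
      (λ e → lia 1 (λ v → v :+ # 1 :≡ v :+ # 2 ⇒ ⊢⊥) ν e)
      (lia 2 (λ m v → m :≡ # 1 :+ 2 :* v ⇒ ⊢ m :- (v :+ # 1) :≤ v) M ν M≡)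
      (lia 2 (λ m v → m :≡ # 1 :+ 2 :* v ⇒ ⊢ m :- (v :+ # 2) :≤ v) M ν M≡)
      (λ i → trans (cong w (ℤₚ.+-comm M (- i))) (trans (periodic v (- i))
          (trans (cong (_+ M) (odd v i)) (ℤₚ.+-comm (- w i) M))))
      (trans (down-eq (inj₂ (by (+ 1) (trans (lia 2 (λ m v → m :≡ # 1 :+ 2 :* v ⇒ ⊢ v :+ # 1 :≡ :- v :+ m) M ν M≡)
          (cong (λ m → - ν + m) (sym (ℤₚ.*-identityˡ M)))))))
        (lia 2 (λ m v → m :≡ # 1 :+ 2 :* v ⇒ ⊢ v :+ # 1 :- (# 2 :+ v :- v) :≡ m :- (v :+ # 2)) M ν M≡))
      (trans (down-eq (inj₁ (≡⇒≈ (ℤₚ.+-comm ν (+ 2)))))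
        (lia 2 (λ m v → m :≡ # 1 :+ 2 :* v ⇒ ⊢ v :+ # 2 :- (# 2 :+ v :- v) :≡ m :- (v :+ # 1)) M ν M≡))
      (λ i → lia 3 (λ i m v → m :≡ # 1 :+ 2 :* v ⇒ v :< i ⇒ ⊢ m :- i :≤ v) i M ν M≡)
      (λ i _ → lia 3 (λ i m v → m :≡ # 1 :+ 2 :* v ⇒ i :≤ v ⇒ ⊢ v :< m :- i) i M ν M≡)
      (between⇒≉0 (lia 1 (λ v → # 3 :≤ v ⇒ ⊢ # 0 :< v :+ # 1) ν 3≤ν)
          (lia 2 (λ m v → m :≡ # 1 :+ 2 :* v ⇒ # 3 :≤ v ⇒ ⊢ v :+ # 1 :< m) M ν M≡ 3≤ν))
      (between⇒≉0 (lia 1 (λ v → # 3 :≤ v ⇒ ⊢ # 0 :< v :+ # 2) ν 3≤ν)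
          (lia 2 (λ m v → m :≡ # 1 :+ 2 :* v ⇒ # 3 :≤ v ⇒ ⊢ v :+ # 2 :< m) M ν M≡ 3≤ν))
      across
      where
      3≤ν = right-D⇒3≤ν r≡D
      g = gen ty n n
      inv = simple-involution (rightD-gen r≡D)
      open Reflection (Simple.reflection (rightD-gen r≡D))
      across : ∀ z → z ≤ ν → ν < g z → z ≡ M - (ν + + 1) ⊎ z ≡ M - (ν + + 2)
      across z le gt = byMove (move z)
        where
        byMove : Moves g ν (+ 2 + ν) z → z ≡ M - (ν + + 1) ⊎ z ≡ M - (ν + + 2)
        byMove (up _ e) = go (z ℤₚ.≟ ν)
          where
          go : Dec (z ≡ ν) → z ≡ M - (ν + + 1) ⊎ z ≡ M - (ν + + 2)
          go (yes z≡) = inj₁ (lia 3 (λ z m v → m :≡ # 1 :+ 2 :* v ⇒ z :≡ v ⇒ ⊢ z :≡ m :- (v :+ # 1)) z M ν M≡ z≡)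
          go (no z≢) = inj₂ (lia 4 (λ z g m v → m :≡ # 1 :+ 2 :* v ⇒ g :≡ z :+ (# 2 :+ v :- v) ⇒ v :< g ⇒ z :< v ⇒ ⊢ z
              :≡ m :- (v :+ # 2)) z (g z) M ν M≡ e gt (ℤₚ.≤∧≢⇒< le z≢))
        byMove (down _ e) = ⊥-elim (lia 3 (λ z g v → g :≡ z :- (# 2 :+ v :- v) ⇒ v :< g ⇒ z :≤ v ⇒ ⊢⊥) z (g z) ν e gt
            le)
        byMove (fixed _ _ e) = ⊥-elim (ℤₚ.<⇒≱ gt (subst (_≤ ν) (sym e) le))

    act-inW̃ : W̃ ty n v → ∀ r (r≤n : r ℕ.≤ n) → W̃ ty n (act (gen-involution r r≤n) v)
    act-inW̃ (lp , rp) r r≤n = leftPart (left ty) refl lp , rightPart (right ty) refl rp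
      where
      open Involution (gen-involution r r≤n)
      v′ = act (gen-involution r r≤n) v
      leftPart : ∀ E → left ty ≡ E → LeftParity E v → LeftParity E v′
      leftPart C _ _ = _
      leftPart D l≡D even = byIndex r refl
        where
        byIndex : ∀ r₀ → r₀ ≡ r → LeftParity D v′
        byIndex zero e = subst (λ q → EvenlyMany (Crossing 0ℤ (gen ty n q ∘ w))) e (left-toggled l≡D even)
        byIndex (suc _) e = crossing-unchanged (λ i → mk⇔
          (λ p → ℤₚ.i<j⇒suc[i]≤j (subst (0ℤ <_) (involutive (w i)) (positive-kept 1≤r r≤n (ℤₚ.suc[i]≤j⇒i<j p))))
          (λ p → ℤₚ.i<j⇒suc[i]≤j (positive-kept 1≤r r≤n (ℤₚ.suc[i]≤j⇒i<j p)))) even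
          where
          1≤r : 1 ℕ.≤ r
          1≤r = subst (1 ℕ.≤_) e (s≤s z≤n)
      rightPart : ∀ E → right ty ≡ E → RightParity E v → RightParity E v′
      rightPart C _ _ = _
      rightPart D r≡D even = byIndex (ℕₚ.m≤n⇒m<n∨m≡n r≤n)
        where
        byIndex : r ℕ.< n ⊎ r ≡ n → RightParity D v′
        byIndex (inj₂ e) = subst (λ q → EvenlyMany (Crossing ν (gen ty n q ∘ w))) (sym e) (right-toggled r≡D even)
        byIndex (inj₁ r<n) = crossing-unchanged (λ i → mk⇔
          (λ p → ℤₚ.i<j⇒suc[i]≤j (ℤₚ.≰⇒> λ le → ℤₚ.<⇒≱ (ℤₚ.suc[i]≤j⇒i<j p) (low-kept r<n le)))
          (λ p → ℤₚ.i<j⇒suc[i]≤j (ℤₚ.≰⇒> λ le → ℤₚ.<⇒≱ (ℤₚ.suc[i]≤j⇒i<j p)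
              (subst (_≤ ν) (involutive (w i)) (low-kept r<n le))))) even

  -- The next representative and termination.

  Excluded-shift : ∀ {s t} k → t ≡ s + (k + k) * M → Excluded t → Excluded s
  Excluded-shift {s} k refl (evenSum l≡D j e) = evenSum l≡D (j - k)
      (trans (lia 3 (λ s p q → s :+ p :≡ q ⇒ ⊢ s :≡ q :- p) s ((k + k) * M) ((j + j) * M) e) (ring j k M))
    where
    ring : ∀ j k m → (j + j) * m - (k + k) * m ≡ (j - k + (j - k)) * m
    ring = solve-∀
  Excluded-shift {s} k refl (oddSum r≡D j e) = oddSum r≡D (j - k)
      (trans (lia 3 (λ s p q → s :+ p :≡ q ⇒ ⊢ s :≡ q :- p) s ((k + k) * M) ((j + j + + 1) * M) e) (ring j k M))
    where
    ring : ∀ j k m → (j + j + + 1) * m - (k + k) * m ≡ (j - k + (j - k) + + 1) * m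
    ring = solve-∀

  Excluded-neg : ∀ {s} → Excluded (- s) → Excluded s
  Excluded-neg {s} (evenSum l≡D j e) = evenSum l≡D (- j) (trans (lia 2 (λ s q → :- s :≡ q ⇒ ⊢ s :≡ :- q) s
      ((j + j) * M) e) (ring j M))
    where
    ring : ∀ j m → - ((j + j) * m) ≡ (- j + - j) * m
    ring = solve-∀
  Excluded-neg {s} (oddSum r≡D j e) = oddSum r≡D (- j - + 1) (trans
      (lia 2 (λ s q → :- s :≡ q ⇒ ⊢ s :≡ :- q) s ((j + j + + 1) * M) e) (ring j M))
    where
    ring : ∀ j m → - ((j + j + + 1) * m) ≡ (- j - + 1 + (- j - + 1) + + 1) * m
    ring = solve-∀

  -- The sum is x + y up to sign and an even multiple of M, and neither changes the parity on which
  -- `Excluded` depends.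
  down-root : ∀ {g x y b} → Simple g x y → Down x y b → ¬ Excluded (b - (y - x) + b)
  down-root {x = x} {y} {b} s (inj₁ (by k e)) = Simple.root s ∘ Excluded-shift k
      (trans (cong (λ b → b - (y - x) + b) e) (ring x y k M))
    where
    ring : ∀ x y k m → y + k * m - (y - x) + (y + k * m) ≡ x + y + (k + k) * m
    ring = solve-∀
  down-root {x = x} {y} {b} s (inj₂ (by k e)) = Simple.root s ∘ Excluded-neg ∘ Excluded-shift k
      (trans (cong (λ b → b - (y - x) + b) e) (ring x y k M))
    where
    ring : ∀ x y k m → - x + k * m - (y - x) + (- x + k * m) ≡ - (x + y) + (k + k) * m
    ring = solve-∀

  module _ (w : W̃/W ty n) {xs b} (eq : referenceBeads (perm w) ≡ xs ∷ʳ b) where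

    private
      v = perm w
      pc = peelCase v (inW̃ w) eq
      open PeelCase pc
      open Reference (snoc-reference v eq)
      inv = gen-involution r r≤n
      δ = y - x
      p = b - δ
      g-b : gen ty n r b ≡ p
      g-b = Reflection.down-eq (Simple.reflection simple) isDown
      p≉0 : ¬ p ≈ 0ℤ
      p≉0 = b≉0 ∘ ≈0-image⁻ inv ∘ subst (_≈ 0ℤ) (sym g-b)
      r′ : Fin (suc n)
      r′ = fromℕ< (s≤s r≤n)
      r′≡ : toℕ r′ ≡ r
      r′≡ = Finₚ.toℕ-fromℕ< (s≤s r≤n)
      p≡ = fun-inverse v p
      b≡ = fun-inverse v b

    -- The product s_r w itself, with no correction from W. The bead b has w⁻¹(b) < M and the gap p
    -- = b - δ has w⁻¹(p) > M, so the exchanged pair is inverted as `gen-minimal` requires.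
    peeledRep : W̃/W ty n
    peeledRep = record
      { perm    = act inv v
      ; inW̃     = act-inW̃ v (inW̃ w) r r≤n
      ; minimal = subst (λ q → ∀ u k → ℓ[_]≤_ ty n (gen ty n q ∘ fun v ∘ ⟦_⟧ᵂ ty n u) k → ℓ[_]≤_ ty n
          (gen ty n q ∘ fun v) k) r′≡
          (gen-minimal w r′ {inverse v p} {inverse v b}
            (ℤₚ.<-trans (proj₂ (bead⇒ v bead)) (gap⇒ v p≉0 gap))
            (subst₂ _<_ (sym p≡) (sym b≡) (lia 3 (λ b x y → x :< y ⇒ ⊢ b :- (y :- x) :< b) b x y (Simple.x<y simple)))
            (subst₂ Root (sym p≡) (sym b≡) (root p≉0 b≉0 (down-root simple isDown)))
            (subst₂ (Reflection (gen ty n (toℕ r′))) (sym p≡) (sym b≡)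
                (subst (λ q → Reflection (gen ty n q) p b) (sym r′≡)
              (subst (Reflection (gen ty n r) p) (lia 2 (λ b d → ⊢ b :- d :+ d :≡ b) b δ)
                  (rebase (Simple.reflection simple) (Down-− isDown))))))
      }

    open Stepping v (act inv v) (inW̃ w) eq pc (act-moved inv v) using
        (Next; gone; kept; next; g-far; lowered; ∈xs⇒∈L; moves; stays; 1≤δ; ∈L⁻)

    private
      weight : List ℤ → ℕ
      weight L = sum (map ∣_∣ L)

      abs-mono : ∀ {c d} → 0ℤ ≤ c → c ≤ d → ∣ c ∣ ℕ.≤ ∣ d ∣
      abs-mono 0≤c c≤d = ℤₚ.drop‿+≤+ (subst₂ _≤_ (sym (ℤₚ.0≤i⇒+∣i∣≡i 0≤c)) (sym (ℤₚ.0≤i⇒+∣i∣≡i (ℤₚ.≤-trans 0≤c c≤d)))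
          c≤d)

      abs-mono-< : ∀ {c d} → 0ℤ ≤ c → c < d → ∣ c ∣ ℕ.< ∣ d ∣
      abs-mono-< 0≤c c<d = ℤₚ.drop‿+<+ (subst₂ _<_ (sym (ℤₚ.0≤i⇒+∣i∣≡i 0≤c))
          (sym (ℤₚ.0≤i⇒+∣i∣≡i (ℤₚ.≤-trans 0≤c (ℤₚ.<⇒≤ c<d)))) c<d)

      weight-mono : ∀ ys → (∀ {z} → z ∈ ys → ∣ gen ty n r z ∣ ℕ.≤ ∣ z ∣) → weight (map (gen ty n r) ys) ℕ.≤ weight ys
      weight-mono []       _  = z≤n
      weight-mono (z ∷ ys) le = ℕₚ.+-mono-≤ (le (here refl)) (weight-mono ys (le ∘ there))

      weight-∷ʳ : ∀ ys z → weight (ys ∷ʳ z) ≡ weight ys ℕ.+ ∣ z ∣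
      weight-∷ʳ ys z = trans (cong sum (map-∷ʳ ∣_∣ ys z)) (trans (Sumₚ.sum-++ (map ∣_∣ ys) (∣ z ∣ ∷ []))
          (cong (weight ys ℕ.+_) (ℕₚ.+-identityʳ ∣ z ∣)))

      0≤ : ∀ {z} → base < z → 0ℤ ≤ z
      0≤ lt = ℤₚ.≤-trans 0≤base (ℤₚ.<⇒≤ lt)

      shrinks : ∀ {z} → z ∈ xs → ∣ gen ty n r z ∣ ℕ.≤ ∣ z ∣
      shrinks {z} z∈ = abs-mono (0≤ (g-far z∈)) (go (lowered (∈xs⇒∈L z∈)))
        where
        go : _ → gen ty n r z ≤ z
        go (moves _ e) = lia 3 (λ g z d → g :≡ z :- d ⇒ # 1 :≤ d ⇒ ⊢ g :≤ z) (gen ty n r z) z δ e 1≤δ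
        go (stays _ e) = ℤₚ.≤-reflexive e

    -- All reference beads are positive, none is raised, and b is lowered or dropped.
    weight-decreases : weight (referenceBeads (act inv v)) ℕ.< weight (referenceBeads v)
    weight-decreases = subst (weight (referenceBeads (act inv v)) ℕ.<_)
        (sym (trans (cong weight eq) (weight-∷ʳ xs b))) (go next)
      where
      xs≤ = weight-mono xs shrinks
      go : Next → weight (referenceBeads (act inv v)) ℕ.< weight xs ℕ.+ ∣ b ∣
      go (gone _ eq′) = subst (ℕ._< weight xs ℕ.+ ∣ b ∣) (sym (cong weight eq′))
        (ℕₚ.≤-<-trans xs≤ (ℕₚ.m<m+n (weight xs) (abs-mono-< ℤₚ.≤-refl (ℤₚ.≤-<-trans 0≤base base<b))))
      go (kept lt eq′) = subst (ℕ._< weight xs ℕ.+ ∣ b ∣) (sym (trans (cong weight eq′)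
          (weight-∷ʳ (map (gen ty n r) xs) p)))
        (ℕₚ.+-mono-≤-< xs≤ (abs-mono-< (0≤ lt) (lia 2 (λ b d → # 1 :≤ d ⇒ ⊢ b :- d :< b) b δ 1≤δ)))

  beadWeight : W̃/W ty n → ℕ
  beadWeight w = sum (map ∣_∣ (referenceBeads (perm w)))

  peels-from : ∀ w → Acc ℕ._<_ (beadWeight w) → ∃[ U ] Peels ty n w U
  peels-from w (acc smaller) = go (snocView (referenceBeads (perm w)))
    where
    go : referenceBeads (perm w) ≡ [] ⊎ (∃₂ λ ys y → referenceBeads (perm w) ≡ ys ∷ʳ y) → ∃[ U ] Peels ty n w U
    go (inj₁ none) = [] , done (empty-shape (perm w) (no-reference (perm w) (inW̃ w) none))
    go (inj₂ (_ , _ , eq)) = _ , peel (shape-nonempty (perm w) eq)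
        (subst (1 ℕ.≤_) (sym (peelingRow≡ w eq)) (1≤e (perm w) eq))
        (peelingResidue≡ w eq) ([] , λ _ → refl) (proj₂ (peels-from (peeledRep w eq)
            (smaller (weight-decreases w eq))))

  peels-exists : ∀ w → ∃[ U ] Peels ty n w U
  peels-exists w = peels-from w (<-wellFounded (beadWeight w))

  -- The invariant gives the same value for every peeling, hence the forward direction; the backward
  -- direction adds that a peeling exists.
  bead-formula : (w : W̃/W ty n) (β : List Part) → (ℬ[ w ]≡ β) ⇔ (β ≡ beadParts ty (𝒜 (perm w)))
  bead-formula w β = mk⇔
    (λ (_ , peels , eq) → trans eq (rowParts≡ (perm w) (summary peels)))
    (λ eq → let U , peels = peels-exists w in U , peels , trans eq (sym (rowParts≡ (perm w) (summary peels))))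

open import Data.Nat.Base using (_≤_)

proposition7p4 : (ty : Type) (n : ℕ) → minRank ty ≤ n →
    (w : W̃/W ty n) (β : List Part) →
    (ℬ[ w ]≡ β) ⇔ (β ≡ beadParts ty (𝒜 (perm w)))
proposition7p4 = Development.bead-formula
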